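{- For any positive integer $b$, there is a bijection between bipartite plane maps of girth $2b$ and outer degree $2b$ and $b$-dibranching mobiles. Moreover, under this bijection each inner face of degree $2i$ of the map corresponds to a black vertex of degree $2i$ of the mobile (so for every $i$ the number of inner faces of degree $2i$ of the map equals the number of black vertices of degree $2i$ of the associated mobile).
   Context: A planar map is a connected graph (loops and multiple edges allowed) embedded in the oriented sphere, up to continuous deformation; the degree of a face is its number of incident corners (angular sections between consecutive half-edges around a vertex). The girth is the minimal length of a cycle; bipartite means the vertices can be 2-colored properly. A plane map is a planar map with a distinguished face (root-face, outer face), whose degree is the outer degree; the other faces are inner faces. A mobile is a plane tree (embedded in the plane up to deformation) whose vertices are colored black or white, where black vertices may carry additional dangling half-edges called buds (placed in the cyclic order around the vertex). The degree of a black vertex is its number of incident half-edges, buds included. A $\mathbb{Z}$-mobile is a mobile in which every non-bud half-edge carries an integer weight, positive if the half-edge is incident to a white vertex and non-positive if it is incident to a black vertex. The weight of an edge is the sum of the weights of its two half-edges; the weight $w(v)$ of a vertex is the sum of the weights of its incident non-bud half-edges. A $b$-dibranching mobile is a $\mathbb{Z}$-mobile in which every half-edge incident to a black vertex has weight $0$ or $-1$ and (i) each edge has weight $b-1$, (ii) each white vertex has weight $b$, (iii) each black vertex $v$ satisfies $\deg(v)/2+w(v)=b$. -}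

module Defs where

open import Data.Nat using (ℕ; zero; suc; _+_; _*_; _∸_; _≤_; _<_; _≤ᵇ_; _≡ᵇ_)
open import Data.Nat.DivMod using (_mod_)
open import Data.Integer as ℤ using (ℤ; +_; 0ℤ; -1ℤ)
open import Data.Bool using (Bool; true; false; _∧_; not; T)
open import Data.Fin using (Fin; toℕ; _≟_)
open import Data.Fin.Permutation using (Permutation; Permutation′; _⟨$⟩ʳ_)
open import Data.List using (List; map; length; filterᵇ; upTo; allFin; foldr)
open import Data.Bool.ListAction using (all; any)
open import Data.Product using (Σ; Σ-syntax; _×_; _,_; proj₁)
open import Data.Sum using (_⊎_)
open import Data.Empty using (⊥)
open import Relation.Nullary using (¬_)
open import Relation.Nullary.Decidable using (⌊_⌋)
open import Relation.Binary.PropositionalEquality using (_≡_; _≢_)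

iter : ∀ {n} → (Fin n → Fin n) → ℕ → Fin n → Fin n
iter f zero    d = d
iter f (suc k) d = f (iter f k d)

-- e lies in the f-orbit of d (for a permutation, exponents < n suffice)
inOrbitᵇ : ∀ {n} → (Fin n → Fin n) → Fin n → Fin n → Bool
inOrbitᵇ {n} f d e = any (λ k → ⌊ iter f k d ≟ e ⌋) (upTo n)

orbitMembers : ∀ {n} → (Fin n → Fin n) → Fin n → List (Fin n)
orbitMembers {n} f d = filterᵇ (inOrbitᵇ f d) (allFin n)

cycleLen : ∀ {n} → (Fin n → Fin n) → Fin n → ℕ
cycleLen f d = length (orbitMembers f d)

isRep : ∀ {n} → (Fin n → Fin n) → Fin n → Bool
isRep f d = all (λ e → toℕ d ≤ᵇ toℕ e) (orbitMembers f d)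

numCycles : ∀ {n} → (Fin n → Fin n) → ℕ
numCycles {n} f = length (filterᵇ (isRep f) (allFin n))

numFixed : ∀ {n} → (Fin n → Fin n) → ℕ
numFixed {n} f = length (filterᵇ (λ d → ⌊ f d ≟ d ⌋) (allFin n))

-- Combinatorial maps: darts Fin n, σ = rotation around vertices,
-- α = involution (fixed points = dangling half-edges / buds).
-- Vertices = σ-cycles, edges = 2-cycles of α, faces = cycles of φ = σ ∘ α.

record PreMap : Set where
  field
    n : ℕ
    σ : Permutation′ n
    α : Permutation′ n

  σf : Fin n → Fin n
  σf d = σ ⟨$⟩ʳ d

  αf : Fin n → Fin n
  αf d = α ⟨$⟩ʳ d

  φf : Fin n → Fin n
  φf d = σf (αf d)

  IsInvolution : Set
  IsInvolution = ∀ d → αf (αf d) ≡ d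

  numVertices : ℕ
  numVertices = numCycles σf

  numEdges : ℕ
  numEdges = numCycles αf ∸ numFixed αf

  numFaces : ℕ
  numFaces = numCycles φf

  SameVertex : Fin n → Fin n → Set
  SameVertex d e = Σ[ k ∈ ℕ ] iter σf k d ≡ e

  data Reach : Fin n → Fin n → Set where
    here  : ∀ {d} → Reach d d
    viaσ  : ∀ {d e} → Reach d e → Reach d (σf e)
    viaα  : ∀ {d e} → Reach d e → Reach d (αf e)

  Connected : Set
  Connected = ∀ d e → Reach d e

  Bipartite : Set
  Bipartite = Σ[ c ∈ (Fin n → Bool) ] ((∀ d → c (σf d) ≡ c d) × (∀ d → c (αf d) ≢ c d))

  -- cycles (simple: distinct vertices, distinct edges) of length suc m,
  -- given by darts d₀ … d_m, d_j going from v_j towards v_{j+1 mod (m+1)}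
  IsCycle : ∀ {m} → (Fin (suc m) → Fin n) → Set
  IsCycle {m} ds =
      (∀ j → SameVertex (αf (ds j)) (ds (suc (toℕ j) mod suc m)))
    × (∀ i j → i ≢ j → ¬ SameVertex (ds i) (ds j))
    × (∀ i j → i ≢ j → (ds i ≢ ds j) × (ds i ≢ αf (ds j)))

  CycleOfLength : ℕ → Set
  CycleOfLength zero    = ⊥
  CycleOfLength (suc m) = Σ[ ds ∈ (Fin (suc m) → Fin n) ] IsCycle ds

  HasGirth : ℕ → Set
  HasGirth g = CycleOfLength g × (∀ k → k < g → ¬ CycleOfLength k)

-- Plane maps: a map with a distinguished (root) face, given by a dart in it.

record PlaneMap : Set where
  field
    pre  : PreMap
  open PreMap pre public
  field
    root : Fin n
    involutive : IsInvolution
    noFixed    : ∀ d → αf d ≢ d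
    connected  : Connected
    -- Euler's formula V - E + F = 2 (genus 0)
    planar     : numVertices + numFaces ≡ numEdges + 2

  outerDegree : ℕ
  outerDegree = cycleLen φf root

  innerFacesOfDegree : ℕ → ℕ
  innerFacesOfDegree k =
    length (filterᵇ (λ d → isRep φf d ∧ (cycleLen φf d ≡ᵇ k) ∧ not (inOrbitᵇ φf root d))
                    (allFin n))

record BMap (b : ℕ) : Set where
  field
    pmap      : PlaneMap
  open PlaneMap pmap public
  field
    bipartite : Bipartite
    girth     : HasGirth (2 * b)
    outerDeg  : outerDegree ≡ 2 * b

_≅ᴾ_ : PlaneMap → PlaneMap → Set
M ≅ᴾ M' = Σ[ ψ ∈ Permutation M.n M'.n ]
      ((∀ d → ψ ⟨$⟩ʳ (M.σf d) ≡ M'.σf (ψ ⟨$⟩ʳ d))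
    × (∀ d → ψ ⟨$⟩ʳ (M.αf d) ≡ M'.αf (ψ ⟨$⟩ʳ d))
    × T (inOrbitᵇ M'.φf M'.root (ψ ⟨$⟩ʳ M.root)))
  where module M = PlaneMap M
        module M' = PlaneMap M'

_≅ᴮ_ : ∀ {b} → BMap b → BMap b → Set
M ≅ᴮ M' = BMap.pmap M ≅ᴾ BMap.pmap M'

-- Mobiles: plane trees with black/white vertices, buds = fixed points of α
-- (allowed at black vertices only), and ℤ-weights on half-edges.
-- Buds carry weight 0 by convention (they carry no weight in the paper).

data Colour : Set where
  black white : Colour

isBlack : Colour → Bool
isBlack black = true
isBlack white = false

sumℤ : List ℤ → ℤ
sumℤ = foldr ℤ._+_ 0ℤ

record PreMobile : Set where
  field
    pre : PreMap
  open PreMap pre public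
  field
    col : Fin n → Colour
    wt  : Fin n → ℤ

  IsBud : Fin n → Set
  IsBud d = αf d ≡ d

  vertexWeight : Fin n → ℤ
  vertexWeight d = sumℤ (map wt (orbitMembers σf d))

  vertexDegree : Fin n → ℕ
  vertexDegree d = cycleLen σf d

  blackVerticesOfDegree : ℕ → ℕ
  blackVerticesOfDegree k =
    length (filterᵇ (λ d → isRep σf d ∧ isBlack (col d) ∧ (cycleLen σf d ≡ᵇ k)) (allFin n))

record Mobile (b : ℕ) : Set where
  field
    mob : PreMobile
  open PreMobile mob public
  field
    involutive : IsInvolution
    connected  : Connected
    tree       : numVertices ≡ numEdges + 1
    colVertex  : ∀ d → col (σf d) ≡ col d
    budsBlack  : ∀ d → IsBud d → col d ≡ black
    budsZero   : ∀ d → IsBud d → wt d ≡ 0ℤ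
    whitePos   : ∀ d → ¬ IsBud d → col d ≡ white → 0ℤ ℤ.< wt d
    blackHalf  : ∀ d → ¬ IsBud d → col d ≡ black → (wt d ≡ 0ℤ) ⊎ (wt d ≡ -1ℤ)
    edgeW      : ∀ d → ¬ IsBud d → wt d ℤ.+ wt (αf d) ≡ + (b ∸ 1)
    whiteW     : ∀ d → col d ≡ white → vertexWeight d ≡ + b
    -- (iii) each black vertex v has deg(v)/2 + w(v) = b, i.e. deg(v) + 2 w(v) = 2b
    blackW     : ∀ d → col d ≡ black →
                   + (vertexDegree d) ℤ.+ (+ 2) ℤ.* vertexWeight d ≡ + (2 * b)

_≅ᵀ_ : ∀ {b} → Mobile b → Mobile b → Set
T ≅ᵀ T' = Σ[ ψ ∈ Permutation T.n T'.n ]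
      ((∀ d → ψ ⟨$⟩ʳ (T.σf d) ≡ T'.σf (ψ ⟨$⟩ʳ d))
    × (∀ d → ψ ⟨$⟩ʳ (T.αf d) ≡ T'.αf (ψ ⟨$⟩ʳ d))
    × (∀ d → T'.col (ψ ⟨$⟩ʳ d) ≡ T.col d)
    × (∀ d → T'.wt (ψ ⟨$⟩ʳ d) ≡ T.wt d))
  where module T = Mobile T
        module T' = Mobile T'

{-# OPTIONS --safe #-}
-- A map is encoded by integer weights x on its darts: x q + x (α q) = b - 1, the positive parts sum to b around
-- every vertex, the negative parts sum to b - i along every inner face of degree 2i, outer darts have weight -1,
-- and the walk that turns around the vertex (σ) at a dart of weight ≤ 0 and follows the face (φ) otherwise leads
-- from every dart to the dart opposite to the root.  Two such weights differ by the coboundary of a potential that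
-- is monotone along both walks, so they agree.  For existence, maximise the total potential over all choices of
-- steps: a choice that can be improved is found unless the weights have the required signs, and the girth
-- condition bounds from below the cost of the cycles created by changing one step.
-- The mobile has a black vertex for each inner face and a white one for each inner vertex, and the map is
-- recovered from it by matching, along the contour of the tree, each white dart with the first free bud.
-- Conversely the weights force bipartiteness (parity of a potential) and girth 2b: the region enclosed by a cycle
-- has Euler characteristic at least 1, and summing the weights over it bounds the length of the cycle.
module Submission where

open import Defs
open import Data.Nat as ℕ using (ℕ; zero; suc; z≤n; s≤s)
import Data.Nat.Properties as ℕP
open import Data.Nat.DivMod using (_mod_; m<n⇒m%n≡m; n%n≡0)
open import Data.Nat.Induction using (<-rec)
open import Data.Integer as ℤ using (ℤ; -[1+_]; 0ℤ; 1ℤ; -1ℤ; _+_; _-_; _*_; -_; _≤_; _<_) renaming (+_ to pos)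
import Data.Integer.Properties as ℤP
open import Data.Integer.DivMod using (_%ℕ_; _/ℕ_; a≡a%ℕn+[a/ℕn]*n; n%ℕd<d)
open import Data.Integer.Tactic.RingSolver using (solve-∀)
import Data.Bool
import Data.Bool.Properties
open import Data.Bool using (Bool; true; false; not; T; if_then_else_; _∧_; _∨_)
import Data.Bool.ListAction as BL
open import Data.Fin as F using (Fin; zero; suc; toℕ; _≟_; punchIn; punchOut)
import Data.Fin.Properties as FP
open import Data.Fin.Permutation using (Permutation; Permutation′; _⟨$⟩ʳ_; _⟨$⟩ˡ_; permutation; inverseʳ; inverseˡ)
open import Data.List using (_∷_; map; length; filterᵇ; upTo; allFin; tabulate)
open import Data.Product using (Σ-syntax; ∃; _×_; _,_; proj₁; proj₂)
open import Data.Sum using (_⊎_; inj₁; inj₂; [_,_]′)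
open import Data.Empty using (⊥; ⊥-elim)
open import Data.Unit using (⊤; tt)
open import Relation.Nullary using (¬_; Dec; yes; no; does)
open import Relation.Nullary.Decidable using (⌊_⌋; _×-dec_)
open import Relation.Binary.PropositionalEquality using (_≡_; _≢_; refl; sym; cong; cong₂; subst; module ≡-Reasoning) renaming (trans to infixr 5 _∙_)
open import Relation.Binary.Definitions using (tri<; tri≈; tri>)
open import Function using (_∘_; id; case_of_)

-- Finite sums of integers

-- A dart `q` doubles as a corner: the quadrilateral formed by `vert q`, the edge of `σ⁻ q`,
-- `face q` and `edge q` in the incidence graph of vertices, edges and faces. Its two sides at
-- `edge q` are exits, crossed by `σ` and by `φ`. If a rule chooses one exit per corner and all
-- walks end at one corner, the uncrossed sides and one more form a spanning tree, so questions on
-- the sphere reduce to trees; Euler's formula enters as the node count `n + 2` and as the balance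
-- of a demand. With `y` and `z` the positive and negative parts of a weight, the sign of `x q` says
-- which exit is free of charge: weights are reduced costs of a shortest-path problem on corners,
-- and the exits taken are its optimal policy. Uniqueness is that of a potential, existence is
-- policy improvement. The obstacle is a switch that would close up a walk; this is where girth
-- enters. Insides of closed curves are never defined geometrically: they are sides of a fundamental
-- cut of the tree, or level sets of a potential.

b2z : Bool → ℤ
b2z true  = 1ℤ
b2z false = 0ℤ

0≤b2z : ∀ x → 0ℤ ≤ b2z x
0≤b2z true  = ℤ.+≤+ z≤n
0≤b2z false = ℤ.+≤+ z≤n

b2z≤1 : ∀ x → b2z x ≤ 1ℤ
b2z≤1 true  = ℤP.≤-refl
b2z≤1 false = ℤ.+≤+ z≤n

opaque
  ∑ : ∀ {n} → (Fin n → ℤ) → ℤ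
  ∑ {zero}  g = 0ℤ
  ∑ {suc n} g = g zero + ∑ (λ i → g (suc i))

  ∑-cong : ∀ {n} {g h : Fin n → ℤ} → (∀ i → g i ≡ h i) → ∑ g ≡ ∑ h
  ∑-cong {zero}  e = refl
  ∑-cong {suc n} e = cong₂ _+_ (e zero) (∑-cong (λ i → e (suc i)))

  ∑-zero : ∀ {n} {g : Fin n → ℤ} → (∀ i → g i ≡ 0ℤ) → ∑ g ≡ 0ℤ
  ∑-zero {zero}  e = refl
  ∑-zero {suc n} e = cong₂ _+_ (e zero) (∑-zero (λ i → e (suc i)))

  ∑-+ : ∀ {n} (g h : Fin n → ℤ) → ∑ (λ i → g i + h i) ≡ ∑ g + ∑ h
  ∑-+ {zero}  g h = refl
  ∑-+ {suc n} g h = cong (_+_ (g zero + h zero)) (∑-+ (g ∘ suc) (h ∘ suc)) ∙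
    lem (g zero) (h zero) (∑ (g ∘ suc)) (∑ (h ∘ suc))
    where lem : ∀ a b c d → (a + b) + (c + d) ≡ (a + c) + (b + d)
          lem = solve-∀

  ∑-*ˡ : ∀ {n} c (g : Fin n → ℤ) → ∑ (λ i → c * g i) ≡ c * ∑ g
  ∑-*ˡ {zero}  c g = sym (ℤP.*-zeroʳ c)
  ∑-*ˡ {suc n} c g = cong (_+_ (c * g zero)) (∑-*ˡ c (g ∘ suc)) ∙ sym (ℤP.*-distribˡ-+ c (g zero) _)

  ∑-*ʳ : ∀ {n} c (g : Fin n → ℤ) → ∑ (λ i → g i * c) ≡ ∑ g * c
  ∑-*ʳ c g = ∑-cong (λ i → ℤP.*-comm (g i) c) ∙ ∑-*ˡ c g ∙ ℤP.*-comm c (∑ g)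

  ∑-neg : ∀ {n} (g : Fin n → ℤ) → ∑ (λ i → - g i) ≡ - ∑ g
  ∑-neg {zero}  g = refl
  ∑-neg {suc n} g = cong (_+_ (- g zero)) (∑-neg (g ∘ suc)) ∙ sym (ℤP.neg-distrib-+ (g zero) _)

  ∑-- : ∀ {n} (g h : Fin n → ℤ) → ∑ (λ i → g i - h i) ≡ ∑ g - ∑ h
  ∑-- g h = ∑-+ g (λ i → - h i) ∙ cong (_+_ (∑ g)) (∑-neg h)

  ∑-swap : ∀ {m n} (g : Fin m → Fin n → ℤ) → ∑ (λ i → ∑ (λ j → g i j)) ≡ ∑ (λ j → ∑ (λ i → g i j))
  ∑-swap {zero} {n} g = sym (∑-zero {n} {g = λ _ → 0ℤ} (λ _ → refl))
  ∑-swap {suc m} g = cong (_+_ (∑ (g zero))) (∑-swap (λ i → g (suc i))) ∙ sym (∑-+ (g zero) _)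

  ∑-unfold : ∀ {n} (g : Fin (suc n) → ℤ) → ∑ g ≡ g zero + ∑ (λ i → g (suc i))
  ∑-unfold g = refl

  ∑-empty : (g : Fin 0 → ℤ) → ∑ g ≡ 0ℤ
  ∑-empty g = refl

  ∑-mono : ∀ {n} {g h : Fin n → ℤ} → (∀ i → g i ≤ h i) → ∑ g ≤ ∑ h
  ∑-mono {zero}  e = ℤP.≤-refl
  ∑-mono {suc n} e = ℤP.+-mono-≤ (e zero) (∑-mono (λ i → e (suc i)))

  ∑-nonneg : ∀ {n} {g : Fin n → ℤ} → (∀ i → 0ℤ ≤ g i) → 0ℤ ≤ ∑ g
  ∑-nonneg {zero}  e = ℤP.≤-refl
  ∑-nonneg {suc n} e = ℤP.+-mono-≤ (e zero) (∑-nonneg (λ i → e (suc i)))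

  ∑-const : ∀ n c → ∑ {n} (λ _ → c) ≡ pos n * c
  ∑-const zero    c = refl
  ∑-const (suc n) c = cong (c +_) (∑-const n c) ∙ sym (ℤP.suc-* (pos n) c)

  ind : ∀ {n} → Fin n → Fin n → ℤ
  ind i j = b2z (does (i ≟ j))

  ind-case : ∀ {n} (i j : Fin n) → (i ≡ j × ind i j ≡ 1ℤ) ⊎ (i ≢ j × ind i j ≡ 0ℤ)
  ind-case i j with i ≟ j
  ... | yes p = inj₁ (p , refl)
  ... | no ne = inj₂ (ne , refl)

  ind-≟ : ∀ {n} (i j : Fin n) → ind i j ≡ b2z (does (i ≟ j))
  ind-≟ i j = refl

  ind-refl : ∀ {n} (i : Fin n) → ind i i ≡ 1ℤ
  ind-refl i with i ≟ i
  ... | yes _ = refl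
  ... | no ¬p = ⊥-elim (¬p refl)

  ind-no : ∀ {n} {i j : Fin n} → i ≢ j → ind i j ≡ 0ℤ
  ind-no {i = i} {j} ne with i ≟ j
  ... | yes p = ⊥-elim (ne p)
  ... | no _  = refl

  ind-iff : ∀ {m n} {i j : Fin m} {k l : Fin n} → (i ≡ j → k ≡ l) → (k ≡ l → i ≡ j) → ind i j ≡ ind k l
  ind-iff {i = i} {j} {k} {l} f g with i ≟ j | k ≟ l
  ... | yes _ | yes _ = refl
  ... | yes p | no ¬q = ⊥-elim (¬q (f p))
  ... | no ¬p | yes q = ⊥-elim (¬p (g q))
  ... | no _  | no _  = refl

  ind-sym : ∀ {n} (i j : Fin n) → ind i j ≡ ind j i
  ind-sym i j = ind-iff {i = i} {j} {j} {i} sym sym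

  0≤ind : ∀ {n} (i j : Fin n) → 0ℤ ≤ ind i j
  0≤ind i j = 0≤b2z _

  ind-*-cong : ∀ {n} (i j : Fin n) {x y : ℤ} → (i ≡ j → x ≡ y) → ind i j * x ≡ ind i j * y
  ind-*-cong i j e with i ≟ j
  ... | yes p = cong (1ℤ *_) (e p)
  ... | no _  = refl

  ∑-ind : ∀ {n} (i : Fin n) (g : Fin n → ℤ) → ∑ (λ j → ind i j * g j) ≡ g i
  ∑-ind {suc n} zero    g = cong₂ _+_ (ℤP.*-identityˡ (g zero)) (∑-zero {n} {λ j → 0ℤ} (λ j → refl)) ∙ ℤP.+-identityʳ (g zero)
  ∑-ind {suc n} (suc i) g = cong (_+_ (0ℤ * g zero)) (∑-cong {n} {λ j → ind (suc i) (suc j) * g (suc j)} {λ j → ind i j * g (suc j)}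
      (λ j → cong (_* g (suc j)) (ind-iff {i = suc i} {suc j} {i} {j} FP.suc-injective (cong suc))) ∙ ∑-ind i (g ∘ suc)) ∙
    (ℤP.+-identityˡ _)

∑-bij : ∀ {m n} (f : Fin m → Fin n) (f⁻ : Fin n → Fin m) → (∀ i → f⁻ (f i) ≡ i) → (∀ j → f (f⁻ j) ≡ j) →
        (g : Fin n → ℤ) → ∑ (λ i → g (f i)) ≡ ∑ g
∑-bij f f⁻ l r g = begin
  ∑ (λ i → g (f i))                      ≡⟨ ∑-cong (λ i → sym (∑-ind (f i) g)) ⟩
  ∑ (λ i → ∑ (λ j → ind (f i) j * g j))  ≡⟨ ∑-swap (λ i j → ind (f i) j * g j) ⟩
  ∑ (λ j → ∑ (λ i → ind (f i) j * g j))  ≡⟨ ∑-cong (λ j → ∑-cong (λ i → cong (_* g j) (ind-iff {i = f i} {j} {f⁻ j} {i} (λ p → cong f⁻ (sym p) ∙ l i) (λ p → cong f (sym p) ∙ r j) ∙ refl))) ⟩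
  ∑ (λ j → ∑ (λ i → ind (f⁻ j) i * g j)) ≡⟨ ∑-cong (λ j → ∑-ind (f⁻ j) (λ _ → g j)) ⟩
  ∑ g ∎
  where open ≡-Reasoning

fib : ∀ {n m} → (Fin n → Fin m) → Fin m → (Fin n → ℤ) → ℤ
fib q v g = ∑ (λ d → ind (q d) v * g d)

-- Push-forward along `q` is adjoint to pull-back. This turns a family of conditions, one for each
-- vertex or face, into a single sum over darts, and back.
∑-fib : ∀ {n m} (q : Fin n → Fin m) (h : Fin m → ℤ) (g : Fin n → ℤ) →
        ∑ (λ v → h v * fib q v g) ≡ ∑ (λ d → h (q d) * g d)
∑-fib q h g = begin
  ∑ (λ v → h v * fib q v g)                      ≡⟨ ∑-cong (λ v → sym (∑-*ˡ (h v) (λ d → ind (q d) v * g d))) ⟩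
  ∑ (λ v → ∑ (λ d → h v * (ind (q d) v * g d)))  ≡⟨ ∑-swap (λ v d → h v * (ind (q d) v * g d)) ⟩
  ∑ (λ d → ∑ (λ v → h v * (ind (q d) v * g d)))  ≡⟨ ∑-cong (λ d → ∑-cong (λ v → lem (h v) (ind (q d) v) (g d))) ⟩
  ∑ (λ d → ∑ (λ v → ind (q d) v * (h v * g d)))  ≡⟨ ∑-cong (λ d → ∑-ind (q d) (λ v → h v * g d)) ⟩
  ∑ (λ d → h (q d) * g d) ∎
  where open ≡-Reasoning
        lem : ∀ a b c → a * (b * c) ≡ b * (a * c)
        lem = solve-∀

≤-by : ∀ {a b} c → 0ℤ ≤ c → b - a ≡ c → a ≤ b
≤-by c p e = ℤP.0≤i-j⇒j≤i (subst (0ℤ ≤_) (sym e) p)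

0≤+ : ∀ {a b} → 0ℤ ≤ a → 0ℤ ≤ b → 0ℤ ≤ a + b
0≤+ = ℤP.+-mono-≤

0≤* : ∀ {a b} → 0ℤ ≤ a → 0ℤ ≤ b → 0ℤ ≤ a * b
0≤* {pos a} {pos b} p q = subst (0ℤ ≤_) (ℤP.pos-* a b) (ℤ.+≤+ z≤n)

0≤- : ∀ {a b} → a ≤ b → 0ℤ ≤ b - a
0≤- = ℤP.i≤j⇒0≤j-i

<⇒1+≤ : ∀ {a b} → a < b → 1ℤ + a ≤ b
<⇒1+≤ = ℤP.i<j⇒suc[i]≤j

1+≤⇒< : ∀ {a b} → 1ℤ + a ≤ b → a < b
1+≤⇒< = ℤP.suc[i]≤j⇒i<j

∑-term : ∀ {n} (g : Fin n → ℤ) → (∀ i → 0ℤ ≤ g i) → ∀ i → g i ≤ ∑ g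
∑-term g nn i = ℤP.≤-trans (ℤP.≤-reflexive (sym (∑-ind i g))) (∑-mono (λ j → le j))
  where le : ∀ j → ind i j * g j ≤ g j
        le j with ind-case i j
        ... | inj₁ (_ , e) = ℤP.≤-reflexive (cong (_* g j) e ∙ ℤP.*-identityˡ (g j))
        ... | inj₂ (_ , e) = subst (_≤ g j) (sym (cong (_* g j) e)) (nn j)

∑-term₂ : ∀ {n} (g : Fin n → ℤ) → (∀ i → 0ℤ ≤ g i) → ∀ i j → i ≢ j → g i + g j ≤ ∑ g
∑-term₂ g nn i j ne = ℤP.≤-trans (ℤP.≤-reflexive (sym (∑-+ (λ k → ind i k * g k) (λ k → ind j k * g k) ∙ cong₂ _+_ (∑-ind i g) (∑-ind j g)))) (∑-mono le)
  where le : ∀ k → ind i k * g k + ind j k * g k ≤ g k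
        le k with ind-case i k | ind-case j k
        ... | inj₁ (p , _) | inj₁ (q , _) = ⊥-elim (ne (p ∙ sym q))
        ... | inj₁ (_ , e) | inj₂ (_ , f) = ℤP.≤-reflexive (cong₂ (λ u v → u * g k + v * g k) e f ∙ ℤP.+-identityʳ (1ℤ * g k) ∙ ℤP.*-identityˡ (g k))
        ... | inj₂ (_ , e) | inj₁ (_ , f) = ℤP.≤-reflexive (cong₂ (λ u v → u * g k + v * g k) e f ∙ ℤP.+-identityˡ (1ℤ * g k) ∙ ℤP.*-identityˡ (g k))
        ... | inj₂ (_ , e) | inj₂ (_ , f) = subst (_≤ g k) (sym (cong₂ (λ u v → u * g k + v * g k) e f)) (nn k)

∑-zero⁻ : ∀ {n} (g : Fin n → ℤ) → (∀ i → 0ℤ ≤ g i) → ∑ g ≡ 0ℤ → ∀ i → g i ≡ 0ℤ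
∑-zero⁻ g nn e i = ℤP.≤-antisym (ℤP.≤-trans (∑-term g nn i) (ℤP.≤-reflexive e)) (nn i)

-- Finite multigraphs with arcs s a → t a; all facts are proved by contracting the first arc

Cut : ∀ {A N} → (s t : Fin A → Fin N) → (Fin N → Bool) → Set
Cut s t h = ∀ a → h (s a) ≡ h (t a)

-- Connectedness is tested by two-valued functions instead of paths: this form passes to a
-- contracted graph by composing with the contraction, and a side of a cut is itself such a
-- function.
Conn : ∀ {A N} → (s t : Fin A → Fin N) → Set
Conn s t = ∀ h → Cut s t h → ∀ x y → h x ≡ h y

module _ {N : ℕ} (s t : Fin (suc N)) (t≢s : t ≢ s) where
  contract : Fin (suc N) → Fin N
  contract x with t ≟ x
  ... | yes _ = punchOut t≢s
  ... | no ne = punchOut ne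

  contract-punchIn : ∀ y → contract (punchIn t y) ≡ y
  contract-punchIn y with t ≟ punchIn t y
  ... | yes p = ⊥-elim (FP.punchInᵢ≢i t y (sym p))
  ... | no ne = FP.punchOut-cong t refl ∙ FP.punchOut-punchIn t

  contract-t : contract t ≡ contract s
  contract-t with t ≟ t | t ≟ s
  ... | yes _ | yes q = ⊥-elim (t≢s q)
  ... | yes _ | no _  = FP.punchOut-cong t refl
  ... | no ¬p | _     = ⊥-elim (¬p refl)

  punchIn-contract : ∀ x → t ≢ x → punchIn t (contract x) ≡ x
  punchIn-contract x ne with t ≟ x
  ... | yes p = ⊥-elim (ne p)
  ... | no _  = FP.punchIn-punchOut _

  factor : ∀ {B : Set} (h : Fin (suc N) → B) → h s ≡ h t → ∀ x → h x ≡ h (punchIn t (contract x))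
  factor h e x with t ≟ x
  ... | yes refl = sym e ∙ cong h (sym (FP.punchIn-punchOut t≢s))
  ... | no ne = cong h (sym (FP.punchIn-punchOut ne))

  ∑-contract : (g : Fin (suc N) → ℤ) → ∑ g ≡ g t + ∑ (λ y → g (punchIn t y))
  ∑-contract g = go g t
    where go : ∀ {N} (g : Fin (suc N) → ℤ) t → ∑ g ≡ g t + ∑ (λ y → g (punchIn t y))
          go g zero = ∑-unfold g
          go {suc N} g (suc t) = ∑-unfold g ∙ cong (g zero +_) (go (g ∘ suc) t) ∙ lem (g zero) (g (suc t)) (∑ (λ y → g (suc (punchIn t y)))) ∙
             cong (g (suc t) +_) (sym (∑-unfold (λ y → g (punchIn (suc t) y))))
            where lem : ∀ a b c → a + (b + c) ≡ b + (a + c)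
                  lem = solve-∀

conn-contract : ∀ {A N} (s t : Fin (suc A) → Fin (suc N)) (ne : t zero ≢ s zero) → Conn s t →
  let κ = contract (s zero) (t zero) ne in Conn (λ a → κ (s (suc a))) (λ a → κ (t (suc a)))
conn-contract s t ne c h ch x y = cong h (sym (contract-punchIn _ _ ne x)) ∙
   c (h ∘ contract _ _ ne) ch' (punchIn (t zero) x) (punchIn (t zero) y) ∙ cong h (contract-punchIn _ _ ne y)
  where ch' : Cut s t (h ∘ contract _ _ ne)
        ch' zero = cong h (sym (contract-t _ _ ne))
        ch' (suc a) = ch a

conn-loop : ∀ {A N} (s t : Fin (suc A) → Fin N) → t zero ≡ s zero → Conn s t → Conn (s ∘ suc) (t ∘ suc)
conn-loop s t e c h ch = c h λ { zero → cong h (sym e) ; (suc a) → ch a }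

conn-empty : ∀ {N} (s t : Fin 0 → Fin (suc N)) → Conn s t → N ≡ 0
conn-empty {zero} s t c = refl
conn-empty {suc N} s t c with c (λ { zero → true ; (suc _) → false }) (λ ()) zero (suc zero)
... | ()

-- Contracting a non-loop arc removes one counted arc and at most one marked vertex, until no arc is
-- left and the marked vertices coincide. Only arcs with `w` true are counted, so a caller discards
-- an arc by turning it into a loop.
spanned-bound : ∀ {A N} (s t : Fin A → Fin N) (k : Fin N → Bool) (w : Fin A → Bool) →
  (∀ a → w a ≡ false → s a ≡ t a) →
  (∀ h → Cut s t h → ∀ x y → k x ≡ true → k y ≡ true → h x ≡ h y) →
  ∑ (λ x → b2z (k x)) ≤ ∑ (λ a → b2z (w a)) + 1ℤ
spanned-bound {zero} {zero} s t k w wl c = subst (_≤ ∑ (λ a → b2z (w a)) + 1ℤ) (sym (∑-empty (λ x → b2z (k x)))) (subst (λ z → 0ℤ ≤ z + 1ℤ) (sym (∑-empty (λ a → b2z (w a)))) (ℤ.+≤+ z≤n))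
spanned-bound {zero} {suc N} s t k w wl c with FP.any? (λ x → k x Data.Bool.≟ true)
  where import Data.Bool
... | no none = ℤP.≤-trans (ℤP.≤-reflexive (∑-zero (λ x → cong b2z (nf x)))) (0≤+ (∑-nonneg (λ a → 0≤b2z (w a))) (ℤ.+≤+ z≤n))
  where nf : ∀ x → k x ≡ false
        nf x with k x in e
        ... | true = ⊥-elim (none (x , e))
        ... | false = refl
... | yes (x , kx) = ℤP.≤-trans (∑-mono le) (ℤP.≤-reflexive (∑-cong (λ y → sym (ℤP.*-identityʳ (ind x y))) ∙ ∑-ind x (λ _ → 1ℤ) ∙ cong (_+ 1ℤ) (sym (∑-empty (λ a → b2z (w a))))))
  where le : ∀ y → b2z (k y) ≤ ind x y
        le y with k y in ky
        ... | false = 0≤ind x y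
        ... | true with c (λ z → does (x ≟ z)) (λ ()) x y kx ky
        ...   | q = ℤP.≤-reflexive (sym (ind-refl x) ∙ ind-≟ x x ∙ cong b2z q ∙ sym (ind-≟ x y))
spanned-bound {suc A} {suc N} s t k w wl c with t zero ≟ s zero
... | yes e = ℤP.≤-trans (spanned-bound (s ∘ suc) (t ∘ suc) k (w ∘ suc) (wl ∘ suc) (λ h ch → c h λ { zero → cong h (sym e) ; (suc a) → ch a }))
       (≤-by (b2z (w zero)) (0≤b2z (w zero)) (cong (λ z → (z + 1ℤ) - (∑ (λ a → b2z (w (suc a))) + 1ℤ)) (∑-unfold (λ a → b2z (w a))) ∙ lem (b2z (w zero)) (∑ (λ a → b2z (w (suc a))))))
  where lem : ∀ a b → (a + b + 1ℤ) - (b + 1ℤ) ≡ a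
        lem = solve-∀
... | no ne = ℤP.≤-trans step (ℤP.≤-trans (ℤP.+-monoʳ-≤ 1ℤ ih) (ℤP.≤-reflexive fin))
  where
  κ = contract (s zero) (t zero) ne
  ι = punchIn (t zero)
  k' : Fin N → Bool
  k' y = k (ι y) ∨ (does (y ≟ κ (s zero)) ∧ k (t zero))
  wz : w zero ≡ true
  wz with w zero in e
  ... | true = refl
  ... | false = ⊥-elim (ne (sym (wl zero e)))
  orig : ∀ y → k' y ≡ true → ∃ λ x → κ x ≡ y × k x ≡ true
  orig y ky with k (ι y) in e
  ... | true = ι y , contract-punchIn _ _ ne y , e
  ... | false with y ≟ κ (s zero)
  ...   | yes p = t zero , (contract-t _ _ ne) ∙ sym p , ky
  ...   | no _ with ky
  ...     | ()
  ih : ∑ (λ y → b2z (k' y)) ≤ ∑ (λ a → b2z (w (suc a))) + 1ℤ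
  ih = spanned-bound (λ a → κ (s (suc a))) (λ a → κ (t (suc a))) k' (w ∘ suc) (λ a e → cong κ (wl (suc a) e)) c'
    where
    c' : ∀ h → Cut (λ a → κ (s (suc a))) (λ a → κ (t (suc a))) h → ∀ x y → k' x ≡ true → k' y ≡ true → h x ≡ h y
    c' h ch x y kx ky with orig x kx | orig y ky
    ... | x' , refl , kx' | y' , refl , ky' = c (h ∘ κ) (λ { zero → cong h (sym (contract-t _ _ ne)) ; (suc a) → ch a }) x' y' kx' ky'
  step : ∑ (λ x → b2z (k x)) ≤ 1ℤ + ∑ (λ y → b2z (k' y))
  step = ℤP.≤-trans (ℤP.≤-reflexive (∑-contract _ _ ne (λ x → b2z (k x)))) (ℤP.+-mono-≤ (b2z≤1 (k (t zero))) (∑-mono (λ y → le y)))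
    where le : ∀ y → b2z (k (ι y)) ≤ b2z (k' y)
          le y with k (ι y)
          ... | true = ℤP.≤-refl
          ... | false = 0≤b2z _
  fin : 1ℤ + (∑ (λ a → b2z (w (suc a))) + 1ℤ) ≡ ∑ (λ a → b2z (w a)) + 1ℤ
  fin = lem (∑ (λ a → b2z (w (suc a)))) ∙ cong (_+ 1ℤ) (cong (λ z → b2z z + ∑ (λ a → b2z (w (suc a)))) (sym wz) ∙ sym (∑-unfold (λ a → b2z (w a))))
    where lem : ∀ a → 1ℤ + (a + 1ℤ) ≡ 1ℤ + a + 1ℤ
          lem = solve-∀
spanned-bound {suc A} {zero} s t k w wl c with s zero
... | ()

conn-bound : ∀ {A N} (s t : Fin A → Fin N) → Conn s t → N ℕ.≤ suc A
conn-bound {A} {N} s t c = ℤP.drop‿+≤+ (ℤP.≤-trans (ℤP.≤-reflexive (sym (count N)))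
     (ℤP.≤-trans (spanned-bound s t (λ _ → true) (λ _ → true) (λ a ()) (λ h ch x y _ _ → c h ch x y))
      (ℤP.≤-reflexive (cong (_+ 1ℤ) (count A) ∙ ℤP.+-comm (pos A) 1ℤ))))
  where count : ∀ n → ∑ {n} (λ _ → 1ℤ) ≡ pos n
        count n = ∑-const n 1ℤ ∙ ℤP.*-identityʳ (pos n)

Div : ∀ {A N} → (s t : Fin A → Fin N) → (Fin A → ℤ) → (Fin N → ℤ) → ℤ
Div s t g h = ∑ (λ a → (h (s a) - h (t a)) * g a)

-- A tree has no cycle to carry a flow. A loop as first arc would leave too few arcs to connect the
-- vertices; after contraction the other arcs carry 0 by induction, and the first one is read off by
-- testing with the indicator of its source.
tree-circulation : ∀ {A} (s t : Fin A → Fin (suc A)) → Conn s t → (g : Fin A → ℤ) →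
  (∀ h → Div s t g h ≡ 0ℤ) → ∀ a → g a ≡ 0ℤ
tree-circulation {suc A} s t c g circ with t zero ≟ s zero
... | yes e = ⊥-elim (ℕP.<-irrefl refl (conn-bound (s ∘ suc) (t ∘ suc) (conn-loop s t e c)))
... | no ne = λ { zero → g0 ; (suc a) → gs a }
  where
  κ = contract (s zero) (t zero) ne
  gs : ∀ a → g (suc a) ≡ 0ℤ
  gs = tree-circulation (λ a → κ (s (suc a))) (λ a → κ (t (suc a))) (conn-contract s t ne c) (g ∘ suc)
        λ h → sym (∑-unfold (λ a → (h (κ (s a)) - h (κ (t a))) * g a) ∙ cong (_+ Div (λ a → κ (s (suc a))) (λ a → κ (t (suc a))) (g ∘ suc) h) (z h) ∙ (ℤP.+-identityˡ _)) ∙ circ (h ∘ κ)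
    where z : ∀ (h : Fin (suc A) → ℤ) → (h (κ (s zero)) - h (κ (t zero))) * g zero ≡ 0ℤ
          z h = cong (λ w → (h (κ (s zero)) - h w) * g zero) (contract-t (s zero) (t zero) ne) ∙ cong (_* g zero) (ℤP.+-inverseʳ (h (κ (s zero))))
  g0 : g zero ≡ 0ℤ
  g0 = sym (∑-unfold (λ a → k a * g a) ∙ cong₂ _+_ e1 (∑-zero (λ a → cong (k (suc a) *_) (gs a) ∙ ℤP.*-zeroʳ (k (suc a)))) ∙ ℤP.+-identityʳ (g zero)) ∙ circ (ind (s zero))
    where k : Fin (suc A) → ℤ
          k a = ind (s zero) (s a) - ind (s zero) (t a)
          e1 : (ind (s zero) (s zero) - ind (s zero) (t zero)) * g zero ≡ g zero
          e1 rewrite ind-refl (s zero) | ind-no (λ p → ne (sym p)) = ℤP.*-identityˡ (g zero)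

-- The demand is pushed forward to the contracted graph and routed there; the contracted arc then
-- carries whatever balances its target. No division occurs, so the flow is integral.
routing : ∀ {A N} (s t : Fin A → Fin N) → Conn s t → (q : Fin N → ℤ) → ∑ q ≡ 0ℤ →
  Σ[ g ∈ (Fin A → ℤ) ] (∀ h → Div s t g h ≡ ∑ (λ x → h x * q x))
routing {zero} {zero} s t c q q0 = (λ ()) , λ h → (∑-empty _) ∙ sym (∑-empty _)
routing {zero} {suc N} s t c q q0 with conn-empty s t c
... | refl = (λ ()) , λ h → (∑-empty _) ∙ sym (∑-zero λ { zero → cong (h zero *_) qz ∙ ℤP.*-zeroʳ (h zero) })
  where qz : q zero ≡ 0ℤ
        qz = sym (∑-unfold q ∙ cong (q zero +_) (∑-empty (λ i → q (suc i))) ∙ ℤP.+-identityʳ (q zero)) ∙ q0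
routing {suc A} {zero} s t c q q0 with s zero
... | ()
routing {suc A} {suc N} s t c q q0 with t zero ≟ s zero
... | yes e = (λ { zero → 0ℤ ; (suc a) → g a }) , λ h → (∑-unfold _) ∙ cong (_+ Div (s ∘ suc) (t ∘ suc) g h) (ℤP.*-zeroʳ (h (s zero) - h (t zero))) ∙ (ℤP.+-identityˡ _) ∙ eg h
  where r = routing (s ∘ suc) (t ∘ suc) (conn-loop s t e c) q q0
        g = proj₁ r
        eg = proj₂ r
... | no ne = g , pf
  where
  κ = contract (s zero) (t zero) ne
  ι = punchIn (t zero)
  q' : Fin N → ℤ
  q' y = fib κ y q
  q'-weak : ∀ h → ∑ (λ y → h y * q' y) ≡ ∑ (λ x → h (κ x) * q x)
  q'-weak h = ∑-fib κ h q
  r = routing (λ a → κ (s (suc a))) (λ a → κ (t (suc a))) (conn-contract s t ne c) q'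
        (∑-cong (λ y → sym (ℤP.*-identityˡ (q' y))) ∙ q'-weak (λ _ → 1ℤ) ∙ ∑-cong (λ y → ℤP.*-identityˡ (q y)) ∙ q0)
  g' = proj₁ r
  D' : (Fin (suc N) → ℤ) → ℤ
  D' h = Div (s ∘ suc) (t ∘ suc) g' h
  g : Fin (suc A) → ℤ
  -- Solves the balance at `t zero`: tested with its indicator, the first arc contributes minus its
  -- value and the others contribute `D'`.
  g zero = D' (ind (t zero)) - q (t zero)
  g (suc a) = g' a
  pf : ∀ h → Div s t g h ≡ ∑ (λ x → h x * q x)
  pf h = begin
    Div s t g h
      ≡⟨ ∑-unfold (λ a → (h (s a) - h (t a)) * g a) ⟩
    (h (s zero) - h (t zero)) * (D' (ind (t zero)) - q (t zero)) + D' h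
      ≡⟨ cong ((h (s zero) - h (t zero)) * (D' (ind (t zero)) - q (t zero)) +_) eD ⟩
    (h (s zero) - h (t zero)) * (D' (ind (t zero)) - q (t zero)) + (∑ (λ x → k (κ x) * q x) + e * D' (ind (t zero)))
      ≡⟨ lem (h (s zero)) (h (t zero)) (D' (ind (t zero))) (q (t zero)) (∑ (λ x → k (κ x) * q x)) ⟩
    ∑ (λ x → k (κ x) * q x) + e * q (t zero)
      ≡⟨ cong (∑ (λ x → k (κ x) * q x) +_) (cong (e *_) (sym (∑-ind (t zero) q)) ∙ sym (∑-*ˡ e (λ x → ind (t zero) x * q x))) ⟩
    ∑ (λ x → k (κ x) * q x) + ∑ (λ x → e * (ind (t zero) x * q x))
      ≡⟨ sym (∑-+ (λ x → k (κ x) * q x) (λ x → e * (ind (t zero) x * q x))) ⟩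
    ∑ (λ x → k (κ x) * q x + e * (ind (t zero) x * q x))
      ≡⟨ ∑-cong (λ x → lem2 (k (κ x)) e (ind (t zero) x) (q x) ∙ cong (_* q x) (sym (hk x))) ⟩
    ∑ (λ x → h x * q x) ∎
    where
    open ≡-Reasoning
    k : Fin N → ℤ
    k y = h (ι y)
    e = h (t zero) - h (s zero)
    hk : ∀ x → h x ≡ k (κ x) + e * ind (t zero) x
    hk x with ind-case (t zero) x
    ... | inj₁ (refl , i1) = l (h (t zero)) (h (s zero)) ∙ cong₂ (λ w j → w + e * j)
            (cong h (sym (cong ι (contract-t _ _ ne) ∙ (punchIn-contract _ _ ne (s zero) ne)))) (sym i1)
      where l : ∀ a b → a ≡ b + (a - b) * 1ℤ
            l = solve-∀
    ... | inj₂ (n , i0) = cong h (sym (punchIn-contract _ _ ne x n)) ∙ sym (ℤP.+-identityʳ (k (κ x))) ∙ cong (k (κ x) +_) (sym (ℤP.*-zeroʳ e) ∙ cong (e *_) (sym i0))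
    lem : ∀ a b x y z → (a - b) * (x - y) + (z + (b - a) * x) ≡ z + (b - a) * y
    lem = solve-∀
    lem2 : ∀ a b c d → a * d + b * (c * d) ≡ (a + b * c) * d
    lem2 = solve-∀
    eD : D' h ≡ ∑ (λ x → k (κ x) * q x) + e * D' (ind (t zero))
    eD = ∑-cong (λ a → cong₂ (λ u v → (u - v) * g' a) (hk (s (suc a))) (hk (t (suc a))) ∙ lem3 (k (κ (s (suc a)))) e (ind (t zero) (s (suc a))) (k (κ (t (suc a)))) (ind (t zero) (t (suc a))) (g' a)) ∙
         ∑-+ (λ a → (k (κ (s (suc a))) - k (κ (t (suc a)))) * g' a) (λ a → e * ((ind (t zero) (s (suc a)) - ind (t zero) (t (suc a))) * g' a)) ∙ cong₂ _+_ (proj₂ r k ∙ q'-weak k) (∑-*ˡ e (λ a → (ind (t zero) (s (suc a)) - ind (t zero) (t (suc a))) * g' a))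
      where lem3 : ∀ a e i b j g → ((a + e * i) - (b + e * j)) * g ≡ (a - b) * g + e * ((i - j) * g)
            lem3 = solve-∀

-- Connectedness quantifies over all functions; contraction makes it decidable and, when it fails,
-- yields an explicit cut. The cut is wanted as data because it later serves as a region of the
-- sphere.
conn-or-cut : ∀ {A N} (s t : Fin A → Fin N) → Conn s t ⊎ (Σ[ h ∈ (Fin N → Bool) ] Cut s t h × (∃ λ x → ∃ λ y → h x ≢ h y))
conn-or-cut {zero} {zero} s t = inj₁ λ h c ()
conn-or-cut {zero} {suc zero} s t = inj₁ λ { h c zero zero → refl }
conn-or-cut {zero} {suc (suc N)} s t = inj₂ ((λ { zero → true ; (suc _) → false }) , (λ ()) , zero , suc zero , λ ())
conn-or-cut {suc A} {zero} s t = inj₁ λ h c ()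
conn-or-cut {suc A} {suc N} s t with t zero ≟ s zero
... | yes e = [ (λ c → inj₁ λ h ch → c h (ch ∘ suc)) , (λ { (h , c , r) → inj₂ (h , (λ { zero → cong h (sym e) ; (suc a) → c a }) , r) }) ]′ (conn-or-cut (s ∘ suc) (t ∘ suc))
... | no ne = [ (λ c → inj₁ λ h ch x y → (factor _ _ ne h (ch zero) x) ∙ c (h ∘ punchIn (t zero)) (λ a → sym (factor _ _ ne h (ch zero) _) ∙ ch (suc a) ∙ (factor _ _ ne h (ch zero) _)) (κ x) (κ y) ∙
               sym (factor _ _ ne h (ch zero) y))
              , (λ { (h , c , x , y , r) → inj₂ (h ∘ κ , (λ { zero → cong h (sym (contract-t _ _ ne)) ; (suc a) → c a }) , punchIn (t zero) x , punchIn (t zero) y ,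
                   λ p → r (cong h (sym (contract-punchIn _ _ ne x)) ∙ p ∙ cong h (contract-punchIn _ _ ne y))) }) ]′
              (conn-or-cut (λ a → κ (s (suc a))) (λ a → κ (t (suc a))))
  where κ = contract (s zero) (t zero) ne

-- If one extra arc from the side h = true to the other side makes the graph connected,
-- the side h = true is itself connected, hence has at most (its arcs) + 1 vertices.
side-bound : ∀ {A N} (s t : Fin A → Fin N) (s₀ t₀ : Fin N) (h : Fin N → Bool) → Cut s t h → h s₀ ≡ true → h t₀ ≡ false →
  (∀ k → Cut s t k → k s₀ ≡ k t₀ → ∀ x y → k x ≡ k y) →
  ∑ (λ x → b2z (h x)) ≤ ∑ (λ a → b2z (h (s a))) + 1ℤ
side-bound {A} {N} s t s₀ t₀ h ch h1 h0 c = spanned-bound s' t' h (h ∘ s) wl cc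
  where
  -- Arcs on the other side become loops at `s₀`, so that `spanned-bound` does not count them.
  s' t' : Fin A → Fin N
  s' a = if h (s a) then s a else s₀
  t' a = if h (s a) then t a else s₀
  wl : ∀ a → h (s a) ≡ false → s' a ≡ t' a
  wl a e rewrite e = refl
  cc : ∀ k → Cut s' t' k → ∀ x y → h x ≡ true → h y ≡ true → k x ≡ k y
  cc k ck x y hx hy = sym (k'1 x hx) ∙ c k' ck' e0 x y ∙ k'1 y hy
    where
    -- A function on the side is extended by its value at `s₀`; the extra arc then joins equal
    -- values and the connectedness hypothesis applies.
    k' : Fin N → Bool
    k' z = if h z then k z else k s₀
    k'1 : ∀ z → h z ≡ true → k' z ≡ k z
    k'1 z e rewrite e = refl
    e0 : k' s₀ ≡ k' t₀
    e0 rewrite h1 | h0 = refl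
    ck' : Cut s t k'
    ck' a with h (s a) | h (t a) | ch a | ck a
    ... | true | true | _ | p = p
    ... | false | false | _ | _ = refl

-- Orbits of maps on Fin n

true≢false : true ≢ false
true≢false ()

bool-ext : ∀ {x y} → (x ≡ true → y ≡ true) → (y ≡ true → x ≡ true) → x ≡ y
bool-ext {true}  {true}  f g = refl
bool-ext {true}  {false} f g = sym (f refl)
bool-ext {false} {true}  f g = g refl
bool-ext {false} {false} f g = refl

does-true : ∀ {P : Set} (p? : Dec P) → does p? ≡ true → P
does-true (yes p) _ = p

true-does : ∀ {P : Set} (p? : Dec P) → P → does p? ≡ true
true-does (yes _) _ = refl
true-does (no ¬p) p = ⊥-elim (¬p p)

false-does : ∀ {P : Set} (p? : Dec P) → ¬ P → does p? ≡ false
false-does (yes p) ¬p = ⊥-elim (¬p p)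
false-does (no _) _ = refl

isYes-true : ∀ {P : Set} (p? : Dec P) → ⌊ p? ⌋ ≡ true → P
isYes-true (yes p) _ = p

true-isYes : ∀ {P : Set} (p? : Dec P) → P → ⌊ p? ⌋ ≡ true
true-isYes (yes _) _ = refl
true-isYes (no ¬p) p = ⊥-elim (¬p p)

iter-+ : ∀ {n} (f : Fin n → Fin n) j k d → iter f (j ℕ.+ k) d ≡ iter f j (iter f k d)
iter-+ f zero    k d = refl
iter-+ f (suc j) k d = cong f (iter-+ f j k d)

iter-suc : ∀ {n} (f : Fin n → Fin n) k d → iter f (suc k) d ≡ iter f k (f d)
iter-suc f zero    d = refl
iter-suc f (suc k) d = cong f (iter-suc f k d)

Orb : ∀ {n} → (Fin n → Fin n) → Fin n → Fin n → Set
Orb f d e = ∃ λ k → iter f k d ≡ e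

Orb-trans : ∀ {n} {f : Fin n → Fin n} {a b c} → Orb f a b → Orb f b c → Orb f a c
Orb-trans {f = f} {a} (j , p) (k , q) = k ℕ.+ j , iter-+ f k j a ∙ cong (iter f k) p ∙ q

Orb-refl : ∀ {n} {f : Fin n → Fin n} {a} → Orb f a a
Orb-refl = 0 , refl

Orb-step : ∀ {n} {f : Fin n → Fin n} {a} → Orb f a (f a)
Orb-step = 1 , refl

iter-inv : ∀ {A : Set} {n} {f : Fin n → Fin n} (g : Fin n → A) → (∀ d → g (f d) ≡ g d) → ∀ k d → g (iter f k d) ≡ g d
iter-inv g e zero d = refl
iter-inv {f = f} g e (suc k) d = e (iter f k d) ∙ iter-inv g e k d

orb-inv : ∀ {A : Set} {n} {f : Fin n → Fin n} (g : Fin n → A) → (∀ d → g (f d) ≡ g d) → ∀ {d e} → Orb f d e → g d ≡ g e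
orb-inv g e {d} (k , o) = sym (iter-inv g e k d) ∙ cong g o

-- Among the first `n + 1` iterates two coincide, and the stretch between them can be cut out of the
-- exponent.
orb< : ∀ {n} (f : Fin n → Fin n) d e → Orb f d e → ∃ λ k → k ℕ.< n × iter f k d ≡ e
orb< {n} f d e (k , p) = <-rec (λ k → iter f k d ≡ e → ∃ λ j → j ℕ.< n × iter f j d ≡ e) go k p
  where
  go : ∀ k → (∀ {j} → j ℕ.< k → iter f j d ≡ e → ∃ λ j → j ℕ.< n × iter f j d ≡ e) → iter f k d ≡ e → ∃ λ j → j ℕ.< n × iter f j d ≡ e
  go k rec p with k ℕP.<? n
  ... | yes lt = k , lt , p
  ... | no ge with FP.pigeonhole {n} {suc n} ℕP.≤-refl (λ i → iter f (toℕ i) d)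
  ...   | i , j , i<j , eq = rec {k ℕ.∸ toℕ j ℕ.+ toℕ i} lt (iter-+ f (k ℕ.∸ toℕ j) (toℕ i) d ∙ cong (iter f (k ℕ.∸ toℕ j)) eq ∙
            sym (iter-+ f (k ℕ.∸ toℕ j) (toℕ j) d) ∙ cong (λ m → iter f m d) (ℕP.m∸n+n≡m j≤k) ∙ p)
    where j≤k : toℕ j ℕ.≤ k
          j≤k = ℕP.≤-trans (ℕP.≤-pred (FP.toℕ<n j)) (ℕP.≮⇒≥ ge)
          lt : k ℕ.∸ toℕ j ℕ.+ toℕ i ℕ.< k
          lt = subst (k ℕ.∸ toℕ j ℕ.+ toℕ i ℕ.<_) (ℕP.m∸n+n≡m j≤k) (ℕP.+-monoʳ-< (k ℕ.∸ toℕ j) i<j)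

orb? : ∀ {n} (f : Fin n → Fin n) d e → Dec (Orb f d e)
orb? {n} f d e with FP.any? {n} (λ k → iter f (toℕ k) d ≟ e)
... | yes (k , p) = yes (toℕ k , p)
... | no ¬p = no λ o → let (k , k<n , p) = orb< f d e o in ¬p (F.fromℕ< k<n , cong (λ m → iter f m d) (FP.toℕ-fromℕ< k<n) ∙ p)

any-true : ∀ {A : Set} (p : A → Bool) xs → BL.any p xs ≡ true → ∃ λ x → p x ≡ true
any-true p (x ∷ xs) e with p x in eq
... | true = x , eq
... | false = any-true p xs e

any-applyUpTo : ∀ (p : ℕ → Bool) (g : ℕ → ℕ) n k → k ℕ.< n → p (g k) ≡ true → BL.any p (Data.List.applyUpTo g n) ≡ true
any-applyUpTo p g (suc n) zero lt e rewrite e = refl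
any-applyUpTo p g (suc n) (suc k) (s≤s lt) e with p (g zero)
... | true = refl
... | false = any-applyUpTo p (g ∘ suc) n k lt e

inOrbit-sound : ∀ {n} (f : Fin n → Fin n) d e → inOrbitᵇ f d e ≡ true → Orb f d e
inOrbit-sound {n} f d e h with any-true (λ k → ⌊ iter f k d ≟ e ⌋) (upTo n) h
... | k , p = k , isYes-true (iter f k d ≟ e) p

inOrbit-complete : ∀ {n} (f : Fin n → Fin n) d e → Orb f d e → inOrbitᵇ f d e ≡ true
inOrbit-complete {n} f d e o with orb< f d e o
... | k , lt , p = any-applyUpTo (λ k → ⌊ iter f k d ≟ e ⌋) id n k lt (true-isYes (iter f k d ≟ e) p)

Inj : ∀ {m n} → (Fin m → Fin n) → Set
Inj f = ∀ {x y} → f x ≡ f y → x ≡ y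

iter-inj : ∀ {n} {f : Fin n → Fin n} → Inj f → ∀ k → Inj (iter f k)
iter-inj i zero    p = p
iter-inj i (suc k) p = iter-inj i k (i p)

period : ∀ {n} (f : Fin n → Fin n) → Inj f → ∀ d → ∃ λ m → iter f (suc m) d ≡ d
period {n} f inj d with FP.pigeonhole {n} {suc n} ℕP.≤-refl (λ i → iter f (toℕ i) d)
... | i , j , i<j , eq = toℕ j ℕ.∸ suc (toℕ i) , sym (iter-inj inj (toℕ i)
       (eq ∙ cong (λ m → iter f m d) (sym ((ℕP.+-suc (toℕ i) _) ∙ ℕP.m+[n∸m]≡n i<j)) ∙ iter-+ f (toℕ i) (suc (toℕ j ℕ.∸ suc (toℕ i))) d))

-- The predecessor of `d` on its cycle, reached by going forward around it; a permutation can thus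
-- be built from injectivity alone.
inv : ∀ {n} (f : Fin n → Fin n) → Inj f → Fin n → Fin n
inv f inj d = iter f (proj₁ (period f inj d)) d

inv-r : ∀ {n} (f : Fin n → Fin n) (inj : Inj f) d → f (inv f inj d) ≡ d
inv-r f inj d = proj₂ (period f inj d)

inv-l : ∀ {n} (f : Fin n → Fin n) (inj : Inj f) d → inv f inj (f d) ≡ d
inv-l f inj d = inj (inv-r f inj (f d))

mkPerm : ∀ {n} (f : Fin n → Fin n) → Inj f → Permutation′ n
mkPerm f inj = permutation f (inv f inj) (inv-r f inj) (inv-l f inj)

perm-inj : ∀ {m n} (π : Permutation m n) → Inj (π ⟨$⟩ʳ_)
perm-inj π {x} {y} p = sym (inverseˡ π) ∙ cong (π ⟨$⟩ˡ_) p ∙ inverseˡ π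

Orb-sym : ∀ {n} {f : Fin n → Fin n} → Inj f → ∀ {a b} → Orb f a b → Orb f b a
Orb-sym {f = f} inj {a} (zero , refl) = 0 , refl
Orb-sym {f = f} inj {a} (suc k , refl) = Orb-trans (back (iter f k a)) (Orb-sym inj (k , refl))
  where back : ∀ x → Orb f (f x) x
        back x = proj₁ (period f inj x) , sym (iter-suc f (proj₁ (period f inj x)) x) ∙ proj₂ (period f inj x)

-- Subsets of Fin n, enumerated

count : ∀ {n} → (Fin n → Bool) → ℕ
count {zero}  p = 0
count {suc n} p = (if p zero then 1 else 0) ℕ.+ count (p ∘ suc)

count-∑ : ∀ {n} (p : Fin n → Bool) → pos (count p) ≡ ∑ (λ i → b2z (p i))
count-∑ {zero}  p = sym (∑-empty _)
count-∑ {suc n} p with p zero in e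
... | true  = cong (1ℤ +_) (count-∑ (p ∘ suc)) ∙ cong (λ z → b2z z + ∑ (λ i → b2z (p (suc i)))) (sym e) ∙ sym (∑-unfold (λ i → b2z (p i)))
... | false = count-∑ (p ∘ suc) ∙ sym (ℤP.+-identityˡ _) ∙ cong (λ z → b2z z + ∑ (λ i → b2z (p (suc i)))) (sym e) ∙ sym (∑-unfold (λ i → b2z (p i)))

length-filter : ∀ {A : Set} {n} (p : A → Bool) (g : Fin n → A) → length (filterᵇ p (tabulate g)) ≡ count (p ∘ g)
length-filter {n = zero}  p g = refl
length-filter {n = suc n} p g with p (g zero)
... | true  = cong suc (length-filter p (g ∘ suc))
... | false = length-filter p (g ∘ suc)

length-filter-∑ : ∀ {n} (p : Fin n → Bool) → pos (length (filterᵇ p (allFin n))) ≡ ∑ (λ i → b2z (p i))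
length-filter-∑ p = cong pos (length-filter p id) ∙ count-∑ p

sum-filter : ∀ {A : Set} {n} (p : A → Bool) (w : A → ℤ) (g : Fin n → A) → sumℤ (map w (filterᵇ p (tabulate g))) ≡ ∑ (λ i → b2z (p (g i)) * w (g i))
sum-filter {n = zero}  p w g = sym (∑-empty _)
sum-filter {n = suc n} p w g with p (g zero) in e
... | true  = cong₂ _+_ (sym (ℤP.*-identityˡ (w (g zero))) ∙ cong (λ z → b2z z * w (g zero)) (sym e)) (sum-filter p w (g ∘ suc)) ∙ sym (∑-unfold (λ i → b2z (p (g i)) * w (g i)))
... | false = (sum-filter p w (g ∘ suc) ∙ sym (ℤP.+-identityˡ _) ∙ cong (λ z → b2z z * w (g zero) + ∑ (λ i → b2z (p (g (suc i))) * w (g (suc i)))) (sym e)) ∙ sym (∑-unfold (λ i → b2z (p (g i)) * w (g i)))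

el : ∀ {n} (p : Fin n → Bool) → Fin (count p) → Fin n
el {suc n} p i with p zero
el {suc n} p zero    | true  = zero
el {suc n} p (suc i) | true  = suc (el (p ∘ suc) i)
el {suc n} p i       | false = suc (el (p ∘ suc) i)

el-p : ∀ {n} (p : Fin n → Bool) i → p (el p i) ≡ true
el-p {suc n} p i with p zero in e
el-p {suc n} p zero    | true  = e
el-p {suc n} p (suc i) | true  = el-p (p ∘ suc) i
el-p {suc n} p i       | false = el-p (p ∘ suc) i

ix : ∀ {n} (p : Fin n → Bool) d → p d ≡ true → Fin (count p)
ix {suc n} p zero h with p zero
... | true = zero
ix {suc n} p (suc d) h with p zero
... | true = suc (ix (p ∘ suc) d h)
... | false = ix (p ∘ suc) d h

el-ix : ∀ {n} (p : Fin n → Bool) d (h : p d ≡ true) → el p (ix p d h) ≡ d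
el-ix {suc n} p zero h with p zero
... | true = refl
el-ix {suc n} p (suc d) h with p zero
... | true = cong suc (el-ix (p ∘ suc) d h)
... | false = cong suc (el-ix (p ∘ suc) d h)

el-inj : ∀ {n} (p : Fin n → Bool) → Inj (el p)
el-inj {suc n} p {i} {j} e with p zero
el-inj {suc n} p {zero} {zero} e | true = refl
el-inj {suc n} p {suc i} {suc j} e | true = cong suc (el-inj (p ∘ suc) (FP.suc-injective e))
el-inj {suc n} p {i} {j} e | false = el-inj (p ∘ suc) (FP.suc-injective e)

ix-el : ∀ {n} (p : Fin n → Bool) i (h : p (el p i) ≡ true) → ix p (el p i) h ≡ i
ix-el p i h = el-inj p (el-ix p (el p i) h)

∑-el : ∀ {n} (p : Fin n → Bool) (g : Fin n → ℤ) → ∑ (λ i → g (el p i)) ≡ ∑ (λ d → b2z (p d) * g d)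
∑-el {zero} p g = (∑-empty _) ∙ sym (∑-empty _)
∑-el {suc n} p g with p zero in e
... | true = (∑-unfold _) ∙ cong₂ _+_ (sym (ℤP.*-identityˡ (g zero)) ∙ cong (λ z → b2z z * g zero) (sym e)) (∑-el (p ∘ suc) (g ∘ suc)) ∙ sym (∑-unfold (λ d → b2z (p d) * g d))
... | false = ∑-el (p ∘ suc) (g ∘ suc) ∙ (sym (ℤP.+-identityˡ _) ∙ cong (λ z → b2z z * g zero + ∑ (λ i → b2z (p (suc i)) * g (suc i))) (sym e)) ∙ sym (∑-unfold (λ d → b2z (p d) * g d))

least : ∀ {n} (p : Fin n → Bool) d → p d ≡ true → ∃ λ e → p e ≡ true × (∀ x → p x ≡ true → toℕ e ℕ.≤ toℕ x)
least {suc n} p d h with p zero in e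
... | true = zero , e , λ x _ → z≤n
least {suc n} p zero h | false = ⊥-elim (true≢false (sym h ∙ e))
least {suc n} p (suc d) h | false with least (p ∘ suc) d h
... | x , px , m = suc x , px , λ { zero q → ⊥-elim (true≢false (sym q ∙ e)) ; (suc y) q → s≤s (m y q) }

all-filter⁺ : ∀ {A : Set} {n} (p q : A → Bool) (g : Fin n → A) → (∀ i → q (g i) ≡ true → p (g i) ≡ true) → BL.all p (filterᵇ q (tabulate g)) ≡ true
all-filter⁺ {n = zero} p q g h = refl
all-filter⁺ {n = suc n} p q g h with q (g zero) in e
... | true rewrite h zero e = all-filter⁺ p q (g ∘ suc) (h ∘ suc)
... | false = all-filter⁺ p q (g ∘ suc) (h ∘ suc)

all-filter⁻ : ∀ {A : Set} {n} (p q : A → Bool) (g : Fin n → A) → BL.all p (filterᵇ q (tabulate g)) ≡ true → ∀ i → q (g i) ≡ true → p (g i) ≡ true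
all-filter⁻ {n = suc n} p q g h i k with q (g zero) in e
all-filter⁻ {n = suc n} p q g h zero k    | false = ⊥-elim (true≢false (sym k ∙ e))
all-filter⁻ {n = suc n} p q g h (suc i) k | false = all-filter⁻ p q (g ∘ suc) h i k
all-filter⁻ {n = suc n} p q g h i k | true with p (g zero) in e'
all-filter⁻ {n = suc n} p q g h zero k    | true | true = e'
all-filter⁻ {n = suc n} p q g h (suc i) k | true | true = all-filter⁻ p q (g ∘ suc) h i k

≤ᵇ-sound : ∀ a b → (a ℕ.≤ᵇ b) ≡ true → a ℕ.≤ b
≤ᵇ-sound a b e = ℕP.≤ᵇ⇒≤ a b (subst T (sym e) tt)

≤ᵇ-complete : ∀ a b → a ℕ.≤ b → (a ℕ.≤ᵇ b) ≡ true
≤ᵇ-complete a b l with a ℕ.≤ᵇ b | ℕP.≤⇒≤ᵇ l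
... | true | _ = refl

module Quot {n} (f : Fin n → Fin n) (inj : Inj f) where
  size : ℕ
  size = count (isRep f)

  size-numCycles : numCycles f ≡ size
  size-numCycles = length-filter (isRep f) id

  opaque
    rep-of : ∀ d → ∃ λ e → isRep f e ≡ true × Orb f d e
    rep-of d with least (inOrbitᵇ f d) d (inOrbit-complete f d d Orb-refl)
    ... | e , h , m = e , all-filter⁺ (λ x → toℕ e ℕ.≤ᵇ toℕ x) (inOrbitᵇ f e) id
            (λ x k → ≤ᵇ-complete (toℕ e) (toℕ x) (m x (inOrbit-complete f d x (Orb-trans (inOrbit-sound f d e h) (inOrbit-sound f e x k))))) , inOrbit-sound f d e h

    rep-unique : ∀ {d e} → isRep f d ≡ true → isRep f e ≡ true → Orb f d e → d ≡ e
    rep-unique {d} {e} rd re o = FP.toℕ-injective (ℕP.≤-antisym (le d e rd o) (le e d re (Orb-sym inj o)))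
      where le : ∀ d e → isRep f d ≡ true → Orb f d e → toℕ d ℕ.≤ toℕ e
            le d e r o = ≤ᵇ-sound (toℕ d) (toℕ e) (all-filter⁻ (λ x → toℕ d ℕ.≤ᵇ toℕ x) (inOrbitᵇ f d) id r e (inOrbit-complete f d e o))

    -- Orbits are numbered through their least elements, the ones that `isRep` accepts, so that
    -- `size` agrees with the count made by `numCycles`.
    cls : Fin n → Fin size
    cls d = ix (isRep f) (proj₁ (rep-of d)) (proj₁ (proj₂ (rep-of d)))

    rep : Fin size → Fin n
    rep = el (isRep f)

    rep-cls : ∀ d → Orb f d (rep (cls d))
    rep-cls d = subst (Orb f d) (sym (el-ix (isRep f) (proj₁ (rep-of d)) (proj₁ (proj₂ (rep-of d))))) (proj₂ (proj₂ (rep-of d)))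

    cls-eq : ∀ {d e} → Orb f d e → cls d ≡ cls e
    cls-eq {d} {e} o = el-inj (isRep f) (rep-unique {rep (cls d)} {rep (cls e)} (el-p (isRep f) (cls d)) (el-p (isRep f) (cls e))
                          (Orb-trans (Orb-sym inj (rep-cls d)) (Orb-trans o (rep-cls e))))

    cls-orb : ∀ {d e} → cls d ≡ cls e → Orb f d e
    cls-orb {d} {e} p = Orb-trans (rep-cls d) (subst (λ c → Orb f (rep c) e) (sym p) (Orb-sym inj (rep-cls e)))

    cls-rep : ∀ v → cls (rep v) ≡ v
    cls-rep v = el-inj (isRep f) (rep-unique {rep (cls (rep v))} {rep v} (el-p (isRep f) (cls (rep v))) (el-p (isRep f) v) (Orb-sym inj (rep-cls (rep v))))

  cls-f : ∀ d → cls (f d) ≡ cls d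
  cls-f d = sym (cls-eq Orb-step)

  inOrbit-cls : ∀ d e → b2z (inOrbitᵇ f d e) ≡ ind (cls e) (cls d)
  inOrbit-cls d e with ind-case (cls e) (cls d)
  ... | inj₁ (p , q) = cong b2z (inOrbit-complete f d e (cls-orb (sym p))) ∙ sym q
  ... | inj₂ (p , q) = cong b2z nf ∙ sym q
    where nf : inOrbitᵇ f d e ≡ false
          nf with inOrbitᵇ f d e in h
          ... | true = ⊥-elim (p (sym (cls-eq (inOrbit-sound f d e h))))
          ... | false = refl

  orbit-sum : ∀ (w : Fin n → ℤ) d → sumℤ (map w (orbitMembers f d)) ≡ fib cls (cls d) w
  orbit-sum w d = sum-filter (inOrbitᵇ f d) w id ∙ ∑-cong (λ e → cong (_* w e) (inOrbit-cls d e))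

  cycleLen-fib : ∀ d → pos (cycleLen f d) ≡ fib cls (cls d) (λ _ → 1ℤ)
  cycleLen-fib d = length-filter-∑ (inOrbitᵇ f d) ∙ ∑-cong (λ e → inOrbit-cls d e ∙ sym (ℤP.*-identityʳ _))

-- Each enlargement adds an element, so at most `n` of them occur. It serves for `P` given
-- inductively, such as reachability: the result is a Boolean set of elements known to satisfy `P`,
-- and its closure makes connectedness applicable to it.
saturate : ∀ {n} (P : Fin n → Set) (Closed : (Fin n → Bool) → Set) →
  (∀ X → (∀ x → X x ≡ true → P x) → (∃ λ x → X x ≡ false × P x) ⊎ Closed X) →
  Σ[ X ∈ (Fin n → Bool) ] (∀ x → X x ≡ true → P x) × Closed X
saturate {n} P Closed grow = go n (λ _ → false) (λ _ ()) (ℕP.m≤m+n n (count {n} (λ _ → false)))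
  where
  add : (Fin n → Bool) → Fin n → Fin n → Bool
  add X x y = does (x ≟ y) ∨ X y
  go : ∀ m X → (∀ x → X x ≡ true → P x) → n ℕ.≤ m ℕ.+ count X → Σ[ X ∈ (Fin n → Bool) ] (∀ x → X x ≡ true → P x) × Closed X
  go m X h b with grow X h
  ... | inj₂ c = X , h , c
  ... | inj₁ (x , xf , px) = step m b
    where
    Y = add X x
    hY : ∀ y → Y y ≡ true → P y
    hY y e with x ≟ y
    ... | yes refl = px
    ... | no _ = h y e
    cnt : pos (count Y) ≡ pos (suc (count X))
    cnt = count-∑ Y ∙ ∑-cong pt ∙ ∑-+ (λ y → ind x y * 1ℤ) (λ y → b2z (X y)) ∙ cong₂ _+_ (∑-ind x (λ _ → 1ℤ)) (sym (count-∑ X))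
      where pt : ∀ y → b2z (Y y) ≡ ind x y * 1ℤ + b2z (X y)
            pt y with x ≟ y | ind-≟ x y
            ... | yes refl | i = sym (cong₂ (λ u v → u * 1ℤ + b2z v) i xf) ∙ refl
            ... | no _ | i = sym (ℤP.+-identityˡ _) ∙ cong (λ u → u * 1ℤ + b2z (X y)) (sym i)
    full : ¬ (n ℕ.≤ count X)
    full le = ℕP.<-irrefl refl (ℕP.≤-<-trans le (subst (ℕ._≤ n) (ℤP.+-injective cnt) (FP.injective⇒≤ {f = el Y} (el-inj Y))))
    step : ∀ m → n ℕ.≤ m ℕ.+ count X → Σ[ X ∈ (Fin n → Bool) ] (∀ x → X x ≡ true → P x) × Closed X
    step zero b = ⊥-elim (full b)
    step (suc m) b = go m Y hY (subst (n ℕ.≤_) (sym (ℕP.+-suc m (count X)) ∙ cong (m ℕ.+_) (sym (ℤP.+-injective cnt))) b)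

-- Connected spherical maps with vertex, edge and face labels

∑-split : ∀ m {n} (g : Fin (m ℕ.+ n) → ℤ) → ∑ g ≡ ∑ (λ i → g (i F.↑ˡ n)) + ∑ (λ j → g (m F.↑ʳ j))
∑-split zero    g = sym (ℤP.+-identityˡ (∑ g)) ∙ cong (_+ ∑ g) (sym (∑-empty _))
∑-split (suc m) {n} g = ∑-unfold g ∙ cong (g zero +_) (∑-split m (g ∘ suc)) ∙
   sym (ℤP.+-assoc (g zero) (∑ (λ i → g (suc (i F.↑ˡ n)))) (∑ (λ j → g (suc (m F.↑ʳ j))))) ∙ cong (_+ ∑ (λ j → g (suc (m F.↑ʳ j)))) (sym (∑-unfold (λ i → g (i F.↑ˡ n))))

tree-circulation' : ∀ {A N} → N ≡ suc A → (s t : Fin A → Fin N) → Conn s t → (g : Fin A → ℤ) →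
  (∀ h → Div s t g h ≡ 0ℤ) → ∀ a → g a ≡ 0ℤ
tree-circulation' refl = tree-circulation

-- First hitting times of `d0`. They decrease along `f` away from `d0`, which supports induction
-- along a walk; the bound by `n` also allows induction the other way, from the farthest points
-- inwards.
rank : ∀ {n} (f : Fin n → Fin n) d0 → (∀ q → Orb f q d0) → Σ[ ℓ ∈ (Fin n → ℕ) ] (∀ q → q ≢ d0 → ℓ (f q) ℕ.< ℓ q) × (∀ q → ℓ q ℕ.< n)
rank {n} f d0 r = ℓ , dec , λ q → FP.toℕ<n (proj₁ (L q))
  where
  hit : Fin n → Fin n → Bool
  hit q k = does (iter f (toℕ k) q ≟ d0)
  L : ∀ q → ∃ λ k → hit q k ≡ true × (∀ j → hit q j ≡ true → toℕ k ℕ.≤ toℕ j)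
  L q with orb< f q d0 (r q)
  ... | k , k<n , e = least (hit q) (F.fromℕ< k<n) (true-does (iter f (toℕ (F.fromℕ< k<n)) q ≟ d0) (cong (λ m → iter f m q) (FP.toℕ-fromℕ< k<n) ∙ e))
  ℓ : Fin n → ℕ
  ℓ q = toℕ (proj₁ (L q))
  dec : ∀ q → q ≢ d0 → ℓ (f q) ℕ.< ℓ q
  dec q ne = go (ℓ q) refl
    where
    at : iter f (ℓ q) q ≡ d0
    at = does-true (iter f (ℓ q) q ≟ d0) (proj₁ (proj₂ (L q)))
    go : ∀ k → ℓ q ≡ k → ℓ (f q) ℕ.< ℓ q
    go zero e = ⊥-elim (ne (subst (λ m → iter f m q ≡ d0) e at))
    go (suc k) e = subst (ℓ (f q) ℕ.<_) (sym e) (s≤s (subst (ℓ (f q) ℕ.≤_) (FP.toℕ-fromℕ< k<n) (proj₂ (proj₂ (L (f q))) (F.fromℕ< k<n)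
          (true-does (iter f (toℕ (F.fromℕ< k<n)) (f q) ≟ d0) (cong (λ m → iter f m (f q)) (FP.toℕ-fromℕ< k<n) ∙
            sym (iter-suc f k q) ∙ subst (λ m → iter f m q ≡ d0) e at)))))
      where k<n : k ℕ.< n
            k<n = ℕP.<-trans (ℕP.n<1+n k) (subst (ℕ._< n) e (FP.toℕ<n (proj₁ (L q))))

b-cases : ∀ (b c : Bool) → (b ≡ c) ⊎ (b ≡ not c)
b-cases true true = inj₁ refl
b-cases true false = inj₂ refl
b-cases false true = inj₂ refl
b-cases false false = inj₁ refl

record Surface : Set where
  field
    n V E Fc : ℕ
    σ α σ⁻ : Fin n → Fin n
    σσ⁻ : ∀ d → σ (σ⁻ d) ≡ d
    σ⁻σ : ∀ d → σ⁻ (σ d) ≡ d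
    αα  : ∀ d → α (α d) ≡ d
    α≢  : ∀ d → α d ≢ d
    vert : Fin n → Fin V
    vrep : Fin V → Fin n
    vert-vrep : ∀ v → vert (vrep v) ≡ v
    vert-σ : ∀ d → vert (σ d) ≡ vert d
    vert-orb : ∀ {d e} → vert d ≡ vert e → Orb σ d e
    edge : Fin n → Fin E
    erep : Fin E → Fin n
    edge-erep : ∀ e → edge (erep e) ≡ e
    edge-α : ∀ d → edge (α d) ≡ edge d
    edge-eq : ∀ {d e} → edge d ≡ edge e → (d ≡ e) ⊎ (d ≡ α e)
    face : Fin n → Fin Fc
    frep : Fin Fc → Fin n
    face-frep : ∀ f → face (frep f) ≡ f
    face-φ : ∀ d → face (σ (α d)) ≡ face d
    face-orb : ∀ {d e} → face d ≡ face e → Orb (λ x → σ (α x)) d e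
    conn : ∀ (h : Fin n → Bool) → (∀ d → h (σ d) ≡ h d) → (∀ d → h (α d) ≡ h d) → ∀ d e → h d ≡ h e
    euler : V ℕ.+ Fc ≡ E ℕ.+ 2

  D : Set
  D = Fin n

  φ : D → D
  φ d = σ (α d)

  φ⁻ : D → D
  φ⁻ d = α (σ⁻ d)

  φφ⁻ : ∀ d → φ (φ⁻ d) ≡ d
  φφ⁻ d = cong σ (αα (σ⁻ d)) ∙ σσ⁻ d

  φ⁻φ : ∀ d → φ⁻ (φ d) ≡ d
  φ⁻φ d = cong α (σ⁻σ (α d)) ∙ αα d

  face-α : ∀ d → face (α d) ≡ face (σ d)
  face-α d = sym (face-φ (α d)) ∙ cong (λ x → face (σ x)) (αα d)

  σ-inj : Inj σ
  σ-inj {x} {y} p = sym (σ⁻σ x) ∙ cong σ⁻ p ∙ σ⁻σ y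

  φ-inj : Inj φ
  φ-inj {x} {y} p = sym (φ⁻φ x) ∙ cong φ⁻ p ∙ φ⁻φ y

  α-inj : Inj α
  α-inj {x} {y} p = sym (αα x) ∙ cong α p ∙ αα y

  ∑-σ : ∀ (g : D → ℤ) → ∑ (λ d → g (σ d)) ≡ ∑ g
  ∑-σ = ∑-bij σ σ⁻ σ⁻σ σσ⁻

  ∑-α : ∀ (g : D → ℤ) → ∑ (λ d → g (α d)) ≡ ∑ g
  ∑-α = ∑-bij α α αα αα

  ∑-φ : ∀ (g : D → ℤ) → ∑ (λ d → g (φ d)) ≡ ∑ g
  ∑-φ = ∑-bij φ φ⁻ φ⁻φ φφ⁻

  fib-edge : ∀ e (g : D → ℤ) → fib edge e g ≡ g (erep e) + g (α (erep e))
  fib-edge e g = ∑-cong pt ∙ ∑-+ (λ d → ind (erep e) d * g d) (λ d → ind (α (erep e)) d * g d) ∙ cong₂ _+_ (∑-ind (erep e) g) (∑-ind (α (erep e)) g)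
    where
    pt : ∀ d → ind (edge d) e * g d ≡ ind (erep e) d * g d + ind (α (erep e)) d * g d
    pt d = cong (_* g d) i ∙ ℤP.*-distribʳ-+ (g d) (ind (erep e) d) (ind (α (erep e)) d)
      where
      i : ind (edge d) e ≡ ind (erep e) d + ind (α (erep e)) d
      i with ind-case (edge d) e | ind-case (erep e) d | ind-case (α (erep e)) d
      ... | _ | inj₁ (p , _) | inj₁ (q , _) = ⊥-elim (α≢ (erep e) (q ∙ sym p))
      ... | inj₁ (_ , x) | inj₁ (p , y) | inj₂ (q , z) = x ∙ sym (cong₂ _+_ y z)
      ... | inj₁ (_ , x) | inj₂ (p , y) | inj₁ (q , z) = x ∙ sym (cong₂ _+_ y z)
      ... | inj₂ (_ , x) | inj₂ (p , y) | inj₂ (q , z) = x ∙ sym (cong₂ _+_ y z)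
      ... | inj₂ (w , x) | inj₁ (p , y) | _ = ⊥-elim (w (cong edge (sym p) ∙ edge-erep e))
      ... | inj₂ (w , x) | _ | inj₁ (q , z) = ⊥-elim (w (cong edge (sym q) ∙ edge-α (erep e) ∙ edge-erep e))
      ... | inj₁ (w , x) | inj₂ (p , y) | inj₂ (q , z) with edge-eq (w ∙ sym (edge-erep e))
      ...   | inj₁ r = ⊥-elim (p (sym r))
      ...   | inj₂ r = ⊥-elim (q (sym r))

  ∑-edge : ∀ (he : Fin E → ℤ) (g : D → ℤ) → ∑ (λ d → he (edge d) * g d) ≡ ∑ (λ e → he e * (g (erep e) + g (α (erep e))))
  ∑-edge he g = sym (∑-fib edge he g) ∙ ∑-cong (λ e → cong (he e *_) (fib-edge e g))

  n≡2E : pos n ≡ pos 2 * pos E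
  n≡2E = sym (∑-const n 1ℤ ∙ ℤP.*-identityʳ (pos n)) ∙ ∑-edge (λ _ → 1ℤ) (λ _ → 1ℤ) ∙ ∑-const E (pos 2) ∙ ℤP.*-comm (pos E) (pos 2)

  -- Since `n = 2E`, Euler's formula says that a spanning tree of the incidence graph consists of
  -- `n + 1` of its `2n` arcs.
  nodes-count : V ℕ.+ (E ℕ.+ Fc) ≡ suc (suc n)
  nodes-count = ℤP.+-injective (ℤP.pos-+ V (E ℕ.+ Fc) ∙ cong (pos V +_) (ℤP.pos-+ E Fc) ∙ l1 (pos V) (pos E) (pos Fc) ∙
     cong (_+ pos E) (sym (ℤP.pos-+ V Fc) ∙ cong pos euler ∙ ℤP.pos-+ E 2) ∙ l2 (pos E) ∙ cong (pos 2 +_) (sym n≡2E))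
    where l1 : ∀ a b c → a + (b + c) ≡ (a + c) + b
          l1 = solve-∀
          l2 : ∀ a → (a + pos 2) + a ≡ pos 2 + pos 2 * a
          l2 = solve-∀

  -- Functions on the arcs of the incidence graph of vertices, edges and faces: y q lives on
  -- edge–vertex incidences and z q on edge–face incidences.
  Wk : (y z : D → ℤ) (hv : Fin V → ℤ) (he : Fin E → ℤ) (hf : Fin Fc → ℤ) → ℤ
  Wk y z hv he hf = ∑ (λ q → y q * (hv (vert q) - he (edge q)) + z q * (he (edge q) - hf (face q)))

  Circ : (y z : D → ℤ) → Set
  Circ y z = ∀ hv he hf → Wk y z hv he hf ≡ 0ℤ

  ∂σ ∂φ : (D → ℤ) → D → ℤ
  ∂σ p q = p q - p (σ q)
  ∂φ p q = p q - p (φ q)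

  Wk-expand : ∀ y z hv he hf → Wk y z hv he hf ≡ ∑ (λ q → hv (vert q) * y q) + ∑ (λ q → he (edge q) * (z q - y q)) - ∑ (λ q → hf (face q) * z q)
  Wk-expand y z hv he hf = ∑-cong (λ q → lem (y q) (z q) (hv (vert q)) (he (edge q)) (hf (face q))) ∙
    ∑-- (λ q → hv (vert q) * y q + he (edge q) * (z q - y q)) (λ q → hf (face q) * z q) ∙
           cong (_- ∑ (λ q → hf (face q) * z q)) (∑-+ (λ q → hv (vert q) * y q) (λ q → he (edge q) * (z q - y q)))
    where lem : ∀ y z v e f → y * (v - e) + z * (e - f) ≡ v * y + e * (z - y) - f * z
          lem = solve-∀

  Wk-lin : ∀ y z y' z' c hv he hf → Wk (λ q → y q + c * y' q) (λ q → z q + c * z' q) hv he hf ≡ Wk y z hv he hf + c * Wk y' z' hv he hf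
  Wk-lin y z y' z' c hv he hf = ∑-cong (λ q → lem (y q) (z q) (y' q) (z' q) c (hv (vert q)) (he (edge q)) (hf (face q))) ∙
     ∑-+ (λ q → y q * (hv (vert q) - he (edge q)) + z q * (he (edge q) - hf (face q))) (λ q → c * (y' q * (hv (vert q) - he (edge q)) + z' q * (he (edge q) - hf (face q)))) ∙
       cong (Wk y z hv he hf +_) (∑-*ˡ c (λ q → y' q * (hv (vert q) - he (edge q)) + z' q * (he (edge q) - hf (face q))))
    where lem : ∀ y z y' z' c v e f → (y + c * y') * (v - e) + (z + c * z') * (e - f) ≡ (y * (v - e) + z * (e - f)) + c * (y' * (v - e) + z' * (e - f))
          lem = solve-∀

  -- Around a vertex `σ`, and around a face `φ`, only permutes the terms. At an edge the difference
  -- `∂φ p q - ∂σ p q` is `p (σ q) - p (φ q)`, and `φ q = σ (α q)` makes the two darts of the edge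
  -- cancel.
  ∂-circ : ∀ p → Circ (∂σ p) (∂φ p)
  ∂-circ p hv he hf = Wk-expand (∂σ p) (∂φ p) hv he hf ∙ cong₂ _-_ (cong₂ _+_ a b) c ∙ refl
    where
    a : ∑ (λ q → hv (vert q) * (p q - p (σ q))) ≡ 0ℤ
    a = ∑-cong (λ q → ℤP.*-distribˡ-+ (hv (vert q)) (p q) (- p (σ q)) ∙ cong (hv (vert q) * p q +_) (sym (ℤP.neg-distribʳ-* (hv (vert q)) (p (σ q))) ∙ cong (λ v → - (hv v * p (σ q))) (sym (vert-σ q)))) ∙
        ∑-- (λ q → hv (vert q) * p q) (λ q → hv (vert (σ q)) * p (σ q)) ∙ cong (_-_ (∑ (λ q → hv (vert q) * p q))) (∑-σ (λ q → hv (vert q) * p q)) ∙ ℤP.+-inverseʳ (∑ (λ q → hv (vert q) * p q))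
    c : ∑ (λ q → hf (face q) * (p q - p (φ q))) ≡ 0ℤ
    c = ∑-cong (λ q → ℤP.*-distribˡ-+ (hf (face q)) (p q) (- p (φ q)) ∙ cong (hf (face q) * p q +_) (sym (ℤP.neg-distribʳ-* (hf (face q)) (p (φ q))) ∙ cong (λ v → - (hf v * p (φ q))) (sym (face-φ q)))) ∙
        ∑-- (λ q → hf (face q) * p q) (λ q → hf (face (φ q)) * p (φ q)) ∙ cong (_-_ (∑ (λ q → hf (face q) * p q))) (∑-φ (λ q → hf (face q) * p q)) ∙ ℤP.+-inverseʳ (∑ (λ q → hf (face q) * p q))
    b : ∑ (λ q → he (edge q) * ((p q - p (φ q)) - (p q - p (σ q)))) ≡ 0ℤ
    b = ∑-cong (λ q → lem (he (edge q)) (p q) (p (φ q)) (p (σ q)) ∙ cong (λ w → he (edge q) * p (σ q) - he w * p (φ q)) (sym (edge-α q))) ∙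
        ∑-- (λ q → he (edge q) * p (σ q)) (λ q → he (edge (α q)) * p (σ (α q))) ∙ cong (_-_ (∑ (λ q → he (edge q) * p (σ q)))) (∑-α (λ q → he (edge q) * p (σ q))) ∙ ℤP.+-inverseʳ (∑ (λ q → he (edge q) * p (σ q)))
      where lem : ∀ h a b c → h * ((a - b) - (a - c)) ≡ h * c - h * b
            lem = solve-∀

  N : ℕ
  N = V ℕ.+ (E ℕ.+ Fc)

  nV : Fin V → Fin N
  nV v = v F.↑ˡ (E ℕ.+ Fc)
  nE : Fin E → Fin N
  nE e = V F.↑ʳ (e F.↑ˡ Fc)
  nF : Fin Fc → Fin N
  nF f = V F.↑ʳ (E F.↑ʳ f)

  node-elim : ∀ (P : Fin N → Set) → (∀ v → P (nV v)) → (∀ e → P (nE e)) → (∀ f → P (nF f)) → ∀ x → P x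
  node-elim P pv pe pf x with F.splitAt V x in eq
  ... | inj₁ v = subst P (FP.splitAt⁻¹-↑ˡ eq) (pv v)
  ... | inj₂ w with F.splitAt E w in eq'
  ...   | inj₁ e = subst P (cong (V F.↑ʳ_) (FP.splitAt⁻¹-↑ˡ eq') ∙ FP.splitAt⁻¹-↑ʳ eq) (pe e)
  ...   | inj₂ f = subst P (cong (V F.↑ʳ_) (FP.splitAt⁻¹-↑ʳ eq') ∙ FP.splitAt⁻¹-↑ʳ eq) (pf f)

  nodeF : ∀ {A : Set} → (Fin V → A) → (Fin E → A) → (Fin Fc → A) → Fin N → A
  nodeF hv he hf x = [ hv , (λ w → [ he , hf ]′ (F.splitAt E w)) ]′ (F.splitAt V x)

  nodeF-V : ∀ {A : Set} (hv : Fin V → A) (he : Fin E → A) (hf : Fin Fc → A) v → nodeF hv he hf (nV v) ≡ hv v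
  nodeF-V hv he hf v = cong [ hv , (λ w → [ he , hf ]′ (F.splitAt E w)) ]′ (FP.splitAt-↑ˡ V v (E ℕ.+ Fc))
  nodeF-E : ∀ {A : Set} (hv : Fin V → A) (he : Fin E → A) (hf : Fin Fc → A) e → nodeF hv he hf (nE e) ≡ he e
  nodeF-E hv he hf e = (cong [ hv , (λ w → [ he , hf ]′ (F.splitAt E w)) ]′ (FP.splitAt-↑ʳ V (E ℕ.+ Fc) (e F.↑ˡ Fc))) ∙ (cong [ he , hf ]′ (FP.splitAt-↑ˡ E e Fc))
  nodeF-F : ∀ {A : Set} (hv : Fin V → A) (he : Fin E → A) (hf : Fin Fc → A) f → nodeF hv he hf (nF f) ≡ hf f
  nodeF-F hv he hf f = (cong [ hv , (λ w → [ he , hf ]′ (F.splitAt E w)) ]′ (FP.splitAt-↑ʳ V (E ℕ.+ Fc) (E F.↑ʳ f))) ∙ (cong [ he , hf ]′ (FP.splitAt-↑ʳ E Fc f))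

  ∑-nodes : ∀ (g : Fin N → ℤ) → ∑ g ≡ ∑ (λ v → g (nV v)) + (∑ (λ e → g (nE e)) + ∑ (λ f → g (nF f)))
  ∑-nodes g = ∑-split V g ∙ cong (∑ (λ v → g (nV v)) +_) (∑-split E (λ w → g (V F.↑ʳ w)))

  -- The far end of the arc crossed when stepping from q by σ (true) or by φ (false).
  tgt : Bool → D → Fin N
  tgt true  q = nV (vert q)
  tgt false q = nF (face q)

  stp : Bool → D → D
  stp true  q = σ q
  stp false q = φ q

  nxt : (D → Bool) → D → D
  nxt π q = stp (π q) q

  module Quad {B : Set} (h : Fin N → B) where
    Side : D → Bool → Set
    Side q b = h (nE (edge q)) ≡ h (tgt b q)

    -- The two sides of the corner `q` at its other edge: `σ⁻ q` and `φ⁻ q` are the two darts of one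
    -- edge, and these sides are the ones crossed on entering `q` by `σ` or by `φ`.
    quad : ∀ q → Side (σ⁻ q) true → Side (φ⁻ q) false → h (nV (vert q)) ≡ h (nF (face q))
    quad q a b = begin
      h (nV (vert q))          ≡⟨ cong (h ∘ nV) (cong vert (sym (σσ⁻ q)) ∙ vert-σ (σ⁻ q)) ⟩
      h (nV (vert (σ⁻ q)))     ≡⟨ sym a ⟩
      h (nE (edge (σ⁻ q)))     ≡⟨ cong (h ∘ nE) (sym (edge-α (σ⁻ q))) ⟩
      h (nE (edge (φ⁻ q)))     ≡⟨ b ⟩
      h (nF (face (φ⁻ q)))     ≡⟨ cong (h ∘ nF) (sym (face-φ (φ⁻ q)) ∙ cong face (φφ⁻ q)) ⟩
      h (nF (face q)) ∎
      where open ≡-Reasoning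

    other : ∀ q b → h (nV (vert q)) ≡ h (nF (face q)) → Side q b → Side q (not b)
    other q true  e s = s ∙ e
    other q false e s = s ∙ sym e

  -- A policy whose walks all end at d0: the arcs that are not crossed, together with the
  -- arc crossed at d0, form a spanning tree of the incidence graph.
  module Policy (π : D → Bool) (d0 : D) (ℓ : D → ℕ) (ℓ-dec : ∀ q → q ≢ d0 → ℓ (nxt π q) ℕ.< ℓ q) (ℓ<n : ∀ q → ℓ q ℕ.< n) where

    aS aT : Fin (suc n) → Fin N
    aS zero    = nE (edge d0)
    aS (suc q) = nE (edge q)
    aT zero    = tgt (π d0) d0
    aT (suc q) = tgt (not (π q)) q

    -- Worked out from the corners of highest rank inwards. An entrance side of a corner is
    -- uncrossed, or is the extra arc, or is crossed from a corner of higher rank, so both entrances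
    -- are known; with the uncrossed exit side that makes three sides of the quadrilateral, and the
    -- fourth follows.
    tree-conn : Conn aS aT
    tree-conn h cut = λ x y → all x ∙ sym (all y)
      where
      open Quad h
      known : ∀ q b → (b ≡ π q → q ≢ d0 → Side q b) → Side q b
      known q b k with b-cases b (π q)
      ... | inj₂ refl = cut (suc q)
      ... | inj₁ refl with q ≟ d0
      ...   | yes refl = cut zero
      ...   | no ne = k refl ne
      -- The fuel `m` exceeds `n - ℓ q`: the induction climbs in rank.
      sides : ∀ m q → n ℕ.< ℓ q ℕ.+ m → ∀ b → Side q b
      sides zero q lt b = ⊥-elim (ℕP.<-asym (ℓ<n q) (subst (n ℕ.<_) (ℕP.+-identityʳ (ℓ q)) lt))
      sides (suc m) q lt b = known q b λ { refl ne → subst (Side q) (nn (π q)) (other q (not (π q)) (quad q sa sb) (cut (suc q))) }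
        where
        nn : ∀ b → not (not b) ≡ b
        nn true = refl
        nn false = refl
        up : ∀ q' → ℓ q ℕ.< ℓ q' → n ℕ.< ℓ q' ℕ.+ m
        up q' l = ℕP.<-≤-trans lt (subst (ℕ._≤ ℓ q' ℕ.+ m) (sym (ℕP.+-suc (ℓ q) m)) (ℕP.+-monoˡ-≤ m l))
        sa : Side (σ⁻ q) true
        sa = known (σ⁻ q) true λ e ne → sides m (σ⁻ q) (up (σ⁻ q) (subst (λ z → ℓ z ℕ.< ℓ (σ⁻ q)) (cong (λ b → stp b (σ⁻ q)) (sym e) ∙ σσ⁻ q) (ℓ-dec (σ⁻ q) ne))) true
        sb : Side (φ⁻ q) false
        sb = known (φ⁻ q) false λ e ne → sides m (φ⁻ q) (up (φ⁻ q) (subst (λ z → ℓ z ℕ.< ℓ (φ⁻ q)) (cong (λ b → stp b (φ⁻ q)) (sym e) ∙ φφ⁻ q) (ℓ-dec (φ⁻ q) ne))) false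
      side : ∀ q b → Side q b
      side q b = sides (suc n) q (ℕP.m≤n+m (suc n) (ℓ q)) b
      k : D → Bool
      k q = h (nE (edge q))
      kc : ∀ q → k q ≡ k d0
      kc q = conn k (λ d → side (σ d) true ∙ cong (h ∘ nV) (vert-σ d) ∙ sym (side d true)) (λ d → cong (h ∘ nE) (edge-α d)) q d0
      all : ∀ x → h x ≡ k d0
      all = node-elim (λ x → h x ≡ k d0)
        (λ v → cong (h ∘ nV) (sym (vert-vrep v)) ∙ sym (side (vrep v) true) ∙ kc (vrep v))
        (λ e → cong (h ∘ nE) (sym (edge-erep e)) ∙ kc (erep e))
        (λ f → cong (h ∘ nF) (sym (face-frep f)) ∙ sym (side (frep f) false) ∙ kc (frep f))

    opaque
      psum : (D → ℤ) → ℕ → D → ℤ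
      psum c zero q = 0ℤ
      psum c (suc k) q = if does (q ≟ d0) then 0ℤ else c q + psum c k (nxt π q)

      -- The walk from `q` stops after at most `ℓ q` steps, so more fuel changes nothing; `pot` is
      -- therefore the sum of `c` along the walk to `d0`.
      psum-stable : ∀ c k k' q → ℓ q ℕ.≤ k → ℓ q ℕ.≤ k' → psum c k q ≡ psum c k' q
      psum-stable c zero zero q a b = refl
      psum-stable c zero (suc k') q a b with q ≟ d0
      ... | yes _ = refl
      ... | no ne = ⊥-elim (ℕP.n≮0 (ℕP.<-≤-trans (ℓ-dec q ne) a))
      psum-stable c (suc k) zero q a b with q ≟ d0
      ... | yes _ = refl
      ... | no ne = ⊥-elim (ℕP.n≮0 (ℕP.<-≤-trans (ℓ-dec q ne) b))
      psum-stable c (suc k) (suc k') q a b with q ≟ d0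
      ... | yes _ = refl
      ... | no ne = cong (c q +_) (psum-stable c k k' (nxt π q) (ℕP.≤-pred (ℕP.<-≤-trans (ℓ-dec q ne) a)) (ℕP.≤-pred (ℕP.<-≤-trans (ℓ-dec q ne) b)))

      pot : (D → ℤ) → D → ℤ
      pot c = psum c (suc n)

      psum-bound : ∀ c M → 0ℤ ≤ M → (∀ q → c q ≤ M) → ∀ k q → psum c k q ≤ pos k * M
      psum-bound c M m0 cM zero q = ℤP.≤-refl
      psum-bound c M m0 cM (suc k) q with q ≟ d0
      ... | yes _ = 0≤* {pos (suc k)} (ℤ.+≤+ z≤n) m0
      ... | no _ = ℤP.≤-trans (ℤP.+-mono-≤ (cM q) (psum-bound c M m0 cM k (nxt π q))) (ℤP.≤-reflexive (sym (ℤP.suc-* (pos k) M)))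

      pot-bound : ∀ c M → 0ℤ ≤ M → (∀ q → c q ≤ M) → ∀ q → pot c q ≤ pos (suc n) * M
      pot-bound c M m0 cM q = psum-bound c M m0 cM (suc n) q

      pot-d0 : ∀ c → pot c d0 ≡ 0ℤ
      pot-d0 c with d0 ≟ d0
      ... | yes _ = refl
      ... | no ne = ⊥-elim (ne refl)

      pot-step : ∀ c q → q ≢ d0 → pot c q ≡ c q + pot c (nxt π q)
      pot-step c q ne with q ≟ d0
      ... | yes p = ⊥-elim (ne p)
      ... | no _ = cong (c q +_) (psum-stable c n (suc n) (nxt π q) (ℕP.<⇒≤ (ℓ<n (nxt π q))) (ℕP.<⇒≤ (ℕP.m<n⇒m<1+n (ℓ<n (nxt π q)))))

    -- The Poincaré lemma on the sphere. Integrating `(y , z)` along the walks gives `p`;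
    -- subtracting its coboundary kills the flow on every crossed arc except perhaps at `d0`, and
    -- what is left is a circulation on the spanning tree.
    circulation : ∀ y z → Circ y z → Σ[ p ∈ (D → ℤ) ] (∀ q → y q ≡ ∂σ p q) × (∀ q → z q ≡ ∂φ p q) × p d0 ≡ 0ℤ
    circulation y z cz = p , (λ q → sub0 (y q) (∂σ p q) (eσ q)) , (λ q → sub0 (z q) (∂φ p q) (eφ q)) , pot-d0 c
      where
      c : D → ℤ
      c q = if π q then y q else z q
      p = pot c
      ey ez : D → ℤ
      ey q = y q + -1ℤ * ∂σ p q
      ez q = z q + -1ℤ * ∂φ p q
      sub0 : ∀ a b → a + -1ℤ * b ≡ 0ℤ → a ≡ b
      sub0 a b e = lem a b ∙ cong (_+ b) e ∙ ℤP.+-identityˡ b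
        where lem : ∀ a b → a ≡ (a + -1ℤ * b) + b
              lem = solve-∀
      ecirc : Circ ey ez
      ecirc hv he hf = (Wk-lin y z (∂σ p) (∂φ p) -1ℤ hv he hf) ∙ cong₂ (λ a b → a + -1ℤ * b) (cz hv he hf) (∂-circ p hv he hf)
      -- Tree arcs leave the edge node, whereas `Wk` counts `y` from vertex to edge: hence the sign.
      ge : Bool → D → ℤ
      ge true  q = - ey q
      ge false q = ez q
      exit' : ∀ b q → π q ≡ b → q ≢ d0 → ge b q ≡ 0ℤ
      exit' true q e ne = cong (λ w → - (y q + -1ℤ * (w - p (σ q)))) (pot-step c q ne ∙ cong (λ b → (if b then y q else z q) + p (stp b q)) e) ∙ lem (y q) (p (σ q))
        where lem : ∀ a b → - (a + -1ℤ * ((a + b) - b)) ≡ 0ℤ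
              lem = solve-∀
      exit' false q e ne = cong (λ w → z q + -1ℤ * (w - p (φ q))) (pot-step c q ne ∙ cong (λ b → (if b then y q else z q) + p (stp b q)) e) ∙ lem (z q) (p (φ q))
        where lem : ∀ a b → a + -1ℤ * ((a + b) - b) ≡ 0ℤ
              lem = solve-∀
      exit0 : ∀ q → q ≢ d0 → ge (π q) q ≡ 0ℤ
      exit0 q ne = exit' (π q) q refl ne
      g : Fin (suc n) → ℤ
      g zero = ge (π d0) d0
      g (suc q) = ge (not (π q)) q
      term : (Fin N → ℤ) → Bool → D → ℤ
      term h b q = (h (nE (edge q)) - h (tgt b q)) * ge b q
      circ' : ∀ h → Div aS aT g h ≡ 0ℤ
      circ' h = begin
        Div aS aT g h ≡⟨ ∑-unfold (λ a → (h (aS a) - h (aT a)) * g a) ⟩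
        term h (π d0) d0 + ∑ (λ q → term h (not (π q)) q)
          ≡⟨ cong (_+ ∑ (λ q → term h (not (π q)) q)) (sym (∑-ind d0 (λ q → term h (π q) q)) ∙ ∑-cong only) ⟩
        ∑ (λ q → term h (π q) q) + ∑ (λ q → term h (not (π q)) q) ≡⟨ sym (∑-+ (λ q → term h (π q) q) (λ q → term h (not (π q)) q)) ⟩
        ∑ (λ q → term h (π q) q + term h (not (π q)) q) ≡⟨ ∑-cong both ⟩
        Wk ey ez (h ∘ nV) (h ∘ nE) (h ∘ nF) ≡⟨ ecirc (h ∘ nV) (h ∘ nE) (h ∘ nF) ⟩
        0ℤ ∎
        where
        open ≡-Reasoning
        only : ∀ q → ind d0 q * term h (π q) q ≡ term h (π q) q
        only q with ind-case d0 q
        ... | inj₁ (_ , e) = cong (_* term h (π q) q) e ∙ (ℤP.*-identityˡ _)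
        ... | inj₂ (ne , e) = cong (ind d0 q *_) t0 ∙ ℤP.*-zeroʳ (ind d0 q) ∙ sym t0
          where t0 : term h (π q) q ≡ 0ℤ
                t0 = cong ((h (nE (edge q)) - h (tgt (π q) q)) *_) (exit0 q (λ p → ne (sym p))) ∙ ℤP.*-zeroʳ (h (nE (edge q)) - h (tgt (π q) q))
        both : ∀ q → term h (π q) q + term h (not (π q)) q ≡ ey q * (h (nV (vert q)) - h (nE (edge q))) + ez q * (h (nE (edge q)) - h (nF (face q)))
        both q with π q
        ... | true = lem (h (nE (edge q))) (h (nV (vert q))) (ey q) (h (nF (face q))) (ez q)
          where lem : ∀ e v y f z → (e - v) * (- y) + (e - f) * z ≡ y * (v - e) + z * (e - f)
                lem = solve-∀
        ... | false = lem (h (nE (edge q))) (h (nV (vert q))) (ey q) (h (nF (face q))) (ez q)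
          where lem : ∀ e v y f z → (e - f) * z + (e - v) * (- y) ≡ y * (v - e) + z * (e - f)
                lem = solve-∀
      g0 : ∀ a → g a ≡ 0ℤ
      g0 = tree-circulation' nodes-count aS aT tree-conn g circ'
      ge0 : ∀ b q → ge b q ≡ 0ℤ
      ge0 b q = [ (λ e → cong (λ b → ge b q) e ∙ exit) , (λ e → cong (λ b → ge b q) e ∙ g0 (suc q)) ]′ (b-cases b (π q))
        where exit : ge (π q) q ≡ 0ℤ
              exit = case q ≟ d0 of λ { (yes e) → subst (λ x → ge (π x) x ≡ 0ℤ) (sym e) (g0 zero) ; (no ne) → exit0 q ne }
      eσ : ∀ q → ey q ≡ 0ℤ
      eσ q = sym (ℤP.neg-involutive (ey q)) ∙ (cong -_ (ge0 true q))
      eφ : ∀ q → ez q ≡ 0ℤ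
      eφ q = ge0 false q

-- Signed weights as a linear system, and their uniqueness.

pp nn : ℤ → ℤ
pp (pos n)   = pos n
pp -[1+ n ]  = 0ℤ
nn (pos n)   = 0ℤ
nn -[1+ n ]  = pos (suc n)

-- Zero sides with the negative weights: a dart of weight 0 is left by `σ` and becomes the black end
-- of a mobile edge.
np : ℤ → Bool
np (pos zero)    = true
np (pos (suc _)) = false
np -[1+ _ ]      = true

pp-nn : ∀ x → pp x - nn x ≡ x
pp-nn (pos n)  = ℤP.+-identityʳ (pos n)
pp-nn -[1+ n ] = refl

0≤pp : ∀ x → 0ℤ ≤ pp x
0≤pp (pos n)  = ℤ.+≤+ z≤n
0≤pp -[1+ n ] = ℤ.+≤+ z≤n

0≤nn : ∀ x → 0ℤ ≤ nn x
0≤nn (pos n)  = ℤ.+≤+ z≤n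
0≤nn -[1+ n ] = ℤ.+≤+ z≤n

np-true : ∀ x → np x ≡ true → pp x ≡ 0ℤ
np-true (pos zero) e = refl
np-true -[1+ n ]   e = refl

np-false : ∀ x → np x ≡ false → nn x ≡ 0ℤ
np-false (pos (suc n)) e = refl

np-false-pos : ∀ x → np x ≡ false → 1ℤ ≤ x
np-false-pos (pos (suc n)) e = ℤ.+≤+ (s≤s z≤n)

pos-np-false : ∀ x → 1ℤ ≤ x → np x ≡ false
pos-np-false (pos (suc n)) _ = refl
pos-np-false (pos zero) (ℤ.+≤+ ())

nonpos-np-true : ∀ x → x ≤ 0ℤ → np x ≡ true
nonpos-np-true (pos zero) _ = refl
nonpos-np-true (pos (suc n)) (ℤ.+≤+ ())
nonpos-np-true -[1+ n ] _ = refl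

np-true-nonpos : ∀ x → np x ≡ true → x ≤ 0ℤ
np-true-nonpos (pos zero) e = ℤP.≤-refl
np-true-nonpos -[1+ n ] e = ℤ.-≤+

pp-id : ∀ x → 0ℤ ≤ x → pp x ≡ x
pp-id (pos n) _ = refl

nn-neg : ∀ x → x ≤ 0ℤ → nn x ≡ - x
nn-neg (pos zero) _ = refl
nn-neg (pos (suc n)) (ℤ.+≤+ ())
nn-neg -[1+ n ] _ = refl

nn-zero : ∀ x → 0ℤ ≤ x → nn x ≡ 0ℤ
nn-zero (pos n) _ = refl

cancel2 : ∀ {a b} → pos 2 * a ≡ pos 2 * b → a ≡ b
cancel2 {a} {b} e = ℤP.*-cancelˡ-≡ (pos 2) a b e

module Weights (S : Surface) (b : ℕ) (fo : Fin (Surface.Fc S)) where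
  open Surface S

  B : ℤ
  B = pos b

  χ : (Fin V → ℤ) → (Fin E → ℤ) → (Fin Fc → ℤ) → ℤ
  χ hv he hf = ∑ hv + ∑ hf - ∑ he

  Kφ : (Fin E → ℤ) → (Fin Fc → ℤ) → ℤ
  Kφ he hf = ∑ (λ q → hf (face q) - he (edge q))

  -- On indicators of a region, `χ` is its Euler characteristic and `Kφ` counts the darts of its
  -- faces whose edges are missing from it. The term `4B` lowers the target of the outer face from
  -- `2B` to `-2B`, the value produced by `2B` darts of weight -1. The overall factor 2 avoids
  -- halving face degrees.
  rhs : (Fin V → ℤ) → (Fin E → ℤ) → (Fin Fc → ℤ) → ℤ
  rhs hv he hf = pos 2 * B * χ hv he hf - Kφ he hf - pos 4 * B * hf fo

  -- The conditions of `Sol` tested against arbitrary functions on the cells: affine in `(y , z)`,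
  -- insensitive to adding a coboundary, and directly applicable to indicators of regions.
  WS : (y z : D → ℤ) → Set
  WS y z = ∀ hv he hf → pos 2 * Wk y z hv he hf ≡ rhs hv he hf

  record Sol (y z : D → ℤ) : Set where
    field
      sv : ∀ v → fib vert v y ≡ B
      se : ∀ q → (y q - z q) + (y (α q) - z (α q)) ≡ B - 1ℤ
      sf : ∀ f → fib face f (λ q → 1ℤ - pos 2 * z q) ≡ pos 2 * B - pos 4 * B * ind fo f

  Kφ-split : ∀ he hf → Kφ he hf ≡ ∑ (λ q → hf (face q)) - pos 2 * ∑ he
  Kφ-split he hf = ∑-- (λ q → hf (face q)) (λ q → he (edge q)) ∙ cong (_-_ (∑ (λ q → hf (face q))))
     (∑-cong (λ q → sym (ℤP.*-identityʳ (he (edge q)))) ∙ ∑-edge he (λ _ → 1ℤ) ∙ ∑-*ʳ (pos 2) he ∙ ℤP.*-comm (∑ he) (pos 2))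

  Sol→WS : ∀ {y z} → Sol y z → WS y z
  Sol→WS {y} {z} s hv he hf = cong (pos 2 *_) (Wk-expand y z hv he hf) ∙ lem (∑ (λ q → hv (vert q) * y q)) (∑ (λ q → he (edge q) * (z q - y q))) (∑ (λ q → hf (face q) * z q)) ∙
     cong₂ _+_ (cong₂ (λ a c → pos 2 * a + pos 2 * c) av ae) af ∙ lem2 (∑ hv) (∑ he) (∑ hf) B (∑ (λ q → hf (face q))) (hf fo) ∙ cong (λ k → pos 2 * B * χ hv he hf - k - pos 4 * B * hf fo) (sym (Kφ-split he hf))
    where
    open Sol s
    lem : ∀ a c d → pos 2 * (a + c - d) ≡ (pos 2 * a + pos 2 * c) + - (pos 2 * d)
    lem = solve-∀
    lem2 : ∀ v e f b k o → (pos 2 * (v * b) + pos 2 * (e * - (b - 1ℤ))) + ((f * (pos 2 * b) - (pos 4 * b) * o) - k) ≡ pos 2 * b * (v + f - e) - (k - pos 2 * e) - pos 4 * b * o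
    lem2 = solve-∀
    av : ∑ (λ q → hv (vert q) * y q) ≡ ∑ hv * B
    av = sym (∑-fib vert hv y) ∙ ∑-cong (λ v → cong (hv v *_) (sv v)) ∙ ∑-*ʳ B hv
    ae : ∑ (λ q → he (edge q) * (z q - y q)) ≡ ∑ he * - (B - 1ℤ)
    ae = ∑-edge he (λ q → z q - y q) ∙ ∑-cong (λ e → cong (he e *_) (l (y (erep e)) (z (erep e)) (y (α (erep e))) (z (α (erep e))) ∙ (cong -_ (se (erep e))))) ∙ ∑-*ʳ (- (B - 1ℤ)) he
      where l : ∀ a c d e → (c - a) + (e - d) ≡ - ((a - c) + (d - e))
            l = solve-∀
    af : - (pos 2 * ∑ (λ q → hf (face q) * z q)) ≡ (∑ hf * (pos 2 * B) - (pos 4 * B) * hf fo) - ∑ (λ q → hf (face q))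
    af = lm (pos 2 * ∑ (λ q → hf (face q) * z q)) (∑ (λ q → hf (face q))) ∙ cong (_- ∑ (λ q → hf (face q))) (begin
       ∑ (λ q → hf (face q)) - pos 2 * ∑ (λ q → hf (face q) * z q) ≡⟨ cong (_-_ (∑ (λ q → hf (face q)))) (sym (∑-*ˡ (pos 2) (λ q → hf (face q) * z q))) ⟩
       ∑ (λ q → hf (face q)) - ∑ (λ q → pos 2 * (hf (face q) * z q)) ≡⟨ sym (∑-- (λ q → hf (face q)) (λ q → pos 2 * (hf (face q) * z q))) ⟩
       ∑ (λ q → hf (face q) - pos 2 * (hf (face q) * z q)) ≡⟨ ∑-cong (λ q → lq (hf (face q)) (z q)) ⟩
       ∑ (λ q → hf (face q) * (1ℤ - pos 2 * z q)) ≡⟨ sym (∑-fib face hf (λ q → 1ℤ - pos 2 * z q)) ⟩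
       ∑ (λ f → hf f * fib face f (λ q → 1ℤ - pos 2 * z q)) ≡⟨ ∑-cong (λ f → cong (hf f *_) (sf f)) ⟩
       ∑ (λ f → hf f * (pos 2 * B - pos 4 * B * ind fo f)) ≡⟨ ∑-cong (λ f → ld (hf f) B (ind fo f)) ⟩
       ∑ (λ f → hf f * (pos 2 * B) - pos 4 * B * (ind fo f * hf f)) ≡⟨ ∑-- (λ f → hf f * (pos 2 * B)) (λ f → pos 4 * B * (ind fo f * hf f)) ⟩
       ∑ (λ f → hf f * (pos 2 * B)) - ∑ (λ f → pos 4 * B * (ind fo f * hf f)) ≡⟨ cong₂ _-_ (∑-*ʳ (pos 2 * B) hf) (∑-*ˡ (pos 4 * B) (λ f → ind fo f * hf f) ∙ cong (pos 4 * B *_) (∑-ind fo hf)) ⟩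
       ∑ hf * (pos 2 * B) - (pos 4 * B) * hf fo ∎)
      where
      open ≡-Reasoning
      lm : ∀ a c → - a ≡ (c - a) - c
      lm = solve-∀
      lq : ∀ h z → h - pos 2 * (h * z) ≡ h * (1ℤ - pos 2 * z)
      lq = solve-∀
      ld : ∀ h b i → h * (pos 2 * b - pos 4 * b * i) ≡ h * (pos 2 * b) - pos 4 * b * (i * h)
      ld = solve-∀

  ∑0 : ∀ {m} → ∑ {m} (λ _ → 0ℤ) ≡ 0ℤ
  ∑0 = ∑-zero (λ _ → refl)

  WS→Sol : ∀ {y z} → WS y z → Sol y z
  WS→Sol {y} {z} w = record { sv = sv' ; se = se' ; sf = sf' }
    where
    zV : Fin V → ℤ
    zV _ = 0ℤ
    zE : Fin E → ℤ
    zE _ = 0ℤ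
    zF : Fin Fc → ℤ
    zF _ = 0ℤ
    sv' : ∀ v → fib vert v y ≡ B
    sv' v = cancel2 (cong (pos 2 *_) (∑-cong (λ q → cong (_* y q) (ind-sym (vert q) v) ∙ l1 (ind v (vert q)) (y q) (z q)) ∙ refl) ∙ w (ind v) zE zF ∙
        cong₂ (λ k s → pos 2 * B * s - k - pos 4 * B * 0ℤ) (∑-zero (λ q → refl)) (cong₂ _-_ (cong₂ _+_ s1 ∑0) ∑0) ∙ l2 B)
      where s1 : ∑ (ind v) ≡ 1ℤ
            s1 = ∑-cong (λ u → sym (ℤP.*-identityʳ (ind v u))) ∙ ∑-ind v (λ _ → 1ℤ)
            l1 : ∀ i y z → i * y ≡ y * (i - 0ℤ) + z * (0ℤ - 0ℤ)
            l1 = solve-∀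
            l2 : ∀ b → pos 2 * b * (1ℤ + 0ℤ - 0ℤ) - 0ℤ - pos 4 * b * 0ℤ ≡ pos 2 * b
            l2 = solve-∀
    se' : ∀ q → (y q - z q) + (y (α q) - z (α q)) ≡ B - 1ℤ
    se' q = eq q ∙ at (edge q)
      where
      g : D → ℤ
      g q = y q - z q
      eq : ∀ q → g q + g (α q) ≡ g (erep (edge q)) + g (α (erep (edge q)))
      eq q with edge-eq (sym (edge-erep (edge q)))
      ... | inj₁ p = cong (λ r → g r + g (α r)) p
      ... | inj₂ p = cong (λ r → g r + g (α r)) p ∙ cong (g (α (erep (edge q))) +_) (cong g (αα (erep (edge q)))) ∙ ℤP.+-comm (g (α (erep (edge q)))) (g (erep (edge q)))
      at : ∀ e → g (erep e) + g (α (erep e)) ≡ B - 1ℤ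
      at e = sym (ℤP.neg-involutive _) ∙ (cong -_ (cancel2 (cong (pos 2 *_) t1 ∙ w zV (ind e) zF ∙ t2))) ∙ ℤP.neg-involutive (B - 1ℤ)
        where
        s1 : ∑ (ind e) ≡ 1ℤ
        s1 = ∑-cong (λ u → sym (ℤP.*-identityʳ (ind e u))) ∙ ∑-ind e (λ _ → 1ℤ)
        t1 : - (g (erep e) + g (α (erep e))) ≡ Wk y z zV (ind e) zF
        t1 = (cong -_ (sym (fib-edge e g))) ∙ sym (∑-neg (λ d → ind (edge d) e * g d)) ∙ ∑-cong (λ d → cong (λ i → - (i * g d)) (ind-sym (edge d) e) ∙ l (ind e (edge d)) (y d) (z d))
          where l : ∀ i y z → - (i * (y - z)) ≡ y * (0ℤ - i) + z * (i - 0ℤ)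
                l = solve-∀
        t2 : rhs zV (ind e) zF ≡ pos 2 * - (B - 1ℤ)
        t2 = cong₂ (λ k s → pos 2 * B * s - k - pos 4 * B * 0ℤ) (Kφ-split (ind e) zF ∙ cong₂ (λ a c → a - pos 2 * c) ∑0 s1) (cong₂ _-_ (cong₂ _+_ ∑0 ∑0) s1) ∙ l B
          where l : ∀ b → pos 2 * b * (0ℤ + 0ℤ - 1ℤ) - (0ℤ - pos 2 * 1ℤ) - pos 4 * b * 0ℤ ≡ pos 2 * - (b - 1ℤ)
                l = solve-∀
    sf' : ∀ f → fib face f (λ q → 1ℤ - pos 2 * z q) ≡ pos 2 * B - pos 4 * B * ind fo f
    sf' f = t1 ∙ cong (λ a → ∑ (λ q → ind f (face q)) + a) (w zV zE (ind f)) ∙ cong₂ (λ k s → ∑ (λ q → ind f (face q)) + (pos 2 * B * s - k - pos 4 * B * ind f fo)) (Kφ-split zE (ind f) ∙ cong (λ c → ∑ (λ q → ind f (face q)) - pos 2 * c) ∑0) (cong₂ _-_ (cong₂ _+_ ∑0 s1) ∑0) ∙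
         l (∑ (λ q → ind f (face q))) B (ind f fo) ∙ cong (λ i → pos 2 * B - pos 4 * B * i) (ind-sym f fo)
      where
      s1 : ∑ (ind f) ≡ 1ℤ
      s1 = ∑-cong (λ u → sym (ℤP.*-identityʳ (ind f u))) ∙ ∑-ind f (λ _ → 1ℤ)
      t1 : fib face f (λ q → 1ℤ - pos 2 * z q) ≡ ∑ (λ q → ind f (face q)) + pos 2 * Wk y z zV zE (ind f)
      t1 = ∑-cong (λ q → cong (_* (1ℤ - pos 2 * z q)) (ind-sym (face q) f) ∙ lq (ind f (face q)) (y q) (z q)) ∙ ∑-+ (λ q → ind f (face q)) (λ q → pos 2 * (y q * (0ℤ - 0ℤ) + z q * (0ℤ - ind f (face q)))) ∙ cong (∑ (λ q → ind f (face q)) +_) (∑-*ˡ (pos 2) (λ q → y q * (0ℤ - 0ℤ) + z q * (0ℤ - ind f (face q))))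
        where lq : ∀ i y z → i * (1ℤ - pos 2 * z) ≡ i + pos 2 * (y * (0ℤ - 0ℤ) + z * (0ℤ - i))
              lq = solve-∀
      l : ∀ k b i → k + (pos 2 * b * (0ℤ + 1ℤ - 0ℤ) - (k - pos 2 * 0ℤ) - pos 4 * b * i) ≡ pos 2 * b - pos 4 * b * i
      l = solve-∀

  WS-diff : ∀ {y z y' z'} → WS y z → WS y' z' → Circ (λ q → y' q + -1ℤ * y q) (λ q → z' q + -1ℤ * z q)
  WS-diff {y} {z} {y'} {z'} w w' hv he hf = cancel2 (cong (pos 2 *_) (Wk-lin y' z' y z -1ℤ hv he hf) ∙
     l (Wk y' z' hv he hf) (Wk y z hv he hf) ∙ cong₂ _-_ (w' hv he hf) (w hv he hf) ∙ ℤP.+-inverseʳ (rhs hv he hf))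
    where l : ∀ a c → pos 2 * (a + -1ℤ * c) ≡ pos 2 * a - pos 2 * c
          l = solve-∀

  record Orient (x : D → ℤ) : Set where
    field
      r0 : D
      r0-outer : face r0 ≡ fo
      o1 : ∀ q → x q + x (α q) ≡ B - 1ℤ
      o2 : ∀ v → fib vert v (pp ∘ x) ≡ B
      o3 : ∀ f → f ≢ fo → fib face f (λ q → 1ℤ - pos 2 * nn (x q)) ≡ pos 2 * B
      o4 : ∀ r → face r ≡ fo → x r ≡ -1ℤ
      outer-deg : fib face fo (λ _ → 1ℤ) ≡ pos 2 * B
      good : ∀ q → Orb (nxt (np ∘ x)) q (α r0)

    sol : Sol (pp ∘ x) (nn ∘ x)
    sol = record { sv = o2 ; se = λ q → cong₂ _+_ (pp-nn (x q)) (pp-nn (x (α q))) ∙ o1 q ; sf = sf' }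
      where
      sf' : ∀ f → fib face f (λ q → 1ℤ - pos 2 * nn (x q)) ≡ pos 2 * B - pos 4 * B * ind fo f
      sf' f with ind-case fo f
      ... | inj₂ (ne , e) = o3 f (λ p → ne (sym p)) ∙ l B ∙ cong (λ i → pos 2 * B - pos 4 * B * i) (sym e)
        where l : ∀ b → pos 2 * b ≡ pos 2 * b - pos 4 * b * 0ℤ
              l = solve-∀
      ... | inj₁ (refl , e) = ∑-cong (λ q → ind-*-cong (face q) fo (λ p → cong (λ w → 1ℤ - pos 2 * nn w) (o4 q p)) ∙ l1 (ind (face q) fo)) ∙ ∑-neg (λ q → ind (face q) fo * 1ℤ) ∙
           (cong -_ outer-deg) ∙ l B ∙ cong (λ i → pos 2 * B - pos 4 * B * i) (sym e)
        where l1 : ∀ i → i * (1ℤ - pos 2 * 1ℤ) ≡ - (i * 1ℤ)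
              l1 = solve-∀
              l : ∀ b → - (pos 2 * b) ≡ pos 2 * b - pos 4 * b * 1ℤ
              l = solve-∀

    xα : ∀ r → face r ≡ fo → x (α r) ≡ B
    xα r e = l (x r) (x (α r)) B (o1 r) ∙ cong (λ w → (B - 1ℤ) - w) (o4 r e) ∙ l2 B
      where l : ∀ a c b → a + c ≡ b - 1ℤ → c ≡ (b - 1ℤ) - a
            l a c b e = l' a c ∙ cong (_- a) e
              where l' : ∀ a c → c ≡ (a + c) - a
                    l' = solve-∀
            l2 : ∀ b → (b - 1ℤ) - -1ℤ ≡ b
            l2 = solve-∀

    -- An outer vertex receives its whole weight from its unique outgoing outer edge.
    outer-vertex : ∀ r q → face r ≡ fo → vert q ≡ vert (α r) → q ≢ α r → pp (x q) ≡ 0ℤ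
    outer-vertex r q fr e ne = ℤP.≤-antisym (≤-by (B - (B + pp (x q))) (0≤- le) (lc (pp (x q)) B)) (0≤pp (x q))
      where
      lc : ∀ a b → 0ℤ - a ≡ b - (b + a)
      lc = solve-∀
      g : D → ℤ
      g d = ind (vert d) (vert (α r)) * pp (x d)
      g1 : ∀ d → vert d ≡ vert (α r) → g d ≡ pp (x d)
      g1 d e = cong (λ v → ind v (vert (α r)) * pp (x d)) e ∙ cong (_* pp (x d)) (ind-refl (vert (α r))) ∙ ℤP.*-identityˡ (pp (x d))
      le : B + pp (x q) ≤ B
      le = subst (_≤ B) (cong₂ _+_ (g1 (α r) refl ∙ cong pp (xα r fr) ∙ refl) (g1 q e))
             (ℤP.≤-trans (∑-term₂ g (λ d → 0≤* (0≤ind (vert d) (vert (α r))) (0≤pp (x d))) (α r) q (λ p → ne (sym p))) (ℤP.≤-reflexive (o2 (vert (α r)))))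

  module Unique (b≥1 : 1 ℕ.≤ b) (x x' : D → ℤ) (O : Orient x) (O' : Orient x') where
    module O = Orient O
    module O' = Orient O'
    d0 = α O.r0
    d1 = α O'.r0

    private
      rk = rank (nxt (np ∘ x)) d0 O.good
      open Policy (np ∘ x) d0 (proj₁ rk) (proj₁ (proj₂ rk)) (proj₂ (proj₂ rk))
      cr = circulation (λ q → pp (x' q) + -1ℤ * pp (x q)) (λ q → nn (x' q) + -1ℤ * nn (x q)) (WS-diff {pp ∘ x} {nn ∘ x} {pp ∘ x'} {nn ∘ x'} (Sol→WS O.sol) (Sol→WS O'.sol))
      p = proj₁ cr
      eσ : ∀ q → pp (x' q) + -1ℤ * pp (x q) ≡ p q - p (σ q)
      eσ = proj₁ (proj₂ cr)
      eφ : ∀ q → nn (x' q) + -1ℤ * nn (x q) ≡ p q - p (φ q)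
      eφ = proj₁ (proj₂ (proj₂ cr))
      pd0 : p d0 ≡ 0ℤ
      pd0 = proj₂ (proj₂ (proj₂ cr))

      -- A step of the walk of `x` crosses a side on which the corresponding part of `x` vanishes,
      -- so the difference of the weights there is a part of `x'` alone, which has a sign; `up'`
      -- exchanges the roles.
      down' : ∀ q b → np (x q) ≡ b → p (stp b q) ≤ p q
      down' q true e = ≤-by (pp (x' q)) (0≤pp (x' q)) (sym (eσ q) ∙ cong (λ w → pp (x' q) + -1ℤ * w) (np-true (x q) e) ∙ ℤP.+-identityʳ (pp (x' q)))
      down' q false e = ≤-by (nn (x' q)) (0≤nn (x' q)) (sym (eφ q) ∙ cong (λ w → nn (x' q) + -1ℤ * w) (np-false (x q) e) ∙ ℤP.+-identityʳ (nn (x' q)))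
      up' : ∀ q b → np (x' q) ≡ b → p q ≤ p (stp b q)
      up' q true e = ≤-by (pp (x q)) (0≤pp (x q)) (l (p q) (p (σ q)) ∙ (cong -_ (sym (eσ q))) ∙ cong (λ w → - (w + -1ℤ * pp (x q))) (np-true (x' q) e) ∙ l2 (pp (x q)))
        where l : ∀ a b → b - a ≡ - (a - b)
              l = solve-∀
              l2 : ∀ a → - (0ℤ + -1ℤ * a) ≡ a
              l2 = solve-∀
      up' q false e = ≤-by (nn (x q)) (0≤nn (x q)) (l (p q) (p (φ q)) ∙ (cong -_ (sym (eφ q))) ∙ cong (λ w → - (w + -1ℤ * nn (x q))) (np-false (x' q) e) ∙ l2 (nn (x q)))
        where l : ∀ a b → b - a ≡ - (a - b)
              l = solve-∀
              l2 : ∀ a → - (0ℤ + -1ℤ * a) ≡ a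
              l2 = solve-∀

      along : ∀ (f : D → D) (R : ℤ → ℤ → Set) → (∀ {a} → R a a) → (∀ {a b c} → R a b → R b c → R a c) → (∀ q → R (p q) (p (f q))) → ∀ k q → R (p q) (p (iter f k q))
      along f R rf tr st zero q = rf
      along f R rf tr st (suc k) q = tr (along f R rf tr st k q) (st (iter f k q))

      lower : ∀ q → 0ℤ ≤ p q
      lower q = let (k , e) = O.good q in subst (_≤ p q) (cong p e ∙ pd0) (along (nxt (np ∘ x)) (λ a b → b ≤ a) ℤP.≤-refl (λ u v → ℤP.≤-trans v u) (λ q → down' q (np (x q)) refl) k q)

      upper : ∀ q → p q ≤ p d1
      upper q = let (k , e) = O'.good q in subst (λ w → p q ≤ p w) e (along (nxt (np ∘ x')) _≤_ ℤP.≤-refl ℤP.≤-trans (λ q → up' q (np (x' q)) refl) k q)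

      1≤B : 1ℤ ≤ B
      1≤B = ℤ.+≤+ b≥1

      -- At an outer vertex both weights have the same positive parts, `B` at the opposite of the
      -- outer dart and 0 elsewhere.
      flat : ∀ r q → face r ≡ fo → vert q ≡ vert (α r) → p q ≡ p (σ q)
      flat r q fr e = l (p q) (p (σ q)) ∙ cong (_+ p (σ q)) (sym (eσ q) ∙ same (q ≟ α r)) ∙ ℤP.+-identityˡ (p (σ q))
        where l : ∀ a b → a ≡ (a - b) + b
              l = solve-∀
              same : Dec (q ≡ α r) → pp (x' q) + -1ℤ * pp (x q) ≡ 0ℤ
              same (yes refl) = cong₂ (λ u v → pp u + -1ℤ * pp v) (O'.xα r fr) (O.xα r fr) ∙ l' B
                where l' : ∀ a → a + -1ℤ * a ≡ 0ℤ
                      l' = solve-∀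
              same (no ne) = cong₂ (λ u v → u + -1ℤ * v) (O'.outer-vertex r q fr e ne) (O.outer-vertex r q fr e ne)

      flatφ : ∀ r → face r ≡ fo → p (α r) ≡ p (σ r)
      flatφ r fr = l (p (α r)) (p (σ r)) ∙ cong (λ w → (p (α r) - p w) + p (σ r)) (cong σ (sym (αα r))) ∙ cong (_+ p (σ r)) (sym (eφ (α r)) ∙ zz) ∙ ℤP.+-identityˡ (p (σ r))
        where l : ∀ a b → a ≡ (a - b) + b
              l = solve-∀
              zz : nn (x' (α r)) + -1ℤ * nn (x (α r)) ≡ 0ℤ
              zz = cong₂ (λ u v → nn u + -1ℤ * nn v) (O'.xα r fr) (O.xα r fr)

      -- The two walks may end at the opposites of different outer darts. Sliding along the outer
      -- face shows that `p` has one value at all of them, which closes the gap between `lower` and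
      -- `upper`.
      walk : ∀ r → face r ≡ fo → p (α r) ≡ p (α (φ r))
      walk r fr = flat r (α r) fr refl ∙ flat r (φ r) fr (vert-σ (α r)) ∙ sym (flatφ (φ r) (face-φ r ∙ fr))

      walks : ∀ k r → face r ≡ fo → p (α r) ≡ p (α (iter φ k r))
      walks zero r fr = refl
      walks (suc k) r fr = walk r fr ∙ walks k (φ r) (face-φ r ∙ fr) ∙ cong (λ w → p (α w)) (sym (iter-suc φ k r))

      p≡0 : ∀ q → p q ≡ 0ℤ
      p≡0 q = let (k , e) = face-orb (O.r0-outer ∙ sym O'.r0-outer) in ℤP.≤-antisym (subst (p q ≤_) (sym (walks k O.r0 O.r0-outer ∙ cong (λ w → p (α w)) e) ∙ pd0) (upper q)) (lower q)

      flat0 : ∀ a b u → a + -1ℤ * b ≡ p u - p (σ u) → a ≡ b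
      flat0 a b u e = l a b ∙ cong (_+ b) (e ∙ cong₂ _-_ (p≡0 u) (p≡0 (σ u))) ∙ ℤP.+-identityˡ b
        where l : ∀ a b → a ≡ (a + -1ℤ * b) + b
              l = solve-∀

    x-unique : ∀ q → x' q ≡ x q
    x-unique q = sym (pp-nn (x' q)) ∙ cong₂ _-_ (flat0 (pp (x' q)) (pp (x q)) q (eσ q))
       (flat0 (nn (x' q)) (nn (x q)) (α q) (eφ q ∙ cong (_- p (φ q)) (p≡0 q ∙ sym (p≡0 (α q))))) ∙ pp-nn (x q)

-- Simple cycles, and the boundary of a set of faces.

toℕ-mod : ∀ a m → toℕ (a mod suc m) ≡ a ℕ.% suc m
toℕ-mod a m = FP.toℕ-fromℕ< _

module Cycles (S : Surface) where
  open Surface S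

  record Cycle (m : ℕ) : Set where
    field
      ds : Fin (suc m) → D
      closed : ∀ j → vert (α (ds j)) ≡ vert (ds (suc (toℕ j) mod suc m))
      simple : ∀ i j → i ≢ j → vert (ds i) ≢ vert (ds j)
      edges : ∀ i j → i ≢ j → (ds i ≢ ds j) × (ds i ≢ α (ds j))

  -- Following successors inside C until a vertex repeats.
  extract : (C : D → Bool) (q0 : D) → C q0 ≡ true → (∀ q → C q ≡ true → C (α q) ≡ false) →
    (∀ q → C q ≡ true → ∃ λ q' → C q' ≡ true × vert q' ≡ vert (α q)) → ∃ λ m → Cycle m × suc m ℕ.≤ count C
  extract C q0 c0 anti succ = go (suc V) 0 (λ a a' _ ()) (subst (suc V ℕ.≤_) (sym (ℕP.+-identityʳ (suc V))) ℕP.≤-refl)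
    where
    sq : ℕ → Σ[ q ∈ D ] C q ≡ true
    sq zero = q0 , c0
    sq (suc k) = let (q , c) = sq k ; (q' , c' , _) = succ q c in q' , c'
    s : ℕ → D
    s k = proj₁ (sq k)
    s-next : ∀ k → vert (s (suc k)) ≡ vert (α (s k))
    s-next k = proj₂ (proj₂ (succ (proj₁ (sq k)) (proj₂ (sq k))))
    Dist : ℕ → Set
    Dist j = ∀ a a' → a ℕ.< a' → a' ℕ.< j → vert (s a) ≢ vert (s a')
    build : ∀ i m → Dist (suc (m ℕ.+ i)) → vert (s i) ≡ vert (s (suc (m ℕ.+ i))) → Cycle m × suc m ℕ.≤ count C
    build i m dist rep = record { ds = ds ; closed = cl ; simple = si ; edges = ed } , FP.injective⇒≤ {f = λ a → ix C (ds a) (proj₂ (sq (toℕ a ℕ.+ i)))}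
          (λ {a} {a'} e → inj-ds (sym (el-ix C (ds a) _) ∙ cong (el C) e ∙ (el-ix C (ds a') _)))
      where
      ds : Fin (suc m) → D
      ds a = s (toℕ a ℕ.+ i)
      lt : ∀ (a : Fin (suc m)) → toℕ a ℕ.+ i ℕ.< suc (m ℕ.+ i)
      lt a = s≤s (ℕP.+-monoˡ-≤ i (ℕP.≤-pred (FP.toℕ<n a)))
      si : ∀ a a' → a ≢ a' → vert (ds a) ≢ vert (ds a')
      si a a' ne e with ℕP.<-cmp (toℕ a) (toℕ a')
      ... | tri< l _ _ = dist _ _ (ℕP.+-monoˡ-< i l) (lt a') e
      ... | tri≈ _ q _ = ne (FP.toℕ-injective q)
      ... | tri> _ _ l = dist _ _ (ℕP.+-monoˡ-< i l) (lt a) (sym e)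
      inj-ds : ∀ {a a'} → ds a ≡ ds a' → a ≡ a'
      inj-ds {a} {a'} e with a ≟ a'
      ... | yes p = p
      ... | no ne = ⊥-elim (si a a' ne (cong vert e))
      ed : ∀ a a' → a ≢ a' → (ds a ≢ ds a') × (ds a ≢ α (ds a'))
      ed a a' ne = (λ e → si a a' ne (cong vert e)) , λ e → true≢false (sym (proj₂ (sq (toℕ a ℕ.+ i))) ∙ cong C e ∙ anti (ds a') (proj₂ (sq (toℕ a' ℕ.+ i))))
      cl : ∀ j → vert (α (ds j)) ≡ vert (ds (suc (toℕ j) mod suc m))
      cl j with suc (toℕ j) ℕP.<? suc m
      ... | yes l = sym (s-next (toℕ j ℕ.+ i)) ∙ cong (λ k → vert (s (k ℕ.+ i))) (sym (toℕ-mod (suc (toℕ j)) m ∙ m<n⇒m%n≡m l))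
      ... | no g = sym (s-next (toℕ j ℕ.+ i)) ∙ cong (λ k → vert (s (suc (k ℕ.+ i)))) jm ∙ sym rep ∙ cong (λ k → vert (s (k ℕ.+ i))) (sym (toℕ-mod (suc (toℕ j)) m ∙ cong (λ k → suc k ℕ.% suc m) jm ∙ n%n≡0 (suc m)))
        where jm : toℕ j ≡ m
              jm = ℕP.≤-antisym (ℕP.≤-pred (FP.toℕ<n j)) (ℕP.≤-pred (ℕP.≮⇒≥ g))
    find : ∀ j → Dec (∃ λ i → i ℕ.< j × vert (s i) ≡ vert (s j))
    find j with FP.any? {j} (λ i → vert (s (toℕ i)) ≟ vert (s j))
    ... | yes (i , e) = yes (toℕ i , FP.toℕ<n i , e)
    ... | no ¬p = no λ { (i , l , e) → ¬p (F.fromℕ< l , cong (λ k → vert (s k)) (FP.toℕ-fromℕ< l) ∙ e) }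
    go : ∀ fuel j → Dist j → suc V ℕ.≤ fuel ℕ.+ j → ∃ λ m → Cycle m × suc m ℕ.≤ count C
    go fuel j dist le with find j
    ... | yes (i , i<j , e) = j ℕ.∸ suc i , build i (j ℕ.∸ suc i) (subst Dist jj dist) (e ∙ cong (λ k → vert (s k)) jj)
      where jj : j ≡ suc (j ℕ.∸ suc i ℕ.+ i)
            jj = sym (ℕP.m∸n+n≡m i<j) ∙ ℕP.+-suc (j ℕ.∸ suc i) i
    ... | no none = next fuel le
      where
      dist' : Dist (suc j)
      dist' a a' a<a' l e with ℕP.m≤n⇒m<n∨m≡n (ℕP.≤-pred l)
      ... | inj₁ l' = dist a a' a<a' l' e
      ... | inj₂ refl = none (a , a<a' , e)
      next : ∀ fuel → suc V ℕ.≤ fuel ℕ.+ j → ∃ λ m → Cycle m × suc m ℕ.≤ count C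
      next (suc fuel) le = go fuel (suc j) dist' (subst (suc V ℕ.≤_) (sym (ℕP.+-suc fuel j)) le)
      next zero le with FP.pigeonhole {V} {suc V} ℕP.≤-refl (λ a → vert (s (toℕ a)))
      ... | a , a' , l , e = ⊥-elim (dist (toℕ a) (toℕ a') l (ℕP.<-≤-trans (FP.toℕ<n a') le) e)

  bdry : (Fin Fc → Bool) → D → Bool
  bdry hf q = hf (face q) ∧ not (hf (face (α q)))

  ∧-true : ∀ {x y} → x ∧ y ≡ true → x ≡ true × y ≡ true
  ∧-true {true} {true} e = refl , refl

  not-true : ∀ {x} → not x ≡ true → x ≡ false
  not-true {false} e = refl

  bdry-intro : ∀ hf q → hf (face q) ≡ true → hf (face (α q)) ≡ false → bdry hf q ≡ true
  bdry-intro hf q a c = cong₂ _∧_ a (cong not c) ∙ refl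

  bdry-elim : ∀ hf q → bdry hf q ≡ true → hf (face q) ≡ true × hf (face (α q)) ≡ false
  bdry-elim hf q e = proj₁ (∧-true {hf (face q)} e) , not-true (proj₂ (∧-true {hf (face q)} e))

  -- Rotation around the head of a boundary dart starts inside the set and ends at the outer side of
  -- that dart, so it leaves the set at a further boundary dart: boundary darts have successors and
  -- `extract` applies. Without boundary darts the set would be invariant, against connectedness.
  boundary-cycle : (hf : Fin Fc → Bool) → ∀ f g → hf f ≡ true → hf g ≡ false → ∃ λ m → Cycle m × suc m ℕ.≤ count (bdry hf)
  boundary-cycle hf f g hf1 hg0 = start (FP.any? (λ q → bdry hf q Data.Bool.≟ true))
    where
    k : D → Bool
    k q = hf (face q)
    anti : ∀ q → bdry hf q ≡ true → bdry hf (α q) ≡ false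
    anti q e = cong (_∧ not (hf (face (α (α q))))) (not-true (proj₂ (∧-true e)))
    drop : ∀ m y → k y ≡ true → k (iter σ m y) ≡ false → ∃ λ i → bdry hf (iter σ i y) ≡ true
    drop zero y a c = ⊥-elim (true≢false (sym a ∙ c))
    drop (suc m) y a c with k (iter σ m y) in e
    ... | true = m , bdry-intro hf (iter σ m y) e (cong hf (face-α (iter σ m y)) ∙ c)
    ... | false = drop m y a e
    succ : ∀ q → bdry hf q ≡ true → ∃ λ q' → bdry hf q' ≡ true × vert q' ≡ vert (α q)
    succ q e with Orb-sym σ-inj (Orb-step {f = σ} {α q})
    ... | m , r = let (i , w) = drop m (σ (α q)) (cong hf (face-φ q) ∙ proj₁ (∧-true e)) (cong k r ∙ not-true (proj₂ (∧-true e))) in iter σ i (σ (α q)) , w , iter-inv vert vert-σ i (σ (α q)) ∙ vert-σ (α q)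
    start : Dec (∃ λ q → bdry hf q ≡ true) → ∃ λ m → Cycle m × suc m ℕ.≤ count (bdry hf)
    start (yes (q , e)) = extract (bdry hf) q e anti succ
    start (no none) = ⊥-elim (true≢false (sym hf1 ∙ sym (cong hf (face-frep f)) ∙ conn k kσ kα (frep f) (frep g) ∙ cong hf (face-frep g) ∙ hg0))
      where
      fw : ∀ q → k q ≡ true → k (σ q) ≡ true
      fw q e with k (σ q) in w
      ... | true = refl
      ... | false = ⊥-elim (none (q , bdry-intro hf q e (cong hf (face-α q) ∙ w)))
      fws : ∀ m q → k q ≡ true → k (iter σ m q) ≡ true
      fws zero q e = e
      fws (suc m) q e = fw (iter σ m q) (fws m q e)
      kσ : ∀ q → k (σ q) ≡ k q
      kσ q = bool-ext (λ e → let (m , r) = Orb-sym σ-inj (Orb-step {f = σ} {q}) in cong k (sym r) ∙ fws m (σ q) e) (fw q)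
      kα : ∀ q → k (α q) ≡ k q
      kα q = cong hf (face-α q) ∙ kσ q

-- Cycles created by changing one step of a policy

b2z-case : ∀ x → (x ≡ true × b2z x ≡ 1ℤ) ⊎ (x ≡ false × b2z x ≡ 0ℤ)
b2z-case true = inj₁ (refl , refl)
b2z-case false = inj₂ (refl , refl)

∑-update : ∀ {n} (d : Fin n) (g : Fin n → ℤ) c → ∑ (λ q → if does (q ≟ d) then c else g q) ≡ ∑ g + (c - g d)
∑-update d g c = ∑-cong pt ∙ ∑-+ g (λ q → ind d q * (c - g q)) ∙ cong (∑ g +_) (∑-ind d (λ q → c - g q))
  where pt : ∀ q → (if does (q ≟ d) then c else g q) ≡ g q + ind d q * (c - g q)
        pt q with q ≟ d | ind-case d q
        ... | yes p | inj₁ (_ , e) = l c (g q) ∙ cong (λ i → g q + i * (c - g q)) (sym e)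
          where l : ∀ c g → c ≡ g + 1ℤ * (c - g)
                l = solve-∀
        ... | yes p | inj₂ (ne , _) = ⊥-elim (ne (sym p))
        ... | no ne | inj₁ (p , _) = ⊥-elim (ne (sym p))
        ... | no _ | inj₂ (_ , e) = l c (g q) ∙ cong (λ i → g q + i * (c - g q)) (sym e)
          where l : ∀ c g → g ≡ g + 0ℤ * (c - g)
                l = solve-∀

data Path {n} (f : Fin n → Fin n) (d0 d : Fin n) : Fin n → Set where
  here : Path f d0 d d
  step : ∀ {q} → q ≢ d0 → Path f d0 d (f q) → Path f d0 d q

module CycleCost (S : Surface) (b : ℕ) (b≥1 : 1 ℕ.≤ b) (fo : Fin (Surface.Fc S)) (r0 : Fin (Surface.n S)) (r0o : Surface.face S r0 ≡ fo)
  (bound : ∀ hf f → hf f ≡ true → hf fo ≡ false → pos 2 * pos b ≤ ∑ (λ q → b2z (Cycles.bdry S hf q)))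
  (π : Fin (Surface.n S) → Bool) (ℓ : Fin (Surface.n S) → ℕ) where
  open Surface S
  open Weights S b fo
  open Cycles S

  d0 : D
  d0 = α r0

  module _ (ℓ-dec : ∀ q → q ≢ d0 → ℓ (nxt π q) ℕ.< ℓ q) (ℓ<n : ∀ q → ℓ q ℕ.< n) (πr0 : π r0 ≡ true)
    (w : Bool → D → ℤ) (ws : WS (w true) (w false)) (exit : ∀ q → q ≢ d0 → w (π q) q ≡ 0ℤ)
    (d : D) (s : Bool) (s-flip : s ≡ not (π d)) (d≢r0 : d ≢ r0) (path : Path (nxt π) d0 d (stp s d)) where
    open Policy π d0 ℓ ℓ-dec ℓ<n

    private
      -- The spanning tree without the arc crossed by the alternative step at `d`; slot `d` is
      -- reused for the extra arc at `d0`. With `n` arcs on `n + 2` nodes it splits, and the cut is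
      -- dual to the cycle that a switch at `d` would create.
      gS gT : Fin n → Fin N
      gS q = if does (q ≟ d) then nE (edge d0) else nE (edge q)
      gT q = if does (q ≟ d) then tgt (π d0) d0 else tgt (not (π q)) q

      gS-d : gS d ≡ nE (edge d0)
      gS-d with d ≟ d
      ... | yes _ = refl
      ... | no ne = ⊥-elim (ne refl)
      gT-d : gT d ≡ tgt (π d0) d0
      gT-d with d ≟ d
      ... | yes _ = refl
      ... | no ne = ⊥-elim (ne refl)
      gS-q : ∀ q → q ≢ d → gS q ≡ nE (edge q)
      gS-q q ne with q ≟ d
      ... | yes p = ⊥-elim (ne p)
      ... | no _ = refl
      gT-q : ∀ q → q ≢ d → gT q ≡ tgt (not (π q)) q
      gT-q q ne with q ≟ d
      ... | yes p = ⊥-elim (ne p)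
      ... | no _ = refl

      cut→arcs : ∀ (h : Fin N → Bool) → Cut gS gT h → h (nE (edge d)) ≡ h (tgt s d) → ∀ x y → h x ≡ h y
      cut→arcs h c e = tree-conn h λ { zero → cong h (sym gS-d) ∙ c d ∙ cong h gT-d ; (suc q) → at q (q ≟ d) }
        where at : ∀ q → Dec (q ≡ d) → h (nE (edge q)) ≡ h (tgt (not (π q)) q)
              at q (yes refl) = e ∙ cong (λ b → h (tgt b d)) s-flip
              at q (no ne) = cong h (sym (gS-q q ne)) ∙ c q ∙ cong h (gT-q q ne)

      -- The marked side is chosen so that the alternative step carries flow +1 out of `d`: for a
      -- `σ` step the edge is inside and the vertex outside, for a `φ` step the face is inside and
      -- the edge outside.
      right left : Fin N
      right = if s then nE (edge d) else tgt s d
      left = if s then tgt s d else nE (edge d)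

      rl : ∀ (h : Fin N → Bool) → h right ≡ h left → h (nE (edge d)) ≡ h (tgt s d)
      rl h = go s
        where go : ∀ u → h (if u then nE (edge d) else tgt s d) ≡ h (if u then tgt s d else nE (edge d)) → h (nE (edge d)) ≡ h (tgt s d)
              go true e = e
              go false e = sym e

      opaque
        the-cut : Σ[ k ∈ (Fin N → Bool) ] Cut gS gT k × k right ≡ true × k left ≡ false
        the-cut with conn-or-cut gS gT
        ... | inj₁ c = ⊥-elim (ℕP.<-irrefl refl (subst (ℕ._≤ suc n) nodes-count (conn-bound gS gT c)))
        ... | inj₂ (h , c , x , y , ne) = choose (h right) (h left) refl refl
          where
          choose : ∀ u v → h right ≡ u → h left ≡ v → Σ[ k ∈ (Fin N → Bool) ] Cut gS gT k × k right ≡ true × k left ≡ false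
          choose true false e e' = h , c , e , e'
          choose false true e e' = not ∘ h , (λ a → cong not (c a)) , cong not e , cong not e'
          choose true true e e' = ⊥-elim (ne (cut→arcs h c (rl h (e ∙ sym e')) x y))
          choose false false e e' = ⊥-elim (ne (cut→arcs h c (rl h (e ∙ sym e')) x y))

      k = proj₁ the-cut
      k-cut : Cut gS gT k
      k-cut = proj₁ (proj₂ the-cut)
      H : Fin N → ℤ
      H x = b2z (k x)
      hv : Fin V → ℤ
      hv v = H (nV v)
      he : Fin E → ℤ
      he e = H (nE e)
      hf : Fin Fc → ℤ
      hf f = H (nF f)

      J : Bool → D → ℤ
      J true q = he (edge q) - hv (vert q)
      J false q = hf (face q) - he (edge q)

      J0 : ∀ b q → k (nE (edge q)) ≡ k (tgt b q) → J b q ≡ 0ℤ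
      J0 true q e = cong (λ u → b2z u - hv (vert q)) e ∙ ℤP.+-inverseʳ (hv (vert q))
      J0 false q e = cong (λ u → hf (face q) - b2z u) e ∙ ℤP.+-inverseʳ (hf (face q))

      J-T : ∀ q → q ≢ d → J (not (π q)) q ≡ 0ℤ
      J-T q ne = J0 (not (π q)) q (cong k (sym (gS-q q ne)) ∙ k-cut q ∙ cong k (gT-q q ne))

      J-d0 : J (π d0) d0 ≡ 0ℤ
      J-d0 = J0 (π d0) d0 (cong k (sym gS-d) ∙ k-cut d ∙ cong k gT-d)

      J-d : J s d ≡ 1ℤ
      J-d = go s refl
        where go : ∀ u → s ≡ u → J u d ≡ 1ℤ
              go true e = cong₂ _-_ (cong b2z (cong (λ u → k (if u then nE (edge d) else tgt s d)) (sym e) ∙ proj₁ (proj₂ (proj₂ the-cut))))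
                                     (cong b2z ((cong (λ u → k (tgt u d)) (sym e) ∙ cong (λ u → k (if u then tgt s d else nE (edge d))) (sym e)) ∙ proj₂ (proj₂ (proj₂ the-cut))))
              go false e = cong₂ _-_ (cong b2z ((cong (λ u → k (tgt u d)) (sym e) ∙ cong (λ u → k (if u then nE (edge d) else tgt s d)) (sym e)) ∙ proj₁ (proj₂ (proj₂ the-cut))))
                                      (cong b2z (cong (λ u → k (if u then tgt s d else nE (edge d))) (sym e) ∙ proj₂ (proj₂ (proj₂ the-cut))))

      -- Both sums are the difference of the cut function between the face and the vertex of the
      -- corner, taken once through its exits and once through its entrances: the coboundary of a
      -- cut is a flow on the dual graph.
      J-cons : ∀ q → J true q + J false q ≡ J true (σ⁻ q) + J false (φ⁻ q)
      J-cons q = l (he (edge q)) (hv (vert q)) (hf (face q)) ∙ cong₂ _-_ (cong hf (cong face (sym (φφ⁻ q)) ∙ face-φ (φ⁻ q))) (cong hv (cong vert (sym (σσ⁻ q)) ∙ vert-σ (σ⁻ q))) ∙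
           sym (l (he (edge (σ⁻ q))) (hv (vert (σ⁻ q))) (hf (face (φ⁻ q)))) ∙ cong (λ e → J true (σ⁻ q) + (hf (face (φ⁻ q)) - he e)) (sym (edge-α (σ⁻ q)))
        where l : ∀ e v f → (e - v) + (f - e) ≡ f - v
              l = solve-∀

      -- X b g q: the flow g leaving q along a step of kind b that the policy really makes.
      X : Bool → (D → ℤ) → D → ℤ
      X b g q = if does (q ≟ d0) then 0ℤ else (if does (π q Data.Bool.≟ b) then g q else 0ℤ)

      X-d0 : ∀ b g q → q ≡ d0 → X b g q ≡ 0ℤ
      X-d0 b g q e with q ≟ d0
      ... | yes _ = refl
      ... | no ne = ⊥-elim (ne e)

      X-yes : ∀ b g q → q ≢ d0 → π q ≡ b → X b g q ≡ g q
      X-yes b g q ne e with q ≟ d0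
      ... | yes p = ⊥-elim (ne p)
      ... | no _ with Data.Bool._≟_ (π q) b
      ...   | yes _ = refl
      ...   | no ne' = ⊥-elim (ne' e)

      X-no : ∀ b g q → π q ≢ b → X b g q ≡ 0ℤ
      X-no b g q ne' with q ≟ d0
      ... | yes p = refl
      ... | no _ with Data.Bool._≟_ (π q) b
      ...   | yes e = ⊥-elim (ne' e)
      ...   | no _ = refl

      X-cases : ∀ b q → (q ≡ d0) ⊎ ((q ≢ d0 × π q ≡ b) ⊎ (π q ≢ b))
      X-cases b q with q ≟ d0 | Data.Bool._≟_ (π q) b
      ... | yes p | _ = inj₁ p
      ... | no ne | yes e = inj₂ (inj₁ (ne , e))
      ... | no _ | no ne = inj₂ (inj₂ ne)

      In : (D → ℤ) → D → ℤ
      In g q = X true g (σ⁻ q) + X false g (φ⁻ q)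

      X-+ : ∀ b g g' q → X b (λ x → g x + g' x) q ≡ X b g q + X b g' q
      X-+ b g g' q with X-cases b q
      ... | inj₁ e = X-d0 b (λ x → g x + g' x) q e ∙ sym (cong₂ _+_ (X-d0 b g q e) (X-d0 b g' q e))
      ... | inj₂ (inj₁ (ne , e)) = X-yes b (λ x → g x + g' x) q ne e ∙ sym (cong₂ _+_ (X-yes b g q ne e) (X-yes b g' q ne e))
      ... | inj₂ (inj₂ ne) = X-no b (λ x → g x + g' x) q ne ∙ sym (cong₂ _+_ (X-no b g q ne) (X-no b g' q ne))

      In-+ : ∀ g g' q → In (λ x → g x + g' x) q ≡ In g q + In g' q
      In-+ g g' q = cong₂ _+_ (X-+ true g g' (σ⁻ q)) (X-+ false g g' (φ⁻ q)) ∙ l (X true g (σ⁻ q)) (X true g' (σ⁻ q)) (X false g (φ⁻ q)) (X false g' (φ⁻ q))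
        where l : ∀ a b c e → (a + b) + (c + e) ≡ (a + c) + (b + e)
              l = solve-∀

      pre : Bool → D → D
      pre true = σ⁻
      pre false = φ⁻
      pre-stp : ∀ b q → pre b (stp b q) ≡ q
      pre-stp true q = σ⁻σ q
      pre-stp false q = φ⁻φ q
      stp-pre : ∀ b q → stp b (pre b q) ≡ q
      stp-pre true q = σσ⁻ q
      stp-pre false q = φφ⁻ q

      X-ind : ∀ b x q → x ≢ d0 → X b (ind x) (pre b q) ≡ (if does (π x Data.Bool.≟ b) then ind (nxt π x) q else 0ℤ)
      X-ind b x q ne with Data.Bool._≟_ (π x) b | X-cases b (pre b q)
      ... | yes refl | inj₂ (inj₁ (ne' , e')) = X-yes b (ind x) (pre b q) ne' e' ∙ ind-iff (λ p → cong (stp b) p ∙ stp-pre b q) (λ p → sym (pre-stp b x) ∙ cong (pre b) p)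
      ... | yes refl | inj₁ e' = X-d0 b (ind x) (pre b q) e' ∙ sym (ind-no (λ p → ne (sym (pre-stp b x) ∙ cong (pre b) p ∙ e')))
      ... | yes refl | inj₂ (inj₂ ne') = X-no b (ind x) (pre b q) ne' ∙ sym (ind-no (λ p → ne' (cong π (cong (pre b) (sym p) ∙ pre-stp b x))))
      ... | no ne2 | inj₁ e' = X-d0 b (ind x) (pre b q) e'
      ... | no ne2 | inj₂ (inj₁ (ne' , e')) = X-yes b (ind x) (pre b q) ne' e' ∙ ind-no (λ p → ne2 (cong π p ∙ e'))
      ... | no ne2 | inj₂ (inj₂ ne') = X-no b (ind x) (pre b q) ne'

      In-ind : ∀ x q → x ≢ d0 → In (ind x) q ≡ ind (nxt π x) q
      In-ind x q ne = cong₂ _+_ (X-ind true x q ne) (X-ind false x q ne) ∙ go (π x)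
        where go : ∀ b → (if does (b Data.Bool.≟ true) then ind (nxt π x) q else 0ℤ) + (if does (b Data.Bool.≟ false) then ind (nxt π x) q else 0ℤ) ≡ ind (nxt π x) q
              go true = ℤP.+-identityʳ (ind (nxt π x) q)
              go false = ℤP.+-identityˡ (ind (nxt π x) q)

      pflow : ∀ {t} → Path (nxt π) d0 d t → D → ℤ
      pflow here x = 0ℤ
      pflow (step {q} ne p) x = ind q x + pflow p x

      In-0 : ∀ q → In (λ _ → 0ℤ) q ≡ 0ℤ
      In-0 q = cong₂ _+_ (z true (σ⁻ q)) (z false (φ⁻ q))
        where z : ∀ b q → X b (λ _ → 0ℤ) q ≡ 0ℤ
              z b q with X-cases b q
              ... | inj₁ e = X-d0 b _ q e
              ... | inj₂ (inj₁ (ne , e)) = X-yes b (λ _ → 0ℤ) q ne e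
              ... | inj₂ (inj₂ ne) = X-no b _ q ne

      pflow-cons : ∀ {t} (p : Path (nxt π) d0 d t) q → pflow p q + ind d q ≡ In (pflow p) q + ind t q
      pflow-cons here q = cong (_+ ind d q) (sym (In-0 q))
      pflow-cons (step {x} ne p) q = l (ind x q) (pflow p q) (ind d q) ∙ cong (ind x q +_) (pflow-cons p q) ∙ l2 (ind x q) (In (pflow p) q) (ind (nxt π x) q) ∙
           cong (_+ ind x q) (cong (_+ In (pflow p) q) (sym (In-ind x q ne)) ∙ sym (In-+ (ind x) (pflow p) q))
        where l : ∀ a b c → (a + b) + c ≡ a + (b + c)
              l = solve-∀
              l2 : ∀ a b c → a + (b + c) ≡ (c + b) + a
              l2 = solve-∀

      0≤pflow : ∀ {t} (p : Path (nxt π) d0 d t) q → 0ℤ ≤ pflow p q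
      0≤pflow here q = ℤP.≤-refl
      0≤pflow (step {x} ne p) q = 0≤+ (0≤ind x q) (0≤pflow p q)

      Jx : D → ℤ
      Jx q = J (π q) q

      sD : Bool → D → ℤ
      sD b q = if does (b Data.Bool.≟ s) then ind d q else 0ℤ

      -- Uncrossed arcs other than the removed one belong to the split tree, so `J` vanishes on
      -- them, and it vanishes on the extra arc at `d0` too; only policy steps and the alternative
      -- step at `d` can carry flow.
      J-dec : ∀ b q → J b q ≡ X b Jx q + sD b q
      J-dec b q with Data.Bool._≟_ b s | ind-case d q | X-cases b q
      J-dec b q | no ns | _ | inj₂ (inj₁ (ne , e)) = cong (λ u → J u q) (sym e) ∙ sym (ℤP.+-identityʳ (Jx q)) ∙ cong (_+ 0ℤ) (sym (X-yes b Jx q ne e))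
      J-dec b q | no ns | _ | inj₁ refl = j0 (b-cases b (π d0)) ∙ cong (_+ 0ℤ) (sym (X-d0 b Jx d0 refl))
        where j0 : (b ≡ π d0) ⊎ (b ≡ not (π d0)) → J b d0 ≡ 0ℤ
              j0 (inj₁ e) = cong (λ u → J u d0) e ∙ J-d0
              j0 (inj₂ e) = cong (λ u → J u d0) e ∙ J-T d0 (λ p → ns (e ∙ cong (not ∘ π) p ∙ sym s-flip))
      J-dec b q | no ns | _ | inj₂ (inj₂ ne) = j0 (b-cases b (π q)) ∙ cong (_+ 0ℤ) (sym (X-no b Jx q ne))
        where j0 : (b ≡ π q) ⊎ (b ≡ not (π q)) → J b q ≡ 0ℤ
              j0 (inj₁ e) = ⊥-elim (ne (sym e))
              j0 (inj₂ e) = cong (λ u → J u q) e ∙ J-T q (λ p → ns (e ∙ cong (not ∘ π) p ∙ sym s-flip))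
      J-dec b q | yes refl | inj₁ (refl , i) | xc = J-d ∙ sym (ℤP.+-identityˡ 1ℤ) ∙ cong₂ _+_ (sym (x0 xc)) (sym i)
        where x0 : (d ≡ d0) ⊎ ((d ≢ d0 × π d ≡ s) ⊎ (π d ≢ s)) → X s Jx d ≡ 0ℤ
              x0 (inj₁ e) = X-d0 s Jx d e
              x0 (inj₂ (inj₁ (_ , e))) = ⊥-elim (contra (π d) (e ∙ s-flip))
                where contra : ∀ u → u ≢ not u
                      contra true ()
                      contra false ()
              x0 (inj₂ (inj₂ ne)) = X-no s Jx d ne
      J-dec b q | yes refl | inj₂ (nd , i) | inj₂ (inj₁ (ne , e)) = cong (λ u → J u q) (sym e) ∙ sym (ℤP.+-identityʳ (Jx q)) ∙ cong₂ _+_ (sym (X-yes b Jx q ne e)) (sym i)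
      J-dec b q | yes refl | inj₂ (nd , i) | inj₁ refl = j0 (b-cases b (π d0)) ∙ cong₂ _+_ (sym (X-d0 b Jx d0 refl)) (sym i)
        where j0 : (b ≡ π d0) ⊎ (b ≡ not (π d0)) → J b d0 ≡ 0ℤ
              j0 (inj₁ e) = cong (λ u → J u d0) e ∙ J-d0
              j0 (inj₂ e) = cong (λ u → J u d0) e ∙ J-T d0 (λ p → nd (sym p))
      J-dec b q | yes refl | inj₂ (nd , i) | inj₂ (inj₂ ne) = j0 (b-cases b (π q)) ∙ cong₂ _+_ (sym (X-no b Jx q ne)) (sym i)
        where j0 : (b ≡ π q) ⊎ (b ≡ not (π q)) → J b q ≡ 0ℤ
              j0 (inj₁ e) = ⊥-elim (ne (sym e))
              j0 (inj₂ e) = cong (λ u → J u q) e ∙ J-T q (λ p → nd (sym p))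

      sD-in : ∀ q → sD true (σ⁻ q) + sD false (φ⁻ q) ≡ ind (stp s d) q
      sD-in q = go s
        where go : ∀ s → (if does (true Data.Bool.≟ s) then ind d (σ⁻ q) else 0ℤ) + (if does (false Data.Bool.≟ s) then ind d (φ⁻ q) else 0ℤ) ≡ ind (stp s d) q
              go true = ℤP.+-identityʳ (ind d (σ⁻ q)) ∙ ind-iff (λ p → cong σ p ∙ σσ⁻ q) (λ p → sym (σ⁻σ d) ∙ cong σ⁻ p)
              go false = ℤP.+-identityˡ (ind d (φ⁻ q)) ∙ ind-iff (λ p → cong φ p ∙ φφ⁻ q) (λ p → sym (φ⁻φ d) ∙ cong φ⁻ p)

      sD-out : ∀ q → sD true q + sD false q ≡ ind d q
      sD-out q = go s
        where go : ∀ s → (if does (true Data.Bool.≟ s) then ind d q else 0ℤ) + (if does (false Data.Bool.≟ s) then ind d q else 0ℤ) ≡ ind d q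
              go true = ℤP.+-identityʳ (ind d q)
              go false = ℤP.+-identityˡ (ind d q)

      X-out : ∀ g q → q ≢ d0 → X true g q + X false g q ≡ g q
      X-out g q ne = go (π q) refl
        where go : ∀ u → π q ≡ u → X true g q + X false g q ≡ g q
              go true e = cong₂ _+_ (X-yes true g q ne e) (X-no false g q (λ p → true≢false (sym e ∙ p))) ∙ ℤP.+-identityʳ (g q)
              go false e = cong₂ _+_ (X-no true g q (λ p → true≢false (sym p ∙ e))) (X-yes false g q ne e) ∙ ℤP.+-identityˡ (g q)

      Jx-cons : ∀ q → q ≢ d0 → Jx q + ind d q ≡ In Jx q + ind (stp s d) q
      Jx-cons q ne = sym (cong₂ _+_ (X-out Jx q ne) (sD-out q)) ∙ l (X true Jx q) (X false Jx q) (sD true q) (sD false q) ∙ sym (cong₂ _+_ (J-dec true q) (J-dec false q)) ∙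
            J-cons q ∙ cong₂ _+_ (J-dec true (σ⁻ q)) (J-dec false (φ⁻ q)) ∙ l2 (X true Jx (σ⁻ q)) (sD true (σ⁻ q)) (X false Jx (φ⁻ q)) (sD false (φ⁻ q)) ∙ cong (In Jx q +_) (sD-in q)
        where l : ∀ a b c e → (a + b) + (c + e) ≡ (a + c) + (b + e)
              l = solve-∀
              l2 : ∀ a b c e → (a + b) + (c + e) ≡ (a + c) + (b + e)
              l2 = solve-∀

      -- Both flows satisfy the same conservation law, hence agree by descending rank.
      Jx≡ : ∀ m q → n ℕ.< ℓ q ℕ.+ m → q ≢ d0 → Jx q ≡ pflow path q
      Jx≡ zero q lt ne = ⊥-elim (ℕP.<-asym (ℓ<n q) (subst (n ℕ.<_) (ℕP.+-identityʳ (ℓ q)) lt))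
      Jx≡ (suc m) q lt ne = l (Jx q) (ind d q) ∙ cong (_- ind d q) (Jx-cons q ne ∙ cong (_+ ind (stp s d) q) in≡ ∙ sym (pflow-cons path q)) ∙ sym (l (pflow path q) (ind d q))
        where
        l : ∀ a b → a ≡ (a + b) - b
        l = solve-∀
        up : ∀ q' → ℓ q ℕ.< ℓ q' → n ℕ.< ℓ q' ℕ.+ m
        up q' l = ℕP.<-≤-trans lt (subst (ℕ._≤ ℓ q' ℕ.+ m) (sym (ℕP.+-suc (ℓ q) m)) (ℕP.+-monoˡ-≤ m l))
        x≡ : ∀ b → X b Jx (pre b q) ≡ X b (pflow path) (pre b q)
        x≡ b with X-cases b (pre b q)
        ... | inj₁ e = X-d0 b Jx (pre b q) e ∙ sym (X-d0 b (pflow path) (pre b q) e)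
        ... | inj₂ (inj₂ ne') = X-no b Jx (pre b q) ne' ∙ sym (X-no b (pflow path) (pre b q) ne')
        ... | inj₂ (inj₁ (ne' , e)) = X-yes b Jx (pre b q) ne' e ∙ Jx≡ m (pre b q) (up (pre b q)
                (subst (λ z → ℓ z ℕ.< ℓ (pre b q)) (cong (λ u → stp u (pre b q)) e ∙ stp-pre b q) (ℓ-dec (pre b q) ne'))) ne' ∙ sym (X-yes b (pflow path) (pre b q) ne' e)
        in≡ : In Jx q ≡ In (pflow path) q
        in≡ = cong₂ _+_ (x≡ true) (x≡ false)

      -- This rests on the path from the alternative step back to `d`: the flow of the cut is the
      -- flow around that cycle. Consequently `hv ≤ he ≤ hf` along incidences, so the marked cells
      -- form an open region, containing with a vertex its edges and with an edge its faces.
      0≤J : ∀ b q → 0ℤ ≤ J b q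
      0≤J b q = subst (0ℤ ≤_) (sym (J-dec b q)) (0≤+ x s')
        where x : 0ℤ ≤ X b Jx q
              x with X-cases b q
              ... | inj₁ e = ℤP.≤-reflexive (sym (X-d0 b Jx q e))
              ... | inj₂ (inj₂ ne) = ℤP.≤-reflexive (sym (X-no b Jx q ne))
              ... | inj₂ (inj₁ (ne , e)) = subst (0ℤ ≤_) (sym (X-yes b Jx q ne e ∙ Jx≡ (suc n) q (ℕP.m≤n+m (suc n) (ℓ q)) ne)) (0≤pflow path q)
              s' : 0ℤ ≤ sD b q
              s' with Data.Bool._≟_ b s
              ... | yes _ = 0≤ind d q
              ... | no _ = ℤP.≤-refl

      c : ℤ
      c = w s d

      -- Complementary slackness: the weights vanish on the steps of the policy, the flow vanishes
      -- off them, and only the alternative step at `d` contributes.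
      Wk≡ : Wk (w true) (w false) hv he hf ≡ - c
      Wk≡ = ∑-cong pt ∙ ∑-neg (λ q → ind d q * w s q) ∙ (cong -_ (∑-ind d (w s)))
        where
        wX : ∀ b q → w b q * X b Jx q ≡ 0ℤ
        wX b q with X-cases b q
        ... | inj₁ e = cong (w b q *_) (X-d0 b Jx q e) ∙ ℤP.*-zeroʳ (w b q)
        ... | inj₂ (inj₂ ne) = cong (w b q *_) (X-no b Jx q ne) ∙ ℤP.*-zeroʳ (w b q)
        ... | inj₂ (inj₁ (ne , e)) = cong (_* X b Jx q) (cong (λ u → w u q) (sym e) ∙ exit q ne)
        ws' : ∀ s q → w true q * (if does (true Data.Bool.≟ s) then ind d q else 0ℤ) + w false q * (if does (false Data.Bool.≟ s) then ind d q else 0ℤ) ≡ ind d q * w s q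
        ws' true q = l (w true q) (w false q) (ind d q)
          where l : ∀ a b i → a * i + b * 0ℤ ≡ i * a
                l = solve-∀
        ws' false q = l (w true q) (w false q) (ind d q)
          where l : ∀ a b i → a * 0ℤ + b * i ≡ i * b
                l = solve-∀
        pt : ∀ q → w true q * (hv (vert q) - he (edge q)) + w false q * (he (edge q) - hf (face q)) ≡ - (ind d q * w s q)
        pt q = l1 (w true q) (w false q) (hv (vert q)) (he (edge q)) (hf (face q)) ∙ (cong -_ (cong₂ (λ u v → w true q * u + w false q * v) (J-dec true q) (J-dec false q) ∙
               l2 (w true q) (w false q) (X true Jx q) (sD true q) (X false Jx q) (sD false q) ∙ cong₂ _+_ (cong₂ _+_ (wX true q) (wX false q)) (ws' s q) ∙ ℤP.+-identityˡ (ind d q * w s q)))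
          where l1 : ∀ y z v e f → y * (v - e) + z * (e - f) ≡ - (y * (e - v) + z * (f - e))
                l1 = solve-∀
                l2 : ∀ y z a b c e → y * (a + b) + z * (c + e) ≡ (y * a + z * c) + (y * b + z * e)
                l2 = solve-∀

      K : ℤ
      K = Kφ he hf

      h0 hd : ℤ
      h0 = he (edge d0)
      hd = he (edge d)

      -- The marked side is connected by its own arcs, so it has at most one node more than arcs.
      -- Each marked edge accounts for two slots, except that slot `d` now belongs to the edge of
      -- `d0`; this explains `h0 - hd`.
      χ≤ : χ hv he hf ≤ 1ℤ + h0 - hd
      χ≤ = ≤-by ((∑ (λ q → H (gS q)) + 1ℤ) - ∑ H) (0≤- sb) (l (∑ hv) (∑ he) (∑ hf) h0 hd ∙ cong₂ (λ u v → (u + 1ℤ) - v) (sym sg) (sym (∑-nodes H)))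
        where
        sb : ∑ H ≤ ∑ (λ q → H (gS q)) + 1ℤ
        sb = side-bound gS gT right left k k-cut (proj₁ (proj₂ (proj₂ the-cut))) (proj₂ (proj₂ (proj₂ the-cut))) (λ k' c' e → cut→arcs k' c' (rl k' e))
        sg : ∑ (λ q → H (gS q)) ≡ pos 2 * ∑ he + (h0 - hd)
        sg = ∑-cong (λ q → pt q) ∙ ∑-update d (λ q → he (edge q)) h0 ∙ cong (_+ (h0 - hd))
               (∑-cong (λ q → sym (ℤP.*-identityʳ (he (edge q)))) ∙ ∑-edge he (λ _ → 1ℤ) ∙ ∑-*ʳ (pos 2) he ∙ ℤP.*-comm (∑ he) (pos 2))
          where pt : ∀ q → H (gS q) ≡ (if does (q ≟ d) then h0 else he (edge q))
                pt q with does (q ≟ d)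
                ... | true = refl
                ... | false = refl
        l : ∀ v e f a b → (1ℤ + a - b) - (v + f - e) ≡ ((pos 2 * e + (a - b)) + 1ℤ) - (v + (e + f))
        l = solve-∀

      -- The policy leaves `r0` by `σ`, so the arc from its edge to the outer face is kept and both
      -- ends lie on one side; the edge of `d0` is the edge of `r0`.
      fo≡ : hf fo ≡ h0
      fo≡ = cong hf (sym r0o) ∙ sym (l (he (edge r0)) (hf (face r0)) ∙ cong (λ u → hf (face r0) - u) (cong (λ b → J (not b) r0) (sym πr0) ∙ J-T r0 (λ p → d≢r0 (sym p))) ∙ ℤP.+-identityʳ (hf (face r0))) ∙ cong he (sym (edge-α r0))
        where l : ∀ e f → e ≡ f - (f - e)
              l = solve-∀

      0≤K : 0ℤ ≤ K
      0≤K = ∑-nonneg (0≤J false)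

      -- With the outer face unmarked, the marked faces have at least `2B` boundary darts, which is
      -- the form the girth condition takes here; `K` dominates their number because `J false` is
      -- nonnegative.
      K≥ : k (nF (face d)) ≡ true → h0 ≡ 0ℤ → pos 2 * B ≤ K
      K≥ kd h00 = ℤP.≤-trans (bound (k ∘ nF) (face d) kd kfo) (∑-mono pt)
        where
        1≢0 : 1ℤ ≢ 0ℤ
        1≢0 ()
        kfo : k (nF fo) ≡ false
        kfo with b2z-case (k (nF fo))
        ... | inj₁ (_ , e) = ⊥-elim (1≢0 (sym e ∙ fo≡ ∙ h00))
        ... | inj₂ (e , _) = e
        pt : ∀ q → b2z (bdry (k ∘ nF) q) ≤ J false q
        pt q with b2z-case (bdry (k ∘ nF) q)
        ... | inj₂ (_ , e) = subst (_≤ J false q) (sym e) (0≤J false q)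
        ... | inj₁ (t , e) = subst (_≤ J false q) (sym e) (≤-by (J false (α q)) (0≤J false (α q)) (cong₂ (λ u v → (b2z u - v) - 1ℤ) (proj₁ (bdry-elim (k ∘ nF) q t)) (cong he (sym (edge-α q))) ∙
               l (he (edge (α q))) ∙ cong (λ u → b2z u - he (edge (α q))) (sym (proj₂ (bdry-elim (k ∘ nF) q t)))))
          where l : ∀ e → (1ℤ - e) - 1ℤ ≡ 0ℤ - e
                l = solve-∀

      2c≡ : pos 2 * c ≡ K + pos 4 * B * h0 - pos 2 * B * χ hv he hf
      2c≡ = l (pos 2 * c) ∙ (cong -_ (l3 c ∙ cong (pos 2 *_) (sym Wk≡) ∙ ws hv he hf)) ∙ cong (λ u → - (pos 2 * B * χ hv he hf - K - pos 4 * B * u)) fo≡ ∙ l2 B (χ hv he hf) K h0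
        where l : ∀ a → a ≡ - (- a)
              l = solve-∀
              l3 : ∀ a → - (pos 2 * a) ≡ pos 2 * - a
              l3 = solve-∀
              l2 : ∀ b x k h → - (pos 2 * b * x - k - pos 4 * b * h) ≡ k + pos 4 * b * h - pos 2 * b * x
              l2 = solve-∀

      0≤B : 0ℤ ≤ B
      0≤B = ℤ.+≤+ z≤n

      2c≥ : K + pos 2 * B * h0 - pos 2 * B + pos 2 * B * hd ≤ pos 2 * c
      2c≥ = ≤-by (pos 2 * B * ((1ℤ + h0 - hd) - χ hv he hf)) (0≤* {pos 2 * B} (0≤* {pos 2} (ℤ.+≤+ z≤n) 0≤B) (0≤- χ≤)) (cong (_- (K + pos 2 * B * h0 - pos 2 * B + pos 2 * B * hd)) 2c≡ ∙ l K B h0 hd (χ hv he hf))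
        where l : ∀ k b h d x → (k + pos 4 * b * h - pos 2 * b * x) - (k + pos 2 * b * h - pos 2 * b + pos 2 * b * d) ≡ pos 2 * b * ((1ℤ + h - d) - x)
              l = solve-∀

      half : ∀ a → pos 2 * a ≤ pos 2 * c → a ≤ c
      half a le = ℤP.*-cancelˡ-≤-pos a c (pos 2) le

    -- Here `hd = 1`, and the bound on `2c` is at least `2B` in both cases: the term `2B * h0` pays
    -- if the outer face is marked, the girth pays if not. A `φ` step has `hd = 0`, which costs `2B`
    -- and leaves only `0 ≤ c` in `cost-φ`.
    cost-σ : s ≡ true → 1ℤ ≤ c
    cost-σ e = half 1ℤ (ℤP.≤-trans 2≤2B (ℤP.≤-trans main 2c≥))
      where
      kr : k (nE (edge d)) ≡ true
      kr = cong (λ u → k (if u then nE (edge d) else tgt s d)) (sym e) ∙ proj₁ (proj₂ (proj₂ the-cut))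
      kf : k (nF (face d)) ≡ true
      kf with b2z-case (k (nF (face d)))
      ... | inj₁ (t , _) = t
      ... | inj₂ (_ , z) = ⊥-elim (neg (subst (0ℤ ≤_) (cong₂ _-_ z (cong b2z kr)) (0≤J false d)))
        where neg : ¬ (0ℤ ≤ 0ℤ - 1ℤ)
              neg ()
      2≤2B : pos 2 * 1ℤ ≤ pos 2 * B
      2≤2B = ℤP.*-monoˡ-≤-nonNeg (pos 2) (ℤ.+≤+ b≥1)
      main : pos 2 * B ≤ K + pos 2 * B * h0 - pos 2 * B + pos 2 * B * hd
      main with b2z-case (k (nE (edge d0)))
      ... | inj₁ (_ , h1) = ≤-by K 0≤K (cong₂ (λ u v → (K + pos 2 * B * u - pos 2 * B + pos 2 * B * v) - pos 2 * B) h1 (cong b2z kr) ∙ l K B)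
        where l : ∀ k b → (k + pos 2 * b * 1ℤ - pos 2 * b + pos 2 * b * 1ℤ) - pos 2 * b ≡ k
              l = solve-∀
      ... | inj₂ (_ , h1) = ℤP.≤-trans (K≥ kf h1) (ℤP.≤-reflexive (sym (cong₂ (λ u v → K + pos 2 * B * u - pos 2 * B + pos 2 * B * v) h1 (cong b2z kr) ∙ l K B)))
        where l : ∀ k b → k + pos 2 * b * 0ℤ - pos 2 * b + pos 2 * b * 1ℤ ≡ k
              l = solve-∀

    cost-φ : s ≡ false → 0ℤ ≤ c
    cost-φ e = half 0ℤ (ℤP.≤-trans main 2c≥)
      where
      kr : k (nF (face d)) ≡ true
      kr = cong (λ u → k (tgt u d)) (sym e) ∙ cong (λ u → k (if u then nE (edge d) else tgt s d)) (sym e) ∙ proj₁ (proj₂ (proj₂ the-cut))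
      kl : k (nE (edge d)) ≡ false
      kl = cong (λ u → k (if u then tgt s d else nE (edge d))) (sym e) ∙ proj₂ (proj₂ (proj₂ the-cut))
      main : 0ℤ ≤ K + pos 2 * B * h0 - pos 2 * B + pos 2 * B * hd
      main with b2z-case (k (nE (edge d0)))
      ... | inj₁ (_ , h1) = ℤP.≤-trans 0≤K (ℤP.≤-reflexive (sym (cong₂ (λ u v → K + pos 2 * B * u - pos 2 * B + pos 2 * B * v) h1 (cong b2z kl) ∙ l K B)))
        where l : ∀ k b → k + pos 2 * b * 1ℤ - pos 2 * b + pos 2 * b * 0ℤ ≡ k
              l = solve-∀
      ... | inj₂ (_ , h1) = subst (0ℤ ≤_) (sym (cong₂ (λ u v → K + pos 2 * B * u - pos 2 * B + pos 2 * B * v) h1 (cong b2z kl) ∙ l K B)) (0≤- (K≥ kr h1))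
        where l : ∀ k b → k + pos 2 * b * 0ℤ - pos 2 * b + pos 2 * b * 0ℤ ≡ k - pos 2 * b
              l = solve-∀

-- Existence of the orientation

leastℕ : (P : ℕ → Bool) (k : ℕ) → P k ≡ true → ∃ λ j → P j ≡ true × (∀ i → i ℕ.< j → P i ≡ false)
leastℕ P zero e = 0 , e , λ i ()
leastℕ P (suc k) e with P zero in e0
... | true = 0 , e0 , λ i ()
... | false with leastℕ (P ∘ suc) k e
...   | j , pj , m = suc j , pj , λ { zero _ → e0 ; (suc i) (s≤s l) → m i l }

∨-true : ∀ {x y} → x ∨ y ≡ true → x ≡ true ⊎ y ≡ true
∨-true {true} e = inj₁ refl
∨-true {false} e = inj₂ e

and-true : ∀ {x y} → x ∧ y ≡ true → x ≡ true × y ≡ true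
and-true {true} {true} e = refl , refl

not-true' : ∀ {x} → not x ≡ true → x ≡ false
not-true' {false} e = refl

-- A particular solution, and a search for an initial policy.

module Base (S : Surface) (b : ℕ) (fo : Fin (Surface.Fc S)) (hd : Fin (Surface.Fc S) → ℤ) (hd-eq : ∀ f → fib (Surface.face S) f (λ _ → 1ℤ) ≡ pos 2 * hd f) where
  open Surface S
  open Weights S b fo

  d0 : D
  d0 = frep fo

  ∑-hd : ∀ hf → ∑ (λ q → hf (face q)) ≡ ∑ (λ f → hf f * (pos 2 * hd f))
  ∑-hd hf = ∑-cong (λ q → sym (ℤP.*-identityʳ (hf (face q)))) ∙ sym (∑-fib face hf (λ _ → 1ℤ)) ∙ ∑-cong (λ f → cong (hf f *_) (hd-eq f))

  -- Any integral flow on the (connected) incidence graph with prescribed demands is a base solution.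
  base : Σ[ y ∈ (D → ℤ) ] Σ[ z ∈ (D → ℤ) ] WS y z
  base = y0 , z0 , ws
    where
    iS iT : Fin (n ℕ.+ n) → Fin N
    iS a = [ (λ q → nV (vert q)) , (λ q → nE (edge q)) ]′ (F.splitAt n a)
    iT a = [ (λ q → nE (edge q)) , (λ q → nF (face q)) ]′ (F.splitAt n a)
    c : Conn iS iT
    c h cut x y = all x ∙ sym (all y)
      where
      k : D → Bool
      k q = h (nE (edge q))
      cv : ∀ q → h (nV (vert q)) ≡ k q
      cv q = cong h (sym (cong [ (λ q → nV (vert q)) , (λ q → nE (edge q)) ]′ (FP.splitAt-↑ˡ n q n))) ∙ cut (q F.↑ˡ n) ∙ cong h (cong [ (λ q → nE (edge q)) , (λ q → nF (face q)) ]′ (FP.splitAt-↑ˡ n q n))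
      cf : ∀ q → k q ≡ h (nF (face q))
      cf q = cong h (sym (cong [ (λ q → nV (vert q)) , (λ q → nE (edge q)) ]′ (FP.splitAt-↑ʳ n n q))) ∙ cut (n F.↑ʳ q) ∙ cong h (cong [ (λ q → nE (edge q)) , (λ q → nF (face q)) ]′ (FP.splitAt-↑ʳ n n q))
      kc : ∀ q → k q ≡ k d0
      kc q = conn k (λ d → sym (cv (σ d)) ∙ cong (h ∘ nV) (vert-σ d) ∙ cv d) (λ d → cong (h ∘ nE) (edge-α d)) q d0
      all : ∀ x → h x ≡ k d0
      all = node-elim (λ x → h x ≡ k d0)
        (λ v → cong (h ∘ nV) (sym (vert-vrep v)) ∙ cv (vrep v) ∙ kc (vrep v))
        (λ e → cong (h ∘ nE) (sym (edge-erep e)) ∙ kc (erep e))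
        (λ f → cong (h ∘ nF) (sym (face-frep f)) ∙ sym (cf (frep f)) ∙ kc (frep f))
    dF : Fin Fc → ℤ
    dF f = - (hd f - B) - pos 2 * B * ind fo f
    dem : Fin N → ℤ
    dem = nodeF (λ _ → B) (λ _ → - (B - 1ℤ)) dF
    dem-sum : ∀ hv he hf → pos 2 * ∑ (λ x → nodeF hv he hf x * dem x) ≡ rhs hv he hf
    dem-sum hv he hf = cong (pos 2 *_) (∑-nodes (λ x → nodeF hv he hf x * dem x) ∙ cong₂ _+_
        (∑-cong (λ v → cong₂ _*_ (nodeF-V hv he hf v) (nodeF-V (λ _ → B) (λ _ → - (B - 1ℤ)) dF v)) ∙ ∑-*ʳ B hv)
        (cong₂ _+_ (∑-cong (λ e → cong₂ _*_ (nodeF-E hv he hf e) (nodeF-E (λ _ → B) (λ _ → - (B - 1ℤ)) dF e)) ∙ ∑-*ʳ (- (B - 1ℤ)) he)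
          (∑-cong (λ f → cong₂ _*_ (nodeF-F hv he hf f) (nodeF-F (λ _ → B) (λ _ → - (B - 1ℤ)) dF f) ∙ l0 (hf f) (hd f) B (ind fo f)) ∙
            ∑-- (λ f → hf f * (B - hd f)) (λ f → pos 2 * B * (ind fo f * hf f)) ∙ cong₂ _-_ (∑-cong (λ f → l1 (hf f) B (hd f)) ∙ ∑-- (λ f → hf f * B) (λ f → hf f * hd f) ∙ cong (_- ∑ (λ f → hf f * hd f)) (∑-*ʳ B hf))
               (∑-*ˡ (pos 2 * B) (λ f → ind fo f * hf f) ∙ cong (pos 2 * B *_) (∑-ind fo hf))))) ∙
        l2 (∑ hv) (∑ he) (∑ hf) B (∑ (λ f → hf f * hd f)) (hf fo) ∙ cong (λ k → pos 2 * B * χ hv he hf - k - pos 4 * B * hf fo) (sym (Kφ-split he hf ∙ cong (_- pos 2 * ∑ he) (∑-hd hf ∙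
          ∑-cong (λ f → l3 (hf f) (hd f)) ∙ ∑-*ˡ (pos 2) (λ f → hf f * hd f))))
      where
      l0 : ∀ h e b i → h * (- (e - b) - pos 2 * b * i) ≡ h * (b - e) - pos 2 * b * (i * h)
      l0 = solve-∀
      l1 : ∀ h b e → h * (b - e) ≡ h * b - h * e
      l1 = solve-∀
      l2 : ∀ v e f b k o → pos 2 * (v * b + (e * - (b - 1ℤ) + ((f * b - k) - pos 2 * b * o))) ≡ pos 2 * b * (v + f - e) - (pos 2 * k - pos 2 * e) - pos 4 * b * o
      l2 = solve-∀
      l3 : ∀ h e → h * (pos 2 * e) ≡ pos 2 * (h * e)
      l3 = solve-∀
    one : ∀ {m} → Fin m → ℤ
    one _ = 1ℤ
    ∑1 : ∀ m → ∑ {m} one ≡ pos m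
    ∑1 m = ∑-const m 1ℤ ∙ ℤP.*-identityʳ (pos m)
    -- The demands balance because the Euler characteristic is 2: `2B * 2` cancels the outer
    -- correction `4B`.
    dem0 : ∑ dem ≡ 0ℤ
    dem0 = cancel2 (cong (pos 2 *_) (∑-cong (λ x → sym (cong (_* dem x) (n1 x) ∙ ℤP.*-identityˡ (dem x)))) ∙ dem-sum one one one ∙
        cong₂ (λ u k → pos 2 * B * u - k - pos 4 * B * 1ℤ) χ1 (∑-zero (λ q → refl)) ∙ l B)
      where
      n1 : ∀ x → nodeF one one one x ≡ 1ℤ
      n1 = node-elim (λ x → nodeF one one one x ≡ 1ℤ) (nodeF-V one one one) (nodeF-E one one one) (nodeF-F one one one)
      χ1 : χ one one one ≡ pos 2
      χ1 = cong₂ _-_ (cong₂ _+_ (∑1 V) (∑1 Fc) ∙ sym (ℤP.pos-+ V Fc) ∙ cong pos euler ∙ ℤP.pos-+ E 2) (∑1 E) ∙ l' (pos E)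
        where l' : ∀ e → (e + pos 2) - e ≡ pos 2
              l' = solve-∀
      l : ∀ b → pos 2 * b * pos 2 - 0ℤ - pos 4 * b * 1ℤ ≡ pos 2 * 0ℤ
      l = solve-∀
    r = routing iS iT c dem dem0
    g = proj₁ r
    y0 z0 : D → ℤ
    y0 q = g (q F.↑ˡ n)
    z0 q = g (n F.↑ʳ q)
    ws : WS y0 z0
    ws hv he hf = cong (pos 2 *_) wk ∙ dem-sum hv he hf
      where
      h = nodeF hv he hf
      wk : Wk y0 z0 hv he hf ≡ ∑ (λ x → h x * dem x)
      wk = (∑-+ (λ q → y0 q * (hv (vert q) - he (edge q))) (λ q → z0 q * (he (edge q) - hf (face q))) ∙ cong₂ _+_
            (∑-cong (λ q → ℤP.*-comm (y0 q) (hv (vert q) - he (edge q)) ∙ cong (_* y0 q) (cong₂ _-_ (sym (cong h (cong [ (λ q → nV (vert q)) , (λ q → nE (edge q)) ]′ (FP.splitAt-↑ˡ n q n)) ∙ nodeF-V hv he hf (vert q)))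
                 (sym (cong h (cong [ (λ q → nE (edge q)) , (λ q → nF (face q)) ]′ (FP.splitAt-↑ˡ n q n)) ∙ nodeF-E hv he hf (edge q))))))
            (∑-cong (λ q → ℤP.*-comm (z0 q) (he (edge q) - hf (face q)) ∙ cong (_* z0 q) (cong₂ _-_ (sym (cong h (cong [ (λ q → nV (vert q)) , (λ q → nE (edge q)) ]′ (FP.splitAt-↑ʳ n n q)) ∙ nodeF-E hv he hf (edge q)))
                 (sym (cong h (cong [ (λ q → nE (edge q)) , (λ q → nF (face q)) ]′ (FP.splitAt-↑ʳ n n q)) ∙ nodeF-F hv he hf (face q))))))) ∙
          sym (∑-split n (λ a → (h (iS a) - h (iT a)) * g a)) ∙ proj₂ r h

-- Breadth-first search backwards from `d0`, with `φ` permitted only at darts where `okφ` holds. By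
-- hypothesis no proper set containing `d0` is closed under permitted predecessors; `saturate` turns
-- this into a finite distance for every dart, and `π` follows decreasing distance.
module BFS (S : Surface) (d0 : Fin (Surface.n S)) (okφ : Fin (Surface.n S) → Bool)
  (all : ∀ (X : Fin (Surface.n S) → Bool) → X d0 ≡ true → (∀ q → X (Surface.σ S q) ≡ true → X q ≡ true) → (∀ q → okφ q ≡ true → X (Surface.φ S q) ≡ true → X q ≡ true) → ∀ q → X q ≡ true) where
  open Surface S

  private
    ok : Bool → D → Bool
    ok true q = true
    ok false q = okφ q
    data AR : D → Set where
      base-AR : AR d0
      step-AR : ∀ c q → ok c q ≡ true → AR (stp c q) → AR q
    Closed : (D → Bool) → Set
    Closed X = X d0 ≡ true × (∀ c q → ok c q ≡ true → X (stp c q) ≡ true → X q ≡ true)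
    grow : ∀ X → (∀ x → X x ≡ true → AR x) → (∃ λ x → X x ≡ false × AR x) ⊎ Closed X
    grow X h with X d0 in e0
    ... | false = inj₁ (d0 , e0 , base-AR)
    ... | true with FP.any? (λ q → (not (X q) ∧ (X (σ q) ∨ (ok false q ∧ X (φ q)))) Data.Bool.≟ true)
    ...   | yes (q , e) = inj₁ (q , not-true' (proj₁ (and-true {not (X q)} e)) , ar (∨-true (proj₂ (and-true {not (X q)} e))))
      where ar : X (σ q) ≡ true ⊎ ok false q ∧ X (φ q) ≡ true → AR q
            ar (inj₁ p) = step-AR true q refl (h (σ q) p)
            ar (inj₂ p) = step-AR false q (proj₁ (and-true {ok false q} p)) (h (φ q) (proj₂ (and-true {ok false q} p)))
    ...   | no none = inj₂ (refl , cl)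
      where cl : ∀ c q → ok c q ≡ true → X (stp c q) ≡ true → X q ≡ true
            cl c q o p with X q in e
            ... | true = refl
            ... | false = ⊥-elim (none (q , cong₂ _∧_ (cong not e) (or c o p)))
              where or : ∀ c → ok c q ≡ true → X (stp c q) ≡ true → X (σ q) ∨ (ok false q ∧ X (φ q)) ≡ true
                    or true o p = cong (_∨ (ok false q ∧ X (φ q))) p
                    or false o p with X (σ q)
                    ... | true = refl
                    ... | false = cong₂ _∧_ o p
    sat = saturate AR Closed grow
    X = proj₁ sat
    X0 : X d0 ≡ true
    X0 = proj₁ (proj₂ (proj₂ sat))
    Xcl = proj₂ (proj₂ (proj₂ sat))
    ar : ∀ q → AR q
    ar q = proj₁ (proj₂ sat) q (all X X0 (λ q → Xcl true q refl) (λ q → Xcl false q) q)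
    Lv : ℕ → D → Bool
    Lv zero q = does (q ≟ d0)
    Lv (suc k) q = Lv k q ∨ (Lv k (σ q) ∨ (ok false q ∧ Lv k (φ q)))
    ar-lv : ∀ q → AR q → ∃ λ k → Lv k q ≡ true
    ar-lv q base-AR = 0 , true-does (d0 ≟ d0) refl
    ar-lv q (step-AR true q o a) with ar-lv (σ q) a
    ... | k , e = suc k , (go (Lv k q) e)
      where go : ∀ u {v w} → v ≡ true → u ∨ (v ∨ w) ≡ true
            go true _ = refl
            go false refl = refl
    ar-lv q (step-AR false q o a) with ar-lv (φ q) a
    ... | k , e = suc k , go (Lv k q) (Lv k (σ q)) (cong₂ _∧_ o e)
      where go : ∀ u v {w} → w ≡ true → u ∨ (v ∨ w) ≡ true
            go true _ _ = refl
            go false true _ = refl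
            go false false e = e
    L : ∀ q → ∃ λ j → Lv j q ≡ true × (∀ i → i ℕ.< j → Lv i q ≡ false)
    L q = leastℕ (λ k → Lv k q) (proj₁ (ar-lv q (ar q))) (proj₂ (ar-lv q (ar q)))
  ρ : D → ℕ
  ρ q = proj₁ (L q)

  private
    ρ-min : ∀ k q → Lv k q ≡ true → ρ q ℕ.≤ k
    ρ-min k q e = ℕP.≮⇒≥ (λ l → true≢false (sym e ∙ proj₂ (proj₂ (L q)) k l))
    pick : ∀ q j → ρ q ≡ j → Σ[ c ∈ Bool ] ok c q ≡ true × (q ≢ d0 → ρ (stp c q) ℕ.< ρ q)
    pick q zero e = true , refl , λ ne → ⊥-elim (ne (does-true (q ≟ d0) (subst (λ k → Lv k q ≡ true) e (proj₁ (proj₂ (L q))))))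
    pick q (suc j) e = go (∨-true {Lv j q} (subst (λ k → Lv k q ≡ true) e (proj₁ (proj₂ (L q)))))
      where
      go2 : Lv j (σ q) ≡ true ⊎ ok false q ∧ Lv j (φ q) ≡ true → Σ[ c ∈ Bool ] ok c q ≡ true × (q ≢ d0 → ρ (stp c q) ℕ.< ρ q)
      go2 (inj₁ p) = true , refl , λ _ → subst (ρ (σ q) ℕ.<_) (sym e) (s≤s (ρ-min j (σ q) p))
      go2 (inj₂ p) = false , proj₁ (and-true {ok false q} p) , λ _ → subst (ρ (φ q) ℕ.<_) (sym e) (s≤s (ρ-min j (φ q) (proj₂ (and-true {ok false q} p))))
      go : Lv j q ≡ true ⊎ Lv j (σ q) ∨ (ok false q ∧ Lv j (φ q)) ≡ true → Σ[ c ∈ Bool ] ok c q ≡ true × (q ≢ d0 → ρ (stp c q) ℕ.< ρ q)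
      go (inj₁ p) = ⊥-elim (ℕP.<-irrefl refl (subst (ℕ._≤ j) e (ρ-min j q p)))
      go (inj₂ p) = go2 (∨-true {Lv j (σ q)} p)

  π : D → Bool
  π q = proj₁ (pick q (ρ q) refl)

  π-ok : ∀ q → π q ≡ false → okφ q ≡ true
  π-ok q e = subst (λ c → ok c q ≡ true) e (proj₁ (proj₂ (pick q (ρ q) refl)))

  ρ-dec : ∀ q → q ≢ d0 → ρ (nxt π q) ℕ.< ρ q
  ρ-dec q = proj₂ (proj₂ (pick q (ρ q) refl))

  nxt0 : D → D
  nxt0 q = if does (q ≟ d0) then d0 else nxt π q

  nxt0-ne : ∀ q → q ≢ d0 → nxt0 q ≡ nxt π q
  nxt0-ne q ne with q ≟ d0
  ... | yes p = ⊥-elim (ne p)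
  ... | no _ = refl

  reach : ∀ q → Orb nxt0 q d0
  reach q = go (ρ q) q ℕP.≤-refl
    where
    go : ∀ k q → ρ q ℕ.≤ k → Orb nxt0 q d0
    on : ∀ q → Dec (q ≡ d0) → ∀ k → ρ q ℕ.≤ k → Orb nxt0 q d0
    go k q l = on q (q ≟ d0) k l
    on q (yes e) k l = 0 , e
    on q (no ne) zero l = ⊥-elim (ℕP.n≮0 (ℕP.<-≤-trans (ρ-dec q ne) l))
    on q (no ne) (suc k) l = Orb-trans (1 , nxt0-ne q ne) (go k (nxt π q) (ℕP.≤-pred (ℕP.<-≤-trans (ρ-dec q ne) l)))

-- Policy improvement.

module Exist (S : Surface) (b : ℕ) (b≥1 : 1 ℕ.≤ b) (fo : Fin (Surface.Fc S)) (r0 : Fin (Surface.n S)) (r0o : Surface.face S r0 ≡ fo)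
  (hd : Fin (Surface.Fc S) → ℤ) (hd-eq : ∀ f → fib (Surface.face S) f (λ _ → 1ℤ) ≡ pos 2 * hd f)
  (od : fib (Surface.face S) fo (λ _ → 1ℤ) ≡ pos 2 * pos b)
  (innerα : ∀ r → Surface.face S r ≡ fo → Surface.face S (Surface.α S r) ≢ fo)
  (bound : ∀ hf f → hf f ≡ true → hf fo ≡ false → pos 2 * pos b ≤ ∑ (λ q → b2z (Cycles.bdry S hf q))) where
  open Surface S
  open Weights S b fo
  open Cycles S

  d0 : D
  d0 = α r0

  opaque
    base' : Σ[ y ∈ (D → ℤ) ] Σ[ z ∈ (D → ℤ) ] WS y z
    base' = Base.base S b fo hd hd-eq

  cost : Bool → D → ℤ
  cost true = proj₁ base'
  cost false = proj₁ (proj₂ base')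

  base-ws : WS (cost true) (cost false)
  base-ws = proj₂ (proj₂ base')

  nxt0 : (D → Bool) → D → D
  nxt0 π q = if does (q ≟ d0) then d0 else nxt π q

  nxt0-ne : ∀ π q → q ≢ d0 → nxt0 π q ≡ nxt π q
  nxt0-ne π q ne with q ≟ d0
  ... | yes p = ⊥-elim (ne p)
  ... | no _ = refl

  nxt0-d0 : ∀ π k → iter (nxt0 π) k d0 ≡ d0
  nxt0-d0 π zero = refl
  nxt0-d0 π (suc k) with iter (nxt0 π) k d0 ≟ d0
  ... | yes _ = refl
  ... | no ne = ⊥-elim (ne (nxt0-d0 π k))

  -- Outer darts are bound to `σ`, so no sign is asked of `z` on the outer face during the
  -- optimisation; that it equals 1 there is deduced at the end.
  record State : Set where
    field
      π : D → Bool
      val : ∀ q → face q ≡ fo → π q ≡ true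
      reach : ∀ q → Orb (nxt0 π) q d0

  initial : State
  initial = record { π = π ; val = val ; reach = reach }
    where
    okφ : D → Bool
    okφ q = not (does (face q ≟ fo))
    ok-false : ∀ q → face q ≢ fo → okφ q ≡ true
    ok-false q ne = cong not (false-does (face q ≟ fo) ne)
    module _ (X : D → Bool) (X0 : X d0 ≡ true) (Xcl : ∀ q → X (σ q) ≡ true → X q ≡ true) (Xcl' : ∀ q → okφ q ≡ true → X (φ q) ≡ true → X q ≡ true) where
      Xσ : ∀ q → X (σ q) ≡ X q
      Xσ q = bool-ext (Xcl q) (λ e → let (m , r) = Orb-sym σ-inj (Orb-step {f = σ} {q}) in back m (σ q) (cong X r ∙ e))
        where back : ∀ m y → X (iter σ m y) ≡ true → X y ≡ true
              back zero y e = e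
              back (suc m) y e = back m y (Xcl (iter σ m y) e)
      Xα→ : ∀ q → face q ≢ fo → X (α q) ≡ true → X q ≡ true
      Xα→ q ne e = Xcl' q (ok-false q ne) (Xσ (α q) ∙ e)
      -- `φ` steps are forbidden at outer darts, so the outer face is covered from the other side:
      -- `α r` gives `φ r` by rotation, and `α (φ r)` is an inner dart whose `φ` step lands at the
      -- vertex of `φ r`.
      outer : ∀ k → X (iter φ k r0) ≡ true × X (α (iter φ k r0)) ≡ true
      outer k = go k
        where
        fk : ∀ k → face (iter φ k r0) ≡ fo
        fk zero = r0o
        fk (suc k) = face-φ (iter φ k r0) ∙ fk k
        nx : ∀ r → face r ≡ fo → X (α r) ≡ true → X (φ r) ≡ true × X (α (φ r)) ≡ true
        nx r fr e = xr , Xα→ (α (φ r)) (innerα (φ r) (face-φ r ∙ fr)) (cong X (αα (φ r)) ∙ xr)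
          where xr : X (φ r) ≡ true
                xr = Xσ (α r) ∙ e
        αk : ∀ k → X (α (iter φ k r0)) ≡ true
        αk zero = X0
        αk (suc k) = proj₂ (nx (iter φ k r0) (fk k) (αk k))
        go : ∀ k → X (iter φ k r0) ≡ true × X (α (iter φ k r0)) ≡ true
        go zero with Orb-sym φ-inj (Orb-step {f = φ} {r0})
        ... | m , r = subst (λ w → X w ≡ true) (iter-suc φ m r0 ∙ r) (proj₁ (nx (iter φ m r0) (fk m) (αk m))) , X0
        go (suc k) = nx (iter φ k r0) (fk k) (αk k)
      Xout : ∀ q → face q ≡ fo → X q ≡ true × X (α q) ≡ true
      Xout q e with face-orb (r0o ∙ sym e)
      ... | k , refl = outer k
      Xα : ∀ q → X (α q) ≡ X q
      Xα q with face q ≟ fo | face (α q) ≟ fo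
      ... | yes e | _ = proj₂ (Xout q e) ∙ sym (proj₁ (Xout q e))
      ... | no _ | yes e = proj₁ (Xout (α q) e) ∙ sym (cong X (sym (αα q)) ∙ proj₂ (Xout (α q) e))
      ... | no ne | no ne' = bool-ext (Xα→ q ne) (λ e → Xα→ (α q) ne' (cong X (αα q) ∙ e))
      everything : ∀ q → X q ≡ true
      everything q = conn X Xσ Xα q d0 ∙ X0
    open BFS S d0 okφ everything using (π; π-ok; reach)
    val : ∀ q → face q ≡ fo → π q ≡ true
    val q e = go (π q) refl
      where go : ∀ c → π q ≡ c → π q ≡ true
            go true p = p
            go false p = ⊥-elim (true≢false (sym (π-ok q p) ∙ cong not (true-does (face q ≟ fo) e)))

  module OfState (st : State) where
    open State st public

    rk = rank (nxt0 π) d0 reach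
    ℓ = proj₁ rk
    ℓ-dec : ∀ q → q ≢ d0 → ℓ (nxt π q) ℕ.< ℓ q
    ℓ-dec q ne = subst (λ x → ℓ x ℕ.< ℓ q) (nxt0-ne π q ne) (proj₁ (proj₂ rk) q ne)
    ℓ<n = proj₂ (proj₂ rk)
    open Policy π d0 ℓ ℓ-dec ℓ<n public

    p : D → ℤ
    p = pot (λ q → - cost (π q) q)

    -- Reduced costs: adding the coboundary of the potential keeps the tested system and makes the
    -- cost of every chosen step vanish away from `d0`.
    w : Bool → D → ℤ
    w true q = cost true q + 1ℤ * ∂σ p q
    w false q = cost false q + 1ℤ * ∂φ p q

    w-eq : ∀ b q → w b q ≡ cost b q + (p q - p (stp b q))
    w-eq true q = cong (cost true q +_) (ℤP.*-identityˡ (p q - p (σ q)))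
    w-eq false q = cong (cost false q +_) (ℤP.*-identityˡ (p q - p (φ q)))

    w-ws : WS (w true) (w false)
    w-ws hv he hf = cong (pos 2 *_) (Wk-lin (cost true) (cost false) (∂σ p) (∂φ p) 1ℤ hv he hf ∙ cong (λ u → Wk (cost true) (cost false) hv he hf + 1ℤ * u) (∂-circ p hv he hf) ∙ (ℤP.+-identityʳ _)) ∙ base-ws hv he hf

    exit : ∀ q → q ≢ d0 → w (π q) q ≡ 0ℤ
    exit q ne = w-eq (π q) q ∙ cong (λ u → cost (π q) q + (u - p (nxt π q))) (pot-step (λ q → - cost (π q) q) q ne) ∙ l (cost (π q) q) (p (nxt π q))
      where l : ∀ a b → a + ((- a + b) - b) ≡ 0ℤ
            l = solve-∀

    toPath : ∀ k t d → d ≢ d0 → iter (nxt0 π) k t ≡ d → Path (nxt π) d0 d t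
    toPath zero t d ne refl = here
    toPath (suc k) t d ne e with t ≟ d0
    ... | yes refl = ⊥-elim (ne (sym e ∙ nxt0-d0 π (suc k)))
    ... | no ne' = step ne' (toPath k (nxt π t) d ne (cong (iter (nxt0 π) k) (sym (nxt0-ne π t ne')) ∙ sym (iter-suc (nxt0 π) k t) ∙ e))

    toPath0 : ∀ k t → iter (nxt0 π) k t ≡ d0 → Path (nxt π) d0 d0 t
    toPath0 zero t refl = here
    toPath0 (suc k) t e with t ≟ d0
    ... | yes refl = here
    ... | no ne' = step ne' (toPath0 k (nxt π t) (cong (iter (nxt0 π) k) (sym (nxt0-ne π t ne')) ∙ sym (iter-suc (nxt0 π) k t) ∙ e))

    -- A lexicographic order packed into one integer: the number of `σ` steps is at most `n`, so it
    -- decides only between equal total potentials.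
    meas : ℤ
    meas = pos (suc n) * ∑ p + ∑ (λ q → b2z (π q))

    d0≢R : face d0 ≢ fo
    d0≢R = innerα r0 r0o

    -- A switch that closes a cycle would leave darts cut off from `d0`, so it cannot be performed;
    -- the cost estimate says that it would not have been an improvement.
    cyc-σ : ∀ q → π q ≡ false → q ≢ d0 → Orb (nxt0 π) (σ q) q → 1ℤ ≤ w true q
    cyc-σ q e ne (k , o) = CycleCost.cost-σ S b b≥1 fo r0 r0o bound π ℓ ℓ-dec ℓ<n (val r0 r0o) w w-ws exit q true (cong not (sym e))
       (λ { refl → true≢false (sym (val r0 r0o) ∙ e) }) (toPath k (σ q) q ne o) refl

    cyc-φ : ∀ q → π q ≡ true → face q ≢ fo → q ≢ d0 → Orb (nxt0 π) (φ q) q → 0ℤ ≤ w false q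
    cyc-φ q e nf ne (k , o) = CycleCost.cost-φ S b b≥1 fo r0 r0o bound π ℓ ℓ-dec ℓ<n (val r0 r0o) w w-ws exit q false (cong not (sym e))
       (λ { refl → nf r0o }) (toPath k (φ q) q ne o) refl

    -- Slackness says nothing at `d0`, where walks stop. The step prescribed there does not affect
    -- them, so it may be set opposite to `s`; the walk from `stp s d0` back to `d0` then supplies
    -- the cycle for the cost estimate.
    module AtRoot (s : Bool) where
      π* : D → Bool
      π* q = if does (q ≟ d0) then not s else π q
      π*-ne : ∀ q → q ≢ d0 → π* q ≡ π q
      π*-ne q ne with q ≟ d0
      ... | yes p = ⊥-elim (ne p)
      ... | no _ = refl
      π*-d0 : π* d0 ≡ not s
      π*-d0 with d0 ≟ d0
      ... | yes _ = refl
      ... | no ne = ⊥-elim (ne refl)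
      dec* : ∀ q → q ≢ d0 → ℓ (nxt π* q) ℕ.< ℓ q
      dec* q ne = subst (λ c → ℓ (stp c q) ℕ.< ℓ q) (sym (π*-ne q ne)) (ℓ-dec q ne)
      r0≢d0 : r0 ≢ d0
      r0≢d0 e = d0≢R (cong face (sym e) ∙ r0o)
      path* : ∀ t → Path (nxt π) d0 d0 t → Path (nxt π*) d0 d0 t
      path* t here = here
      path* t (step ne p) = step ne (subst (λ c → Path (nxt π*) d0 d0 (stp c t)) (sym (π*-ne t ne)) (path* (nxt π t) p))
      exit* : ∀ q → q ≢ d0 → w (π* q) q ≡ 0ℤ
      exit* q ne = cong (λ c → w c q) (π*-ne q ne) ∙ exit q ne
      nn' : ∀ u → u ≡ not (not u)
      nn' true = refl
      nn' false = refl
      path : Path (nxt π*) d0 d0 (stp s d0)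
      path = path* (stp s d0) (toPath0 (proj₁ (reach (stp s d0))) (stp s d0) (proj₂ (reach (stp s d0))))
      cσ : s ≡ true → 1ℤ ≤ w s d0
      cσ = CycleCost.cost-σ S b b≥1 fo r0 r0o bound π* ℓ dec* ℓ<n (π*-ne r0 r0≢d0 ∙ val r0 r0o) w w-ws exit* d0 s (nn' s ∙ cong not (sym π*-d0)) (λ e → r0≢d0 (sym e)) path
      cφ : s ≡ false → 0ℤ ≤ w s d0
      cφ = CycleCost.cost-φ S b b≥1 fo r0 r0o bound π* ℓ dec* ℓ<n (π*-ne r0 r0≢d0 ∙ val r0 r0o) w w-ws exit* d0 s (nn' s ∙ cong not (sym π*-d0)) (λ e → r0≢d0 (sym e)) path

  -- The bounds 0 and 1 differ because ties are decided in favour of `σ`: away from `d0`, `φ` is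
  -- then followed exactly where the weight is positive, and the walk can be read off from the signs
  -- of `x`.
  record Optimal : Set where
    field
      st : State
    open OfState st
    field
      opt-φ : ∀ q → π q ≡ true → face q ≢ fo → q ≢ d0 → 0ℤ ≤ w false q
      opt-σ : ∀ q → π q ≡ false → q ≢ d0 → 1ℤ ≤ w true q

  module Flip (st : State) (q : D) (ne : q ≢ d0) (nf : face q ≢ fo)
    (free : ¬ Orb (nxt0 (State.π st)) (stp (not (State.π st q)) q) q) (worse : OfState.w st (not (State.π st q)) q ≤ 0ℤ) where
    module O = OfState st
    π' : D → Bool
    π' x = if does (x ≟ q) then not (O.π q) else O.π x
    π'-q : π' q ≡ not (O.π q)
    π'-q with q ≟ q
    ... | yes _ = refl
    ... | no n = ⊥-elim (n refl)
    π'-ne : ∀ x → x ≢ q → π' x ≡ O.π x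
    π'-ne x n with x ≟ q
    ... | yes p = ⊥-elim (n p)
    ... | no _ = refl
    same : ∀ x → x ≢ q → nxt0 π' x ≡ nxt0 O.π x
    same x n with x ≟ d0
    ... | yes _ = refl
    ... | no _ = cong (λ c → stp c x) (π'-ne x n)
    avoid : ∀ k x → iter (nxt0 O.π) k x ≡ d0 → ¬ Orb (nxt0 O.π) x q → Orb (nxt0 π') x d0
    avoid zero x e no-q = 0 , e
    avoid (suc k) x e no-q = Orb-trans (1 , same x (λ p → no-q (0 , p))) (avoid k (nxt0 O.π x) (sym (iter-suc (nxt0 O.π) k x) ∙ e) (λ o → no-q (Orb-trans Orb-step o)))
    t = stp (not (O.π q)) q
    from-t : Orb (nxt0 π') t d0
    from-t = avoid (proj₁ (O.reach t)) t (proj₂ (O.reach t)) free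
    from-q : Orb (nxt0 π') q d0
    from-q = Orb-trans (1 , nxt0-ne π' q ne ∙ cong (λ c → stp c q) π'-q) from-t
    reach' : ∀ k x → iter (nxt0 O.π) k x ≡ d0 → Orb (nxt0 π') x d0
    reach' zero x e = 0 , e
    reach' (suc k) x e with x ≟ q
    ... | yes refl = from-q
    ... | no n = Orb-trans (1 , same x n) (reach' k (nxt0 O.π x) (sym (iter-suc (nxt0 O.π) k x) ∙ e))
    st' : State
    st' = record { π = π' ; val = λ x e → π'-ne x (λ p → nf (cong face (sym p) ∙ e)) ∙ O.val x e ; reach = λ x → reach' (proj₁ (O.reach x)) x (proj₂ (O.reach x)) }
    module O' = OfState st'

    p-step : ∀ x → x ≢ d0 → O'.p x ≡ - cost (π' x) x + O'.p (nxt π' x)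
    p-step x n = O'.pot-step (λ q → - cost (π' q) q) x n

    -- Induction along the new walks: away from `q` their steps are the old ones, and at `q` the
    -- potential rises by minus the reduced cost of the new step, besides what is gained further on.
    gain : ∀ k x → O'.ℓ x ℕ.< k → O.p x ≤ O'.p x
    gain-q : ∀ k → O'.ℓ q ℕ.< suc k → O.p q - O.w (not (O.π q)) q ≤ O'.p q
    gain (suc k) x l = go (x ≟ d0) (x ≟ q)
      where
      go : Dec (x ≡ d0) → Dec (x ≡ q) → O.p x ≤ O'.p x
      go (yes e) _ = ℤP.≤-reflexive (cong O.p e ∙ (O.pot-d0 _) ∙ sym (cong O'.p e ∙ (O'.pot-d0 _)))
      go (no nd) (yes refl) = ℤP.≤-trans (≤-by (- O.w (not (O.π q)) q) (ℤP.neg-mono-≤ worse) (lm (O.p q) (O.w (not (O.π q)) q))) (gain-q k l)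
        where lm : ∀ a c → (a - c) - a ≡ - c
              lm = solve-∀
      go (no nd) (no nq) = ≤-by (O'.p (nxt O.π x) - O.p (nxt O.π x)) (0≤- (gain k (nxt O.π x) (subst (λ c → O'.ℓ (stp c x) ℕ.< k) (π'-ne x nq) (ℕP.<-≤-trans (O'.ℓ-dec x nd) (ℕP.≤-pred l)))))
            (cong₂ _-_ (p-step x nd ∙ cong (λ c → - cost c x + O'.p (stp c x)) (π'-ne x nq)) (O.pot-step (λ q → - cost (O.π q) q) x nd) ∙ lm (- cost (O.π x) x) (O'.p (nxt O.π x)) (O.p (nxt O.π x)))
        where lm : ∀ c a e → (c + a) - (c + e) ≡ a - e
              lm = solve-∀
    gain-q k l = ≤-by (O'.p t - O.p t) (0≤- (gain k t (subst (λ c → O'.ℓ (stp c q) ℕ.< k) π'-q (ℕP.<-≤-trans (O'.ℓ-dec q ne) (ℕP.≤-pred l)))))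
        (cong₂ (λ u v → u - (O.p q - v)) (p-step q ne ∙ cong (λ c → - cost c q + O'.p (stp c q)) π'-q) (O.w-eq (not (O.π q)) q) ∙ lm (cost (not (O.π q)) q) (O'.p t) (O.p q) (O.p t))
      where lm : ∀ c a e f → (- c + a) - (e - (c + (e - f))) ≡ a - f
            lm = solve-∀

    p≤ : ∀ x → O.p x ≤ O'.p x
    p≤ x = gain (suc (O'.ℓ x)) x ℕP.≤-refl

    ∑π : ∑ (λ x → b2z (π' x)) ≡ ∑ (λ x → b2z (O.π x)) + (b2z (not (O.π q)) - b2z (O.π q))
    ∑π = ∑-cong pt ∙ ∑-update q (λ x → b2z (O.π x)) (b2z (not (O.π q)))
      where pt : ∀ x → b2z (π' x) ≡ (if does (x ≟ q) then b2z (not (O.π q)) else b2z (O.π x))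
            pt x with does (x ≟ q)
            ... | true = refl
            ... | false = refl

    -- the number of σ-steps breaks ties
    better-σ : O.π q ≡ false → 1ℤ + O.meas ≤ O'.meas
    better-σ e = ≤-by (pos (suc n) * (∑ O'.p - ∑ O.p)) (0≤* {pos (suc n)} (ℤ.+≤+ z≤n) (0≤- (∑-mono p≤)))
        (cong (λ u → (pos (suc n) * ∑ O'.p + u) - (1ℤ + O.meas)) (∑π ∙ cong (λ c → ∑ (λ x → b2z (O.π x)) + (b2z (not c) - b2z c)) e) ∙ lm (pos (suc n)) (∑ O'.p) (∑ O.p) (∑ (λ x → b2z (O.π x))))
      where lm : ∀ m a c s → (m * a + (s + (1ℤ - 0ℤ))) - (1ℤ + (m * c + s)) ≡ m * (a - c)
            lm = solve-∀

    -- One `σ` step is lost, so the total potential must grow: a reduced cost of at most -1 raises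
    -- it by at least 1, worth `n + 1` in the measure.
    better-φ : O.π q ≡ true → 1ℤ + O.w (not (O.π q)) q ≤ 0ℤ → 1ℤ + O.meas ≤ O'.meas
    better-φ e strict = ≤-by (pos (suc n) * ((∑ O'.p - ∑ O.p) - 1ℤ) + (pos n - 1ℤ)) (0≤+ (0≤* {pos (suc n)} (ℤ.+≤+ z≤n) (0≤- sum1)) (0≤- 1≤n))
        (cong (λ u → (pos (suc n) * ∑ O'.p + u) - (1ℤ + O.meas)) (∑π ∙ cong (λ c → ∑ (λ x → b2z (O.π x)) + (b2z (not c) - b2z c)) e) ∙ cong (λ m → (m * ∑ O'.p + (∑ (λ x → b2z (O.π x)) + (0ℤ - 1ℤ))) - (1ℤ + (m * ∑ O.p + ∑ (λ x → b2z (O.π x))))) (ℤP.pos-+ 1 n) ∙ lm (pos n) (∑ O'.p) (∑ O.p) (∑ (λ x → b2z (O.π x))) ∙ cong (λ m → m * ((∑ O'.p - ∑ O.p) - 1ℤ) + (pos n - 1ℤ)) (sym (ℤP.pos-+ 1 n)))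
      where
      lm : ∀ m a c s → ((1ℤ + m) * a + (s + (0ℤ - 1ℤ))) - (1ℤ + ((1ℤ + m) * c + s)) ≡ (1ℤ + m) * ((a - c) - 1ℤ) + (m - 1ℤ)
      lm = solve-∀
      1≤n : 1ℤ ≤ pos n
      1≤n = ℤ.+≤+ (ℕP.≤-trans (s≤s z≤n) (FP.toℕ<n q))
      sum1 : 1ℤ ≤ ∑ O'.p - ∑ O.p
      sum1 = subst (1ℤ ≤_) (∑-- O'.p O.p) (ℤP.≤-trans g1 (∑-term (λ x → O'.p x - O.p x) (λ x → 0≤- (p≤ x)) q))
        where g1 : 1ℤ ≤ O'.p q - O.p q
              g1 = ≤-by ((O'.p q - (O.p q - O.w (not (O.π q)) q)) + (0ℤ - (1ℤ + O.w (not (O.π q)) q))) (0≤+ (0≤- (gain-q (O'.ℓ q) ℕP.≤-refl)) (0≤- strict)) (l (O'.p q) (O.p q) (O.w (not (O.π q)) q))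
                where l : ∀ a c w → (a - c) - 1ℤ ≡ (a - (c - w)) + (0ℤ - (1ℤ + w))
                      l = solve-∀

  improve : (st : State) → (Σ[ st' ∈ State ] 1ℤ + OfState.meas st ≤ OfState.meas st') ⊎ Optimal
  improve st = try1 (FP.any? bad1?)
    where
    open OfState st
    Result : Set
    Result = (Σ[ st' ∈ State ] 1ℤ + meas ≤ OfState.meas st') ⊎ Optimal
    Bad1 Bad2 : D → Set
    Bad1 q = (π q ≡ true × face q ≢ fo × q ≢ d0) × (w false q < 0ℤ)
    Bad2 q = (π q ≡ false × q ≢ d0) × (w true q < 1ℤ)
    _×?_ : ∀ {P Q : Set} → Dec P → Dec Q → Dec (P × Q)
    yes p ×? yes q = yes (p , q)
    yes p ×? no q = no (λ x → q (proj₂ x))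
    no p ×? _ = no (λ x → p (proj₁ x))
    ¬? : ∀ {P : Set} → Dec P → Dec (¬ P)
    ¬? (yes p) = no (λ n → n p)
    ¬? (no n) = yes n
    bad1? : ∀ q → Dec (Bad1 q)
    bad1? q = ((π q Data.Bool.≟ true) ×? ((¬? (face q ≟ fo)) ×? (¬? (q ≟ d0)))) ×? (w false q ℤP.<? 0ℤ)
    bad2? : ∀ q → Dec (Bad2 q)
    bad2? q = ((π q Data.Bool.≟ false) ×? (¬? (q ≟ d0))) ×? (w true q ℤP.<? 1ℤ)
    nR : ∀ q → π q ≡ false → face q ≢ fo
    nR q e f = true≢false (sym (val q f) ∙ e)
    try2 : (∀ q → ¬ Bad1 q) → Dec (∃ Bad2) → Result
    try2 g1 (no g2) = inj₂ (record { st = st ; opt-φ = λ q e f n → ℤP.≮⇒≥ (λ l → g1 q ((e , f , n) , l)) ; opt-σ = λ q e n → ℤP.≮⇒≥ (λ l → g2 (q , (e , n) , l)) })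
    try2 g1 (yes (q , (e , n) , l)) = decide (orb? (nxt0 π) (stp (not (π q)) q) q)
      where worse : w (not (π q)) q ≤ 0ℤ
            worse = subst (λ c → w (not c) q ≤ 0ℤ) (sym e) (≤-by (1ℤ - (1ℤ + w true q)) (0≤- (<⇒1+≤ l)) (lw (w true q)))
              where lw : ∀ a → 0ℤ - a ≡ 1ℤ - (1ℤ + a)
                    lw = solve-∀
            decide : Dec (Orb (nxt0 π) (stp (not (π q)) q) q) → Result
            decide (yes o) = ⊥-elim (ℤP.<⇒≱ l (cyc-σ q e n (subst (λ c → Orb (nxt0 π) (stp (not c) q) q) e o)))
            decide (no free) = inj₁ (Flip.st' st q n (nR q e) free worse , Flip.better-σ st q n (nR q e) free worse e)
    try1 : Dec (∃ Bad1) → Result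
    try1 (no g1) = try2 (λ q bq → g1 (q , bq)) (FP.any? bad2?)
    try1 (yes (q , (e , f , n) , l)) = decide (orb? (nxt0 π) (stp (not (π q)) q) q)
      where strict : 1ℤ + w (not (π q)) q ≤ 0ℤ
            strict = subst (λ c → 1ℤ + w (not c) q ≤ 0ℤ) (sym e) (<⇒1+≤ l)
            worse : w (not (π q)) q ≤ 0ℤ
            worse = ℤP.≤-trans (ℤP.i≤suc[i] (w (not (π q)) q)) strict
            decide : Dec (Orb (nxt0 π) (stp (not (π q)) q) q) → Result
            decide (yes o) = ⊥-elim (ℤP.<⇒≱ l (cyc-φ q e f n (subst (λ c → Orb (nxt0 π) (stp (not c) q) q) e o)))
            decide (no free) = inj₁ (Flip.st' st q n f free worse , Flip.better-φ st q n f free worse e strict)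

  -- Each improvement raises an integer measure, and `Mx` bounds it: costs are at most `Cm` in size
  -- and a potential adds up at most `n + 1` of them.
  optimal : Optimal
  optimal = go ℤ.∣ Mx - OfState.meas initial ∣ initial (ℤP.≤-reflexive (l (Mx - OfState.meas initial) (OfState.meas initial) Mx ∙ cong (_+ OfState.meas initial) (sym (ℤP.0≤i⇒+∣i∣≡i (0≤- (meas≤ initial))))))
    where
    l : ∀ a c m → m ≡ (m - c) + c
    l _ = solve-∀
    Cm : ℤ
    Cm = ∑ (λ q → pos ℤ.∣ cost true q ∣ + pos ℤ.∣ cost false q ∣)
    0≤Cm : 0ℤ ≤ Cm
    0≤Cm = ∑-nonneg {g = λ q → pos ℤ.∣ cost true q ∣ + pos ℤ.∣ cost false q ∣} (λ q → 0≤+ {pos ℤ.∣ cost true q ∣} {pos ℤ.∣ cost false q ∣} (ℤ.+≤+ z≤n) (ℤ.+≤+ z≤n))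
    abs≤ : ∀ i → - i ≤ pos ℤ.∣ i ∣
    abs≤ (pos zero) = ℤP.≤-refl
    abs≤ (pos (suc k)) = ℤ.-≤+
    abs≤ -[1+ k ] = ℤP.≤-refl
    cm : ∀ c q → - cost c q ≤ Cm
    cm c q = ℤP.≤-trans (le c) (∑-term (λ q → pos ℤ.∣ cost true q ∣ + pos ℤ.∣ cost false q ∣) (λ q → 0≤+ {pos ℤ.∣ cost true q ∣} {pos ℤ.∣ cost false q ∣} (ℤ.+≤+ z≤n) (ℤ.+≤+ z≤n)) q)
      where le : ∀ c → - cost c q ≤ pos ℤ.∣ cost true q ∣ + pos ℤ.∣ cost false q ∣
            le true = ℤP.≤-trans (abs≤ (cost true q)) (ℤP.i≤i+j (pos ℤ.∣ cost true q ∣) (pos ℤ.∣ cost false q ∣))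
            le false = ℤP.≤-trans (abs≤ (cost false q)) (ℤP.i≤j+i (pos ℤ.∣ cost false q ∣) (pos ℤ.∣ cost true q ∣))
    Mx : ℤ
    Mx = pos (suc n) * (pos n * (pos (suc n) * Cm)) + pos n
    meas≤ : ∀ st → OfState.meas st ≤ Mx
    meas≤ st = ℤP.+-mono-≤ (ℤP.*-monoˡ-≤-nonNeg (pos (suc n)) (ℤP.≤-trans (∑-mono (λ q → pot-bound (λ q → - cost (π q) q) Cm 0≤Cm (λ q → cm (π q) q) q)) (ℤP.≤-reflexive (∑-const n (pos (suc n) * Cm)))))
       (ℤP.≤-trans (∑-mono (λ q → b2z≤1 (π q))) (ℤP.≤-reflexive (∑-const n 1ℤ ∙ ℤP.*-identityʳ (pos n))))
      where open OfState st
    go : ∀ k st → Mx ≤ pos k + OfState.meas st → Optimal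
    go k st le = next k le (improve st)
      where
      next : ∀ k → Mx ≤ pos k + OfState.meas st → (Σ[ st' ∈ State ] 1ℤ + OfState.meas st ≤ OfState.meas st') ⊎ Optimal → Optimal
      next k le (inj₂ o) = o
      next zero le (inj₁ (st' , better)) = ⊥-elim (ℤP.<-irrefl refl (1+≤⇒< (ℤP.≤-trans better (ℤP.≤-trans (meas≤ st') (ℤP.≤-trans le (ℤP.≤-reflexive (ℤP.+-identityˡ (OfState.meas st))))))))
      next (suc k) le (inj₁ (st' , better)) = go k st' (ℤP.≤-trans le (≤-by (OfState.meas st' - (1ℤ + OfState.meas st)) (0≤- better) (cong (λ u → (pos k + OfState.meas st') - (u + OfState.meas st)) (ℤP.pos-+ 1 k) ∙ lk (pos k) (OfState.meas st') (OfState.meas st))))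
        where lk : ∀ k a c → (k + a) - ((1ℤ + k) + c) ≡ a - (1ℤ + c)
              lk = solve-∀

  module Final (y z : D → ℤ) (sol : Sol y z) (π : D → Bool) (val : ∀ q → face q ≡ fo → π q ≡ true) (reach : ∀ q → Orb (nxt0 π) q d0)
    (y-σ : ∀ q → q ≢ d0 → π q ≡ true → y q ≡ 0ℤ) (z-φ : ∀ q → q ≢ d0 → π q ≡ false → z q ≡ 0ℤ)
    (0≤y : ∀ q → 0ℤ ≤ y q) (0≤z : ∀ q → face q ≢ fo → 0ℤ ≤ z q) (1≤y : ∀ q → π q ≡ false → q ≢ d0 → 1ℤ ≤ y q) where
    open Sol sol
    d0≢R : face d0 ≢ fo
    d0≢R = innerα r0 r0o
    x : D → ℤ
    x q = y q - z q
    d0≢ : ∀ r → face r ≡ fo → r ≢ d0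
    d0≢ r e p = d0≢R (cong face (sym p) ∙ e)
    y≤B : ∀ q → y q ≤ B
    y≤B q = ℤP.≤-trans (ℤP.≤-reflexive (sym (cong (_* y q) (ind-refl (vert q)) ∙ ℤP.*-identityˡ (y q))))
        (ℤP.≤-trans (∑-term (λ d → ind (vert d) (vert q) * y d) (λ d → 0≤* (0≤ind (vert d) (vert q)) (0≤y d)) q) (ℤP.≤-reflexive (sv (vert q))))
    z≤1 : ∀ r → face r ≡ fo → 0ℤ ≤ 1ℤ - z r
    z≤1 r e = subst (0ℤ ≤_) (sym eq) (0≤+ (0≤- (y≤B (α r))) (0≤z (α r) (innerα r e)))
      where
      l : ∀ z a c b → (0ℤ - z) + (a - c) ≡ b - 1ℤ → 1ℤ - z ≡ (b - a) + c
      l z a c b e = l1 z a c ∙ cong (λ u → (u + 1ℤ) - (a - c)) e ∙ l2 a c b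
        where l1 : ∀ z a c → 1ℤ - z ≡ (((0ℤ - z) + (a - c)) + 1ℤ) - (a - c)
              l1 = solve-∀
              l2 : ∀ a c b → ((b - 1ℤ) + 1ℤ) - (a - c) ≡ (b - a) + c
              l2 = solve-∀
      eq : 1ℤ - z r ≡ (B - y (α r)) + z (α r)
      eq = l (z r) (y (α r)) (z (α r)) B (cong (λ u → (u - z r) + (y (α r) - z (α r))) (sym (y-σ r (d0≢ r e) (val r e))) ∙ se r)
    -- Every outer `z` is at most 1, because the opposite dart has `y ≤ B` and `z ≥ 0`; the degree
    -- `2B` and the outer face condition force the sum of `1 - z` over the face to be 0.
    z1 : ∀ r → face r ≡ fo → z r ≡ 1ℤ
    z1 r e = l (z r) (sym (cong (_* (1ℤ - z r)) (cong (λ f → ind f fo) e ∙ ind-refl fo) ∙ ℤP.*-identityˡ (1ℤ - z r)) ∙ ∑-zero⁻ g g≥0 sum0 r)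
      where
      l : ∀ z → 1ℤ - z ≡ 0ℤ → z ≡ 1ℤ
      l z e = l1 z ∙ cong (_-_ 1ℤ) e
        where l1 : ∀ z → z ≡ 1ℤ - (1ℤ - z)
              l1 = solve-∀
      g : D → ℤ
      g q = ind (face q) fo * (1ℤ - z q)
      g≥0 : ∀ q → 0ℤ ≤ g q
      g≥0 q with ind-case (face q) fo
      ... | inj₁ (p , i) = subst (0ℤ ≤_) (sym (cong (_* (1ℤ - z q)) i ∙ ℤP.*-identityˡ (1ℤ - z q))) (z≤1 q p)
      ... | inj₂ (p , i) = ℤP.≤-reflexive (sym (cong (_* (1ℤ - z q)) i))
      sum0 : ∑ g ≡ 0ℤ
      sum0 = cancel2 (sym (∑-*ˡ (pos 2) g) ∙ ∑-cong (λ q → l2 (ind (face q) fo) (z q)) ∙ ∑-+ (λ q → ind (face q) fo * 1ℤ) (λ q → ind (face q) fo * (1ℤ - pos 2 * z q)) ∙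
           cong₂ _+_ od (sf fo ∙ cong (λ i → pos 2 * B - pos 4 * B * i) (ind-refl fo)) ∙ l3 B)
        where l2 : ∀ i z → pos 2 * (i * (1ℤ - z)) ≡ i * 1ℤ + i * (1ℤ - pos 2 * z)
              l2 = solve-∀
              l3 : ∀ b → pos 2 * b + (pos 2 * b - pos 4 * b * 1ℤ) ≡ pos 2 * 0ℤ
              l3 = solve-∀
    o4' : ∀ r → face r ≡ fo → x r ≡ -1ℤ
    o4' r e = cong₂ _-_ (y-σ r (d0≢ r e) (val r e)) (z1 r e)
    o1' : ∀ q → x q + x (α q) ≡ B - 1ℤ
    o1' = se
    zd0 : z d0 ≡ 0ℤ
    zd0 = ℤP.≤-antisym (≤-by (B - y d0) (0≤- (y≤B d0)) (l1 (y d0) (z d0) ∙ cong (_- y d0) xd)) (0≤z d0 d0≢R)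
      where
      l1 : ∀ a c → 0ℤ - c ≡ (a - c) - a
      l1 = solve-∀
      l2 : ∀ u v → v ≡ (u + v) - u
      l2 = solve-∀
      l3 : ∀ b → (b - 1ℤ) - -1ℤ ≡ b
      l3 = solve-∀
      xd : y d0 - z d0 ≡ B
      xd = l2 (x r0) (y d0 - z d0) ∙ cong₂ _-_ (se r0) (o4' r0 r0o) ∙ l3 B
    sp : ∀ q → (y q ≡ 0ℤ × 0ℤ ≤ z q) ⊎ (z q ≡ 0ℤ × 0ℤ ≤ y q)
    sp q = go (q ≟ d0) (π q) refl
      where go : Dec (q ≡ d0) → ∀ c → π q ≡ c → (y q ≡ 0ℤ × 0ℤ ≤ z q) ⊎ (z q ≡ 0ℤ × 0ℤ ≤ y q)
            go (yes e) c _ = inj₂ (cong z e ∙ zd0 , 0≤y q)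
            go (no n) false e = inj₂ (z-φ q n e , 0≤y q)
            go (no n) true e = inj₁ (y-σ q n e , zz (face q ≟ fo))
              where zz : Dec (face q ≡ fo) → 0ℤ ≤ z q
                    zz (yes f) = subst (0ℤ ≤_) (sym (z1 q f)) (ℤ.+≤+ z≤n)
                    zz (no f) = 0≤z q f
    ppx : ∀ q → pp (x q) ≡ y q × nn (x q) ≡ z q
    ppx q = go (sp q)
      where
      l : ∀ z → - (0ℤ - z) ≡ z
      l = solve-∀
      xz : z q ≡ 0ℤ → x q ≡ y q
      xz a = cong (_-_ (y q)) a ∙ ℤP.+-identityʳ (y q)
      neg : y q ≡ 0ℤ → 0ℤ ≤ z q → x q ≤ 0ℤ
      neg a c = ≤-by (z q) c (cong (λ u → 0ℤ - (u - z q)) a ∙ l' (z q))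
        where l' : ∀ z → 0ℤ - (0ℤ - z) ≡ z
              l' = solve-∀
      ps : z q ≡ 0ℤ → 0ℤ ≤ y q → 0ℤ ≤ x q
      ps a c = subst (0ℤ ≤_) (sym (xz a)) c
      go : (y q ≡ 0ℤ × 0ℤ ≤ z q) ⊎ (z q ≡ 0ℤ × 0ℤ ≤ y q) → pp (x q) ≡ y q × nn (x q) ≡ z q
      go (inj₁ (a , c)) = np-true (x q) (nonpos-np-true (x q) (neg a c)) ∙ sym a , nn-neg (x q) (neg a c) ∙ cong (λ u → - (u - z q)) a ∙ l (z q)
      go (inj₂ (a , c)) = pp-id (x q) (ps a c) ∙ xz a , nn-zero (x q) (ps a c) ∙ sym a
    o2' : ∀ v → fib vert v (pp ∘ x) ≡ B
    o2' v = ∑-cong (λ q → cong (ind (vert q) v *_) (proj₁ (ppx q))) ∙ sv v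
    o3' : ∀ f → f ≢ fo → fib face f (λ q → 1ℤ - pos 2 * nn (x q)) ≡ pos 2 * B
    o3' f ne = ∑-cong (λ q → cong (λ u → ind (face q) f * (1ℤ - pos 2 * u)) (proj₂ (ppx q))) ∙ sf f ∙ cong (λ i → pos 2 * B - pos 4 * B * i) (ind-no (λ p → ne (sym p))) ∙ l B
      where l : ∀ b → pos 2 * b - pos 4 * b * 0ℤ ≡ pos 2 * b
            l = solve-∀
    npx : ∀ q → q ≢ d0 → np (x q) ≡ π q
    npx q n = go (π q) refl
      where go : ∀ c → π q ≡ c → np (x q) ≡ π q
            go true e = nonpos-np-true (x q) (≤-by (z q) (zz (face q ≟ fo)) (cong (λ u → 0ℤ - (u - z q)) (y-σ q n e) ∙ l (z q))) ∙ sym e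
              where l : ∀ z → 0ℤ - (0ℤ - z) ≡ z
                    l = solve-∀
                    zz : Dec (face q ≡ fo) → 0ℤ ≤ z q
                    zz (yes f) = subst (0ℤ ≤_) (sym (z1 q f)) (ℤ.+≤+ z≤n)
                    zz (no f) = 0≤z q f
            go false e = pos-np-false (x q) (subst (1ℤ ≤_) (sym (cong (_-_ (y q)) (z-φ q n e) ∙ ℤP.+-identityʳ (y q))) (1≤y q e n)) ∙ sym e
    good' : ∀ k q → iter (nxt0 π) k q ≡ d0 → Orb (nxt (np ∘ x)) q d0
    good' zero q e = 0 , e
    good' (suc k) q e = go (q ≟ d0)
      where go : Dec (q ≡ d0) → Orb (nxt (np ∘ x)) q d0
            go (yes p) = 0 , p
            go (no n) = Orb-trans (1 , cong (λ c → stp c q) (npx q n)) (good' k (nxt π q) (cong (iter (nxt0 π) k) (sym (nxt0-ne π q n)) ∙ sym (iter-suc (nxt0 π) k q) ∙ e))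

    orient : Orient x
    orient = record { r0 = r0 ; r0-outer = r0o ; o1 = o1' ; o2 = o2' ; o3 = o3' ; o4 = o4' ; outer-deg = od ; good = λ q → good' (proj₁ (reach q)) q (proj₂ (reach q)) }

  opaque
    orientation : Σ[ x ∈ (D → ℤ) ] Orient x
    orientation = Final.x (w true) (w false) sol π val reach y-σ z-φ 0≤y 0≤z 1≤y , Final.orient (w true) (w false) sol π val reach y-σ z-φ 0≤y 0≤z 1≤y
      where
      open Optimal optimal
      open OfState st
      sol : Sol (w true) (w false)
      sol = WS→Sol {w true} {w false} w-ws
      1≤y : ∀ q → π q ≡ false → q ≢ d0 → 1ℤ ≤ w true q
      1≤y = opt-σ
      y-σ : ∀ q → q ≢ d0 → π q ≡ true → w true q ≡ 0ℤ
      y-σ q n e = subst (λ c → w c q ≡ 0ℤ) e (exit q n)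
      z-φ : ∀ q → q ≢ d0 → π q ≡ false → w false q ≡ 0ℤ
      z-φ q n e = subst (λ c → w c q ≡ 0ℤ) e (exit q n)
      0≤y : ∀ q → 0ℤ ≤ w true q
      0≤y q = go (q ≟ d0) (π q) refl
        where go : Dec (q ≡ d0) → ∀ c → π q ≡ c → 0ℤ ≤ w true q
              go (yes e) c _ = subst (λ q → 0ℤ ≤ w true q) (sym e) (ℤP.≤-trans (ℤ.+≤+ z≤n) (AtRoot.cσ true refl))
              go (no n) true e = ℤP.≤-reflexive (sym (y-σ q n e))
              go (no n) false e = ℤP.≤-trans (ℤ.+≤+ z≤n) (opt-σ q e n)
      0≤z : ∀ q → face q ≢ fo → 0ℤ ≤ w false q
      0≤z q nf = go (q ≟ d0) (π q) refl
        where go : Dec (q ≡ d0) → ∀ c → π q ≡ c → 0ℤ ≤ w false q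
              go (yes e) c _ = subst (λ q → 0ℤ ≤ w false q) (sym e) (AtRoot.cφ false refl)
              go (no n) true e = opt-φ q e nf n
              go (no n) false e = ℤP.≤-reflexive (sym (z-φ q n e))

-- The labelled surface of a plane map

module OfMap (M : PlaneMap) where
  open PlaneMap M

  σ-inj : Inj σf
  σ-inj = perm-inj σ
  α-inj : Inj αf
  α-inj = perm-inj α
  φ-inj : Inj φf
  φ-inj p = α-inj (σ-inj p)

  module QV = Quot σf σ-inj
  module QE = Quot αf α-inj
  module QF = Quot φf φ-inj

  invariant-const : ∀ (h : Fin n → Bool) → (∀ d → h (σf d) ≡ h d) → (∀ d → h (αf d) ≡ h d) → ∀ {d e} → Reach d e → h d ≡ h e
  invariant-const h hσ hα here = refl
  invariant-const h hσ hα (viaσ r) = invariant-const h hσ hα r ∙ sym (hσ _)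
  invariant-const h hσ hα (viaα r) = invariant-const h hσ hα r ∙ sym (hα _)

  noFix : numFixed αf ≡ 0
  noFix = ℤP.+-injective (length-filter-∑ (λ d → ⌊ αf d ≟ d ⌋) ∙ ∑-zero (λ d → cong b2z (nf d)))
    where nf : ∀ d → ⌊ αf d ≟ d ⌋ ≡ false
          nf d with αf d ≟ d
          ... | yes p = ⊥-elim (noFixed d p)
          ... | no _ = refl

  orb-α : ∀ {d e} → Orb αf d e → (d ≡ e) ⊎ (d ≡ αf e)
  orb-α (zero , p) = inj₁ p
  orb-α {d} {e} (suc k , p) with orb-α {d} {iter αf k d} (k , refl)
  ... | inj₁ q = inj₂ (sym (involutive d) ∙ cong αf (cong αf q ∙ p))
  ... | inj₂ q = inj₁ (q ∙ p)

  surf : Surface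
  surf = record
    { n = n ; V = QV.size ; E = QE.size ; Fc = QF.size ; σ = σf ; α = αf ; σ⁻ = σ ⟨$⟩ˡ_
    ; σσ⁻ = λ d → inverseʳ σ ; σ⁻σ = λ d → inverseˡ σ ; αα = involutive ; α≢ = noFixed
    ; vert = QV.cls ; vrep = QV.rep ; vert-vrep = QV.cls-rep ; vert-σ = QV.cls-f ; vert-orb = QV.cls-orb
    ; edge = QE.cls ; erep = QE.rep ; edge-erep = QE.cls-rep ; edge-α = QE.cls-f ; edge-eq = λ p → orb-α (QE.cls-orb p)
    ; face = QF.cls ; frep = QF.rep ; face-frep = QF.cls-rep ; face-φ = QF.cls-f ; face-orb = QF.cls-orb
    ; conn = λ h hσ hα d e → invariant-const h hσ hα (connected d e)
    ; euler = cong₂ ℕ._+_ (sym QV.size-numCycles) (sym QF.size-numCycles) ∙ planar ∙ cong (ℕ._+ 2) (cong (numCycles αf ℕ.∸_) noFix ∙ QE.size-numCycles) }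

  fo : Fin QF.size
  fo = QF.cls root

module OfBMap {b : ℕ} (b≥1 : 1 ℕ.≤ b) (M : BMap b) where
  open BMap M using (pmap; bipartite; girth; outerDeg)
  open PlaneMap pmap using (root; CycleOfLength; IsCycle; SameVertex)
  open OfMap pmap public
  open Surface surf public hiding (σ-inj; α-inj; φ-inj)
  open Weights surf b fo public
  open Cycles surf

  col : D → Bool
  col = proj₁ bipartite
  col-α : ∀ q → col (α q) ≡ not (col q)
  col-α q with col (α q) in e | col q in e' | proj₂ (proj₂ bipartite) q
  ... | true | true | ne = ⊥-elim (ne refl)
  ... | true | false | _ = refl
  ... | false | true | _ = refl
  ... | false | false | ne = ⊥-elim (ne refl)
  col-φ : ∀ q → col (φ q) ≡ not (col q)
  col-φ q = proj₁ (proj₂ bipartite) (α q) ∙ col-α q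

  hd : Fin Fc → ℤ
  hd f = fib face f (λ q → b2z (col q))

  -- `φ` alternates the two colours around a face, so half of its darts have colour `true`.
  hd-eq : ∀ f → fib face f (λ _ → 1ℤ) ≡ pos 2 * hd f
  hd-eq f = ∑-cong (λ q → cong (ind (face q) f *_) (one (col q)) ∙ ℤP.*-distribˡ-+ (ind (face q) f) (b2z (col q)) (b2z (not (col q)))) ∙
     ∑-+ (λ q → ind (face q) f * b2z (col q)) (λ q → ind (face q) f * b2z (not (col q))) ∙ cong (hd f +_) flip ∙ l (hd f)
    where
    one : ∀ c → 1ℤ ≡ b2z c + b2z (not c)
    one true = refl
    one false = refl
    l : ∀ a → a + a ≡ pos 2 * a
    l = solve-∀
    flip : ∑ (λ q → ind (face q) f * b2z (not (col q))) ≡ hd f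
    flip = ∑-cong (λ q → cong₂ (λ g c → ind g f * b2z c) (sym (face-φ q)) (sym (col-φ q))) ∙ ∑-φ (λ q → ind (face q) f * b2z (col q))

  od : fib face fo (λ _ → 1ℤ) ≡ pos 2 * B
  od = sym (QF.cycleLen-fib root) ∙ cong pos outerDeg ∙ ℤP.pos-* 2 b

  toCycle : ∀ {m} → Cycle m → CycleOfLength (suc m)
  toCycle c = ds , (λ j → vert-orb (closed j)) , (λ i j ne o → simple i j ne (QV.cls-eq o)) , edges
    where open Cycle c

  bound : ∀ hf f → hf f ≡ true → hf fo ≡ false → pos 2 * pos b ≤ ∑ (λ q → b2z (bdry hf q))
  bound hf f e e' with boundary-cycle hf f fo e e'
  ... | m , c , le = subst (_≤ ∑ (λ q → b2z (bdry hf q))) (ℤP.pos-* 2 b) (subst (pos (2 ℕ.* b) ≤_) (count-∑ (bdry hf)) (ℤ.+≤+ (ℕP.≤-trans (ℕP.≮⇒≥ (λ l → proj₂ girth (suc m) l (toCycle c))) le)))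

  cycle≤E : ∀ k → CycleOfLength k → k ℕ.≤ E
  cycle≤E (suc m) (ds , _ , _ , ed) = FP.injective⇒≤ {f = edge ∘ ds} inj
    where inj : ∀ {i j} → edge (ds i) ≡ edge (ds j) → i ≡ j
          inj {i} {j} e with i ≟ j
          ... | yes p = p
          ... | no ne with edge-eq e
          ...   | inj₁ p = ⊥-elim (proj₁ (ed i j ne) p)
          ...   | inj₂ p = ⊥-elim (proj₂ (ed i j ne) p)

  -- With only the outer face, all `2E` darts lie on it and `E = b`; a cycle of length `2b` uses
  -- `2b` distinct edges, more than there are.
  inner-face : ∃ λ f → f ≢ fo
  inner-face with FP.any? (λ f → Relation.Nullary.Decidable.¬? (f ≟ fo))
    where import Relation.Nullary.Decidable
  ... | yes p = p
  ... | no none = ⊥-elim (ℕP.<-irrefl refl (ℕP.<-≤-trans b<2b (ℕP.≤-trans (cycle≤E (2 ℕ.* b) (proj₁ girth)) (ℕP.≤-reflexive E≡b))))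
    where
    all : ∀ f → f ≡ fo
    all f with f ≟ fo
    ... | yes p = p
    ... | no ne = ⊥-elim (none (f , ne))
    E≡b : E ≡ b
    E≡b = ℤP.+-injective (cancel2 (sym n≡2E ∙ sym (∑-cong (λ q → cong (_* 1ℤ) (cong (λ f → ind f fo) (all (face q)) ∙ ind-refl fo)) ∙ ∑-const n 1ℤ ∙ ℤP.*-identityʳ (pos n)) ∙ od))
    b<2b : b ℕ.< 2 ℕ.* b
    b<2b = ℕP.m<m+n b (ℕP.≤-trans b≥1 (ℕP.≤-reflexive (sym (ℕP.+-identityʳ b))))

  -- The set of inner faces has at least `2b` boundary darts, whose opposites are outer. An outer
  -- dart with outer opposite is not among these, so there would be `2b + 1` outer darts.
  innerα : ∀ r → face r ≡ fo → face (α r) ≢ fo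
  innerα r e e' = ℤP.<-irrefl refl (1+≤⇒< (ℤP.≤-trans (ℤP.+-monoʳ-≤ 1ℤ (bound hf f hf1 hf0)) (ℤP.≤-trans (ℤP.≤-reflexive (cong₂ _+_ (sym (∑-ind r (λ _ → 1ℤ))) (sym (∑-α (λ q → b2z (bdry hf q))))))
        (ℤP.≤-trans (ℤP.≤-reflexive (sym (∑-+ (λ q → ind r q * 1ℤ) (λ q → b2z (bdry hf (α q)))))) (ℤP.≤-trans (∑-mono pt) (ℤP.≤-reflexive od))))))
    where
    hf : Fin Fc → Bool
    hf g = not (does (g ≟ fo))
    f = proj₁ inner-face
    hf1 : hf f ≡ true
    hf1 = cong not (false-does (f ≟ fo) (proj₂ inner-face))
    hf0 : hf fo ≡ false
    hf0 = cong not (true-does (fo ≟ fo) refl)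
    pt : ∀ q → ind r q * 1ℤ + b2z (bdry hf (α q)) ≤ ind (face q) fo * 1ℤ
    pt q with ind-case r q | b2z-case (bdry hf (α q))
    ... | inj₁ (refl , i) | inj₁ (t , _) = ⊥-elim (true≢false (sym (proj₁ (bdry-elim hf (α r) t)) ∙ cong hf e' ∙ hf0))
    ... | inj₁ (refl , i) | inj₂ (_ , t) = ℤP.≤-reflexive (cong₂ (λ u v → u * 1ℤ + v) i t ∙ sym (cong (_* 1ℤ) (cong (λ g → ind g fo) e ∙ ind-refl fo)))
    ... | inj₂ (_ , i) | inj₂ (_ , t) = subst (_≤ ind (face q) fo * 1ℤ) (sym (cong₂ (λ u v → u * 1ℤ + v) i t)) (0≤* {ind (face q) fo} (0≤ind (face q) fo) (ℤ.+≤+ z≤n))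
    ... | inj₂ (_ , i) | inj₁ (t , t1) = ℤP.≤-reflexive (cong₂ (λ u v → u * 1ℤ + v) i t1 ∙ sym (cong (_* 1ℤ) (cong (λ g → ind g fo) fq ∙ ind-refl fo)))
      where fq : face q ≡ fo
            fq with face q ≟ fo in w
            ... | yes p = p
            ... | no ne = ⊥-elim (true≢false (sym (cong not (false-does (face q ≟ fo) ne)) ∙ cong (λ u → hf (face u)) (sym (αα q)) ∙ proj₂ (bdry-elim hf (α q) t)))

  opaque
    orient : Σ[ x ∈ (D → ℤ) ] Orient x
    orient = Exist.orientation surf b b≥1 fo root refl hd hd-eq od innerα bound

  x : D → ℤ
  x = proj₁ orient

  O : Orient x
  O = proj₂ orient

-- Disjoint sums of subsets, first-return maps, involutions, reachability.

bool-irr : ∀ {x y : Bool} (p q : x ≡ y) → p ≡ q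
bool-irr refl refl = refl

-- Half-edges of a mobile are darts of the map in one of two roles, and one dart can play both, as a
-- bud and as a white half-edge; hence a disjoint sum. The closure of a mobile reuses it with black
-- half-edges and unmatched buds.
module TwoSub {n : ℕ} (p q : Fin n → Bool) where
  size : ℕ
  size = count p ℕ.+ count q

  opaque
    inl : ∀ d → p d ≡ true → Fin size
    inl d h = ix p d h F.↑ˡ count q

    inr : ∀ d → q d ≡ true → Fin size
    inr d h = count p F.↑ʳ ix q d h

    rec : ∀ {A : Set} → (∀ d → p d ≡ true → A) → (∀ d → q d ≡ true → A) → Fin size → A
    rec f g i = [ (λ j → f (el p j) (el-p p j)) , (λ j → g (el q j) (el-p q j)) ]′ (F.splitAt (count p) i)

    irr : ∀ {r : Fin n → Bool} {A : Set} (f : ∀ d → r d ≡ true → A) {d d'} → d ≡ d' → ∀ h h' → f d h ≡ f d' h'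
    irr f {d} refl h h' = cong (f d) (bool-irr h h')

    rec-l : ∀ {A : Set} (f : ∀ d → p d ≡ true → A) (g : ∀ d → q d ≡ true → A) d h → rec f g (inl d h) ≡ f d h
    rec-l f g d h = (cong [ (λ j → f (el p j) (el-p p j)) , (λ j → g (el q j) (el-p q j)) ]′ (FP.splitAt-↑ˡ (count p) (ix p d h) (count q))) ∙ (irr f (el-ix p d h) _ h)

    rec-r : ∀ {A : Set} (f : ∀ d → p d ≡ true → A) (g : ∀ d → q d ≡ true → A) d h → rec f g (inr d h) ≡ g d h
    rec-r f g d h = (cong [ (λ j → f (el p j) (el-p p j)) , (λ j → g (el q j) (el-p q j)) ]′ (FP.splitAt-↑ʳ (count p) (count q) (ix q d h))) ∙ (irr g (el-ix q d h) _ h)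

    elim : (P : Fin size → Set) → (∀ d h → P (inl d h)) → (∀ d h → P (inr d h)) → ∀ i → P i
    elim P l r i with F.splitAt (count p) i in e
    ... | inj₁ j = subst P (cong (F._↑ˡ count q) (ix-el p j (el-p p j)) ∙ FP.splitAt⁻¹-↑ˡ e) (l (el p j) (el-p p j))
    ... | inj₂ j = subst P (cong (count p F.↑ʳ_) (ix-el q j (el-p q j)) ∙ FP.splitAt⁻¹-↑ʳ e) (r (el q j) (el-p q j))

    ∑-two : ∀ (g : Fin size → ℤ) (gl gr : Fin n → ℤ) → (∀ d h → g (inl d h) ≡ gl d) → (∀ d h → g (inr d h) ≡ gr d) →
            ∑ g ≡ ∑ (λ d → b2z (p d) * gl d) + ∑ (λ d → b2z (q d) * gr d)
    ∑-two g gl gr el' er' = ∑-split (count p) g ∙ cong₂ _+_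
        (∑-cong (λ j → cong (λ k → g (k F.↑ˡ count q)) (sym (ix-el p j (el-p p j))) ∙ el' (el p j) (el-p p j)) ∙ ∑-el p gl)
        (∑-cong (λ j → cong (λ k → g (count p F.↑ʳ k)) (sym (ix-el q j (el-p q j))) ∙ er' (el q j) (el-p q j)) ∙ ∑-el q gr)

  und : Fin size → Fin n
  und = rec (λ d _ → d) (λ d _ → d)

  isL : Fin size → Bool
  isL = rec (λ _ _ → true) (λ _ _ → false)

  und-l : ∀ d h → und (inl d h) ≡ d
  und-l = rec-l (λ d _ → d) (λ d _ → d)
  und-r : ∀ d h → und (inr d h) ≡ d
  und-r = rec-r (λ d _ → d) (λ d _ → d)
  isL-l : ∀ d h → isL (inl d h) ≡ true
  isL-l = rec-l (λ _ _ → true) (λ _ _ → false)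
  isL-r : ∀ d h → isL (inr d h) ≡ false
  isL-r = rec-r (λ _ _ → true) (λ _ _ → false)

  inl-inj : ∀ {d d' h h'} → inl d h ≡ inl d' h' → d ≡ d'
  inl-inj {d} {d'} {h} {h'} e = sym (und-l d h) ∙ cong und e ∙ und-l d' h'
  inr-inj : ∀ {d d' h h'} → inr d h ≡ inr d' h' → d ≡ d'
  inr-inj {d} {d'} {h} {h'} e = sym (und-r d h) ∙ cong und e ∙ und-r d' h'
  l≢r : ∀ {d d' h h'} → inl d h ≢ inr d' h'
  l≢r {d} {d'} {h} {h'} e = true≢false (sym (isL-l d h) ∙ cong isL e ∙ isL-r d' h')
  inl-cong : ∀ {d d'} → d ≡ d' → ∀ {h h'} → inl d h ≡ inl d' h'
  inl-cong refl {h} {h'} = cong (inl _) (bool-irr h h')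
  inr-cong : ∀ {d d'} → d ≡ d' → ∀ {h h'} → inr d h ≡ inr d' h'
  inr-cong refl {h} {h'} = cong (inr _) (bool-irr h h')

module Return {n : ℕ} (f : Fin n → Fin n) (inj : Inj f) (P : Fin n → Bool) where
  first : ∀ d → P d ≡ true → ∃ λ k → P (iter f (suc k) d) ≡ true × (∀ i → i ℕ.< k → P (iter f (suc i) d) ≡ false)
  first d h with period f inj d
  ... | m , e = leastℕ (λ k → P (iter f (suc k) d)) m (cong P e ∙ h)

  ret : ∀ d → P d ≡ true → Fin n
  ret d h = iter f (suc (proj₁ (first d h))) d

  ret-P : ∀ d h → P (ret d h) ≡ true
  ret-P d h = proj₁ (proj₂ (first d h))

  ret-orb : ∀ d h → Orb f d (ret d h)
  ret-orb d h = suc (proj₁ (first d h)) , refl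

  ret-unique : ∀ d h k → P (iter f (suc k) d) ≡ true → (∀ i → i ℕ.< k → P (iter f (suc i) d) ≡ false) → ret d h ≡ iter f (suc k) d
  ret-unique d h k pk mk with first d h
  ... | j , pj , mj with ℕP.<-cmp j k
  ...   | tri< l _ _ = ⊥-elim (true≢false (sym pj ∙ mk j l))
  ...   | tri≈ _ refl _ = refl
  ...   | tri> _ _ l = ⊥-elim (true≢false (sym pk ∙ mj k l))

  private
    cancel : ∀ j k d d' → j ℕ.≤ k → iter f j d ≡ iter f k d' → d ≡ iter f (k ℕ.∸ j) d'
    cancel zero k d d' le e = e
    cancel (suc j) (suc k) d d' (s≤s le) e = cancel j k d d' le (inj e)

    step-inj : ∀ d h d' h' → proj₁ (first d h) ℕ.≤ proj₁ (first d' h') → ret d h ≡ ret d' h' → d ≡ d'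
    step-inj d h d' h' le e = go (proj₁ (first d' h') ℕ.∸ proj₁ (first d h)) refl (cancel _ _ d d' (s≤s le) e)
      where
      go : ∀ m → proj₁ (first d' h') ℕ.∸ proj₁ (first d h) ≡ m → d ≡ iter f m d' → d ≡ d'
      go zero _ q = q
      go (suc m) em q = ⊥-elim (true≢false (sym h ∙ cong P q ∙ proj₂ (proj₂ (first d' h')) m (ℕP.≤-trans (ℕP.≤-reflexive (sym em)) (ℕP.m∸n≤m (proj₁ (first d' h')) (proj₁ (first d h))))))

  -- Cancelling the shorter excursion from the longer exhibits one starting point among the iterates
  -- of the other; unless they coincide, the latter would have returned earlier.
  ret-inj : ∀ d h d' h' → ret d h ≡ ret d' h' → d ≡ d'
  ret-inj d h d' h' e = [ (λ le → step-inj d h d' h' le e) , (λ le → sym (step-inj d' h' d h le (sym e))) ]′ (ℕP.≤-total (proj₁ (first d h)) (proj₁ (first d' h')))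

  -- Iterates of the first-return map in inductive form, so that an orbit of `f` restricted to `P`
  -- can be followed from one return to the next.
  data Rets (d : Fin n) : Fin n → Set where
    done : ∀ {e} → d ≡ e → Rets d e
    more : ∀ {e} (h : P d ≡ true) → Rets (ret d h) e → Rets d e

  rets : ∀ d → P d ≡ true → ∀ e → P e ≡ true → Orb f d e → Rets d e
  rets d h e he (k , o) = go k k ℕP.≤-refl d h o
    where
    go : ∀ fuel k → k ℕ.≤ fuel → ∀ d → P d ≡ true → iter f k d ≡ e → Rets d e
    go fuel zero le d h o = done o
    go (suc fuel) (suc k) (s≤s le) d h o = more h (go fuel (k ℕ.∸ j) (ℕP.≤-trans (ℕP.m∸n≤m k j) le) (ret d h) (ret-P d h)
         (sym (iter-+ f (k ℕ.∸ j) (suc j) d) ∙ cong (λ m → iter f m d) (ℕP.+-suc (k ℕ.∸ j) j ∙ cong suc (ℕP.m∸n+n≡m j≤k)) ∙ o))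
      where
      j = proj₁ (first d h)
      j≤k : j ℕ.≤ k
      j≤k = ℕP.≮⇒≥ (λ l → true≢false (sym he ∙ cong P (sym o) ∙ proj₂ (proj₂ (first d h)) k l))

module Involution {n} (f : Fin n → Fin n) (ff : ∀ d → f (f d) ≡ d) where
  inj : Inj f
  inj {a} {b} p = sym (ff a) ∙ cong f p ∙ ff b
  module Q = Quot f inj
  nF = numFixed f
  fx : Fin n → ℤ
  fx d = b2z ⌊ f d ≟ d ⌋
  nF≡ : pos nF ≡ ∑ fx
  nF≡ = length-filter-∑ (λ d → ⌊ f d ≟ d ⌋)
  l : ∀ c f → pos 2 * c - f ≡ pos 2 * (c - f) + f
  l = solve-∀
  orb2 : ∀ {d e} → Orb f d e → (e ≡ d) ⊎ (e ≡ f d)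
  orb2 (zero , p) = inj₁ (sym p)
  orb2 {d} (suc k , p) with orb2 {d} {iter f k d} (k , refl)
  ... | inj₁ q = inj₂ (sym p ∙ cong f q)
  ... | inj₂ q = inj₁ (sym p ∙ cong f q ∙ ff d)
  -- A class consists of its representative and the image of it; the last factor keeps a fixed point
  -- from being counted twice.
  class : ∀ c d → ind (Q.cls d) c ≡ ind (Q.rep c) d + ind (f (Q.rep c)) d * (1ℤ - fx (Q.rep c))
  class c d with f (Q.rep c) ≟ Q.rep c | ind-case (Q.cls d) c | ind-case (Q.rep c) d | ind-case (f (Q.rep c)) d
  ... | yes p | inj₁ (a , a') | inj₁ (_ , b') | inj₁ (_ , e') = a' ∙ sym (cong₂ (λ u v → u + v * (1ℤ - 1ℤ)) b' e')
  ... | yes p | inj₁ (a , a') | inj₁ (b , b') | inj₂ (e , e') = ⊥-elim (e (p ∙ b))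
  ... | yes p | inj₁ (a , a') | inj₂ (b , b') | _ with orb2 (Q.cls-orb (Q.cls-rep c ∙ sym a))
  ...   | inj₁ q = ⊥-elim (b (sym q))
  ...   | inj₂ q = ⊥-elim (b (sym (q ∙ p)))
  class c d | yes p | inj₂ (a , a') | inj₁ (b , b') | _ = ⊥-elim (a (cong Q.cls (sym b) ∙ Q.cls-rep c))
  class c d | yes p | inj₂ (a , a') | inj₂ (b , b') | inj₁ (e , e') = ⊥-elim (b (sym p ∙ e))
  class c d | yes p | inj₂ (a , a') | inj₂ (b , b') | inj₂ (e , e') = a' ∙ sym (cong₂ (λ u v → u + v * (1ℤ - 1ℤ)) b' e')
  class c d | no p | inj₁ (a , a') | inj₁ (b , b') | inj₁ (e , e') = ⊥-elim (p (e ∙ sym b))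
  class c d | no p | inj₁ (a , a') | inj₁ (b , b') | inj₂ (e , e') = a' ∙ sym (cong₂ (λ u v → u + v * (1ℤ - 0ℤ)) b' e')
  class c d | no p | inj₁ (a , a') | inj₂ (b , b') | inj₁ (e , e') = a' ∙ sym (cong₂ (λ u v → u + v * (1ℤ - 0ℤ)) b' e')
  class c d | no p | inj₁ (a , a') | inj₂ (b , b') | inj₂ (e , e') with orb2 (Q.cls-orb (Q.cls-rep c ∙ sym a))
  ...   | inj₁ q = ⊥-elim (b (sym q))
  ...   | inj₂ q = ⊥-elim (e (sym q))
  class c d | no p | inj₂ (a , a') | inj₁ (b , b') | _ = ⊥-elim (a (cong Q.cls (sym b) ∙ Q.cls-rep c))
  class c d | no p | inj₂ (a , a') | inj₂ (b , b') | inj₁ (e , e') = ⊥-elim (a (cong Q.cls (sym e) ∙ Q.cls-f (Q.rep c) ∙ Q.cls-rep c))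
  class c d | no p | inj₂ (a , a') | inj₂ (b , b') | inj₂ (e , e') = a' ∙ sym (cong₂ (λ u v → u + v * (1ℤ - 0ℤ)) b' e')
  fib≡ : ∀ c (g : Fin n → ℤ) → fib Q.cls c g ≡ g (Q.rep c) + g (f (Q.rep c)) * (1ℤ - fx (Q.rep c))
  fib≡ c g = ∑-cong (λ d → cong (_* g d) (class c d) ∙ l1 (ind (Q.rep c) d) (ind (f (Q.rep c)) d) (1ℤ - fx (Q.rep c)) (g d)) ∙
     ∑-+ (λ d → ind (Q.rep c) d * g d) (λ d → ind (f (Q.rep c)) d * (g d * (1ℤ - fx (Q.rep c)))) ∙ cong₂ _+_ (∑-ind (Q.rep c) g) (∑-ind (f (Q.rep c)) (λ d → g d * (1ℤ - fx (Q.rep c))))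
    where l1 : ∀ a b c g → (a + b * c) * g ≡ a * g + b * (g * c)
          l1 = solve-∀
  all : ∀ (g : Fin n → ℤ) → ∑ g ≡ ∑ (λ c → g (Q.rep c) + g (f (Q.rep c)) * (1ℤ - fx (Q.rep c)))
  all g = ∑-cong (λ d → sym (ℤP.*-identityˡ (g d))) ∙ sym (∑-fib Q.cls (λ _ → 1ℤ) g) ∙ ∑-cong (λ c → ℤP.*-identityˡ (fib Q.cls c g) ∙ fib≡ c g)
  fix∑ : ∑ fx ≡ ∑ (λ c → fx (Q.rep c))
  fix∑ = all fx ∙ ∑-cong pt
    where pt : ∀ c → fx (Q.rep c) + fx (f (Q.rep c)) * (1ℤ - fx (Q.rep c)) ≡ fx (Q.rep c)
          pt c with f (Q.rep c) ≟ Q.rep c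
          ... | yes p = cong (1ℤ +_) (ℤP.*-zeroʳ (fx (f (Q.rep c)))) ∙ refl
          ... | no ne with f (f (Q.rep c)) ≟ f (Q.rep c)
          ...   | yes p = ⊥-elim (ne (inj p))
          ...   | no _ = refl
  total : pos n ≡ pos 2 * pos Q.size - pos nF
  total = sym (∑-const n 1ℤ ∙ ℤP.*-identityʳ (pos n)) ∙ all (λ _ → 1ℤ) ∙ ∑-cong (λ c → l2 (fx (Q.rep c))) ∙ ∑-- (λ _ → pos 2) (λ c → fx (Q.rep c)) ∙
     cong₂ _-_ (∑-const Q.size (pos 2) ∙ ℤP.*-comm (pos Q.size) (pos 2)) (sym (nF≡ ∙ fix∑))
    where l2 : ∀ a → 1ℤ + 1ℤ * (1ℤ - a) ≡ pos 2 - a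
          l2 = solve-∀
  nF≤ : pos nF ≤ pos Q.size
  nF≤ = subst₂≤ (nF≡ ∙ fix∑) (∑-const Q.size 1ℤ ∙ ℤP.*-identityʳ (pos Q.size)) (∑-mono (λ c → b2z≤1 ⌊ f (Q.rep c) ≟ Q.rep c ⌋))
    where subst₂≤ : ∀ {a b c d} → a ≡ b → c ≡ d → b ≤ c → a ≤ d
          subst₂≤ refl refl p = p
  sub : pos (numCycles f ℕ.∸ nF) ≡ pos Q.size - pos nF
  sub = cong (λ c → pos (c ℕ.∸ nF)) Q.size-numCycles ∙ sym (ℤP.⊖-≥ (ℤP.drop‿+≤+ nF≤)) ∙ sym (ℤP.m-n≡m⊖n Q.size nF)

  involution-count : pos n ≡ pos 2 * pos (numCycles f ℕ.∸ numFixed f) + pos (numFixed f)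
  involution-count = total ∙ l (pos Q.size) (pos nF) ∙ cong (λ u → pos 2 * u + pos nF) (sym sub)

  moved : Fin Q.size → Bool
  moved c = not ⌊ f (Q.rep c) ≟ Q.rep c ⌋

  moved-count : count moved ≡ numCycles f ℕ.∸ numFixed f
  moved-count = ℤP.+-injective (count-∑ moved ∙ ∑-cong (λ c → nb ⌊ f (Q.rep c) ≟ Q.rep c ⌋) ∙ ∑-- (λ _ → 1ℤ) (λ c → fx (Q.rep c)) ∙
      cong₂ _-_ (∑-const Q.size 1ℤ ∙ ℤP.*-identityʳ (pos Q.size)) (sym (nF≡ ∙ fix∑)) ∙ sym sub)
    where nb : ∀ u → b2z (not u) ≡ 1ℤ - b2z u
          nb true = refl
          nb false = refl

open Involution public using (involution-count)

-- A saturated set of reachable darts is invariant under both permutations, since on a finite set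
-- forward closure under a permutation implies backward closure. This passes from two-valued
-- functions to the inductive relation.
reach-all : ∀ (P : PreMap) → let open PreMap P in (∀ h → (∀ d → h (σf d) ≡ h d) → (∀ d → h (αf d) ≡ h d) → ∀ d e → h d ≡ h e) → Connected
reach-all P inv d e = proj₁ (proj₂ sat) e (inv X Xσ Xα e d ∙ proj₁ (proj₂ (proj₂ sat)))
  where
  open PreMap P
  Closed : (Fin n → Bool) → Set
  Closed X = X d ≡ true × (∀ q → X q ≡ true → X (σf q) ≡ true) × (∀ q → X q ≡ true → X (αf q) ≡ true)
  grow : ∀ X → (∀ x → X x ≡ true → Reach d x) → (∃ λ x → X x ≡ false × Reach d x) ⊎ Closed X
  grow X h with X d in e0
  ... | false = inj₁ (d , e0 , here)
  ... | true with FP.any? (λ q → (X q ∧ not (X (σf q))) Data.Bool.≟ true) | FP.any? (λ q → (X q ∧ not (X (αf q))) Data.Bool.≟ true)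
  ...   | yes (q , t) | _ = inj₁ (σf q , nt (proj₂ (∧t {X q} t)) , viaσ (h q (proj₁ (∧t {X q} t))))
    where ∧t : ∀ {x y} → x ∧ y ≡ true → x ≡ true × y ≡ true
          ∧t {true} {true} _ = refl , refl
          nt : ∀ {x} → not x ≡ true → x ≡ false
          nt {false} _ = refl
  ...   | no _ | yes (q , t) = inj₁ (αf q , nt (proj₂ (∧t {X q} t)) , viaα (h q (proj₁ (∧t {X q} t))))
    where ∧t : ∀ {x y} → x ∧ y ≡ true → x ≡ true × y ≡ true
          ∧t {true} {true} _ = refl , refl
          nt : ∀ {x} → not x ≡ true → x ≡ false
          nt {false} _ = refl
  ...   | no a | no c = inj₂ (refl , (λ q t → cl (σf q) (λ u → a (q , cong₂ _∧_ t (cong not u)))) , (λ q t → cl (αf q) (λ u → c (q , cong₂ _∧_ t (cong not u)))))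
    where cl : ∀ y → ¬ (X y ≡ false) → X y ≡ true
          cl y ne with X y
          ... | true = refl
          ... | false = ⊥-elim (ne refl)
  sat = saturate (Reach d) Closed grow
  X = proj₁ sat
  inv-of : ∀ (f : Fin n → Fin n) → Inj f → (∀ q → X q ≡ true → X (f q) ≡ true) → ∀ q → X (f q) ≡ X q
  inv-of f inj fw q = bool-ext (λ t → let (m , r) = Orb-sym inj (Orb-step {f = f} {q}) in cong X (sym r) ∙ fws m (f q) t) (fw q)
    where fws : ∀ m y → X y ≡ true → X (iter f m y) ≡ true
          fws zero y t = t
          fws (suc m) y t = fw (iter f m y) (fws m y t)
  Xσ : ∀ q → X (σf q) ≡ X q
  Xσ = inv-of σf (perm-inj σ) (proj₁ (proj₂ (proj₂ (proj₂ sat))))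
  Xα : ∀ q → X (αf q) ≡ X q
  Xα = inv-of αf (perm-inj α) (proj₂ (proj₂ (proj₂ (proj₂ sat))))

-- The mobile of an oriented plane map

∧-tt : ∀ {x y} → x ≡ true → y ≡ true → x ∧ y ≡ true
∧-tt refl refl = refl

∧-t₁ : ∀ x {y} → x ∧ y ≡ true → x ≡ true
∧-t₁ true _ = refl

∧-t₂ : ∀ x {y} → x ∧ y ≡ true → y ≡ true
∧-t₂ true e = e

not-t : ∀ {x} → not x ≡ true → x ≡ false
not-t {false} _ = refl

t-not : ∀ {x} → x ≡ false → not x ≡ true
t-not refl = refl

module MobileOf (b : ℕ) (b≥1 : 1 ℕ.≤ b) (S : Surface) (fo : Fin (Surface.Fc S)) (x : Fin (Surface.n S) → ℤ)
  (O : Weights.Orient S b fo x) where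
  open Surface S
  open Weights S b fo
  open Orient O

  1≤B : 1ℤ ≤ B
  1≤B = ℤ.+≤+ b≥1

  -- Every dart of an inner face is a half-edge at the black vertex of that face. A dart of positive
  -- weight is also a half-edge at a white vertex, unless it is opposite to an outer dart: outer
  -- vertices give no white vertex, all their positive weight `B` being on such a dart.
  isB isW : D → Bool
  isB q = not (does (face q ≟ fo))
  isW q = not (np (x q)) ∧ isB (α q)

  B-intro : ∀ q → face q ≢ fo → isB q ≡ true
  B-intro q ne = cong not (false-does (face q ≟ fo) ne)
  B-elim : ∀ q → isB q ≡ true → face q ≢ fo
  B-elim q e f = true≢false (sym e ∙ cong not (true-does (face q ≟ fo) f))
  R-elim : ∀ q → isB q ≡ false → face q ≡ fo
  R-elim q e with face q ≟ fo
  ... | yes p = p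
  ... | no _ = ⊥-elim (true≢false e)

  B-φ : ∀ q → isB q ≡ true → isB (φ q) ≡ true
  B-φ q e = cong (λ f → not (does (f ≟ fo))) (face-φ q) ∙ e

  npR : ∀ q → face q ≡ fo → np (x q) ≡ true
  npR q e = cong np (o4 q e)
  npαR : ∀ q → face (α q) ≡ fo → np (x q) ≡ false
  npαR q e = pos-np-false (x q) (subst (1ℤ ≤_) (sym (xα (α q) e) ∙ cong x (αα q)) 1≤B)
  pos-B : ∀ q → np (x q) ≡ false → isB q ≡ true
  pos-B q e = B-intro q (λ f → true≢false (sym (npR q f) ∙ e))
  nonpos-αB : ∀ q → np (x q) ≡ true → isB (α q) ≡ true
  nonpos-αB q e = B-intro (α q) (λ f → true≢false (sym e ∙ npαR q f))
  αR-inner : ∀ r → face r ≡ fo → isB (α r) ≡ true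
  αR-inner r e = pos-B (α r) (npαR (α r) (cong face (αα r) ∙ e))

  isW-np : ∀ q → isW q ≡ true → np (x q) ≡ false
  isW-np q e = not-t (∧-t₁ (not (np (x q))) e)
  isW-α : ∀ q → isW q ≡ true → isB (α q) ≡ true
  isW-α q e = ∧-t₂ (not (np (x q))) e

  -- A positive dart opposite to an outer one takes the whole weight `B` of its vertex, so it cannot
  -- share that vertex with a white dart.
  W-vertex : ∀ d e → isW d ≡ true → vert e ≡ vert d → np (x e) ≡ false → isW e ≡ true
  W-vertex d e w v p = ∧-tt (t-not p) (go (isB (α e)) refl)
    where go : ∀ c → isB (α e) ≡ c → isB (α e) ≡ true
          go true q = q
          go false q = ⊥-elim (ℤP.<-irrefl refl (1+≤⇒< (subst (1ℤ ≤_) px (subst (1ℤ ≤_) (sym (pp-id (x d) (ℤP.≤-trans (ℤ.+≤+ z≤n) (np-false-pos (x d) (isW-np d w))))) (np-false-pos (x d) (isW-np d w))))))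
            where
            fr = R-elim (α e) q
            ne : d ≢ α (α e)
            ne p = B-elim (α d) (isW-α d w) (cong (λ u → face (α u)) (p ∙ αα e) ∙ fr)
            px : pp (x d) ≡ 0ℤ
            px = outer-vertex (α e) d fr (sym v ∙ cong vert (sym (αα e))) ne

  module TS = TwoSub isB isW
  open TS public using (elim; rec) renaming (size to NT; inl to bd; inr to wd)
  module RT = Return σ σ-inj isW
  open RT using (ret; ret-P; ret-orb; Rets; done; more)

  σT : Fin NT → Fin NT
  σT = rec (λ d h → bd (φ d) (B-φ d h)) (λ d h → wd (ret d h) (ret-P d h))

  σT-b : ∀ d h → σT (bd d h) ≡ bd (φ d) (B-φ d h)
  σT-b = TS.rec-l _ _
  σT-w : ∀ d h → σT (wd d h) ≡ wd (ret d h) (ret-P d h)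
  σT-w = TS.rec-r _ _

  σT-inj : Inj σT
  σT-inj {i} {j} = elim (λ i → σT i ≡ σT j → i ≡ j)
     (λ d h → elim (λ j → σT (bd d h) ≡ σT j → bd d h ≡ j)
         (λ d' h' e → TS.inl-cong (φ-inj (TS.inl-inj (sym (σT-b d h) ∙ e ∙ σT-b d' h'))))
         (λ d' h' e → ⊥-elim (TS.l≢r (sym (σT-b d h) ∙ e ∙ σT-w d' h'))) j)
     (λ d h → elim (λ j → σT (wd d h) ≡ σT j → wd d h ≡ j)
         (λ d' h' e → ⊥-elim (TS.l≢r (sym (sym (σT-w d h) ∙ e ∙ σT-b d' h'))))
         (λ d' h' e → TS.inr-cong (RT.ret-inj d h d' h' (TS.inr-inj (sym (σT-w d h) ∙ e ∙ σT-w d' h')))) j) i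

  -- tg d is the end at d of the mobile edge that crosses or follows the edge of d.
  tg′ : ∀ d c → np (x d) ≡ c → isB d ≡ true → isB (α d) ≡ true → Fin NT
  tg′ d true  _ h _ = bd d h
  tg′ d false e _ h = wd d (∧-tt (t-not e) h)

  tg : ∀ d → isB d ≡ true → isB (α d) ≡ true → Fin NT
  tg d = tg′ d (np (x d)) refl

  tg′-eq : ∀ d c (e : np (x d) ≡ c) h h' → tg d h h' ≡ tg′ d c e h h'
  tg′-eq d c refl h h' = refl

  tg-b : ∀ d h h' → np (x d) ≡ true → tg d h h' ≡ bd d h
  tg-b d h h' e = tg′-eq d true e h h'
  tg-w : ∀ d h h' w → tg d h h' ≡ wd d w
  tg-w d h h' w = tg′-eq d false (isW-np d w) h h' ∙ TS.inr-cong refl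

  und-tg : ∀ d h h' → TS.und (tg d h h') ≡ d
  und-tg d h h' = go (np (x d)) refl
    where go : ∀ c → np (x d) ≡ c → TS.und (tg d h h') ≡ d
          go true e = cong TS.und (tg-b d h h' e) ∙ TS.und-l d h
          go false e = cong TS.und (tg-w d h h' (∧-tt (t-not e) h')) ∙ (TS.und-r d _)

  tg-cong : ∀ {d d'} → d ≡ d' → ∀ {h h' k k'} → tg d h h' ≡ tg d' k k'
  tg-cong {d} refl {h} {h'} {k} {k'} = cong₂ (tg d) (bool-irr h k) (bool-irr h' k')

  B-αα : ∀ d → isB d ≡ true → isB (α (α d)) ≡ true
  B-αα d h = cong isB (αα d) ∙ h

  αB : ∀ d c → np (x d) ≡ c → isB d ≡ true → Fin NT
  αB d true e h = tg (α d) (nonpos-αB d e) (B-αα d h)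
  αB d false e h = bd d h

  -- A black half-edge of positive weight is a bud. The others have the form `tg d` and are matched
  -- with `tg (α d)`, so that a mobile edge carries the weights of the two darts of one map edge.
  αT : Fin NT → Fin NT
  αT = rec (λ d h → αB d (np (x d)) refl h) (λ d h → tg (α d) (isW-α d h) (B-αα d (pos-B d (isW-np d h))))

  αT-b : ∀ d c (e : np (x d) ≡ c) h → αT (bd d h) ≡ αB d c e h
  αT-b d c refl h = TS.rec-l _ _ d h
  αT-w : ∀ d h → αT (wd d h) ≡ tg (α d) (isW-α d h) (B-αα d (pos-B d (isW-np d h)))
  αT-w = TS.rec-r _ _

  αT-tg : ∀ d h h' → αT (tg d h h') ≡ tg (α d) h' (B-αα d h)
  αT-tg d h h' = go (np (x d)) refl
    where go : ∀ c → np (x d) ≡ c → αT (tg d h h') ≡ tg (α d) h' (B-αα d h)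
          go true e = cong αT (tg-b d h h' e) ∙ αT-b d true e h ∙ tg-cong refl
          go false e = cong αT (tg-w d h h' (∧-tt (t-not e) h')) ∙ (αT-w d _) ∙ tg-cong refl

  αT-bud : ∀ d h → np (x d) ≡ false → αT (bd d h) ≡ bd d h
  αT-bud d h e = αT-b d false e h

  split : (P : Fin NT → Set) → (∀ d h → np (x d) ≡ false → P (bd d h)) → (∀ d h h' → P (tg d h h')) → ∀ i → P i
  split P bud non = elim P (λ d h → go d h (np (x d)) refl) (λ d h → subst P (tg-w d (pos-B d (isW-np d h)) (isW-α d h) h) (non d _ _))
    where go : ∀ d h c → np (x d) ≡ c → P (bd d h)
          go d h false e = bud d h e
          go d h true e = subst P (tg-b d h (nonpos-αB d e) e) (non d h _)

  αT-inv : ∀ i → αT (αT i) ≡ i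
  αT-inv = split (λ i → αT (αT i) ≡ i) (λ d h e → cong αT (αT-bud d h e) ∙ αT-bud d h e)
     (λ d h h' → cong αT (αT-tg d h h') ∙ αT-tg (α d) h' (B-αα d h) ∙ tg-cong (αα d))

  αT-inj : Inj αT
  αT-inj {i} {j} e = sym (αT-inv i) ∙ cong αT e ∙ αT-inv j

  tg-nonbud : ∀ d h h' → αT (tg d h h') ≢ tg d h h'
  tg-nonbud d h h' e = α≢ d (sym (und-tg (α d) _ _) ∙ cong TS.und (sym (αT-tg d h h') ∙ e) ∙ und-tg d h h')

  preT : PreMap
  preT = record { n = NT ; σ = mkPerm σT σT-inj ; α = mkPerm αT αT-inj }

  colT : Fin NT → Colour
  colT = rec (λ _ _ → black) (λ _ _ → white)
  wtT : Fin NT → ℤ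
  wtT = rec (λ d _ → - nn (x d)) (λ d _ → x d)

  colT-b : ∀ d h → colT (bd d h) ≡ black
  colT-b = TS.rec-l _ _
  colT-w : ∀ d h → colT (wd d h) ≡ white
  colT-w = TS.rec-r _ _
  wtT-b : ∀ d h → wtT (bd d h) ≡ - nn (x d)
  wtT-b = TS.rec-l _ _
  wtT-w : ∀ d h → wtT (wd d h) ≡ x d
  wtT-w = TS.rec-r _ _

  nn-id : ∀ i → np i ≡ true → - nn i ≡ i
  nn-id i e = (cong -_ (nn-neg i (np-true-nonpos i e))) ∙ ℤP.neg-involutive i

  wtT-tg : ∀ d h h' → wtT (tg d h h') ≡ x d
  wtT-tg d h h' = go (np (x d)) refl
    where go : ∀ c → np (x d) ≡ c → wtT (tg d h h') ≡ x d
          go true e = cong wtT (tg-b d h h' e) ∙ wtT-b d h ∙ nn-id (x d) e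
          go false e = cong wtT (tg-w d h h' (∧-tt (t-not e) h')) ∙ (wtT-w d _)

  preMob : PreMobile
  preMob = record { pre = preT ; col = colT ; wt = wtT }

  module QT = Quot σT σT-inj

  iter-b : ∀ k d h → ∃ λ h' → iter σT k (bd d h) ≡ bd (iter φ k d) h'
  iter-b zero d h = h , refl
  iter-b (suc k) d h = let (h' , e) = iter-b k d h in B-φ (iter φ k d) h' , cong σT e ∙ σT-b (iter φ k d) h'

  orb-b : ∀ d h e h' → face d ≡ face e → QT.cls (bd d h) ≡ QT.cls (bd e h')
  orb-b d h e h' p = let (k , o) = face-orb p in QT.cls-eq (k , proj₂ (iter-b k d h) ∙ TS.inl-cong o)

  orb-w : ∀ d h e h' → vert d ≡ vert e → QT.cls (wd d h) ≡ QT.cls (wd e h')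
  orb-w d h e h' p = go d h (RT.rets d h e h' (vert-orb p))
    where go : ∀ d h → Rets d e → QT.cls (wd d h) ≡ QT.cls (wd e h')
          go d h (done q) = cong QT.cls (TS.inr-cong q)
          go d h (more k r) = sym (QT.cls-f (wd d h)) ∙ cong QT.cls (σT-w d h ∙ TS.inr-cong (cong (ret d) (bool-irr h k))) ∙ go (ret d k) (ret-P d k) r

  vert-iter : ∀ k d → vert (iter σ k d) ≡ vert d
  vert-iter = iter-inv vert vert-σ

  vert-ret : ∀ d h → vert (ret d h) ≡ vert d
  vert-ret d h = vert-iter (suc (proj₁ (RT.first d h))) d

  invT : Fin NT → Fin N
  invT = rec (λ d _ → nF (face d)) (λ d _ → nV (vert d))
  invT-b : ∀ d h → invT (bd d h) ≡ nF (face d)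
  invT-b = TS.rec-l _ _
  invT-w : ∀ d h → invT (wd d h) ≡ nV (vert d)
  invT-w = TS.rec-r _ _

  invT-σ : ∀ i → invT (σT i) ≡ invT i
  invT-σ = elim (λ i → invT (σT i) ≡ invT i)
    (λ d h → cong invT (σT-b d h) ∙ (invT-b (φ d) _) ∙ cong nF (face-φ d) ∙ sym (invT-b d h))
    (λ d h → cong invT (σT-w d h) ∙ (invT-w (ret d h) _) ∙ cong nV (vert-ret d h) ∙ sym (invT-w d h))

  invT-cls : ∀ {i j} → QT.cls i ≡ QT.cls j → invT i ≡ invT j
  invT-cls e = orb-inv invT invT-σ (QT.cls-orb e)

  nF-inj : ∀ {f g} → nF f ≡ nF g → f ≡ g
  nF-inj e = FP.↑ʳ-injective E _ _ (FP.↑ʳ-injective V _ _ e)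
  nV-inj : ∀ {v w} → nV v ≡ nV w → v ≡ w
  nV-inj e = FP.↑ˡ-injective (E ℕ.+ Fc) _ _ e
  nV≢nF : ∀ {v f} → nV v ≢ nF f
  nV≢nF {v} {f} e with sym (FP.splitAt-↑ˡ V v (E ℕ.+ Fc)) ∙ cong (F.splitAt V) e ∙ FP.splitAt-↑ʳ V (E ℕ.+ Fc) (E F.↑ʳ f)
  ... | ()

  face-fib : ∀ d h (g : Fin NT → ℤ) (gl gr : D → ℤ) → (∀ e k → g (bd e k) ≡ gl e) → (∀ e k → g (wd e k) ≡ gr e) → fib QT.cls (QT.cls (bd d h)) g ≡ fib face (face d) gl
  face-fib d h g gl gr el er = TS.∑-two (λ i → ind (QT.cls i) (QT.cls (bd d h)) * g i) (λ e → ind (face e) (face d) * gl e) (λ _ → 0ℤ)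
      (λ e k → cong₂ _*_ (ind-iff (λ p → nF-inj (sym (invT-b e k) ∙ invT-cls p ∙ invT-b d h)) (orb-b e k d h)) (el e k))
      (λ e k → cong (_* g (wd e k)) (ind-no (λ p → nV≢nF (sym (invT-w e k) ∙ invT-cls p ∙ invT-b d h)))) ∙
    cong₂ _+_ (∑-cong pt) (∑-zero (λ e → ℤP.*-zeroʳ (b2z (isW e)))) ∙ (ℤP.+-identityʳ _)
    where pt : ∀ e → b2z (isB e) * (ind (face e) (face d) * gl e) ≡ ind (face e) (face d) * gl e
          pt e with ind-case (face e) (face d)
          ... | inj₁ (p , i) = cong (λ c → b2z c * (ind (face e) (face d) * gl e)) (B-intro e (λ f → B-elim d h (sym p ∙ f))) ∙ (ℤP.*-identityˡ _)
          ... | inj₂ (p , i) = cong (λ u → b2z (isB e) * (u * gl e)) i ∙ ℤP.*-zeroʳ (b2z (isB e)) ∙ cong (_* gl e) (sym i)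

  vert-fib : ∀ d h (g : Fin NT → ℤ) (gl gr : D → ℤ) → (∀ e k → g (bd e k) ≡ gl e) → (∀ e k → g (wd e k) ≡ gr e) → fib QT.cls (QT.cls (wd d h)) g ≡ fib vert (vert d) (λ e → b2z (isW e) * gr e)
  vert-fib d h g gl gr el er = TS.∑-two (λ i → ind (QT.cls i) (QT.cls (wd d h)) * g i) (λ _ → 0ℤ) (λ e → ind (vert e) (vert d) * gr e)
      (λ e k → cong (_* g (bd e k)) (ind-no (λ p → nV≢nF (sym (invT-w d h) ∙ invT-cls (sym p) ∙ invT-b e k))))
      (λ e k → cong₂ _*_ (ind-iff (λ p → nV-inj (sym (invT-w e k) ∙ invT-cls p ∙ invT-w d h)) (orb-w e k d h)) (er e k)) ∙
    cong₂ _+_ (∑-zero (λ e → ℤP.*-zeroʳ (b2z (isB e)))) (∑-cong (λ e → l (b2z (isW e)) (ind (vert e) (vert d)) (gr e))) ∙ (ℤP.+-identityˡ _)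
    where l : ∀ a b c → a * (b * c) ≡ b * (a * c)
          l = solve-∀

  white-fib : ∀ d h → fib QT.cls (QT.cls (wd d h)) wtT ≡ B
  white-fib d h = vert-fib d h wtT (λ e → - nn (x e)) x wtT-b wtT-w ∙ ∑-cong (λ e → ind-*-cong (vert e) (vert d) (λ p → pt e p (np (x e)) refl)) ∙ o2 (vert d)
    where pt : ∀ e → vert e ≡ vert d → ∀ c → np (x e) ≡ c → b2z (isW e) * x e ≡ pp (x e)
          pt e p true q = cong (λ c → b2z (not c ∧ isB (α e)) * x e) q ∙ sym (np-true (x e) q)
          pt e p false q = cong (λ c → b2z c * x e) (W-vertex d e h p q) ∙ ℤP.*-identityˡ (x e) ∙ sym (pp-id (x e) (ℤP.≤-trans (ℤ.+≤+ z≤n) (np-false-pos (x e) q)))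

  black-fib : ∀ d h → fib QT.cls (QT.cls (bd d h)) (λ _ → 1ℤ) + pos 2 * fib QT.cls (QT.cls (bd d h)) wtT ≡ pos 2 * B
  black-fib d h = cong₂ (λ u v → u + pos 2 * v) (face-fib d h (λ _ → 1ℤ) (λ _ → 1ℤ) (λ _ → 1ℤ) (λ _ _ → refl) (λ _ _ → refl)) (face-fib d h wtT (λ e → - nn (x e)) x wtT-b wtT-w) ∙
    cong (fib face (face d) (λ _ → 1ℤ) +_) (sym (∑-*ˡ (pos 2) (λ e → ind (face e) (face d) * - nn (x e)))) ∙ sym (∑-+ (λ e → ind (face e) (face d) * 1ℤ) (λ e → pos 2 * (ind (face e) (face d) * - nn (x e)))) ∙
      ∑-cong (λ e → l (ind (face e) (face d)) (nn (x e))) ∙ o3 (face d) (B-elim d h)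
    where l : ∀ i a → i * 1ℤ + pos 2 * (i * - a) ≡ i * (1ℤ - pos 2 * a)
          l = solve-∀

  -- The opposite dart has weight at most `B`, the total of the positive parts at its vertex.
  x≥-1 : ∀ q → -1ℤ ≤ x q
  x≥-1 q = ≤-by (B - x (α q)) (0≤- (ℤP.≤-trans (x≤pp (x (α q))) (pp≤B (α q)))) (l (x q) (x (α q)) B (o1 q))
    where
    l : ∀ a c b → a + c ≡ b - 1ℤ → a - -1ℤ ≡ b - c
    l a c b e = l1 a c ∙ cong (λ u → u + 1ℤ - c) e ∙ l2 b c
      where l1 : ∀ a c → a - -1ℤ ≡ (a + c) + 1ℤ - c
            l1 = solve-∀
            l2 : ∀ b c → (b - 1ℤ) + 1ℤ - c ≡ b - c
            l2 = solve-∀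
    x≤pp : ∀ i → i ≤ pp i
    x≤pp (pos _) = ℤP.≤-refl
    x≤pp -[1+ _ ] = ℤ.-≤+
    pp≤B : ∀ q → pp (x q) ≤ B
    pp≤B q = ℤP.≤-trans (ℤP.≤-reflexive (sym (cong (_* pp (x q)) (ind-refl (vert q)) ∙ ℤP.*-identityˡ (pp (x q)))))
        (ℤP.≤-trans (∑-term (λ d → ind (vert d) (vert q) * pp (x d)) (λ d → 0≤* (0≤ind (vert d) (vert q)) (0≤pp (x d))) q) (ℤP.≤-reflexive (o2 (vert q))))

  nn01 : ∀ i → -1ℤ ≤ i → (- nn i ≡ 0ℤ) ⊎ (- nn i ≡ -1ℤ)
  nn01 (pos _) _ = inj₁ refl
  nn01 -[1+ zero ] _ = inj₂ refl
  nn01 -[1+ suc k ] (ℤ.-≤- ())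

  B-1 : B - 1ℤ ≡ pos (b ℕ.∸ 1)
  B-1 = ℤP.m-n≡m⊖n b 1 ∙ (ℤP.⊖-≥ b≥1)

  cancelB : ∀ {i j} → B * i ≡ B * j → i ≡ j
  cancelB {i} {j} e = ℤP.*-cancelˡ-≡ B i j ⦃ ℕ.>-nonZero b≥1 ⦄ e

  module ConnT (h : Fin NT → Bool) (hσ : ∀ i → h (σT i) ≡ h i) (hα : ∀ i → h (αT i) ≡ h i) where
    d0 : D
    d0 = α r0
    -- Default value for the outer face, its edges and its vertices: the only tree arc tying them to
    -- the mobile is the extra one, from the edge of `d0` to the face of `d0`.
    κ : Bool
    κ = h (bd d0 (αR-inner r0 r0-outer))

    h-cls : ∀ {i j} → QT.cls i ≡ QT.cls j → h i ≡ h j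
    h-cls e = orb-inv h hσ (QT.cls-orb e)

    hF′ : ∀ d c → isB d ≡ c → Bool
    hF′ d true e = h (bd d e)
    hF′ d false e = κ
    hF : D → Bool
    hF d = hF′ d (isB d) refl
    hF-eq : ∀ d c e → hF d ≡ hF′ d c e
    hF-eq d c refl = refl

    gF : Fin Fc → Bool
    gF f = hF (frep f)
    gF-b : ∀ d k → gF (face d) ≡ h (bd d k)
    gF-b d k = hF-eq (frep (face d)) true k' ∙ h-cls (orb-b (frep (face d)) k' d k (face-frep (face d)))
      where k' : isB (frep (face d)) ≡ true
            k' = B-intro (frep (face d)) (λ p → B-elim d k (sym (face-frep (face d)) ∙ p))
    gF-fo : gF fo ≡ κ
    gF-fo = hF-eq (frep fo) false (cong not (true-does (face (frep fo) ≟ fo) (face-frep fo)))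

    hE′ : ∀ d c → isB d ≡ c → ∀ c' → isB (α d) ≡ c' → Bool
    hE′ d true e true e' = h (tg d e e')
    hE′ d true e false e' = κ
    hE′ d false e c' e' = κ
    hE : D → Bool
    hE d = hE′ d (isB d) refl (isB (α d)) refl
    hE-eq : ∀ d c e c' e' → hE d ≡ hE′ d c e c' e'
    hE-eq d c refl c' refl = refl
    hE-tg : ∀ d k k' → hE d ≡ h (tg d k k')
    hE-tg d k k' = hE-eq d true k true k'
    hE-out : ∀ d → face d ≡ fo → hE d ≡ κ
    hE-out d f = hE-eq d false (cong not (true-does (face d ≟ fo) f)) (isB (α d)) refl ∙ refl
    hE-out' : ∀ d → face (α d) ≡ fo → hE d ≡ κ
    hE-out' d f = go (isB d) refl
      where go : ∀ c → isB d ≡ c → hE d ≡ κ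
            go true e = hE-eq d true e false (cong not (true-does (face (α d) ≟ fo) f))
            go false e = hE-out d (R-elim d e)
    hE-α : ∀ d → hE (α d) ≡ hE d
    hE-α d = go (isB d) refl (isB (α d)) refl
      where go : ∀ c → isB d ≡ c → ∀ c' → isB (α d) ≡ c' → hE (α d) ≡ hE d
            go true e true e' = hE-tg (α d) e' (B-αα d e) ∙ sym (cong h (αT-tg d e e')) ∙ hα (tg d e e') ∙ sym (hE-tg d e e')
            go true e false e' = hE-out (α d) (R-elim (α d) e') ∙ sym (hE-out' d (R-elim (α d) e'))
            go false e c' e' = hE-out' (α d) (cong face (αα d) ∙ R-elim d e) ∙ sym (hE-out d (R-elim d e))
    gE : Fin E → Bool
    gE e = hE (erep e)
    gE-d : ∀ d → gE (edge d) ≡ hE d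
    gE-d d = [ cong hE , (λ p → cong hE p ∙ hE-α d) ]′ (edge-eq (edge-erep (edge d)))

    WAt : Fin V → D → Set
    WAt v q = vert q ≡ v × isW q ≡ true
    wAt? : ∀ v q → Dec (WAt v q)
    wAt? v q = (vert q ≟ v) ×-dec (isW q Data.Bool.≟ true)
    gV′ : ∀ v → Dec (∃ (WAt v)) → Bool
    gV′ v (yes (q , _ , w)) = h (wd q w)
    gV′ v (no _) = κ
    gV : Fin V → Bool
    gV v = gV′ v (FP.any? (wAt? v))
    gV-w : ∀ d w → gV (vert d) ≡ h (wd d w)
    gV-w d w = go (FP.any? (wAt? (vert d)))
      where go : ∀ z → gV′ (vert d) z ≡ h (wd d w)
            go (yes (q , p , w')) = h-cls (orb-w q w' d w p)
            go (no n) = ⊥-elim (n (d , refl , w))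
    gV-out : ∀ r → face r ≡ fo → gV (vert (α r)) ≡ κ
    gV-out r f = go (FP.any? (wAt? (vert (α r))))
      where go : ∀ z → gV′ (vert (α r)) z ≡ κ
            go (no _) = refl
            go (yes (q , p , w)) = ⊥-elim (B-elim (α (α r)) (isW-α (α r) (W-vertex q (α r) w (sym p) (npαR (α r) (cong face (αα r) ∙ f)))) (cong face (αα r) ∙ f))

    g : Fin N → Bool
    g = nodeF gV gE gF

    rk = rank (nxt (np ∘ x)) d0 good
    open Policy (np ∘ x) d0 (proj₁ rk) (proj₁ (proj₂ rk)) (proj₂ (proj₂ rk))

    -- Away from the outer face the uncrossed arcs are the non-bud half-edges of the mobile: on the
    -- face side for weights at most 0, on the vertex side for positive ones. An invariant function
    -- on the mobile is thus a cut function of the spanning tree, and the tree is connected.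
    cut : Cut aS aT g
    cut zero = nodeF-E gV gE gF (edge d0) ∙ gE-d d0 ∙ hE-out' d0 (cong face (αα r0) ∙ r0-outer) ∙ sym (cong (λ c → g (tgt c d0)) (npαR d0 (cong face (αα r0) ∙ r0-outer)) ∙ nodeF-F gV gE gF (face d0) ∙ gF-b d0 (αR-inner r0 r0-outer))
    cut (suc q) = nodeF-E gV gE gF (edge q) ∙ gE-d q ∙ go (np (x q)) refl
      where
      go : ∀ c → np (x q) ≡ c → hE q ≡ g (tgt (not (np (x q))) q)
      go true e = on (isB q) refl ∙ sym (cong (λ c → g (tgt (not c) q)) e ∙ nodeF-F gV gE gF (face q))
        where on : ∀ c → isB q ≡ c → hE q ≡ gF (face q)
              on true k = hE-tg q k (nonpos-αB q e) ∙ cong h (tg-b q k (nonpos-αB q e) e) ∙ sym (gF-b q k)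
              on false k = hE-out q (R-elim q k) ∙ sym (cong gF (R-elim q k) ∙ gF-fo)
      go false e = on (isB (α q)) refl ∙ sym (cong (λ c → g (tgt (not c) q)) e ∙ nodeF-V gV gE gF (vert q))
        where on : ∀ c → isB (α q) ≡ c → hE q ≡ gV (vert q)
              on true k = hE-tg q (pos-B q e) k ∙ cong h (tg-w q (pos-B q e) k (∧-tt (t-not e) k)) ∙ sym (gV-w q (∧-tt (t-not e) k))
              on false k = hE-out' q (R-elim (α q) k) ∙ sym (cong (λ u → gV (vert u)) (sym (αα q)) ∙ gV-out (α q) (R-elim (α q) k))

    const : ∀ i j → h i ≡ h j
    const i j = at i ∙ (tree-conn g cut _ _) ∙ sym (at j)
      where at : ∀ i → h i ≡ g (invT i)
            at = elim (λ i → h i ≡ g (invT i)) (λ d k → sym (cong g (invT-b d k) ∙ nodeF-F gV gE gF (face d) ∙ gF-b d k))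
                     (λ d k → sym (cong g (invT-w d k) ∙ nodeF-V gV gE gF (vert d) ∙ gV-w d k))

  cB cW : ℤ
  cB = ∑ (λ d → b2z (isB d))
  cW = ∑ (λ d → b2z (isW d))

  *1 : ∀ (g : D → Bool) → ∑ (λ d → b2z (g d) * 1ℤ) ≡ ∑ (λ d → b2z (g d))
  *1 g = ∑-cong (λ d → ℤP.*-identityʳ (b2z (g d)))

  fixT : Fin NT → ℤ
  fixT i = b2z ⌊ αT i ≟ i ⌋
  fixT-yes : ∀ i → αT i ≡ i → fixT i ≡ 1ℤ
  fixT-yes i e = cong b2z (true-isYes (αT i ≟ i) e)
  fixT-no : ∀ i → αT i ≢ i → fixT i ≡ 0ℤ
  fixT-no i ne with αT i ≟ i
  ... | yes e = ⊥-elim (ne e)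
  ... | no _ = refl

  -- Buds are the positive darts: those that are white as well, and the opposites of the `2B` outer
  -- darts.
  buds : pos (numFixed αT) ≡ cW + pos 2 * B
  buds = length-filter-∑ (λ i → ⌊ αT i ≟ i ⌋) ∙ TS.∑-two fixT (λ d → b2z (not (np (x d)))) (λ _ → 0ℤ) fb fw ∙
     cong₂ _+_ (∑-cong pt) (∑-zero (λ d → ℤP.*-zeroʳ (b2z (isW d)))) ∙ (ℤP.+-identityʳ _) ∙ ∑-+ (λ d → b2z (isW d)) (λ d → ind (face (α d)) fo * 1ℤ) ∙ cong (cW +_) (∑-α (λ d → ind (face d) fo * 1ℤ) ∙ outer-deg)
    where
    fb : ∀ d k → fixT (bd d k) ≡ b2z (not (np (x d)))
    fb d k = go (np (x d)) refl
      where go : ∀ c → np (x d) ≡ c → fixT (bd d k) ≡ b2z (not (np (x d)))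
            go false e = fixT-yes (bd d k) (αT-bud d k e) ∙ cong (λ c → b2z (not c)) (sym e)
            go true e = fixT-no (bd d k) (subst (λ i → αT i ≢ i) (tg-b d k (nonpos-αB d e) e) (tg-nonbud d k (nonpos-αB d e))) ∙ cong (λ c → b2z (not c)) (sym e)
    fw : ∀ d k → fixT (wd d k) ≡ 0ℤ
    fw d k = fixT-no (wd d k) (subst (λ i → αT i ≢ i) (tg-w d (pos-B d (isW-np d k)) (isW-α d k) k) (tg-nonbud d (pos-B d (isW-np d k)) (isW-α d k)))
    pt : ∀ d → b2z (isB d) * b2z (not (np (x d))) ≡ b2z (isW d) + ind (face (α d)) fo * 1ℤ
    pt d = go (np (x d)) refl (isB (α d)) refl
      where
      io : face (α d) ≡ fo → ind (face (α d)) fo ≡ 1ℤ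
      io p = cong (λ f → ind f fo) p ∙ ind-refl fo
      go : ∀ c → np (x d) ≡ c → ∀ c' → isB (α d) ≡ c' → b2z (isB d) * b2z (not (np (x d))) ≡ b2z (isW d) + ind (face (α d)) fo * 1ℤ
      go true e c' e' = cong (λ c → b2z (isB d) * b2z (not c)) e ∙ ℤP.*-zeroʳ (b2z (isB d)) ∙ sym (cong₂ (λ u v → b2z (not u ∧ isB (α d)) + v * 1ℤ) e (ind-no (B-elim (α d) (nonpos-αB d e))))
      go false e true e' = cong₂ (λ u c → b2z u * b2z (not c)) (pos-B d e) e ∙ sym (cong₂ (λ u v → b2z u + v * 1ℤ) (∧-tt (t-not e) e') (ind-no (B-elim (α d) e')))
      go false e false e' = cong₂ (λ u c → b2z u * b2z (not c)) (pos-B d e) e ∙ sym (cong₂ (λ u v → b2z u + v * 1ℤ) (cong₂ (λ u v → not u ∧ v) e e') (io (R-elim (α d) e')))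

  Ed : ℕ
  Ed = numCycles αT ℕ.∸ numFixed αT

  black-darts : cB ≡ pos 2 * pos Ed + pos 2 * B
  black-darts = l cB cW (pos 2 * pos Ed) (pos 2 * B) (sym NT≡ ∙ involution-count αT αT-inv ∙ cong (pos 2 * pos Ed +_) buds)
    where
    NT≡ : pos NT ≡ cB + cW
    NT≡ = sym (∑-const NT 1ℤ ∙ ℤP.*-identityʳ (pos NT)) ∙ TS.∑-two (λ _ → 1ℤ) (λ _ → 1ℤ) (λ _ → 1ℤ) (λ _ _ → refl) (λ _ _ → refl) ∙ cong₂ _+_ (*1 isB) (*1 isW)
    l : ∀ a w e b → a + w ≡ e + (w + b) → a ≡ e + b
    l a w e b p = l1 a w ∙ cong (_- w) p ∙ l2 e w b
      where l1 : ∀ a w → a ≡ (a + w) - w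
            l1 = solve-∀
            l2 : ∀ e w b → (e + (w + b)) - w ≡ e + b
            l2 = solve-∀

  wt-total : pos 2 * ∑ wtT ≡ (pos 2 * pos Ed) * (B - 1ℤ)
  wt-total = l (∑ wtT) ∙ cong (∑ wtT +_) (sym (∑-bij αT αT αT-inv αT-inv wtT)) ∙ sym (∑-+ wtT (λ i → wtT (αT i))) ∙ ∑-cong pt ∙
     ∑-*ʳ (B - 1ℤ) (λ i → 1ℤ - fixT i) ∙ cong (_* (B - 1ℤ)) (∑-- (λ _ → 1ℤ) fixT ∙ cong₂ _-_ (∑-const NT 1ℤ ∙ ℤP.*-identityʳ (pos NT)) (sym (length-filter-∑ (λ i → ⌊ αT i ≟ i ⌋))) ∙
       cong (_- pos (numFixed αT)) (involution-count αT αT-inv) ∙ l2 (pos 2 * pos Ed) (pos (numFixed αT)))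
    where
    l : ∀ a → pos 2 * a ≡ a + a
    l = solve-∀
    l2 : ∀ a c → (a + c) - c ≡ a
    l2 = solve-∀
    pt : ∀ i → wtT i + wtT (αT i) ≡ (1ℤ - fixT i) * (B - 1ℤ)
    pt = split (λ i → wtT i + wtT (αT i) ≡ (1ℤ - fixT i) * (B - 1ℤ))
      (λ d k e → cong₂ _+_ (wtT-b d k ∙ (cong -_ (np-false (x d) e))) (cong wtT (αT-bud d k e) ∙ wtT-b d k ∙ (cong -_ (np-false (x d) e))) ∙
          sym (cong (λ u → (1ℤ - u) * (B - 1ℤ)) (fixT-yes (bd d k) (αT-bud d k e))))
      (λ d k k' → cong₂ _+_ (wtT-tg d k k') (cong wtT (αT-tg d k k') ∙ wtT-tg (α d) k' (B-αα d k)) ∙ o1 d ∙ sym (ℤP.*-identityˡ (B - 1ℤ)) ∙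
          sym (cong (λ u → (1ℤ - u) * (B - 1ℤ)) (fixT-no (tg d k k') (tg-nonbud d k k'))))

  blk : Fin NT → ℤ
  blk = rec (λ _ _ → 1ℤ) (λ _ _ → 0ℤ)

  class-total : ∀ c → fib QT.cls c (λ i → pos 2 * wtT i + blk i) ≡ pos 2 * B
  class-total c = cong (λ c → fib QT.cls c G) (sym (QT.cls-rep c)) ∙ elim (λ i → fib QT.cls (QT.cls i) G ≡ pos 2 * B) onB onW (QT.rep c)
    where
    G : Fin NT → ℤ
    G i = pos 2 * wtT i + blk i
    Gb : ∀ d k → G (bd d k) ≡ 1ℤ - pos 2 * nn (x d)
    Gb d k = cong₂ (λ u v → pos 2 * u + v) (wtT-b d k) (TS.rec-l _ _ d k) ∙ l (nn (x d))
      where l : ∀ a → pos 2 * - a + 1ℤ ≡ 1ℤ - pos 2 * a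
            l = solve-∀
    Gw : ∀ d k → G (wd d k) ≡ pos 2 * x d
    Gw d k = cong₂ (λ u v → pos 2 * u + v) (wtT-w d k) (TS.rec-r _ _ d k) ∙ ℤP.+-identityʳ (pos 2 * x d)
    onB : ∀ d k → fib QT.cls (QT.cls (bd d k)) G ≡ pos 2 * B
    onB d k = face-fib d k G (λ e → 1ℤ - pos 2 * nn (x e)) (λ e → pos 2 * x e) Gb Gw ∙ o3 (face d) (B-elim d k)
    onW : ∀ d k → fib QT.cls (QT.cls (wd d k)) G ≡ pos 2 * B
    onW d k = vert-fib d k G (λ e → 1ℤ - pos 2 * nn (x e)) (λ e → pos 2 * x e) Gb Gw ∙ ∑-cong (λ e → l (ind (vert e) (vert d)) (b2z (isW e)) (x e)) ∙
        ∑-*ˡ (pos 2) (λ e → ind (vert e) (vert d) * (b2z (isW e) * x e)) ∙ cong (pos 2 *_) (sym (vert-fib d k wtT (λ e → - nn (x e)) x wtT-b wtT-w) ∙ white-fib d k)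
      where l : ∀ i a x → i * (a * (pos 2 * x)) ≡ pos 2 * (i * (a * x))
            l = solve-∀

  -- The tree equation comes from weighing. Twice the weights plus the number of black half-edges
  -- amount to `2B` at every vertex; over the whole mobile they amount to `2E(B - 1)` plus
  -- `2E + 2B`. Dividing by `2B` leaves `V = E + 1`.
  tree-eq : numCycles σT ≡ Ed ℕ.+ 1
  tree-eq = QT.size-numCycles ∙ ℤP.+-injective (cancelB (cancel2 (sym lhs ∙ rhs')) ∙ sym (ℤP.pos-+ Ed 1))
    where
    lhs : ∑ (λ i → pos 2 * wtT i + blk i) ≡ pos 2 * (B * pos QT.size)
    lhs = ∑-cong (λ i → sym (ℤP.*-identityˡ (pos 2 * wtT i + blk i))) ∙ sym (∑-fib QT.cls (λ _ → 1ℤ) (λ i → pos 2 * wtT i + blk i)) ∙ ∑-cong (λ c → (ℤP.*-identityˡ _) ∙ class-total c) ∙ ∑-const QT.size (pos 2 * B) ∙ l (pos QT.size) B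
      where l : ∀ n b → n * (pos 2 * b) ≡ pos 2 * (b * n)
            l = solve-∀
    rhs' : ∑ (λ i → pos 2 * wtT i + blk i) ≡ pos 2 * (B * (pos Ed + 1ℤ))
    rhs' = ∑-+ (λ i → pos 2 * wtT i) blk ∙ cong₂ _+_ (∑-*ˡ (pos 2) wtT ∙ wt-total) (TS.∑-two blk (λ _ → 1ℤ) (λ _ → 0ℤ) (TS.rec-l _ _) (TS.rec-r _ _) ∙ cong₂ _+_ (*1 isB) (∑-zero (λ d → ℤP.*-zeroʳ (b2z (isW d)))) ∙ ℤP.+-identityʳ cB ∙ black-darts) ∙
       l (pos Ed) B
      where l : ∀ e b → (pos 2 * e) * (b - 1ℤ) + (pos 2 * e + pos 2 * b) ≡ pos 2 * (b * (e + 1ℤ))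
            l = solve-∀

  mobile : Mobile b
  mobile = record
    { mob = preMob
    ; involutive = αT-inv
    ; connected = reach-all preT (λ h hσ hα → ConnT.const h hσ hα)
    ; tree = tree-eq
    ; colVertex = elim (λ i → colT (σT i) ≡ colT i) (λ d k → cong colT (σT-b d k) ∙ (colT-b (φ d) _) ∙ sym (colT-b d k)) (λ d k → cong colT (σT-w d k) ∙ (colT-w (ret d k) _) ∙ sym (colT-w d k))
    ; budsBlack = split (λ i → αT i ≡ i → colT i ≡ black) (λ d k e _ → colT-b d k) (λ d k k' e → ⊥-elim (tg-nonbud d k k' e))
    ; budsZero = split (λ i → αT i ≡ i → wtT i ≡ 0ℤ) (λ d k e _ → wtT-b d k ∙ (cong -_ (np-false (x d) e))) (λ d k k' e → ⊥-elim (tg-nonbud d k k' e))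
    ; whitePos = elim (λ i → ¬ (αT i ≡ i) → colT i ≡ white → 0ℤ < wtT i) (λ d k _ e → ⊥-elim (bw (sym (colT-b d k) ∙ e)))
         (λ d k _ _ → subst (0ℤ <_) (sym (wtT-w d k)) (1+≤⇒< (np-false-pos (x d) (isW-np d k))))
    ; blackHalf = elim (λ i → ¬ (αT i ≡ i) → colT i ≡ black → (wtT i ≡ 0ℤ) ⊎ (wtT i ≡ -1ℤ)) (λ d k _ _ → subst (λ u → (u ≡ 0ℤ) ⊎ (u ≡ -1ℤ)) (sym (wtT-b d k)) (nn01 (x d) (x≥-1 d)))
         (λ d k _ e → ⊥-elim (bw (sym e ∙ colT-w d k)))
    ; edgeW = split (λ i → ¬ (αT i ≡ i) → wtT i + wtT (αT i) ≡ pos (b ℕ.∸ 1)) (λ d k e n → ⊥-elim (n (αT-bud d k e)))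
         (λ d k k' _ → cong₂ _+_ (wtT-tg d k k') (cong wtT (αT-tg d k k') ∙ wtT-tg (α d) k' (B-αα d k)) ∙ o1 d ∙ B-1)
    ; whiteW = elim (λ i → colT i ≡ white → PreMobile.vertexWeight preMob i ≡ pos b) (λ d k e → ⊥-elim (bw (sym (colT-b d k) ∙ e))) (λ d k _ → QT.orbit-sum wtT (wd d k) ∙ white-fib d k)
    ; blackW = elim (λ i → colT i ≡ black → pos (PreMobile.vertexDegree preMob i) + pos 2 * PreMobile.vertexWeight preMob i ≡ pos (2 ℕ.* b))
         (λ d k _ → cong₂ (λ u v → u + pos 2 * v) (QT.cycleLen-fib (bd d k)) (QT.orbit-sum wtT (bd d k)) ∙ black-fib d k ∙ sym (ℤP.pos-* 2 b))
         (λ d k e → ⊥-elim (bw (sym e ∙ colT-w d k))) }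
    where bw : black ≢ white
          bw ()

-- An oriented map is determined by its mobile

module Recover (b : ℕ) (b≥1 : 1 ℕ.≤ b) (S S' : Surface) (fo : Fin (Surface.Fc S)) (fo' : Fin (Surface.Fc S'))
  (x : Fin (Surface.n S) → ℤ) (x' : Fin (Surface.n S') → ℤ) (O : Weights.Orient S b fo x) (O' : Weights.Orient S' b fo' x') where
  module S = Surface S
  module S' = Surface S'
  module A = MobileOf b b≥1 S fo x O
  module A' = MobileOf b b≥1 S' fo' x' O'
  module OO = Weights.Orient O
  module OO' = Weights.Orient O'
  open A using (bd; wd; tg)

  module _ (ψT : Fin A.NT → Fin A'.NT) (ψT-inj : ∀ {i j} → ψT i ≡ ψT j → i ≡ j) (ψT-sur : ∀ j → ∃ λ i → ψT i ≡ j)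
    (pσ : ∀ i → ψT (A.σT i) ≡ A'.σT (ψT i)) (pα : ∀ i → ψT (A.αT i) ≡ A'.αT (ψT i)) (pc : ∀ i → A'.colT (ψT i) ≡ A.colT i) where

    bw : black ≢ white
    bw ()

    black-form : ∀ j → A'.colT j ≡ black → ∃ λ d → ∃ λ h → j ≡ A'.bd d h
    black-form = A'.elim (λ j → A'.colT j ≡ black → ∃ λ d → ∃ λ h → j ≡ A'.bd d h) (λ d h _ → d , h , refl) (λ d h e → ⊥-elim (bw (sym e ∙ A'.colT-w d h)))

    white-form : ∀ j → A'.colT j ≡ white → ∃ λ d → ∃ λ h → j ≡ A'.wd d h
    white-form = A'.elim (λ j → A'.colT j ≡ white → ∃ λ d → ∃ λ h → j ≡ A'.wd d h) (λ d h e → ⊥-elim (bw (sym (A'.colT-b d h) ∙ e))) (λ d h _ → d , h , refl)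

    imB : ∀ d h → ∃ λ d' → ∃ λ h' → ψT (bd d h) ≡ A'.bd d' h'
    imB d h = black-form (ψT (bd d h)) (pc (bd d h) ∙ A.colT-b d h)
    ψB : ∀ d → A.isB d ≡ true → S'.D
    ψB d h = proj₁ (imB d h)
    ψB-B : ∀ d h → A'.isB (ψB d h) ≡ true
    ψB-B d h = proj₁ (proj₂ (imB d h))
    ψB-eq : ∀ d h → ψT (bd d h) ≡ A'.bd (ψB d h) (ψB-B d h)
    ψB-eq d h = proj₂ (proj₂ (imB d h))
    ψB-cong : ∀ {d d'} → d ≡ d' → ∀ {h h'} → ψB d h ≡ ψB d' h'
    ψB-cong {d} refl {h} {h'} = cong (ψB d) (bool-irr h h')

    imW : ∀ d h → ∃ λ d' → ∃ λ h' → ψT (wd d h) ≡ A'.wd d' h'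
    imW d h = white-form (ψT (wd d h)) (pc (wd d h) ∙ A.colT-w d h)
    ψW : ∀ d → A.isW d ≡ true → S'.D
    ψW d h = proj₁ (imW d h)
    ψW-W : ∀ d h → A'.isW (ψW d h) ≡ true
    ψW-W d h = proj₁ (proj₂ (imW d h))
    ψW-eq : ∀ d h → ψT (wd d h) ≡ A'.wd (ψW d h) (ψW-W d h)
    ψW-eq d h = proj₂ (proj₂ (imW d h))

    ψB-φ : ∀ d h h' → ψB (S.φ d) h' ≡ S'.φ (ψB d h)
    ψB-φ d h h' = A'.TS.inl-inj (sym (ψB-eq (S.φ d) h') ∙ cong ψT (A.TS.inl-cong refl ∙ sym (A.σT-b d h)) ∙ pσ (bd d h) ∙ cong A'.σT (ψB-eq d h) ∙ A'.σT-b (ψB d h) (ψB-B d h))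

    ψB-inj : ∀ d h e k → ψB d h ≡ ψB e k → d ≡ e
    ψB-inj d h e k p = A.TS.inl-inj (ψT-inj (ψB-eq d h ∙ A'.TS.inl-cong p ∙ sym (ψB-eq e k)))

    bud→ : ∀ d h → np (x d) ≡ false → np (x' (ψB d h)) ≡ false
    bud→ d h e = go (np (x' (ψB d h))) refl
      where go : ∀ c → np (x' (ψB d h)) ≡ c → np (x' (ψB d h)) ≡ false
            go false q = q
            go true q = ⊥-elim (A'.tg-nonbud (ψB d h) (ψB-B d h) (A'.nonpos-αB (ψB d h) q) (subst (λ j → A'.αT j ≡ j) (ψB-eq d h ∙ sym (A'.tg-b (ψB d h) (ψB-B d h) _ q))
                     (sym (pα (bd d h)) ∙ cong ψT (A.αT-bud d h e))))
    non→ : ∀ d h → np (x d) ≡ true → np (x' (ψB d h)) ≡ true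
    non→ d h e = go (np (x' (ψB d h))) refl
      where go : ∀ c → np (x' (ψB d h)) ≡ c → np (x' (ψB d h)) ≡ true
            go true q = q
            go false q = ⊥-elim (A.tg-nonbud d h (A.nonpos-αB d e) (subst (λ j → A.αT j ≡ j) (sym (A.tg-b d h _ e))
                     (ψT-inj (pα (bd d h) ∙ cong A'.αT (ψB-eq d h) ∙ A'.αT-bud (ψB d h) (ψB-B d h) q ∙ sym (ψB-eq d h)))))

    ψG : ∀ d → A.isB d ≡ true → A.isB (S.α d) ≡ true → S'.D
    ψG d h h' = A'.TS.und (ψT (tg d h h'))

    ψG-b : ∀ d h h' → np (x d) ≡ true → ψG d h h' ≡ ψB d h
    ψG-b d h h' e = cong (λ i → A'.TS.und (ψT i)) (A.tg-b d h h' e) ∙ cong A'.TS.und (ψB-eq d h) ∙ A'.TS.und-l (ψB d h) (ψB-B d h)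
    ψG-w : ∀ d h h' w → ψG d h h' ≡ ψW d w
    ψG-w d h h' w = cong (λ i → A'.TS.und (ψT i)) (A.tg-w d h h' w) ∙ cong A'.TS.und (ψW-eq d w) ∙ A'.TS.und-r (ψW d w) (ψW-W d w)

    und-α : ∀ j → A'.αT j ≢ j → A'.TS.und (A'.αT j) ≡ S'.α (A'.TS.und j)
    und-α = A'.split (λ j → A'.αT j ≢ j → A'.TS.und (A'.αT j) ≡ S'.α (A'.TS.und j)) (λ d h e ne → ⊥-elim (ne (A'.αT-bud d h e)))
       (λ d h h' _ → cong A'.TS.und (A'.αT-tg d h h') ∙ (A'.und-tg (S'.α d) _ _) ∙ cong S'.α (sym (A'.und-tg d h h')))

    ψG-α : ∀ d h h' k k' → ψG (S.α d) k k' ≡ S'.α (ψG d h h')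
    ψG-α d h h' k k' = cong (λ i → A'.TS.und (ψT i)) (A.tg-cong refl ∙ sym (A.αT-tg d h h')) ∙ cong A'.TS.und (pα (tg d h h')) ∙
        und-α (ψT (tg d h h')) (λ e → A.tg-nonbud d h h' (ψT-inj (pα (tg d h h') ∙ e)))

    σT⁻ : Fin A.NT → Fin A.NT
    σT⁻ = inv A.σT A.σT-inj

    W-vertex-B : ∀ d e → A.isW d ≡ true → S.vert e ≡ S.vert d → A.isB e ≡ true
    W-vertex-B d e w v = A.B-intro e λ f → A.B-elim (S.α u) (A.isW-α u (A.W-vertex d u w (vu ∙ v) (A.npαR u (fu f)))) (fu f)
      where
      u = S.σ⁻ e
      vu : S.vert u ≡ S.vert e
      vu = sym (S.vert-σ u) ∙ cong S.vert (S.σσ⁻ e)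
      fu : S.face e ≡ fo → S.face (S.α u) ≡ fo
      fu f = S.face-α u ∙ cong S.face (S.σσ⁻ e) ∙ f

    d0 : S.D
    d0 = S.α OO.r0

    private
      rk = rank (S.nxt (np ∘ x)) d0 OO.good
      ℓ = proj₁ rk
      ℓ-dec = proj₁ (proj₂ rk)
      ℓ<n = proj₂ (proj₂ rk)

    d0-np : np (x d0) ≡ false
    d0-np = A.npαR d0 (cong S.face (S.αα OO.r0) ∙ OO.r0-outer)

    prev : ∀ w h → ∃ λ w⁻ → ∃ λ h⁻ → A.RT.ret w⁻ h⁻ ≡ w
    prev w h = go (σT⁻ (wd w h)) (inv-r A.σT A.σT-inj (wd w h))
      where go : ∀ j → A.σT j ≡ wd w h → ∃ λ w⁻ → ∃ λ h⁻ → A.RT.ret w⁻ h⁻ ≡ w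
            go = A.elim (λ j → A.σT j ≡ wd w h → ∃ λ w⁻ → ∃ λ h⁻ → A.RT.ret w⁻ h⁻ ≡ w) (λ d k e → ⊥-elim (A.TS.l≢r (sym (A.σT-b d k) ∙ e)))
                 (λ d k e → d , k , A.TS.inr-inj (sym (A.σT-w d k) ∙ e))

    ψW-ret : ∀ w h h' → ψW (A.RT.ret w h) h' ≡ A'.RT.ret (ψW w h) (ψW-W w h)
    ψW-ret w h h' = A'.TS.inr-inj (sym (ψW-eq (A.RT.ret w h) h') ∙ cong ψT (A.TS.inr-cong refl ∙ sym (A.σT-w w h)) ∙ pσ (wd w h) ∙ cong A'.σT (ψW-eq w h) ∙ A'.σT-w (ψW w h) (ψW-W w h))

    -- A white dart occurs in the mobile also as a bud, and both copies must have the same image.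
    -- The white copy is reached from the previous white dart of its vertex by rotation in the map;
    -- on black copies each such rotation is `α` followed by `φ`. An opposite dart met on the way
    -- may again be double, but it steps into this rotation and so has higher rank.
    ψ-agree : ∀ m w (h : A.isW w ≡ true) (k : A.isB w ≡ true) → S.n ℕ.< ℓ w ℕ.+ m → ψB w k ≡ ψW w h
    ψ-agree zero w h k lt = ⊥-elim (ℕP.<-asym (ℓ<n w) (subst (S.n ℕ.<_) (ℕP.+-identityʳ (ℓ w)) lt))
    ψ-agree (suc m) w h k lt = (ψB-cong (sym w≡) ∙ f-eq K ℕP.≤-refl) ∙ sym ret≡ ∙ sym (ψW-ret w⁻ h⁻ (cong A.isW w≡ ∙ h)) ∙ ψW-cong w≡
      where
      w⁻ = proj₁ (prev w h)
      h⁻ = proj₁ (proj₂ (prev w h))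
      w≡ : A.RT.ret w⁻ h⁻ ≡ w
      w≡ = proj₂ (proj₂ (prev w h))
      K = proj₁ (A.RT.first w⁻ h⁻)
      ψW-cong : ∀ {d d'} → d ≡ d' → ∀ {h h'} → ψW d h ≡ ψW d' h'
      ψW-cong {d} refl {h} {h'} = cong (ψW d) (bool-irr h h')
      e : ℕ → S.D
      e i = iter S.σ i w⁻
      f : ℕ → S'.D
      f i = iter S'.σ i (ψW w⁻ h⁻)
      e-B : ∀ i → A.isB (e i) ≡ true
      e-B i = W-vertex-B w⁻ (e i) h⁻ (A.vert-iter i w⁻)
      e-np : ∀ i → i ℕ.< K → np (x (e (suc i))) ≡ true
      e-np i l = go (np (x (e (suc i)))) refl
        where go : ∀ c → np (x (e (suc i))) ≡ c → np (x (e (suc i))) ≡ true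
              go true q = q
              go false q = ⊥-elim (true≢false (sym (A.W-vertex w⁻ (e (suc i)) h⁻ (A.vert-iter (suc i) w⁻) q) ∙ proj₂ (proj₂ (A.RT.first w⁻ h⁻)) i l))
      ℓ-mono : ∀ j i → i ℕ.+ j ≡ K → ℓ w ℕ.≤ ℓ (e (suc i))
      ℓ-mono zero i q = ℕP.≤-reflexive (cong ℓ (sym w≡ ∙ cong (λ k → e (suc k)) (sym (sym (ℕP.+-identityʳ i) ∙ q))))
      ℓ-mono (suc j) i q = ℕP.≤-trans (ℓ-mono j (suc i) (sym (ℕP.+-suc i j) ∙ q)) (ℕP.<⇒≤ (subst (λ z → ℓ z ℕ.< ℓ (e (suc i))) (cong (λ c → S.stp c (e (suc i))) npi) (ℓ-dec (e (suc i)) (λ p → true≢false (sym npi ∙ cong (np ∘ x) p ∙ d0-np)))))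
        where npi = e-np i (subst (i ℕ.<_) q (subst (i ℕ.<_) (sym (ℕP.+-suc i j)) (s≤s (ℕP.m≤m+n i j))))
      e-αB : ∀ i → i ℕ.≤ K → A.isB (S.α (e i)) ≡ true
      e-αB zero l = A.isW-α w⁻ h⁻
      e-αB (suc i) l = A.nonpos-αB (e (suc i)) (e-np i l)
      ψα : ∀ i (l : i ℕ.≤ K) → ψB (S.α (e i)) (e-αB i l) ≡ ψG (S.α (e i)) (e-αB i l) (A.B-αα (e i) (e-B i))
      ψα i l = go (np (x (S.α (e i)))) refl
        where
        go : ∀ c → np (x (S.α (e i))) ≡ c → ψB (S.α (e i)) (e-αB i l) ≡ ψG (S.α (e i)) (e-αB i l) (A.B-αα (e i) (e-B i))
        go true q = sym (ψG-b (S.α (e i)) _ _ q)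
        go false q = ψ-agree m (S.α (e i)) isw (e-αB i l) up ∙ sym (ψG-w (S.α (e i)) _ _ isw)
          where
          isw : A.isW (S.α (e i)) ≡ true
          isw = ∧-tt (t-not q) (A.B-αα (e i) (e-B i))
          ne : S.α (e i) ≢ d0
          ne p = A.B-elim (e i) (e-B i) (cong S.face (sym (S.αα (e i)) ∙ cong S.α p ∙ S.αα OO.r0) ∙ OO.r0-outer)
          nx : S.nxt (np ∘ x) (S.α (e i)) ≡ e (suc i)
          nx = cong (λ c → S.stp c (S.α (e i))) q ∙ cong S.σ (S.αα (e i))
          up : S.n ℕ.< ℓ (S.α (e i)) ℕ.+ m
          up = ℕP.<-≤-trans lt (subst (ℕ._≤ ℓ (S.α (e i)) ℕ.+ m) (sym (ℕP.+-suc (ℓ w) m)) (ℕP.+-monoˡ-≤ m (ℕP.≤-<-trans (ℓ-mono (K ℕ.∸ i) i (ℕP.m+[n∸m]≡n l)) (subst (λ z → ℓ z ℕ.< ℓ (S.α (e i))) nx (ℓ-dec (S.α (e i)) ne)))))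
      step-eq : ∀ i (l : i ℕ.≤ K) → ψG (e i) (e-B i) (e-αB i l) ≡ f i → ψB (e (suc i)) (e-B (suc i)) ≡ f (suc i)
      step-eq i l p = ψB-cong (cong S.σ (sym (S.αα (e i)))) {h' = h2} ∙ ψB-φ (S.α (e i)) (e-αB i l) h2 ∙ cong S'.φ (ψα i l ∙ (ψG-α (e i) (e-B i) (e-αB i l) _ _) ∙ cong S'.α p) ∙ cong S'.σ (S'.αα (f i))
        where h2 : A.isB (S.φ (S.α (e i))) ≡ true
              h2 = A.B-φ (S.α (e i)) (e-αB i l)
      f-eq : ∀ i → i ℕ.≤ K → ψB (e (suc i)) (e-B (suc i)) ≡ f (suc i)
      f-eq zero l = step-eq zero l (ψG-w w⁻ _ _ h⁻)
      f-eq (suc i) l = step-eq (suc i) l ((ψG-b (e (suc i)) _ _ (e-np i l)) ∙ f-eq i (ℕP.≤-trans (ℕP.n≤1+n i) l))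
      fK : np (x' (f (suc K))) ≡ false
      fK = subst (λ u → np (x' u) ≡ false) (f-eq K ℕP.≤-refl) (bud→ (e (suc K)) _ (subst (λ u → np (x u) ≡ false) (sym w≡) (A.isW-np w h)))
      ret≡ : A'.RT.ret (ψW w⁻ h⁻) (ψW-W w⁻ h⁻) ≡ f (suc K)
      ret≡ = A'.RT.ret-unique (ψW w⁻ h⁻) (ψW-W w⁻ h⁻) K (A'.W-vertex (ψW w⁻ h⁻) (f (suc K)) (ψW-W w⁻ h⁻) (A'.vert-iter (suc K) (ψW w⁻ h⁻)) fK)
         (λ i l → cong (λ c → not c ∧ A'.isB (S'.α (f (suc i)))) (subst (λ u → np (x' u) ≡ true) (f-eq i (ℕP.<⇒≤ l)) (non→ (e (suc i)) _ (e-np i l))))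

    ψBW : ∀ w h k → ψB w k ≡ ψW w h
    ψBW w h k = ψ-agree (suc S.n) w h k (ℕP.m≤n+m (suc S.n) (ℓ w))

    ψBα : ∀ d h h' → ψB (S.α d) h' ≡ S'.α (ψB d h)
    ψBα d h h' = sym (bg (S.α d) h' (A.B-αα d h)) ∙ ψG-α d h h' h' (A.B-αα d h) ∙ cong S'.α (bg d h h')
      where bg : ∀ d h h' → ψG d h h' ≡ ψB d h
            bg d h h' = go (np (x d)) refl
              where go : ∀ c → np (x d) ≡ c → ψG d h h' ≡ ψB d h
                    go true q = ψG-b d h h' q
                    go false q = ψG-w d h h' (∧-tt (t-not q) h') ∙ sym (ψBW d (∧-tt (t-not q) h') h)

    -- A bud opposite to an outer dart is one without a white copy, and this passes through the
    -- isomorphism: a white copy of the image would, by surjectivity of `ψT`, come from a white copy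
    -- of the bud.
    outer→ : ∀ r h → S.face r ≡ fo → S'.face (S'.α (ψB (S.α r) h)) ≡ fo'
    outer→ r h f = A'.R-elim (S'.α u) (go (A'.isB (S'.α u)) refl)
      where
      u = ψB (S.α r) h
      go : ∀ c → A'.isB (S'.α u) ≡ c → A'.isB (S'.α u) ≡ false
      go false q = q
      go true q = ⊥-elim (wrong (ψT-sur (A'.wd u w')))
        where
        w' : A'.isW u ≡ true
        w' = ∧-tt (t-not (bud→ (S.α r) h (A.npαR (S.α r) (cong S.face (S.αα r) ∙ f)))) q
        wrong : (∃ λ i → ψT i ≡ A'.wd u w') → ⊥
        wrong (i , e) = A.elim (λ i → ψT i ≡ A'.wd u w' → ⊥) (λ d k e → A'.TS.l≢r (sym (ψB-eq d k) ∙ e))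
           (λ d k e → A.B-elim (S.α d) (A.isW-α d k) (cong S.face (cong S.α (ψB-inj d (A.pos-B d (A.isW-np d k)) (S.α r) h ((ψBW d k _) ∙ A'.TS.inr-inj (sym (ψW-eq d k) ∙ e))) ∙ S.αα r) ∙ f)) i e

    ψ′ : ∀ d c → A.isB d ≡ c → S'.D
    ψ′ d true e = ψB d e
    ψ′ d false e = S'.α (ψB (S.α d) (A.αR-inner d (A.R-elim d e)))
    ψ : S.D → S'.D
    ψ d = ψ′ d (A.isB d) refl
    ψ-eq : ∀ d c e → ψ d ≡ ψ′ d c e
    ψ-eq d c refl = refl
    ψ-B : ∀ d h → ψ d ≡ ψB d h
    ψ-B d h = ψ-eq d true h
    ψ-R : ∀ d → S.face d ≡ fo → ∀ h → ψ d ≡ S'.α (ψB (S.α d) h)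
    ψ-R d f h = ψ-eq d false nb ∙ cong S'.α (ψB-cong refl)
      where nb : A.isB d ≡ false
            nb = cong not (true-does (S.face d ≟ fo) f)

    ψ-α : ∀ d → ψ (S.α d) ≡ S'.α (ψ d)
    ψ-α d = go (A.isB d) refl (A.isB (S.α d)) refl
      where go : ∀ c → A.isB d ≡ c → ∀ c' → A.isB (S.α d) ≡ c' → ψ (S.α d) ≡ S'.α (ψ d)
            go true h true h' = ψ-B (S.α d) h' ∙ ψBα d h h' ∙ cong S'.α (sym (ψ-B d h))
            go true h false h' = ψ-R (S.α d) (A.R-elim (S.α d) h') (A.B-αα d h) ∙ cong S'.α (ψB-cong (S.αα d) ∙ sym (ψ-B d h))
            go false h c' h' = ψ-B (S.α d) k ∙ sym (S'.αα (ψB (S.α d) k)) ∙ cong S'.α (sym (ψ-R d (A.R-elim d h) k))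
              where k = A.αR-inner d (A.R-elim d h)

    ψ-outer : ∀ d → S.face d ≡ fo → S'.face (ψ d) ≡ fo'
    ψ-outer d f = cong S'.face (ψ-R d f (A.αR-inner d f)) ∙ outer→ d (A.αR-inner d f) f

    ψ-σ-inner : ∀ d → A.isB (S.α d) ≡ true → ψ (S.σ d) ≡ S'.σ (ψ d)
    ψ-σ-inner d h = cong ψ (cong S.σ (sym (S.αα d))) ∙ ψ-B (S.φ (S.α d)) (A.B-φ (S.α d) h) ∙ (ψB-φ (S.α d) h _) ∙ cong S'.φ (sym (ψ-B (S.α d) h) ∙ ψ-α d) ∙ cong S'.σ (S'.αα (ψ d))

    -- Two outer darts `s` and `t` at one vertex would put weight `B` on both `σ⁻ s` and `σ⁻ t`,
    -- exceeding the sum at that vertex.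
    outer-unique : ∀ s t → S'.face s ≡ fo' → S'.face t ≡ fo' → S'.vert s ≡ S'.vert t → s ≡ t
    outer-unique s t fs ft v = go (S'.σ⁻ s ≟ S'.σ⁻ t)
      where
      fu : ∀ e → S'.face e ≡ fo' → S'.face (S'.α (S'.σ⁻ e)) ≡ fo'
      fu e f = S'.face-α (S'.σ⁻ e) ∙ cong S'.face (S'.σσ⁻ e) ∙ f
      vu : ∀ e → S'.vert (S'.σ⁻ e) ≡ S'.vert e
      vu e = sym (S'.vert-σ (S'.σ⁻ e)) ∙ cong S'.vert (S'.σσ⁻ e)
      go : Dec (S'.σ⁻ s ≡ S'.σ⁻ t) → s ≡ t
      go (yes p) = sym (S'.σσ⁻ s) ∙ cong S'.σ p ∙ S'.σσ⁻ t
      go (no ne) = ⊥-elim (ℤP.<-irrefl refl (1+≤⇒< (ℤP.≤-trans A'.1≤B (ℤP.≤-reflexive (sym B≡ ∙ z)))))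
        where
        z : pp (x' (S'.σ⁻ s)) ≡ 0ℤ
        z = OO'.outer-vertex (S'.α (S'.σ⁻ t)) (S'.σ⁻ s) (fu t ft) (vu s ∙ v ∙ sym (vu t) ∙ cong S'.vert (sym (S'.αα (S'.σ⁻ t)))) (λ p → ne (p ∙ S'.αα (S'.σ⁻ t)))
        B≡ : pp (x' (S'.σ⁻ s)) ≡ pos b
        B≡ = cong (pp ∘ x') (sym (S'.αα (S'.σ⁻ s))) ∙ cong pp (OO'.xα (S'.α (S'.σ⁻ s)) (fu s fs))

    -- Outer darts are not half-edges of the mobile, so their succession is recovered at vertices:
    -- `φ r` and `α r` are joined by rotations past inner darts, which `ψ` respects; the images then
    -- share a vertex, and an outer dart is determined by its vertex.
    ψ-φ-outer : ∀ r → S.face r ≡ fo → ψ (S.φ r) ≡ S'.φ (ψ r)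
    ψ-φ-outer r f = outer-unique (ψ r1) (S'.φ (ψ r)) (ψ-outer r1 f1) (S'.face-φ (ψ r) ∙ ψ-outer r f)
        (sym (vk K ℕP.≤-refl) ∙ cong S'.vert (cong ψ eK ∙ ψ-α r) ∙ sym (S'.vert-σ (S'.α (ψ r))))
      where
      r1 = S.φ r
      f1 : S.face r1 ≡ fo
      f1 = S.face-φ r ∙ f
      per = Orb-sym S.σ-inj (Orb-step {f = S.σ} {S.α r})
      hit : ℕ → Bool
      hit k = does (iter S.σ k r1 ≟ S.α r)
      L = leastℕ hit (proj₁ per) (true-does (iter S.σ (proj₁ per) r1 ≟ S.α r) (proj₂ per))
      K = proj₁ L
      eK : iter S.σ K r1 ≡ S.α r
      eK = does-true (iter S.σ K r1 ≟ S.α r) (proj₁ (proj₂ L))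
      notyet : ∀ i → i ℕ.< K → iter S.σ i r1 ≢ S.α r
      notyet i l p = true≢false (sym (true-does (iter S.σ i r1 ≟ S.α r) p) ∙ proj₂ (proj₂ L) i l)
      innr : ∀ i → i ℕ.< K → A.isB (S.α (iter S.σ i r1)) ≡ true
      innr i l = A.B-intro (S.α (iter S.σ i r1)) λ g → ℤP.<-irrefl refl (1+≤⇒< (ℤP.≤-trans (np-false-pos (x (iter S.σ i r1)) (A.npαR (iter S.σ i r1) g))
           (ℤP.≤-trans (xle (x (iter S.σ i r1))) (ℤP.≤-reflexive (OO.outer-vertex r (iter S.σ i r1) f (A.vert-iter i r1 ∙ S.vert-σ (S.α r)) (notyet i l))))))
        where xle : ∀ i → i ≤ pp i
              xle (pos _) = ℤP.≤-refl
              xle -[1+ _ ] = ℤ.-≤+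
      vk : ∀ i → i ℕ.≤ K → S'.vert (ψ (iter S.σ i r1)) ≡ S'.vert (ψ r1)
      vk zero l = refl
      vk (suc i) l = cong S'.vert (ψ-σ-inner (iter S.σ i r1) (innr i l)) ∙ S'.vert-σ (ψ (iter S.σ i r1)) ∙ vk i (ℕP.<⇒≤ l)

    ψ-σ : ∀ d → ψ (S.σ d) ≡ S'.σ (ψ d)
    ψ-σ d = go (A.isB (S.α d)) refl
      where go : ∀ c → A.isB (S.α d) ≡ c → ψ (S.σ d) ≡ S'.σ (ψ d)
            go true h = ψ-σ-inner d h
            go false h = cong ψ (cong S.σ (sym (S.αα d))) ∙ ψ-φ-outer (S.α d) (A.R-elim (S.α d) h) ∙ cong (λ u → S'.σ (S'.α u)) (ψ-α d) ∙ cong S'.σ (S'.αα (ψ d))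

    ψ-inj : ∀ {d e} → ψ d ≡ ψ e → d ≡ e
    ψ-inj {d} {e} p = go (A.isB d) refl (A.isB e) refl
      where
      nB : ∀ q → S'.face q ≡ fo' → A'.isB q ≡ true → ⊥
      nB q f h = A'.B-elim q h f
      go : ∀ c → A.isB d ≡ c → ∀ c' → A.isB e ≡ c' → d ≡ e
      go true h true k = ψB-inj d h e k (sym (ψ-B d h) ∙ p ∙ ψ-B e k)
      go true h false k = ⊥-elim (nB (ψ e) (ψ-outer e (A.R-elim e k)) (subst (λ q → A'.isB q ≡ true) (sym (ψ-B d h) ∙ p) (ψB-B d h)))
      go false h true k = ⊥-elim (nB (ψ d) (ψ-outer d (A.R-elim d h)) (subst (λ q → A'.isB q ≡ true) (sym (ψ-B e k) ∙ sym p) (ψB-B e k)))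
      go false h false k = S.α-inj (ψB-inj (S.α d) hd (S.α e) he (S'.α-inj (sym (ψ-R d (A.R-elim d h) hd) ∙ p ∙ ψ-R e (A.R-elim e k) he)))
        where hd = A.αR-inner d (A.R-elim d h)
              he = A.αR-inner e (A.R-elim e k)

    recovered : Σ[ ψ ∈ (S.D → S'.D) ] Inj ψ × (∀ d → ψ (S.σ d) ≡ S'.σ (ψ d)) × (∀ d → ψ (S.α d) ≡ S'.α (ψ d)) × (∀ d → S.face d ≡ fo → S'.face (ψ d) ≡ fo')
    recovered = ψ , ψ-inj , ψ-σ , ψ-α , ψ-outer

inj-perm : ∀ {m n} (f : Fin m → Fin n) → Inj f → n ℕ.≤ m → Σ[ ρ ∈ Permutation m n ] (∀ d → ρ ⟨$⟩ʳ d ≡ f d)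
inj-perm {m} {n} f inj le = go (ℕP.≤-antisym (FP.injective⇒≤ {f = f} inj) le) f inj
  where go : ∀ {m n} → m ≡ n → (f : Fin m → Fin n) → Inj f → Σ[ ρ ∈ Permutation m n ] (∀ d → ρ ⟨$⟩ʳ d ≡ f d)
        go refl f inj = mkPerm f inj , λ d → refl

-- Transporting orientations and mobiles along isomorphisms of maps

module Transport (S S' : Surface) (fo : Fin (Surface.Fc S)) (fo' : Fin (Surface.Fc S'))
  (ψ : Fin (Surface.n S) → Fin (Surface.n S')) (ψ⁻ : Fin (Surface.n S') → Fin (Surface.n S)) (ψ⁻ψ : ∀ d → ψ⁻ (ψ d) ≡ d) (ψψ⁻ : ∀ d → ψ (ψ⁻ d) ≡ d)
  (pσ : ∀ d → ψ (Surface.σ S d) ≡ Surface.σ S' (ψ d)) (pα : ∀ d → ψ (Surface.α S d) ≡ Surface.α S' (ψ d))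
  (r : Fin (Surface.n S)) (r-out : Surface.face S r ≡ fo) (r-out' : Surface.face S' (ψ r) ≡ fo') where
  module S = Surface S
  module S' = Surface S'

  ψ-inj : Inj ψ
  ψ-inj {d} {e} p = sym (ψ⁻ψ d) ∙ cong ψ⁻ p ∙ ψ⁻ψ e

  pφ : ∀ d → ψ (S.φ d) ≡ S'.φ (ψ d)
  pφ d = pσ (S.α d) ∙ cong S'.σ (pα d)

  p-iter : ∀ (f : S.D → S.D) (f' : S'.D → S'.D) → (∀ d → ψ (f d) ≡ f' (ψ d)) → ∀ k d → ψ (iter f k d) ≡ iter f' k (ψ d)
  p-iter f f' e zero d = refl
  p-iter f f' e (suc k) d = e (iter f k d) ∙ cong f' (p-iter f f' e k d)

  vert→ : ∀ {d e} → S.vert d ≡ S.vert e → S'.vert (ψ d) ≡ S'.vert (ψ e)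
  vert→ {d} {e} p = let (k , o) = S.vert-orb p in sym (iter-inv S'.vert S'.vert-σ k (ψ d)) ∙ cong S'.vert (sym (p-iter S.σ S'.σ pσ k d) ∙ cong ψ o)
  vert← : ∀ {d e} → S'.vert (ψ d) ≡ S'.vert (ψ e) → S.vert d ≡ S.vert e
  vert← {d} {e} p = let (k , o) = S'.vert-orb p in sym (iter-inv S.vert S.vert-σ k d) ∙ cong S.vert (ψ-inj (p-iter S.σ S'.σ pσ k d ∙ o))
  face→ : ∀ {d e} → S.face d ≡ S.face e → S'.face (ψ d) ≡ S'.face (ψ e)
  face→ {d} {e} p = let (k , o) = S.face-orb p in sym (iter-inv S'.face S'.face-φ k (ψ d)) ∙ cong S'.face (sym (p-iter S.φ S'.φ pφ k d) ∙ cong ψ o)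
  face← : ∀ {d e} → S'.face (ψ d) ≡ S'.face (ψ e) → S.face d ≡ S.face e
  face← {d} {e} p = let (k , o) = S'.face-orb p in sym (iter-inv S.face S.face-φ k d) ∙ cong S.face (ψ-inj (p-iter S.φ S'.φ pφ k d ∙ o))

  out→ : ∀ d → S.face d ≡ fo → S'.face (ψ d) ≡ fo'
  out→ d e = face→ (e ∙ sym r-out) ∙ r-out'
  out← : ∀ d → S'.face (ψ d) ≡ fo' → S.face d ≡ fo
  out← d e = face← (e ∙ sym r-out') ∙ r-out

  fib-ψ : ∀ {m m'} (cls : S.D → Fin m) (cls' : S'.D → Fin m') → (∀ {d e} → cls d ≡ cls e → cls' (ψ d) ≡ cls' (ψ e)) → (∀ {d e} → cls' (ψ d) ≡ cls' (ψ e) → cls d ≡ cls e) →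
    ∀ q (g : S'.D → ℤ) → fib cls (cls q) (g ∘ ψ) ≡ fib cls' (cls' (ψ q)) g
  fib-ψ cls cls' f f← q g = ∑-cong (λ d → cong (_* g (ψ d)) (ind-iff f f←)) ∙ ∑-bij ψ ψ⁻ ψ⁻ψ ψψ⁻ (λ d → ind (cls' d) (cls' (ψ q)) * g d)

  module _ (b : ℕ) (x' : S'.D → ℤ) (O' : Weights.Orient S' b fo' x') where
    open Weights.Orient O'

    x : S.D → ℤ
    x = x' ∘ ψ

    p-nxt : ∀ d → ψ (S.nxt (np ∘ x) d) ≡ S'.nxt (np ∘ x') (ψ d)
    p-nxt d = go (np (x d))
      where go : ∀ c → ψ (S.stp c d) ≡ S'.stp c (ψ d)
            go true = pσ d
            go false = pφ d

    transport : Weights.Orient S b fo x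
    transport = record
      { r0 = ψ⁻ r0
      ; r0-outer = out← (ψ⁻ r0) (cong S'.face (ψψ⁻ r0) ∙ r0-outer)
      ; o1 = λ q → cong (λ u → x' (ψ q) + x' u) (pα q) ∙ o1 (ψ q)
      ; o2 = λ v → cong (λ v → fib S.vert v (pp ∘ x)) (sym (S.vert-vrep v)) ∙ fib-ψ S.vert S'.vert vert→ vert← (S.vrep v) (pp ∘ x') ∙ o2 (S'.vert (ψ (S.vrep v)))
      ; o3 = λ f ne → cong (λ f → fib S.face f (λ q → 1ℤ - pos 2 * nn (x q))) (sym (S.face-frep f)) ∙ fib-ψ S.face S'.face face→ face← (S.frep f) (λ q → 1ℤ - pos 2 * nn (x' q)) ∙
               o3 (S'.face (ψ (S.frep f))) (λ p → ne (sym (S.face-frep f) ∙ out← (S.frep f) p))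
      ; o4 = λ q e → o4 (ψ q) (out→ q e)
      ; outer-deg = cong (λ f → fib S.face f (λ _ → 1ℤ)) (sym r-out) ∙ fib-ψ S.face S'.face face→ face← r (λ _ → 1ℤ) ∙ cong (λ f → fib S'.face f (λ _ → 1ℤ)) r-out' ∙ outer-deg
      ; good = λ q → let (k , e) = good (ψ q) in k , ψ-inj (p-iter (S.nxt (np ∘ x)) (S'.nxt (np ∘ x')) p-nxt k q ∙ e ∙ sym (pα (ψ⁻ r0) ∙ cong S'.α (ψψ⁻ r0))) }

  module MobIso (b : ℕ) (b≥1 : 1 ℕ.≤ b) (x : S.D → ℤ) (x' : S'.D → ℤ) (O : Weights.Orient S b fo x) (O' : Weights.Orient S' b fo' x') (ex : ∀ d → x' (ψ d) ≡ x d) where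
    module A = MobileOf b b≥1 S fo x O
    module A' = MobileOf b b≥1 S' fo' x' O'
    open A using (bd; wd; tg)

    B≡ : ∀ d → A'.isB (ψ d) ≡ A.isB d
    B≡ d = bool-ext (λ e → A.B-intro d (λ p → A'.B-elim (ψ d) e (out→ d p))) (λ e → A'.B-intro (ψ d) (λ p → A.B-elim d e (out← d p)))
    W≡ : ∀ d → A'.isW (ψ d) ≡ A.isW d
    W≡ d = cong₂ (λ u c → not (np u) ∧ c) (ex d) (cong A'.isB (sym (pα d)) ∙ B≡ (S.α d))

    ψT : Fin A.NT → Fin A'.NT
    ψT = A.rec (λ d h → A'.bd (ψ d) (B≡ d ∙ h)) (λ d h → A'.wd (ψ d) (W≡ d ∙ h))
    ψT-b : ∀ d h → ψT (bd d h) ≡ A'.bd (ψ d) (B≡ d ∙ h)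
    ψT-b = A.TS.rec-l _ _
    ψT-w : ∀ d h → ψT (wd d h) ≡ A'.wd (ψ d) (W≡ d ∙ h)
    ψT-w = A.TS.rec-r _ _
    back : ∀ (f : S'.D → Bool) (g : S.D → Bool) → (∀ d → f (ψ d) ≡ g d) → ∀ d → f d ≡ true → g (ψ⁻ d) ≡ true
    back f g e d h = sym (e (ψ⁻ d)) ∙ cong f (ψψ⁻ d) ∙ h
    ψT⁻ : Fin A'.NT → Fin A.NT
    ψT⁻ = A'.rec (λ d h → bd (ψ⁻ d) (back A'.isB A.isB B≡ d h)) (λ d h → wd (ψ⁻ d) (back A'.isW A.isW W≡ d h))
    ψT⁻ψT : ∀ i → ψT⁻ (ψT i) ≡ i
    ψT⁻ψT = A.elim (λ i → ψT⁻ (ψT i) ≡ i) (λ d h → cong ψT⁻ (ψT-b d h) ∙ (A'.TS.rec-l _ _ (ψ d) _) ∙ A.TS.inl-cong (ψ⁻ψ d))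
       (λ d h → cong ψT⁻ (ψT-w d h) ∙ (A'.TS.rec-r _ _ (ψ d) _) ∙ A.TS.inr-cong (ψ⁻ψ d))
    ψTψT⁻ : ∀ i → ψT (ψT⁻ i) ≡ i
    ψTψT⁻ = A'.elim (λ i → ψT (ψT⁻ i) ≡ i) (λ d h → cong ψT (A'.TS.rec-l _ _ d h) ∙ (ψT-b (ψ⁻ d) _) ∙ A'.TS.inl-cong (ψψ⁻ d))
       (λ d h → cong ψT (A'.TS.rec-r _ _ d h) ∙ (ψT-w (ψ⁻ d) _) ∙ A'.TS.inr-cong (ψψ⁻ d))

    ret≡ : ∀ d h h' → ψ (A.RT.ret d h) ≡ A'.RT.ret (ψ d) h'
    ret≡ d h h' = p-iter S.σ S'.σ pσ (suc k) d ∙ sym (A'.RT.ret-unique (ψ d) h' k (w k ∙ proj₁ (proj₂ (A.RT.first d h))) (λ i l → w i ∙ proj₂ (proj₂ (A.RT.first d h)) i l))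
      where k = proj₁ (A.RT.first d h)
            w : ∀ i → A'.isW (iter S'.σ (suc i) (ψ d)) ≡ A.isW (iter S.σ (suc i) d)
            w i = cong A'.isW (sym (p-iter S.σ S'.σ pσ (suc i) d)) ∙ W≡ (iter S.σ (suc i) d)

    Tσ : ∀ i → ψT (A.σT i) ≡ A'.σT (ψT i)
    Tσ = A.elim (λ i → ψT (A.σT i) ≡ A'.σT (ψT i))
      (λ d h → cong ψT (A.σT-b d h) ∙ (ψT-b (S.φ d) _) ∙ A'.TS.inl-cong (pφ d) ∙ sym (cong A'.σT (ψT-b d h) ∙ (A'.σT-b (ψ d) _)))
      (λ d h → cong ψT (A.σT-w d h) ∙ (ψT-w (A.RT.ret d h) _) ∙ A'.TS.inr-cong (ret≡ d h _) ∙ sym (cong A'.σT (ψT-w d h) ∙ (A'.σT-w (ψ d) _)))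

    ψT-tg : ∀ d h h' k k' → ψT (tg d h h') ≡ A'.tg (ψ d) k k'
    ψT-tg d h h' k k' = go (np (x d)) refl
      where go : ∀ c → np (x d) ≡ c → ψT (tg d h h') ≡ A'.tg (ψ d) k k'
            go true e = cong ψT (A.tg-b d h h' e) ∙ ψT-b d h ∙ A'.TS.inl-cong refl ∙ sym (A'.tg-b (ψ d) k k' (cong np (ex d) ∙ e))
            go false e = cong ψT (A.tg-w d h h' w) ∙ ψT-w d w ∙ A'.TS.inr-cong refl ∙ sym (A'.tg-w (ψ d) k k' (W≡ d ∙ w))
              where w = ∧-tt (t-not e) h'

    Tα : ∀ i → ψT (A.αT i) ≡ A'.αT (ψT i)
    Tα = A.split (λ i → ψT (A.αT i) ≡ A'.αT (ψT i))
      (λ d h e → cong ψT (A.αT-bud d h e) ∙ ψT-b d h ∙ sym (cong A'.αT (ψT-b d h) ∙ (A'.αT-bud (ψ d) _ (cong np (ex d) ∙ e))))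
      (λ d h h' → cong ψT (A.αT-tg d h h') ∙ ψT-tg (S.α d) h' (A.B-αα d h) (α-B d h') (α-αB d h) ∙ A'.tg-cong (pα d) ∙ sym (cong A'.αT (ψT-tg d h h' (B≡ d ∙ h) (cong A'.isB (sym (pα d)) ∙ α-B d h')) ∙ (A'.αT-tg (ψ d) _ _)))
      where α-B : ∀ d → A.isB (S.α d) ≡ true → A'.isB (ψ (S.α d)) ≡ true
            α-B d h' = B≡ (S.α d) ∙ h'
            α-αB : ∀ d → A.isB d ≡ true → A'.isB (S'.α (ψ (S.α d))) ≡ true
            α-αB d h = cong A'.isB (sym (pα (S.α d)) ∙ cong ψ (S.αα d)) ∙ B≡ d ∙ h

    Tcol : ∀ i → A'.colT (ψT i) ≡ A.colT i
    Tcol = A.elim (λ i → A'.colT (ψT i) ≡ A.colT i) (λ d h → cong A'.colT (ψT-b d h) ∙ (A'.colT-b (ψ d) _) ∙ sym (A.colT-b d h)) (λ d h → cong A'.colT (ψT-w d h) ∙ (A'.colT-w (ψ d) _) ∙ sym (A.colT-w d h))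
    Twt : ∀ i → A'.wtT (ψT i) ≡ A.wtT i
    Twt = A.elim (λ i → A'.wtT (ψT i) ≡ A.wtT i) (λ d h → cong A'.wtT (ψT-b d h) ∙ (A'.wtT-b (ψ d) _) ∙ cong (λ u → - nn u) (ex d) ∙ sym (A.wtT-b d h))
       (λ d h → cong A'.wtT (ψT-w d h) ∙ (A'.wtT-w (ψ d) _) ∙ ex d ∙ sym (A.wtT-w d h))

    iso : A.mobile ≅ᵀ A'.mobile
    iso = permutation ψT ψT⁻ ψTψT⁻ ψT⁻ψT , Tσ , Tα , Tcol , Twt

-- Degrees of inner faces and of black vertices.

orbit-count-≤ : ∀ {m n} (f : Fin m → Fin m) (g : Fin n → Fin n) (fi : Inj f) (gi : Inj g) (p : Fin m → Bool) (q : Fin n → Bool) →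
  (∀ d e → Orb g d e → q d ≡ true → q e ≡ true) →
  (β : ∀ d → p d ≡ true → Fin n) → (∀ d h → q (β d h) ≡ true) → (∀ d h e k → Orb g (β d h) (β e k) → Orb f d e) →
  count (λ d → isRep f d ∧ p d) ℕ.≤ count (λ d → isRep g d ∧ q d)
orbit-count-≤ {m} {n} f g fi gi p q qi β βq βo = FP.injective⇒≤ {f = j} j-inj
  where
  module Qf = Quot f fi
  module Qg = Quot g gi
  P : Fin m → Bool
  P d = isRep f d ∧ p d
  Q : Fin n → Bool
  Q d = isRep g d ∧ q d
  ph : ∀ i → p (el P i) ≡ true
  ph i = ∧-t₂ (isRep f (el P i)) (el-p P i)
  im : Fin (count P) → Fin n
  im i = proj₁ (Qg.rep-of (β (el P i) (ph i)))
  im-orb : ∀ i → Orb g (β (el P i) (ph i)) (im i)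
  im-orb i = proj₂ (proj₂ (Qg.rep-of (β (el P i) (ph i))))
  imQ : ∀ i → Q (im i) ≡ true
  imQ i = ∧-tt (proj₁ (proj₂ (Qg.rep-of (β (el P i) (ph i))))) (qi (β (el P i) (ph i)) (im i) (im-orb i) (βq (el P i) (ph i)))
  j : Fin (count P) → Fin (count Q)
  j i = ix Q (im i) (imQ i)
  j-inj : ∀ {a b} → j a ≡ j b → a ≡ b
  j-inj {a} {b} e = el-inj P (Qf.rep-unique {el P a} {el P b} (∧-t₁ (isRep f (el P a)) (el-p P a)) (∧-t₁ (isRep f (el P b)) (el-p P b))
      (βo (el P a) (ph a) (el P b) (ph b) (Orb-trans (im-orb a) (subst (λ z → Orb g z (β (el P b) (ph b))) (sym im≡) (Orb-sym gi (im-orb b))))))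
    where im≡ : im a ≡ im b
          im≡ = sym (el-ix Q (im a) (imQ a)) ∙ cong (el Q) e ∙ el-ix Q (im b) (imQ b)

module Degrees (b : ℕ) (b≥1 : 1 ℕ.≤ b) (S : Surface) (fo : Fin (Surface.Fc S)) (x : Fin (Surface.n S) → ℤ) (O : Weights.Orient S b fo x) where
  open Surface S
  open MobileOf b b≥1 S fo x O

  deg≡ : ∀ d h → pos (cycleLen σT (bd d h)) ≡ pos (cycleLen φ d)
  deg≡ d h = QT.cycleLen-fib (bd d h) ∙ face-fib d h (λ _ → 1ℤ) (λ _ → 1ℤ) (λ _ → 1ℤ) (λ _ _ → refl) (λ _ _ → refl) ∙
     sym (Q.cycleLen-fib d ∙ ∑-cong (λ e → cong (_* 1ℤ) (ind-iff (λ p → sym (fo' (Q.cls-orb (sym p)))) (λ p → Q.cls-eq (face-orb p)))))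
    where
    module Q = Quot φ φ-inj
    fo' : ∀ {d e} → Orb φ d e → face d ≡ face e
    fo' = orb-inv face face-φ

  p : ℕ → D → Bool
  p k d = (cycleLen φ d ℕ.≡ᵇ k) ∧ isB d
  q : ℕ → Fin NT → Bool
  q k i = isBlack (colT i) ∧ (cycleLen σT i ℕ.≡ᵇ k)

  face-of-orb : ∀ {d e} → Orb φ d e → face d ≡ face e
  face-of-orb = orb-inv face face-φ

  cycleLen-orb : ∀ {m} (f : Fin m → Fin m) (fi : Inj f) {d e} → Orb f d e → cycleLen f d ≡ cycleLen f e
  cycleLen-orb f fi {d} {e} o = ℤP.+-injective (Q.cycleLen-fib d ∙ cong (λ c → fib Q.cls c (λ _ → 1ℤ)) (Q.cls-eq o) ∙ sym (Q.cycleLen-fib e))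
    where module Q = Quot f fi

  -- Inner darts and black half-edges correspond, orbit by orbit and with equal lengths. The
  -- correspondence does not preserve least representatives, so the counts are compared by an
  -- injection in each direction.
  counts : ∀ k → count (λ d → isRep φ d ∧ p k d) ≡ count (λ i → isRep σT i ∧ q k i)
  counts k = ℕP.≤-antisym
    (orbit-count-≤ φ σT φ-inj σT-inj (p k) (q k) q-inv (λ d h → bd d (∧-t₂ (cycleLen φ d ℕ.≡ᵇ k) h))
       (λ d h → ∧-tt (cong isBlack (colT-b d _)) (cong (ℕ._≡ᵇ k) (ℤP.+-injective (deg≡ d (∧-t₂ (cycleLen φ d ℕ.≡ᵇ k) h))) ∙ ∧-t₁ (cycleLen φ d ℕ.≡ᵇ k) h))
       (λ d h e h' o → face-orb (nF-inj (sym (invT-b d _) ∙ invT-cls (QT.cls-eq o) ∙ (invT-b e _)))))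
    (orbit-count-≤ σT φ σT-inj φ-inj (q k) (p k) p-inv (λ i h → TS.und i) und-p und-o)
    where
    q-inv : ∀ i j → Orb σT i j → q k i ≡ true → q k j ≡ true
    q-inv i j o h = cong₂ (λ u v → isBlack u ∧ (v ℕ.≡ᵇ k)) (sym (col-orb o)) (sym (cycleLen-orb σT σT-inj o)) ∙ h
      where col-orb : ∀ {i j} → Orb σT i j → colT i ≡ colT j
            col-orb = orb-inv colT (Mobile.colVertex mobile)
    p-inv : ∀ d e → Orb φ d e → p k d ≡ true → p k e ≡ true
    p-inv d e o h = cong₂ (λ u f → (u ℕ.≡ᵇ k) ∧ not (does (f ≟ fo))) (sym (cycleLen-orb φ φ-inj o)) (sym (face-of-orb o)) ∙ h
    bf : ∀ i → q k i ≡ true → ∃ λ d → ∃ λ h → i ≡ bd d h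
    bf = elim (λ i → q k i ≡ true → ∃ λ d → ∃ λ h → i ≡ bd d h) (λ d h _ → d , h , refl) (λ d h e → ⊥-elim (true≢false (sym (sym (cong isBlack (colT-w d h)) ∙ ∧-t₁ (isBlack (colT (wd d h))) e))))
    und-p : ∀ i h → p k (TS.und i) ≡ true
    und-p i h = let (d , k' , e) = bf i h in go d k' e h
      where
      go : ∀ {i} d k' → i ≡ bd d k' → q k i ≡ true → p k (TS.und i) ≡ true
      go d k' refl h = cong (p k) (TS.und-l d k') ∙ ∧-tt (cong (ℕ._≡ᵇ k) (sym (ℤP.+-injective (deg≡ d k'))) ∙ ∧-t₂ (isBlack (colT (bd d k'))) h) k'
    und-o : ∀ i h j h' → Orb φ (TS.und i) (TS.und j) → Orb σT i j
    und-o i h j h' o = let (d , k1 , u) = bf i h ; (e , k2 , v) = bf j h' in go d k1 u e k2 v o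
      where
      go : ∀ {i j} d k1 → i ≡ bd d k1 → ∀ e k2 → j ≡ bd e k2 → Orb φ (TS.und i) (TS.und j) → Orb σT i j
      go d k1 refl e k2 refl o = QT.cls-orb (orb-b d k1 e k2 (face-of-orb (subst₂O (TS.und-l d k1) (TS.und-l e k2) o)))
        where
        subst₂O : ∀ {a a' c c'} → a ≡ a' → c ≡ c' → Orb φ a c → Orb φ a' c'
        subst₂O refl refl o = o

-- The contour of a mobile and its matching of buds with white darts

isBlack-t : ∀ {c} → isBlack c ≡ true → c ≡ black
isBlack-t {black} _ = refl

isBlack-f : ∀ {c} → isBlack c ≡ false → c ≡ white
isBlack-f {white} _ = refl

module Contour (b : ℕ) (b≥1 : 1 ℕ.≤ b) (T : Mobile b) where
  open Mobile T

  X : Set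
  X = Fin n

  B : ℤ
  B = pos b

  1≤B : 1ℤ ≤ B
  1≤B = ℤ.+≤+ b≥1

  σ-inj : Inj σf
  σ-inj = perm-inj σ
  α-inj : Inj αf
  α-inj = perm-inj α
  σ⁻ : X → X
  σ⁻ = σ ⟨$⟩ˡ_
  σσ⁻ : ∀ d → σf (σ⁻ d) ≡ d
  σσ⁻ d = inverseʳ σ
  σ⁻σ : ∀ d → σ⁻ (σf d) ≡ d
  σ⁻σ d = inverseˡ σ

  module QV = Quot σf σ-inj
  module IV = Involution αf involutive

  blk bud : X → Bool
  blk d = isBlack (col d)
  bud d = ⌊ αf d ≟ d ⌋

  blk-σ : ∀ d → blk (σf d) ≡ blk d
  blk-σ d = cong isBlack (colVertex d)
  blk-σ⁻ : ∀ d → blk (σ⁻ d) ≡ blk d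
  blk-σ⁻ d = sym (blk-σ (σ⁻ d)) ∙ cong blk (σσ⁻ d)
  bud-t : ∀ d → bud d ≡ true → αf d ≡ d
  bud-t d e = isYes-true (αf d ≟ d) e
  bud-f : ∀ d → bud d ≡ false → αf d ≢ d
  bud-f d e p = true≢false (sym (true-isYes (αf d ≟ d) p) ∙ e)
  bud-yes : ∀ d → αf d ≡ d → bud d ≡ true
  bud-yes d = true-isYes (αf d ≟ d)
  bud-no : ∀ d → αf d ≢ d → bud d ≡ false
  bud-no d ne with αf d ≟ d
  ... | yes p = ⊥-elim (ne p)
  ... | no _ = refl
  bud-blk : ∀ d → bud d ≡ true → blk d ≡ true
  bud-blk d e = cong isBlack (budsBlack d (bud-t d e))
  white-nonbud : ∀ d → blk d ≡ false → bud d ≡ false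
  white-nonbud d e = bud-no d (λ p → true≢false (sym (bud-blk d (bud-yes d p)) ∙ e))
  bud-α : ∀ d → bud (αf d) ≡ bud d
  bud-α d = bool-ext (λ e → bud-yes d (sym (sym (involutive d) ∙ bud-t (αf d) e))) (λ e → bud-yes (αf d) (cong αf (bud-t d e)))

  cB cW : ℤ
  cB = ∑ (λ d → b2z (blk d))
  cW = ∑ (λ d → b2z (not (blk d)))

  nF : ℤ
  nF = ∑ (λ d → b2z (bud d))

  Ed : ℤ
  Ed = pos numEdges

  n≡ : pos n ≡ pos 2 * Ed + nF
  n≡ = involution-count αf involutive ∙ cong (pos 2 * Ed +_) (length-filter-∑ bud)

  n≡' : pos n ≡ cB + cW
  n≡' = sym (∑-const n 1ℤ ∙ ℤP.*-identityʳ (pos n)) ∙ ∑-cong (λ d → one (blk d)) ∙ ∑-+ (λ d → b2z (blk d)) (λ d → b2z (not (blk d)))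
    where one : ∀ u → 1ℤ ≡ b2z u + b2z (not u)
          one true = refl
          one false = refl

  col-orb : ∀ {d e} → Orb σf d e → blk d ≡ blk e
  col-orb = orb-inv blk blk-σ

  class-blk : ∀ d → fib QV.cls (QV.cls d) (λ e → b2z (blk e)) ≡ b2z (blk d) * fib QV.cls (QV.cls d) (λ _ → 1ℤ)
  class-blk d = ∑-cong (λ e → ind-*-cong (QV.cls e) (QV.cls d) (λ p → cong b2z (col-orb (QV.cls-orb p))) ∙ l (ind (QV.cls e) (QV.cls d)) (b2z (blk d))) ∙ ∑-*ˡ (b2z (blk d)) (λ e → ind (QV.cls e) (QV.cls d) * 1ℤ)
    where l : ∀ i c → i * c ≡ c * (i * 1ℤ)
          l = solve-∀

  class-total : ∀ c → fib QV.cls c (λ i → pos 2 * wt i + b2z (blk i)) ≡ pos 2 * B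
  class-total c = cong (λ c → fib QV.cls c (λ i → pos 2 * wt i + b2z (blk i))) (sym (QV.cls-rep c)) ∙ split ∙ go (blk d) refl
    where
    d = QV.rep c
    w = fib QV.cls (QV.cls d) wt
    split : fib QV.cls (QV.cls d) (λ i → pos 2 * wt i + b2z (blk i)) ≡ pos 2 * w + b2z (blk d) * fib QV.cls (QV.cls d) (λ _ → 1ℤ)
    split = ∑-cong (λ e → l (ind (QV.cls e) (QV.cls d)) (wt e) (b2z (blk e))) ∙ ∑-+ (λ e → pos 2 * (ind (QV.cls e) (QV.cls d) * wt e)) (λ e → ind (QV.cls e) (QV.cls d) * b2z (blk e)) ∙ cong₂ _+_ (∑-*ˡ (pos 2) (λ e → ind (QV.cls e) (QV.cls d) * wt e)) (class-blk d)
      where l : ∀ i w c → i * (pos 2 * w + c) ≡ pos 2 * (i * w) + i * c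
            l = solve-∀
    go : ∀ u → blk d ≡ u → pos 2 * w + b2z (blk d) * fib QV.cls (QV.cls d) (λ _ → 1ℤ) ≡ pos 2 * B
    go true e = cong (λ u → pos 2 * w + b2z u * fib QV.cls (QV.cls d) (λ _ → 1ℤ)) e ∙ l w (fib QV.cls (QV.cls d) (λ _ → 1ℤ)) ∙ sym (cong₂ (λ u v → u + pos 2 * v) (QV.cycleLen-fib d) (QV.orbit-sum wt d)) ∙ blackW d (isBlack-t e) ∙ ℤP.pos-* 2 b
      where l : ∀ a c → pos 2 * a + 1ℤ * c ≡ c + pos 2 * a
            l = solve-∀
    go false e = cong (λ u → pos 2 * w + b2z u * fib QV.cls (QV.cls d) (λ _ → 1ℤ)) e ∙ ℤP.+-identityʳ (pos 2 * w) ∙ cong (pos 2 *_) (sym (QV.orbit-sum wt d) ∙ whiteW d (isBlack-f e))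

  B-1 : pos (b ℕ.∸ 1) ≡ B - 1ℤ
  B-1 = sym (ℤP.m-n≡m⊖n b 1 ∙ (ℤP.⊖-≥ b≥1))

  -- The weighing used for the mobile of a map, now with the tree equation given: it yields
  -- `2E + 2B` black half-edges, and counting all half-edges by colour and by bud gives the surplus.
  -- These `2B` buds will open onto the outer face.
  excess : nF ≡ cW + pos 2 * B
  excess = l nF cW cB (pos 2 * Ed) (pos 2 * B) (sym n≡ ∙ n≡') cB≡
    where
    l : ∀ f w c e b → e + f ≡ c + w → c ≡ e + b → f ≡ w + b
    l f w c e b p q = l1 f e ∙ cong (_- e) (p ∙ cong (_+ w) q) ∙ l2 e b w
      where l1 : ∀ f e → f ≡ (e + f) - e
            l1 = solve-∀
            l2 : ∀ e b w → ((e + b) + w) - e ≡ w + b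
            l2 = solve-∀
    wt-total : pos 2 * ∑ wt ≡ (pos 2 * Ed) * (B - 1ℤ)
    wt-total = ll (∑ wt) ∙ cong (∑ wt +_) (sym (∑-bij αf αf involutive involutive wt)) ∙ sym (∑-+ wt (λ i → wt (αf i))) ∙ ∑-cong (λ i → pt i (bud i) refl) ∙
       ∑-*ʳ (B - 1ℤ) (λ i → 1ℤ - b2z (bud i)) ∙ cong (_* (B - 1ℤ)) (∑-- (λ _ → 1ℤ) (λ i → b2z (bud i)) ∙ cong (_- nF) ((∑-const n 1ℤ ∙ ℤP.*-identityʳ (pos n)) ∙ n≡) ∙ l2 (pos 2 * Ed) nF)
      where
      ll : ∀ a → pos 2 * a ≡ a + a
      ll = solve-∀
      l2 : ∀ a c → (a + c) - c ≡ a
      l2 = solve-∀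
      pt : ∀ i u → bud i ≡ u → wt i + wt (αf i) ≡ (1ℤ - b2z (bud i)) * (B - 1ℤ)
      pt i true e = cong₂ _+_ (budsZero i (bud-t i e)) (cong wt (bud-t i e) ∙ budsZero i (bud-t i e)) ∙ sym (cong (λ u → (1ℤ - b2z u) * (B - 1ℤ)) e)
      pt i false e = edgeW i (bud-f i e) ∙ B-1 ∙ sym (ℤP.*-identityˡ (B - 1ℤ)) ∙ sym (cong (λ u → (1ℤ - b2z u) * (B - 1ℤ)) e)
    total : pos 2 * (B * (Ed + 1ℤ)) ≡ (pos 2 * Ed) * (B - 1ℤ) + cB
    total = l1 B Ed ∙ cong (_* (pos 2 * B)) (sym (ℤP.pos-+ numEdges 1) ∙ cong pos (sym tree ∙ QV.size-numCycles)) ∙ sym (∑-const QV.size (pos 2 * B)) ∙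
        ∑-cong (λ c → sym ((ℤP.*-identityˡ _) ∙ class-total c)) ∙ ∑-fib QV.cls (λ _ → 1ℤ) (λ i → pos 2 * wt i + b2z (blk i)) ∙ ∑-cong (λ i → ℤP.*-identityˡ (pos 2 * wt i + b2z (blk i))) ∙
          ∑-+ (λ i → pos 2 * wt i) (λ i → b2z (blk i)) ∙ cong (_+ cB) (∑-*ˡ (pos 2) wt ∙ wt-total)
      where l1 : ∀ b e → pos 2 * (b * (e + 1ℤ)) ≡ (e + 1ℤ) * (pos 2 * b)
            l1 = solve-∀
    cB≡ : cB ≡ pos 2 * Ed + pos 2 * B
    cB≡ = l1 cB ((pos 2 * Ed) * (B - 1ℤ)) ∙ cong (_- (pos 2 * Ed) * (B - 1ℤ)) (sym total) ∙ l2 B Ed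
      where l1 : ∀ a c → a ≡ (c + a) - c
            l1 = solve-∀
            l2 : ∀ b e → pos 2 * (b * (e + 1ℤ)) - (pos 2 * e) * (b - 1ℤ) ≡ pos 2 * e + pos 2 * b
            l2 = solve-∀

  -- Going around the tree: clockwise at black vertices, counterclockwise at white ones.
  rot rot⁻ : X → X
  rot u = if blk u then σf u else σ⁻ u
  rot⁻ u = if blk u then σ⁻ u else σf u

  if-t : ∀ {A : Set} {u} {a c : A} → u ≡ true → (if u then a else c) ≡ a
  if-t refl = refl
  if-f : ∀ {A : Set} {u} {a c : A} → u ≡ false → (if u then a else c) ≡ c
  if-f refl = refl

  rot-b : ∀ u → blk u ≡ true → rot u ≡ σf u
  rot-b u e = if-t e
  rot-w : ∀ u → blk u ≡ false → rot u ≡ σ⁻ u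
  rot-w u e = if-f e

  rot⁻rot : ∀ u → rot⁻ (rot u) ≡ u
  rot⁻rot u = go (blk u) refl
    where go : ∀ c → blk u ≡ c → rot⁻ (rot u) ≡ u
          go true e = cong rot⁻ (rot-b u e) ∙ if-t (blk-σ u ∙ e) ∙ σ⁻σ u
          go false e = cong rot⁻ (rot-w u e) ∙ if-f (blk-σ⁻ u ∙ e) ∙ σσ⁻ u
  rotrot⁻ : ∀ u → rot (rot⁻ u) ≡ u
  rotrot⁻ u = go (blk u) refl
    where go : ∀ c → blk u ≡ c → rot (rot⁻ u) ≡ u
          go true e = cong rot (if-t e) ∙ rot-b (σ⁻ u) (blk-σ⁻ u ∙ e) ∙ σσ⁻ u
          go false e = cong rot (if-f e) ∙ rot-w (σf u) (blk-σ u ∙ e) ∙ σ⁻σ u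

  -- Next half-edge on the contour. In the mobile of a map the rotation is `φ` at black vertices and
  -- a return map of `σ` at white ones, opposite senses on the sphere; this is why `rot` reverses
  -- the white ones.
  c : X → X
  c t = rot (αf t)

  c-inj : Inj c
  c-inj p = α-inj (sym (rot⁻rot _) ∙ cong rot⁻ p ∙ (rot⁻rot _))

  cls-rot : ∀ u → QV.cls (rot u) ≡ QV.cls u
  cls-rot u = go (blk u) refl
    where go : ∀ c → blk u ≡ c → QV.cls (rot u) ≡ QV.cls u
          go true e = cong QV.cls (rot-b u e) ∙ QV.cls-f u
          go false e = cong QV.cls (rot-w u e) ∙ sym (QV.cls-f (σ⁻ u)) ∙ cong QV.cls (σσ⁻ u)

  invariant-const : ∀ (h : X → Bool) → (∀ d → h (σf d) ≡ h d) → (∀ d → h (αf d) ≡ h d) → ∀ d e → h d ≡ h e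
  invariant-const h hσ hα d e = go (connected d e)
    where go : ∀ {d e} → Reach d e → h d ≡ h e
          go here = refl
          go (viaσ r) = go r ∙ sym (hσ _)
          go (viaα r) = go r ∙ sym (hα _)

  -- A function constant along the contour induces a circulation on the tree, so it is constant.
  module OneFace (h : X → Bool) (hc : ∀ t → h (c t) ≡ h t) where
    private
      A : ℕ
      A = count IV.moved
      rp : Fin A → X
      rp a = IV.Q.rep (el IV.moved a)
      s t : Fin A → Fin QV.size
      s a = QV.cls (rp a)
      t a = QV.cls (αf (rp a))
      H : X → ℤ
      H u = b2z (h u)
      g : X → ℤ
      g u = H u - H (αf u)
      hrot : ∀ u → h (rot u) ≡ h (αf u)
      hrot u = cong (λ v → h (rot v)) (sym (involutive u)) ∙ hc (αf u)

      sizes : QV.size ≡ suc A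
      sizes = sym QV.size-numCycles ∙ tree ∙ ℕP.+-comm numEdges 1 ∙ cong suc (sym IV.moved-count)

      orb2 : ∀ d → (d ≡ IV.Q.rep (IV.Q.cls d)) ⊎ (d ≡ αf (IV.Q.rep (IV.Q.cls d)))
      orb2 d = IV.orb2 (Orb-sym α-inj (IV.Q.rep-cls d))

      cn : Conn s t
      cn k cut x y = cong k (sym (QV.cls-rep x)) ∙ invariant-const (k ∘ QV.cls) (λ d → cong k (QV.cls-f d)) kα (QV.rep x) (QV.rep y) ∙ cong k (QV.cls-rep y)
        where
        kα : ∀ d → k (QV.cls (αf d)) ≡ k (QV.cls d)
        kα d = go (IV.moved e) refl
          where
          e = IV.Q.cls d
          r = IV.Q.rep e
          sw : k (QV.cls r) ≡ k (QV.cls (αf r)) → (d ≡ r) ⊎ (d ≡ αf r) → k (QV.cls (αf d)) ≡ k (QV.cls d)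
          sw p (inj₁ q) = cong (λ u → k (QV.cls (αf u))) q ∙ sym p ∙ cong (λ u → k (QV.cls u)) (sym q)
          sw p (inj₂ q) = cong (λ u → k (QV.cls (αf u))) q ∙ cong (λ u → k (QV.cls u)) (involutive r) ∙ p ∙ cong (λ u → k (QV.cls u)) (sym q)
          go : ∀ u → IV.moved e ≡ u → k (QV.cls (αf d)) ≡ k (QV.cls d)
          go true m = sw (subst (λ z → k (QV.cls (IV.Q.rep z)) ≡ k (QV.cls (αf (IV.Q.rep z)))) (el-ix IV.moved e m) (cut (ix IV.moved e m))) (orb2 d)
          go false m = sw (cong (λ u → k (QV.cls u)) (sym (bud-t r (nt m)))) (orb2 d)
            where nt : ∀ {u} → not u ≡ false → u ≡ true
                  nt {true} _ = refl

      circ : ∀ (k : Fin QV.size → ℤ) → Div s t (λ a → g (rp a)) k ≡ 0ℤ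
      circ k = ∑-el IV.moved (λ e → (k (QV.cls (IV.Q.rep e)) - k (QV.cls (αf (IV.Q.rep e)))) * g (IV.Q.rep e)) ∙ ∑-cong pt ∙ sym (IV.all G) ∙ zero'
        where
        G : X → ℤ
        G u = k (QV.cls u) * g u
        pt : ∀ e → b2z (IV.moved e) * ((k (QV.cls (IV.Q.rep e)) - k (QV.cls (αf (IV.Q.rep e)))) * g (IV.Q.rep e)) ≡ G (IV.Q.rep e) + G (αf (IV.Q.rep e)) * (1ℤ - b2z (bud (IV.Q.rep e)))
        pt e = go (bud r) refl
          where
          r = IV.Q.rep e
          go : ∀ u → bud r ≡ u → b2z (not (bud r)) * ((k (QV.cls r) - k (QV.cls (αf r))) * g r) ≡ G r + G (αf r) * (1ℤ - b2z (bud r))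
          go true q = cong (λ u → b2z (not u) * ((k (QV.cls r) - k (QV.cls (αf r))) * g r)) q ∙ sym (cong₂ (λ u v → k (QV.cls r) * (H r - H u) + G (αf r) * (1ℤ - b2z v)) (bud-t r q) q ∙ l (k (QV.cls r)) (H r) (G (αf r)))
            where l : ∀ k h g → k * (h - h) + g * (1ℤ - 1ℤ) ≡ 0ℤ * ((k - k) * h)
                  l = solve-∀
          go false q = cong (λ u → b2z (not u) * ((k (QV.cls r) - k (QV.cls (αf r))) * g r)) q ∙ l (k (QV.cls r)) (k (QV.cls (αf r))) (H r) (H (αf r)) ∙
              sym (cong₂ (λ u v → G r + k (QV.cls (αf r)) * (H (αf r) - H u) * (1ℤ - b2z v)) (involutive r) q)
            where l : ∀ k k' h h' → 1ℤ * ((k - k') * (h - h')) ≡ k * (h - h') + k' * (h' - h) * (1ℤ - 0ℤ)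
                  l = solve-∀
        zero' : ∑ G ≡ 0ℤ
        zero' = ∑-cong (λ u → ℤP.*-distribˡ-+ (k (QV.cls u)) (H u) (- H (αf u)) ∙ cong (k (QV.cls u) * H u +_) (sym (ℤP.neg-distribʳ-* (k (QV.cls u)) (H (αf u))) ∙ cong₂ (λ a c → - (k a * b2z c)) (sym (cls-rot u)) (sym (hrot u)))) ∙
           ∑-- (λ u → k (QV.cls u) * H u) (λ u → k (QV.cls (rot u)) * H (rot u)) ∙ cong (_-_ (∑ (λ u → k (QV.cls u) * H u))) (∑-bij rot rot⁻ rot⁻rot rotrot⁻ (λ u → k (QV.cls u) * H u)) ∙ ℤP.+-inverseʳ (∑ (λ u → k (QV.cls u) * H u))

      g0 : ∀ a → g (rp a) ≡ 0ℤ
      g0 = tree-circulation' sizes s t cn (λ a → g (rp a)) circ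

      b2z-inj : ∀ u v → b2z u - b2z v ≡ 0ℤ → u ≡ v
      b2z-inj true true _ = refl
      b2z-inj false false _ = refl
      b2z-inj true false ()
      b2z-inj false true ()

      hα : ∀ d → h (αf d) ≡ h d
      hα d = go (IV.moved e) refl
        where
        e = IV.Q.cls d
        r = IV.Q.rep e
        sw : h r ≡ h (αf r) → (d ≡ r) ⊎ (d ≡ αf r) → h (αf d) ≡ h d
        sw p (inj₁ q) = cong (λ u → h (αf u)) q ∙ sym p ∙ cong h (sym q)
        sw p (inj₂ q) = cong (λ u → h (αf u)) q ∙ cong h (involutive r) ∙ p ∙ cong h (sym q)
        go : ∀ u → IV.moved e ≡ u → h (αf d) ≡ h d
        go true m = sw (b2z-inj (h r) (h (αf r)) (subst (λ z → g (IV.Q.rep z) ≡ 0ℤ) (el-ix IV.moved e m) (g0 (ix IV.moved e m)))) (orb2 d)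
        go false m = sw (cong h (sym (bud-t r (nt m)))) (orb2 d)
          where nt : ∀ {u} → not u ≡ false → u ≡ true
                nt {true} _ = refl
      hσ : ∀ d → h (σf d) ≡ h d
      hσ d = go (blk d) refl
        where
        hr : ∀ u → h (rot u) ≡ h u
        hr u = hrot u ∙ hα u
        go : ∀ u → blk d ≡ u → h (σf d) ≡ h d
        go true e = cong h (sym (rot-b d e)) ∙ hr d
        go false e = sym (hr (σf d)) ∙ cong h (rot-w (σf d) (blk-σ d ∙ e) ∙ σ⁻σ d)

    const : ∀ x y → h x ≡ h y
    const = invariant-const h hσ hα

  -- A tree has a single face whatever the rotations at its vertices.
  c-orb : ∀ t t' → Orb c t t'
  c-orb t t' = does-true (orb? c t t') (OneFace.const h hc t' t ∙ true-does (orb? c t t) Orb-refl)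
    where
    h : X → Bool
    h u = does (orb? c t u)
    hc : ∀ u → h (c u) ≡ h u
    hc u = bool-ext (λ e → true-does (orb? c t u) (Orb-trans (does-true (orb? c t (c u)) e) (Orb-sym c-inj (Orb-step {f = c} {u}))))
                    (λ e → true-does (orb? c t (c u)) (Orb-trans (does-true (orb? c t u) e) Orb-step))

  -- The contour read as a bracket word: a half-edge whose other end is white opens a bracket, a bud
  -- closes one (hence +1), every other half-edge is silent.
  ty : X → ℤ
  ty t = b2z (bud t) - b2z (not (blk (αf t)))

  ty-bud : ∀ t → bud t ≡ true → ty t ≡ 1ℤ
  ty-bud t e = cong₂ (λ u v → b2z u - b2z (not v)) e (cong blk (bud-t t e) ∙ bud-blk t e)
  ty-neu : ∀ t → bud t ≡ false → blk (αf t) ≡ true → ty t ≡ 0ℤ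
  ty-neu t e e' = cong₂ (λ u v → b2z u - b2z (not v)) e e'
  ty-push : ∀ t → blk (αf t) ≡ false → ty t ≡ -1ℤ
  ty-push t e' = cong₂ (λ u v → b2z u - b2z (not v)) (sym (bud-α t) ∙ white-nonbud (αf t) e') e'

  data Kind (t : X) : Set where
    kpop  : bud t ≡ true → Kind t
    kneu  : bud t ≡ false → blk (αf t) ≡ true → Kind t
    kpush : blk (αf t) ≡ false → Kind t

  kind : ∀ t → Kind t
  kind t = go (bud t) refl (blk (αf t)) refl
    where go : ∀ u → bud t ≡ u → ∀ v → blk (αf t) ≡ v → Kind t
          go true e v e' = kpop e
          go false e true e' = kneu e e'
          go false e false e' = kpush e'

  Sm : X → ℕ → ℤ
  Sm t zero = 0ℤ
  Sm t (suc k) = ty t + Sm (c t) k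

  Sm-+ : ∀ j k t → Sm t (j ℕ.+ k) ≡ Sm t j + Sm (iter c j t) k
  Sm-+ zero k t = sym (ℤP.+-identityˡ (Sm t k))
  Sm-+ (suc j) k t = cong (ty t +_) (Sm-+ j k (c t) ∙ cong (λ u → Sm (c t) j + Sm u k) (sym (iter-suc c j t))) ∙ sym (ℤP.+-assoc (ty t) (Sm (c t) j) (Sm (iter c (suc j) t) k))

  Sm-last : ∀ k t → Sm t (suc k) ≡ Sm t k + ty (iter c k t)
  Sm-last k t = cong (Sm t) (ℕP.+-comm 1 k) ∙ Sm-+ k 1 t ∙ cong (Sm t k +_) (ℤP.+-identityʳ (ty (iter c k t)))

  Sm-∑ : ∀ k t → Sm t k ≡ ∑ {k} (λ i → ty (iter c (toℕ i) t))
  Sm-∑ zero t = sym (∑-empty _)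
  Sm-∑ (suc k) t = cong (ty t +_) (Sm-∑ k (c t) ∙ ∑-cong (λ i → cong ty (sym (iter-suc c (toℕ i) t)))) ∙ sym (∑-unfold (λ i → ty (iter c (toℕ i) t)))

  -- The contour is one cycle of length `n`, so a full turn sums `ty` over all half-edges: buds
  -- minus white half-edges.
  Sm-n : ∀ t → Sm t n ≡ pos 2 * B
  Sm-n t = Sm-∑ n t ∙ sym (∑-cong (λ y → cong ty (sym (s-at y))) ∙ ∑-bij s (inv s s-inj) (inv-l s s-inj) (inv-r s s-inj) (λ i → ty (iter c (toℕ i) t))) ∙
      ∑-- (λ t → b2z (bud t)) (λ t → b2z (not (blk (αf t)))) ∙ cong₂ _-_ excess (∑-bij αf αf involutive involutive (λ t → b2z (not (blk t)))) ∙ l cW (pos 2 * B)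
    where
    l : ∀ w b → (w + b) - w ≡ b
    l = solve-∀
    so : ∀ y → ∃ λ k → k ℕ.< n × iter c k t ≡ y
    so y = orb< c t y (c-orb t y)
    s : X → Fin n
    s y = F.fromℕ< (proj₁ (proj₂ (so y)))
    s-at : ∀ y → iter c (toℕ (s y)) t ≡ y
    s-at y = cong (λ k → iter c k t) (FP.toℕ-fromℕ< (proj₁ (proj₂ (so y)))) ∙ proj₂ (proj₂ (so y))
    s-inj : Inj s
    s-inj {y} {y'} e = sym (s-at y) ∙ cong (λ i → iter c (toℕ i) t) e ∙ s-at y'

  ty≤1 : ∀ t → ty t ≤ 1ℤ
  ty≤1 t = ≤-by ((1ℤ - b2z (bud t)) + b2z (not (blk (αf t)))) (0≤+ (0≤- (b2z≤1 (bud t))) (0≤b2z (not (blk (αf t))))) (l (b2z (bud t)) (b2z (not (blk (αf t)))))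
    where l : ∀ a c → 1ℤ - (a - c) ≡ (1ℤ - a) + c
          l = solve-∀

  -- q, k steps after t, is the first bud of the contour from t that is not matched in between.
  record HS (t q : X) (k : ℕ) : Set where
    field
      at  : iter c k t ≡ q
      one : Sm t (suc k) ≡ 1ℤ
      low : ∀ j → j ℕ.≤ k → Sm t j ≤ 0ℤ

  first : ∀ t → ∃ λ q → ∃ λ k → HS t q k × (∀ j → 1ℤ ≤ Sm t (suc j) → k ℕ.≤ j)
  first t = iter c k t , k , record { at = refl ; one = one ; low = low } , λ j le → ℕP.≮⇒≥ (λ l → true≢false (sym (true-does (1ℤ ℤP.≤? Sm t (suc j)) le) ∙ proj₂ (proj₂ L) j l))
    where
    P : ℕ → Bool
    P k = does (1ℤ ℤP.≤? Sm t (suc k))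
    2B : ∀ m → n ≡ m → ∃ λ k → P k ≡ true
    2B zero e = ⊥-elim (nofin (subst Fin e t))
      where nofin : Fin 0 → ⊥
            nofin ()
    2B (suc m) e = m , true-does (1ℤ ℤP.≤? Sm t (suc m)) (subst (1ℤ ≤_) (sym (Sm-n t) ∙ cong (Sm t) e) (ℤP.≤-trans 1≤B (≤-by B (ℤ.+≤+ z≤n) (l B))))
      where l : ∀ b → pos 2 * b - b ≡ b
            l = solve-∀
    L = leastℕ P (proj₁ (2B n refl)) (proj₂ (2B n refl))
    k = proj₁ L
    ge : 1ℤ ≤ Sm t (suc k)
    ge = does-true (1ℤ ℤP.≤? Sm t (suc k)) (proj₁ (proj₂ L))
    low : ∀ j → j ℕ.≤ k → Sm t j ≤ 0ℤ
    low zero l = ℤP.≤-refl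
    low (suc j) l = ℤP.≮⇒≥ (λ lt → true≢false (sym (true-does (1ℤ ℤP.≤? Sm t (suc j)) (<⇒1+≤ lt)) ∙ proj₂ (proj₂ L) j l))
    one : Sm t (suc k) ≡ 1ℤ
    one = ℤP.≤-antisym (subst (_≤ 1ℤ) (sym (Sm-last k t)) (ℤP.+-mono-≤ (low k ℕP.≤-refl) (ty≤1 (iter c k t)))) ge

  opaque
    firstBud : ∀ t → ∃ λ q → ∃ λ k → HS t q k × (∀ j → 1ℤ ≤ Sm t (suc j) → k ℕ.≤ j)
    firstBud t = first t

  Fm : X → X
  Fm t = proj₁ (firstBud t)
  Fk : X → ℕ
  Fk t = proj₁ (proj₂ (firstBud t))
  F-HS : ∀ t → HS t (Fm t) (Fk t)
  F-HS t = proj₁ (proj₂ (proj₂ (firstBud t)))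
  F-min : ∀ t j → 1ℤ ≤ Sm t (suc j) → Fk t ℕ.≤ j
  F-min t = proj₂ (proj₂ (proj₂ (firstBud t)))

  HS-bud : ∀ {t q k} → HS t q k → bud q ≡ true
  HS-bud {t} {q} {k} h = go (kind q)
    where
    open HS h
    ge : 1ℤ ≤ ty q
    ge = ≤-by (0ℤ - Sm t k) (0≤- (low k ℕP.≤-refl)) (cong (_- 1ℤ) (l1 (ty q) (Sm t k)) ∙ cong (λ u → (u - Sm t k) - 1ℤ) (cong (λ u → Sm t k + ty u) (sym at) ∙ sym (Sm-last k t) ∙ one) ∙ l2 (Sm t k))
      where l1 : ∀ a c → a ≡ (c + a) - c
            l1 = solve-∀
            l2 : ∀ c → (1ℤ - c) - 1ℤ ≡ 0ℤ - c
            l2 = solve-∀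
    go : Kind q → bud q ≡ true
    go (kpop e) = e
    go (kneu e e') = ⊥-elim (no0 (subst (1ℤ ≤_) (ty-neu q e e') ge))
      where no0 : ¬ (1ℤ ≤ 0ℤ)
            no0 (ℤ.+≤+ ())
    go (kpush e') = ⊥-elim (no1 (subst (1ℤ ≤_) (ty-push q e') ge))
      where no1 : ¬ (1ℤ ≤ -1ℤ)
            no1 ()

  F-bud : ∀ t → bud (Fm t) ≡ true
  F-bud t = HS-bud (F-HS t)

  -- Parse of the bracket word from `t` to its first free bud: a push contains the complete word up
  -- to its own matching bud, after which the parse resumes. The later walks in the closed map are
  -- read off this structure.
  data Seg : X → X → ℕ → Set where
    pop  : ∀ {t} → bud t ≡ true → Seg t t 0
    neu  : ∀ {t q k} → bud t ≡ false → blk (αf t) ≡ true → Seg (c t) q k → Seg t q (suc k)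
    push : ∀ {t q k} → blk (αf t) ≡ false → Seg (c t) (Fm (c t)) (Fk (c t)) → Seg (c (Fm (c t))) q k → Seg t q (suc (suc (Fk (c t))) ℕ.+ k)

  toSeg : ∀ fuel k → k ℕ.≤ fuel → ∀ t q → HS t q k → Seg t q k
  toSeg fuel k le t q h = go fuel k le (kind t) h
    where
    go : ∀ fuel k → k ℕ.≤ fuel → Kind t → HS t q k → Seg t q k
    go fuel zero le (kpop e) h = subst (λ q → Seg t q 0) (HS.at h) (pop e)
    go fuel (suc k) le (kpop e) h = ⊥-elim (bad (subst (_≤ 0ℤ) (ℤP.+-identityʳ (ty t) ∙ ty-bud t e) (HS.low h 1 (s≤s z≤n))))
      where bad : ¬ (1ℤ ≤ 0ℤ)
            bad (ℤ.+≤+ ())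
    go fuel zero le (kneu e e') h = ⊥-elim (bad (sym (HS.one h) ∙ ℤP.+-identityʳ (ty t) ∙ ty-neu t e e'))
      where bad : 1ℤ ≢ 0ℤ
            bad ()
    go (suc fuel) (suc k) (s≤s le) (kneu e e') h = neu e e' (toSeg fuel k le (c t) q record { at = sym (iter-suc c k t) ∙ HS.at h ; one = sym (z (suc k)) ∙ HS.one h ; low = λ j l → subst (_≤ 0ℤ) (z j) (HS.low h (suc j) (s≤s l)) })
      where z : ∀ j → Sm t (suc j) ≡ Sm (c t) j
            z j = cong (_+ Sm (c t) j) (ty-neu t e e') ∙ ℤP.+-identityˡ (Sm (c t) j)
    go fuel zero le (kpush e') h = ⊥-elim (bad (sym (HS.one h) ∙ ℤP.+-identityʳ (ty t) ∙ ty-push t e'))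
      where bad : 1ℤ ≢ -1ℤ
            bad ()
    go (suc fuel) (suc k) (s≤s le) (kpush e') h = subst (Seg t q) ek (push e' (toSeg fuel k1 (ℕP.≤-trans (ℕP.n≤1+n k1) (ℕP.≤-trans k1<k le)) (c t) m (F-HS (c t)))
        (toSeg fuel k2 (ℕP.≤-trans (ℕP.m∸n≤m k (suc k1)) le) (c m) q record { at = at' ; one = sh (suc k2) ∙ cong (Sm t) (ℕP.+-suc (suc (suc k1)) k2 ∙ cong suc ek) ∙ HS.one h ; low = λ j l → subst (_≤ 0ℤ) (sym (sh j)) (HS.low h (suc (suc k1) ℕ.+ j) (subst (suc (suc k1) ℕ.+ j ℕ.≤_) ek (ℕP.+-monoʳ-≤ (suc (suc k1)) l))) }))
      where
      m = Fm (c t)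
      k1 = Fk (c t)
      k2 = k ℕ.∸ suc k1
      Sm2 : Sm (c t) (suc k) ≡ pos 2
      Sm2 = l (Sm (c t) (suc k)) (ty t) ∙ cong₂ _-_ (HS.one h) (ty-push t e')
        where l : ∀ a b → a ≡ (b + a) - b
              l = solve-∀
      -- From `c t` on the word sums to 2, so it reaches 1 strictly before position `k`.
      k1<k : k1 ℕ.< k
      k1<k = ℕP.≤∧≢⇒< (F-min (c t) k (subst (1ℤ ≤_) (sym Sm2) (ℤ.+≤+ (s≤s z≤n)))) (λ e → bad (sym (HS.one (F-HS (c t))) ∙ cong (λ j → Sm (c t) (suc j)) e ∙ Sm2))
        where bad : 1ℤ ≢ pos 2
              bad ()
      ek : suc (suc k1) ℕ.+ k2 ≡ suc k
      ek = cong suc (ℕP.m+[n∸m]≡n k1<k)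
      cm : iter c (suc (suc k1)) t ≡ c m
      cm = cong c (iter-suc c k1 t ∙ HS.at (F-HS (c t)))
      at' : iter c k2 (c m) ≡ q
      at' = cong (iter c k2) (sym cm) ∙ sym (iter-+ c k2 (suc (suc k1)) t) ∙ cong (λ j → iter c j t) (ℕP.+-comm k2 (suc (suc k1)) ∙ ek) ∙ HS.at h
      sh : ∀ j → Sm (c m) j ≡ Sm t (suc (suc k1) ℕ.+ j)
      sh j = sym (Sm-+ (suc (suc k1)) j t ∙ cong₂ _+_ (cong₂ _+_ (ty-push t e') (HS.one (F-HS (c t)))) (cong (λ u → Sm u j) cm) ∙ ℤP.+-identityˡ (Sm (c m) j))

  seg : ∀ t → Seg t (Fm t) (Fk t)
  seg t = toSeg (Fk t) (Fk t) ℕP.≤-refl t (Fm t) (F-HS t)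

  -- The bracket opened by a white `u` is read at `αf u`, and the contour continues at `σ⁻ u`; the
  -- matching bud is the first free one from there.
  ι : X → X
  ι u = Fm (σ⁻ u)

  Matched : X → Set
  Matched q = ∃ λ u → blk u ≡ false × ι u ≡ q

  matched? : ∀ q → Dec (Matched q)
  matched? q with FP.any? (λ u → (not (blk u) ∧ does (ι u ≟ q)) Data.Bool.≟ true)
  ... | yes (u , e) = yes (u , not-t (∧-t₁ (not (blk u)) e) , does-true (ι u ≟ q) (∧-t₂ (not (blk u)) e))
  ... | no no-u = no λ { (u , e , p) → no-u (u , ∧-tt (t-not e) (true-does (ι u ≟ q) p)) }

  isU : X → Bool
  isU q = bud q ∧ not (does (matched? q))

  U-bud : ∀ q → isU q ≡ true → bud q ≡ true
  U-bud q e = ∧-t₁ (bud q) e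
  U-no : ∀ q → isU q ≡ true → ¬ Matched q
  U-no q e m = true≢false (sym (∧-t₂ (bud q) e) ∙ cong not (true-does (matched? q) m))
  U-intro : ∀ q → bud q ≡ true → ¬ Matched q → isU q ≡ true
  U-intro q e m = ∧-tt e (cong not (false-does (matched? q) m))

  push-ι : ∀ t → blk (αf t) ≡ false → ι (αf t) ≡ Fm (c t)
  push-ι t e = cong Fm (sym (rot-w (αf t) e))

  module Dist (d0 : X) (U0 : isU d0 ≡ true) where
    L : ∀ y → ∃ λ j → does (iter c j y ≟ d0) ≡ true × (∀ i → i ℕ.< j → does (iter c i y ≟ d0) ≡ false)
    L y = leastℕ (λ j → does (iter c j y ≟ d0)) (proj₁ (c-orb y d0)) (true-does (iter c (proj₁ (c-orb y d0)) y ≟ d0) (proj₂ (c-orb y d0)))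
    dist : X → ℕ
    dist y = proj₁ (L y)
    dist-min : ∀ k y → iter c k y ≡ d0 → dist y ℕ.≤ k
    dist-min k y e = ℕP.≮⇒≥ (λ l → true≢false (sym (true-does (iter c k y ≟ d0) e) ∙ proj₂ (proj₂ (L y)) k l))
    dist-at : ∀ y → iter c (dist y) y ≡ d0
    dist-at y = does-true (iter c (dist y) y ≟ d0) (proj₁ (proj₂ (L y)))
    dist-suc : ∀ y → y ≢ d0 → dist y ≡ suc (dist (c y))
    dist-suc y ne = ℕP.≤-antisym (dist-min (suc (dist (c y))) y (iter-suc c (dist (c y)) y ∙ dist-at (c y))) (go (dist y) refl)
      where go : ∀ j → dist y ≡ j → suc (dist (c y)) ℕ.≤ dist y
            go zero e = ⊥-elim (ne (subst (λ j → iter c j y ≡ d0) e (dist-at y)))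
            go (suc j) e = subst (suc (dist (c y)) ℕ.≤_) (sym e) (s≤s (dist-min j (c y) (sym (iter-suc c j y) ∙ subst (λ j → iter c j y ≡ d0) e (dist-at y))))

    ne-nonbud : ∀ t → bud t ≡ false → t ≢ d0
    ne-nonbud t e p = true≢false (sym (U-bud d0 U0) ∙ cong bud (sym p) ∙ e)
    ne-push : ∀ t → blk (αf t) ≡ false → Fm (c t) ≢ d0
    ne-push t e p = U-no d0 U0 (αf t , e , push-ι t e ∙ p)
    push-nonbud : ∀ t → blk (αf t) ≡ false → bud t ≡ false
    push-nonbud t e = sym (bud-α t) ∙ white-nonbud (αf t) e

    -- An unmatched bud is never skipped, since the inner segments of a parse end at matched buds.
    -- So a parse cannot pass `d0`, and its length is exactly the decrease of the distance to `d0`.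
    dist-seg : ∀ {t q k} → Seg t q k → k ℕ.+ dist q ≡ dist t
    dist-seg (pop e) = refl
    dist-seg {t} (neu e _ s) = cong suc (dist-seg s) ∙ sym (dist-suc t (ne-nonbud t e))
    dist-seg {t} {q} (push {k = k'} e s s') = arith (Fk (c t)) k' (dist q) ∙ cong (λ z → suc (Fk (c t) ℕ.+ suc z)) (dist-seg s') ∙ cong (λ z → suc (Fk (c t) ℕ.+ z)) (sym (dist-suc (Fm (c t)) (ne-push t e))) ∙
        cong suc (dist-seg s) ∙ sym (dist-suc t (ne-nonbud t (push-nonbud t e)))
      where arith : ∀ k k' z → suc (suc k) ℕ.+ k' ℕ.+ z ≡ suc (k ℕ.+ suc (k' ℕ.+ z))
            arith k k' z = cong suc (cong suc (ℕP.+-assoc k k' z) ∙ sym (ℕP.+-suc k (k' ℕ.+ z)))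

    dist-F : ∀ t → dist (Fm t) ℕ.≤ dist t
    dist-F t = subst (dist (Fm t) ℕ.≤_) (dist-seg (seg t)) (ℕP.m≤n+m (dist (Fm t)) (Fk t))

  cancel-c : ∀ j k d d' → j ℕ.≤ k → iter c j d ≡ iter c k d' → d ≡ iter c (k ℕ.∸ j) d'
  cancel-c zero k d d' le e = e
  cancel-c (suc j) (suc k) d d' (s≤s le) e = cancel-c j k d d' le (c-inj e)

  Op : X → Set
  Op t = (blk (αf t) ≡ false) ⊎ (isU t ≡ true)

  private
    no-inside : ∀ t t' → Op t → Fm (c t) ≡ Fm (c t') → ∀ m → t ≡ iter c (suc m) t' → suc m ℕ.+ Fk (c t) ≡ Fk (c t') → ⊥
    no-inside t t' (inj₁ e) q m tm km = bad (subst (_≤ 0ℤ) val (HS.low (F-HS (c t')) m (subst (m ℕ.≤_) km (ℕP.≤-trans (ℕP.n≤1+n m) (ℕP.m≤m+n (suc m) (Fk (c t)))))))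
      where
      bad : ¬ (1ℤ ≤ 0ℤ)
      bad (ℤ.+≤+ ())
      val : Sm (c t') m ≡ 1ℤ
      val = sym (ℤP.+-identityʳ (Sm (c t') m)) ∙ cong (Sm (c t') m +_) (sym (cong₂ _+_ (ty-push t e) (HS.one (F-HS (c t))) ∙ refl)) ∙
            cong (λ u → Sm (c t') m + Sm u (suc (suc (Fk (c t))))) (tm ∙ iter-suc c m t') ∙ sym (Sm-+ m (suc (suc (Fk (c t)))) (c t')) ∙ cong (Sm (c t')) (ℕP.+-suc m (suc (Fk (c t))) ∙ cong suc (ℕP.+-suc m (Fk (c t)) ∙ km)) ∙ HS.one (F-HS (c t'))
    no-inside t t' (inj₂ u) q m tm km = ℕP.<-irrefl refl (ℕP.<-≤-trans lt (ℕP.≤-trans (ℕP.m≤m+n (Fk (c t')) (dist (Fm (c t')))) (ℕP.≤-trans (ℕP.≤-reflexive (dist-seg (seg (c t')))) (dist-min m (c t') (sym (iter-suc c m t') ∙ sym tm)))))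
      where
      open Dist t u
      lt : m ℕ.< Fk (c t')
      lt = subst (m ℕ.<_) km (s≤s (ℕP.m≤m+n m (Fk (c t))))

    F-inj≤ : ∀ t t' → Op t → Fm (c t) ≡ Fm (c t') → Fk (c t) ℕ.≤ Fk (c t') → t ≡ t'
    F-inj≤ t t' o q le = go (Fk (c t') ℕ.∸ Fk (c t)) refl
      where
      ct : c t ≡ iter c (Fk (c t') ℕ.∸ Fk (c t)) (c t')
      ct = cancel-c (Fk (c t)) (Fk (c t')) (c t) (c t') le (HS.at (F-HS (c t)) ∙ q ∙ sym (HS.at (F-HS (c t'))))
      go : ∀ m → Fk (c t') ℕ.∸ Fk (c t) ≡ m → t ≡ t'
      go zero e = c-inj (ct ∙ cong (λ k → iter c k (c t')) e)
      go (suc m) e = ⊥-elim (no-inside t t' o q m (c-inj (ct ∙ cong (λ k → iter c k (c t')) e ∙ sym (iter-suc c (suc m) t')))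
            (cong (ℕ._+ Fk (c t)) (sym e) ∙ ℕP.m∸n+n≡m le))

  -- Of two openings with the same closing bud, one would lie strictly inside the segment of the
  -- other. If it is a push, the sum up to it would already be 1; if it is an unmatched bud, the
  -- segment would have skipped it.
  F-inj : ∀ t t' → Op t → Op t' → Fm (c t) ≡ Fm (c t') → t ≡ t'
  F-inj t t' o o' q with ℕP.≤-total (Fk (c t)) (Fk (c t'))
  ... | inj₁ le = F-inj≤ t t' o q le
  ... | inj₂ le = sym (F-inj≤ t' t o' (sym q) le)

  wpush : ∀ u → blk u ≡ false → blk (αf (αf u)) ≡ false
  wpush u e = cong blk (involutive u) ∙ e

  ι-F : ∀ u → blk u ≡ false → ι u ≡ Fm (c (αf u))
  ι-F u e = cong ι (sym (involutive u)) ∙ push-ι (αf u) (wpush u e)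

  ι-inj : ∀ u u' → blk u ≡ false → blk u' ≡ false → ι u ≡ ι u' → u ≡ u'
  ι-inj u u' e e' p = α-inj (F-inj (αf u) (αf u') (inj₁ (wpush u e)) (inj₁ (wpush u' e')) (sym (ι-F u e) ∙ p ∙ ι-F u' e'))

  ι-bud : ∀ u → bud (ι u) ≡ true
  ι-bud u = F-bud (σ⁻ u)

  -- On unmatched buds this is the next unmatched bud along the contour; it orders the darts of the
  -- outer face.
  ρ : X → X
  ρ d = Fm (c d)

  ρ-U : ∀ d → isU d ≡ true → isU (ρ d) ≡ true
  ρ-U d u = U-intro (ρ d) (F-bud (c d)) λ { (w , e , p) → nope w e (F-inj (αf w) d (inj₁ (wpush w e)) (inj₂ u) (sym (ι-F w e) ∙ p)) }
    where nope : ∀ w → blk w ≡ false → αf w ≡ d → ⊥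
          nope w e p = true≢false (sym (U-bud d u) ∙ cong bud (sym p) ∙ bud-α w ∙ white-nonbud w e)

  ρ-inj : ∀ d d' → isU d ≡ true → isU d' ≡ true → ρ d ≡ ρ d' → d ≡ d'
  ρ-inj d d' u u' = F-inj d d' (inj₂ u) (inj₂ u')

  ∑-buds : ∀ (g : X → ℤ) → ∑ (λ d → b2z (bud d) * g d) ≡ ∑ (λ w → b2z (not (blk w)) * g (ι w)) + ∑ (λ d → b2z (isU d) * g d)
  ∑-buds g = ∑-cong pt ∙ ∑-+ (λ d → ∑ (λ w → ind (ι w) d * (b2z (not (blk w)) * g d))) (λ d → b2z (isU d) * g d) ∙ cong (_+ ∑ (λ d → b2z (isU d) * g d))
      (∑-swap (λ d w → ind (ι w) d * (b2z (not (blk w)) * g d)) ∙ ∑-cong (λ w → ∑-ind (ι w) (λ d → b2z (not (blk w)) * g d)))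
    where
    pt : ∀ d → b2z (bud d) * g d ≡ ∑ (λ w → ind (ι w) d * (b2z (not (blk w)) * g d)) + b2z (isU d) * g d
    pt d = go (bud d) refl (matched? d)
      where
      z0 : ¬ Matched d → ∑ (λ w → ind (ι w) d * (b2z (not (blk w)) * g d)) ≡ 0ℤ
      z0 nm = ∑-zero λ w → zz w (blk w) refl
        where zz : ∀ w u → blk w ≡ u → ind (ι w) d * (b2z (not (blk w)) * g d) ≡ 0ℤ
              zz w true e = cong (λ u → ind (ι w) d * (b2z (not u) * g d)) e ∙ ℤP.*-zeroʳ (ind (ι w) d)
              zz w false e = cong (_* (b2z (not (blk w)) * g d)) (ind-no (λ p → nm (w , e , p)))
      nb : bud d ≡ false → ¬ Matched d
      nb e (w , _ , p) = true≢false (sym (ι-bud w) ∙ cong bud p ∙ e)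
      go : ∀ u → bud d ≡ u → Dec (Matched d) → b2z (bud d) * g d ≡ ∑ (λ w → ind (ι w) d * (b2z (not (blk w)) * g d)) + b2z (isU d) * g d
      go false e _ = cong (λ u → b2z u * g d) e ∙ sym (cong₂ _+_ (z0 (nb e)) (cong (λ u → b2z (u ∧ not (does (matched? d))) * g d) e))
      go true e (no nm) = cong (λ u → b2z u * g d) e ∙ sym (cong₂ _+_ (z0 nm) (cong (λ u → b2z u * g d) (U-intro d e nm)) ∙ ℤP.+-identityˡ (1ℤ * g d))
      go true e (yes (w , ew , p)) = cong (λ u → b2z u * g d) e ∙ sym (cong₂ _+_ s1 (cong (λ u → b2z u * g d) nU) ∙ ℤP.+-identityʳ (1ℤ * g d))
        where
        nU : isU d ≡ false
        nU = cong₂ (λ u v → u ∧ not v) e (true-does (matched? d) (w , ew , p)) ∙ refl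
        s1 : ∑ (λ w → ind (ι w) d * (b2z (not (blk w)) * g d)) ≡ 1ℤ * g d
        s1 = ∑-cong (λ w' → one w' (blk w') refl) ∙ ∑-ind w (λ _ → 1ℤ * g d)
          where one : ∀ w' u → blk w' ≡ u → ind (ι w') d * (b2z (not (blk w')) * g d) ≡ ind w w' * (1ℤ * g d)
                one w' true e' = cong (λ u → ind (ι w') d * (b2z (not u) * g d)) e' ∙ ℤP.*-zeroʳ (ind (ι w') d) ∙ sym (cong (_* (1ℤ * g d)) (ind-no (λ q → true≢false (sym e' ∙ cong blk (sym q) ∙ ew))))
                one w' false e' = cong₂ (λ i u → i * (b2z (not u) * g d)) (ind-iff (λ q → sym (ι-inj w' w e' ew (q ∙ sym p))) (λ q → cong ι (sym q) ∙ p)) e'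

  U-count : ∑ (λ d → b2z (isU d)) ≡ pos 2 * B
  U-count = l cW (∑ (λ d → b2z (isU d))) ∙ cong (_- cW) (sym buds ∙ excess) ∙ l2 cW (pos 2 * B)
    where
    l : ∀ w u → u ≡ (w + u) - w
    l = solve-∀
    l2 : ∀ w b → (w + b) - w ≡ b
    l2 = solve-∀
    *1 : ∀ (p : X → Bool) → ∑ (λ d → b2z (p d) * 1ℤ) ≡ ∑ (λ d → b2z (p d))
    *1 p = ∑-cong (λ d → ℤP.*-identityʳ (b2z (p d)))
    buds : nF ≡ cW + ∑ (λ d → b2z (isU d))
    buds = sym (*1 bud) ∙ ∑-buds (λ _ → 1ℤ) ∙ cong₂ _+_ (*1 (λ w → not (blk w))) (*1 isU)

  root-bud : ∃ λ q → isU q ≡ true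
  root-bud with FP.any? (λ q → isU q Data.Bool.≟ true)
  ... | yes r = r
  ... | no none = ⊥-elim (bad (subst (1ℤ ≤_) (sym U-count ∙ ∑-zero (λ d → cong b2z (f d))) (ℤP.≤-trans 1≤B (≤-by B (ℤ.+≤+ z≤n) (l B)))))
    where
    l : ∀ b → pos 2 * b - b ≡ b
    l = solve-∀
    bad : ¬ (1ℤ ≤ 0ℤ)
    bad (ℤ.+≤+ ())
    f : ∀ d → isU d ≡ false
    f d with isU d in e
    ... | true = ⊥-elim (none (d , e))
    ... | false = refl

-- The closure of a mobile

module Close (b : ℕ) (b≥1 : 1 ℕ.≤ b) (T : Mobile b) where
  open Mobile T
  open Contour b b≥1 T

  -- The dart of the closed map that a non-bud half-edge becomes: a white half-edge is glued to its
  -- matching bud, so that only black half-edges survive as darts, together with one outer dart for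
  -- each unmatched bud.
  ext : X → X
  ext u = if blk u then u else ι u

  ext-b : ∀ u → blk u ≡ true → ext u ≡ u
  ext-b u e = if-t e
  ext-w : ∀ u → blk u ≡ false → ext u ≡ ι u
  ext-w u e = if-f e

  ext-blk : ∀ u → blk (ext u) ≡ true
  ext-blk u = go (blk u) refl
    where go : ∀ v → blk u ≡ v → blk (ext u) ≡ true
          go true e = cong blk (ext-b u e) ∙ e
          go false e = cong blk (ext-w u e) ∙ bud-blk (ι u) (ι-bud u)

  ext-bud : ∀ u → bud u ≡ false → bud (ext u) ≡ not (blk u)
  ext-bud u nb = go (blk u) refl
    where go : ∀ v → blk u ≡ v → bud (ext u) ≡ not (blk u)
          go true e = cong bud (ext-b u e) ∙ nb ∙ cong not (sym e)
          go false e = cong bud (ext-w u e) ∙ ι-bud u ∙ cong not (sym e)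

  ext-U : ∀ u → bud u ≡ false → isU (ext u) ≡ true → ⊥
  ext-U u nb h = go (blk u) refl
    where go : ∀ v → blk u ≡ v → ⊥
          go true e = true≢false (sym (U-bud (ext u) h) ∙ cong bud (ext-b u e) ∙ nb)
          go false e = U-no (ext u) h (u , e , sym (ext-w u e))

  ext-inj : ∀ u u' → bud u ≡ false → bud u' ≡ false → ext u ≡ ext u' → u ≡ u'
  ext-inj u u' nb nb' p = go (blk u) refl (blk u') refl
    where
    go : ∀ v → blk u ≡ v → ∀ v' → blk u' ≡ v' → u ≡ u'
    go true e true e' = sym (ext-b u e) ∙ p ∙ ext-b u' e'
    go false e false e' = ι-inj u u' e e' (sym (ext-w u e) ∙ p ∙ ext-w u' e')
    go true e false e' = ⊥-elim (true≢false (sym (sym (ext-bud u nb ∙ cong not e) ∙ cong bud p ∙ ext-bud u' nb' ∙ cong not e')))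
    go false e true e' = ⊥-elim (true≢false (sym (ext-bud u nb ∙ cong not e) ∙ cong bud p ∙ ext-bud u' nb' ∙ cong not e'))

  Cl : X → Set
  Cl d = (∃ λ u → bud u ≡ false × ext u ≡ d) ⊎ (isU d ≡ true)

  cl : ∀ d → blk d ≡ true → Cl d
  cl d h = go (bud d) refl (matched? d)
    where go : ∀ v → bud d ≡ v → Dec (Matched d) → Cl d
          go false e _ = inj₁ (d , e , ext-b d h)
          go true e (yes (w , ew , p)) = inj₁ (w , white-nonbud w ew , ext-w w ew ∙ p)
          go true e (no nm) = inj₂ (U-intro d e nm)

  module DS = TwoSub blk isU
  open DS public using (elim; rec) renaming (size to NM; inl to bd; inr to rr)

  ebd : X → Fin NM
  ebd u = bd (ext u) (ext-blk u)

  U-blk : ∀ d → isU d ≡ true → blk d ≡ true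
  U-blk d h = bud-blk d (U-bud d h)

  split : (P : Fin NM → Set) → (∀ u → bud u ≡ false → P (ebd u)) → (∀ d h h' → P (bd d h)) ⊎ (∀ d (h : isU d ≡ true) → P (bd d (U-blk d h))) → (∀ d h → P (rr d h)) → ∀ i → P i
  split P pe pu pr = elim P (λ d h → go d h (cl d h)) pr
    where go : ∀ d h → Cl d → P (bd d h)
          go d h (inj₁ (u , nb , p)) = subst P (DS.inl-cong p) (pe u nb)
          go d h (inj₂ u) = [ (λ f → f d h h) , (λ f → subst P (DS.inl-cong refl) (f d u)) ]′ pu

  αB : ∀ d → Cl d → Fin NM
  αB d (inj₁ (u , _)) = ebd (αf u)
  αB d (inj₂ h) = rr d h

  αM : Fin NM → Fin NM
  αM = rec (λ d h → αB d (cl d h)) (λ d h → bd d (U-blk d h))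

  ebd-cong : ∀ {u u'} → u ≡ u' → ebd u ≡ ebd u'
  ebd-cong refl = refl

  αM-e : ∀ u → bud u ≡ false → αM (ebd u) ≡ ebd (αf u)
  αM-e u nb = (DS.rec-l _ _ (ext u) (ext-blk u)) ∙ go (cl (ext u) (ext-blk u))
    where go : ∀ z → αB (ext u) z ≡ ebd (αf u)
          go (inj₁ (u' , nb' , p)) = ebd-cong (cong αf (ext-inj u' u nb' nb p))
          go (inj₂ h) = ⊥-elim (ext-U u nb h)

  αM-U : ∀ d h k → αM (bd d k) ≡ rr d h
  αM-U d h k = (DS.rec-l _ _ d k) ∙ go (cl d k)
    where go : ∀ z → αB d z ≡ rr d h
          go (inj₁ (u , nb , p)) = ⊥-elim (ext-U u nb (cong isU p ∙ h))
          go (inj₂ h') = DS.inr-cong refl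

  αM-r : ∀ d h → αM (rr d h) ≡ bd d (U-blk d h)
  αM-r = DS.rec-r _ _

  αM-inv : ∀ i → αM (αM i) ≡ i
  αM-inv = split (λ i → αM (αM i) ≡ i) (λ u nb → cong αM (αM-e u nb) ∙ αM-e (αf u) (bud-α u ∙ nb) ∙ ebd-cong (involutive u))
     (inj₂ (λ d h → cong αM (αM-U d h _) ∙ αM-r d h)) (λ d h → cong αM (αM-r d h) ∙ (αM-U d h _))

  αM-inj : Inj αM
  αM-inj {i} {j} e = sym (αM-inv i) ∙ cong αM e ∙ αM-inv j

  αM-≢ : ∀ i → αM i ≢ i
  αM-≢ = split (λ i → αM i ≢ i) (λ u nb e → bud-f u nb (ext-inj (αf u) u (bud-α u ∙ nb) nb (DS.inl-inj (sym (αM-e u nb) ∙ e))))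
     (inj₂ (λ d h e → DS.l≢r (sym (sym (αM-U d h _) ∙ e)))) (λ d h e → DS.l≢r (sym (αM-r d h) ∙ e))

  -- The face permutation is explicit backwards: black vertices are the inner faces, and the outer
  -- face lists the unmatched buds in reverse contour order. `φM` and then `σM` are derived from it.
  φ⁻ : Fin NM → Fin NM
  φ⁻ = rec (λ d h → bd (σ⁻ d) (blk-σ⁻ d ∙ h)) (λ d h → rr (ρ d) (ρ-U d h))
  φ⁻-b : ∀ d h → φ⁻ (bd d h) ≡ bd (σ⁻ d) (blk-σ⁻ d ∙ h)
  φ⁻-b = DS.rec-l _ _
  φ⁻-r : ∀ d h → φ⁻ (rr d h) ≡ rr (ρ d) (ρ-U d h)
  φ⁻-r = DS.rec-r _ _

  φ⁻-inj : Inj φ⁻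
  φ⁻-inj {i} {j} = elim (λ i → φ⁻ i ≡ φ⁻ j → i ≡ j)
     (λ d h → elim (λ j → φ⁻ (bd d h) ≡ φ⁻ j → bd d h ≡ j)
        (λ d' h' e → DS.inl-cong (sym (σσ⁻ d) ∙ cong σf (DS.inl-inj (sym (φ⁻-b d h) ∙ e ∙ φ⁻-b d' h')) ∙ σσ⁻ d'))
        (λ d' h' e → ⊥-elim (DS.l≢r (sym (φ⁻-b d h) ∙ e ∙ φ⁻-r d' h'))) j)
     (λ d h → elim (λ j → φ⁻ (rr d h) ≡ φ⁻ j → rr d h ≡ j)
        (λ d' h' e → ⊥-elim (DS.l≢r (sym (sym (φ⁻-r d h) ∙ e ∙ φ⁻-b d' h'))))
        (λ d' h' e → DS.inr-cong (ρ-inj d d' h h' (DS.inr-inj (sym (φ⁻-r d h) ∙ e ∙ φ⁻-r d' h')))) j) i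

  opaque
    φM : Fin NM → Fin NM
    φM = inv φ⁻ φ⁻-inj
    φ⁻φ : ∀ i → φ⁻ (φM i) ≡ i
    φ⁻φ = inv-r φ⁻ φ⁻-inj
    φφ⁻ : ∀ i → φM (φ⁻ i) ≡ i
    φφ⁻ = inv-l φ⁻ φ⁻-inj

  φM-inj : Inj φM
  φM-inj {i} {j} e = sym (φ⁻φ i) ∙ cong φ⁻ e ∙ φ⁻φ j

  φM-b : ∀ d h k → φM (bd d h) ≡ bd (σf d) k
  φM-b d h k = cong φM (DS.inl-cong (sym (σ⁻σ d)) ∙ sym (φ⁻-b (σf d) k)) ∙ φφ⁻ (bd (σf d) k)
  φM-r : ∀ d h k → φM (rr (ρ d) k) ≡ rr d h
  φM-r d h k = cong φM (DS.inr-cong refl ∙ sym (φ⁻-r d h)) ∙ φφ⁻ (rr d h)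

  σM : Fin NM → Fin NM
  σM i = φM (αM i)

  σM-inj : Inj σM
  σM-inj p = αM-inj (φM-inj p)

  σαM : ∀ i → σM (αM i) ≡ φM i
  σαM i = cong φM (αM-inv i)

  c-bud : ∀ m → bud m ≡ true → c m ≡ σf m
  c-bud m e = cong rot (bud-t m e) ∙ rot-b m (bud-blk m e)

  c-bud-blk : ∀ m → bud m ≡ true → blk (c m) ≡ true
  c-bud-blk m e = cong blk (c-bud m e) ∙ blk-σ m ∙ bud-blk m e

  c-neu-blk : ∀ t → blk (αf t) ≡ true → blk (c t) ≡ true
  c-neu-blk t e = cong blk (rot-b (αf t) e) ∙ blk-σ (αf t) ∙ e

  φM-bud : ∀ m h k → bud m ≡ true → φM (bd m h) ≡ bd (c m) k
  φM-bud m h k e = φM-b m h (blk-σ m ∙ h) ∙ DS.inl-cong (sym (c-bud m e))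

  σM-neu : ∀ t → bud t ≡ false → (e : blk (αf t) ≡ true) → ∀ k → σM (ebd t) ≡ bd (c t) k
  σM-neu t nb e k = cong φM (αM-e t nb ∙ DS.inl-cong (ext-b (αf t) e) {h' = e}) ∙ φM-b (αf t) e (blk-σ (αf t) ∙ e) ∙ DS.inl-cong (sym (rot-b (αf t) e))

  σM-push : ∀ t → blk (αf t) ≡ false → ∀ k → σM (ebd t) ≡ bd (c (Fm (c t))) k
  σM-push t e k = cong φM (αM-e t (sym (bud-α t) ∙ white-nonbud (αf t) e) ∙ DS.inl-cong (ext-w (αf t) e ∙ push-ι t e) {h' = hm}) ∙ φM-bud (Fm (c t)) hm k (F-bud (c t))
    where hm = bud-blk (Fm (c t)) (F-bud (c t))

  σM-r : ∀ q h k → σM (rr q h) ≡ bd (c q) k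
  σM-r q h k = cong φM (αM-r q h) ∙ φM-bud q (U-blk q h) k (U-bud q h)

  σM-U : ∀ q h h' → σM (bd (ρ q) h) ≡ rr q h'
  σM-U q h h' = cong φM (αM-U (ρ q) (ρ-U q h') h) ∙ φM-r q h' (ρ-U q h')

  isBud : Fin NM → Bool
  isBud = rec (λ d _ → bud d) (λ _ _ → false)
  isBud-b : ∀ d h → isBud (bd d h) ≡ bud d
  isBud-b = DS.rec-l _ _
  isBud-r : ∀ d h → isBud (rr d h) ≡ false
  isBud-r = DS.rec-r _ _

  data Walk (q : X) : Fin NM → Set where
    stop : ∀ h → Walk q (bd q h)
    go   : ∀ {i} → isBud i ≡ false → Walk q (σM i) → Walk q i

  -- Rotation in the closed map follows the contour but jumps over matched segments: at a push the
  -- edge leads to the matching bud, and the next dart is the one after that bud. Hence the next bud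
  -- around the vertex is the first free one.
  walk-seg : ∀ {t q k} → Seg t q k → ∀ h → Walk q (bd t h)
  walk-seg (pop e) h = stop h
  walk-seg {t} {q} (neu nb e s) h = go (isBud-b t h ∙ nb) (subst (Walk q) (sym (cong σM (DS.inl-cong (sym (ext-b t h))) ∙ σM-neu t nb e (c-neu-blk t e))) (walk-seg s (c-neu-blk t e)))
  walk-seg {t} {q} (push e s s') h = go (isBud-b t h ∙ nb) (subst (Walk q) (sym (cong σM (DS.inl-cong (sym (ext-b t h))) ∙ σM-push t e k)) (walk-seg s' k))
    where nb = sym (bud-α t) ∙ white-nonbud (αf t) e
          k = c-bud-blk (Fm (c t)) (F-bud (c t))

  walk-white : ∀ w → blk w ≡ false → Walk (Fm w) (σM (ebd w))
  walk-white w e = from (seg w)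
    where
    from : ∀ {q k} → Seg w q k → Walk q (σM (ebd w))
    from {q} (neu nb e' s) = subst (Walk q) (sym (σM-neu w nb e' (c-neu-blk w e'))) (walk-seg s (c-neu-blk w e'))
    from {q} (push e' s s') = subst (Walk q) (sym (σM-push w e' (c-bud-blk (Fm (c w)) (F-bud (c w))))) (walk-seg s' _)
    from (pop e') = ⊥-elim (true≢false (sym e' ∙ white-nonbud w e))

  walk-U : ∀ q → isU q ≡ true → ∀ h → Walk (ρ q) (σM (rr q h))
  walk-U q u h = subst (Walk (ρ q)) (sym (σM-r q h k)) (walk-seg (seg (c q)) k)
    where k = c-bud-blk q (U-bud q u)

  module RT = Return σM σM-inj isBud

  walk-steps : ∀ {q i} → Walk q i → bud q ≡ true → ∃ λ j → ∃ λ h → iter σM j i ≡ bd q h × isBud (iter σM j i) ≡ true × (∀ m → m ℕ.< j → isBud (iter σM m i) ≡ false)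
  walk-steps {q} (stop h) bq = 0 , h , refl , isBud-b q h ∙ bq , λ m ()
  walk-steps {q} {i} (go nb w) bq with walk-steps w bq
  ... | j , h , e , t , f = suc j , h , iter-suc σM j i ∙ e , cong isBud (iter-suc σM j i) ∙ t , λ { zero _ → nb ; (suc m) (s≤s l) → cong isBud (iter-suc σM m i) ∙ f m l }

  ret-walk : ∀ {q} i h → bud q ≡ true → Walk q (σM i) → ∃ λ k → RT.ret i h ≡ bd q k
  ret-walk {q} i h bq w = let (j , k , e , t , f) = walk-steps w bq in k , RT.ret-unique i h j (cong isBud (iter-suc σM j i) ∙ t) (λ m l → cong isBud (iter-suc σM m i) ∙ f m l) ∙ iter-suc σM j i ∙ e

  ι-σ : ∀ w → ι (σf w) ≡ Fm w
  ι-σ w = cong Fm (σ⁻σ w)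

  isBud-e : ∀ w → blk w ≡ false → isBud (ebd w) ≡ true
  isBud-e w e = isBud-b (ext w) (ext-blk w) ∙ ext-bud w (white-nonbud w e) ∙ cong not e

  -- The first free bud from `w` is by definition the match of `σf w`, so the buds around a vertex
  -- of the map follow the rotation of one white vertex.
  ret-white : ∀ w → blk w ≡ false → ∀ h → RT.ret (ebd w) h ≡ ebd (σf w)
  ret-white w e h = let (k , r) = ret-walk (ebd w) h (F-bud w) (walk-white w e) in r ∙ DS.inl-cong (sym (ext-w (σf w) (blk-σ w ∙ e) ∙ ι-σ w))

  ρ-sur : ∀ q → isU q ≡ true → ∃ λ q' → isU q' ≡ true × ρ q' ≡ q
  ρ-sur q u = elim (λ i → φ⁻ i ≡ rr q u → ∃ λ q' → isU q' ≡ true × ρ q' ≡ q) (λ d h e → ⊥-elim (DS.l≢r (sym (φ⁻-b d h) ∙ e))) (λ d h e → d , h , DS.inr-inj (sym (φ⁻-r d h) ∙ e)) (φM (rr q u)) (φ⁻φ (rr q u))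

  -- Rotation from an unmatched bud passes to the outer dart of the preceding unmatched bud and from
  -- there back to the same bud: its vertex carries no other bud.
  ret-U : ∀ q → isU q ≡ true → ∀ k h → RT.ret (bd q k) h ≡ bd q k
  ret-U q u k h = from (ρ-sur q u)
    where from : (∃ λ q' → isU q' ≡ true × ρ q' ≡ q) → RT.ret (bd q k) h ≡ bd q k
          from (q' , u' , refl) = let (k' , r) = ret-walk (bd q k) h (U-bud q u) (subst (Walk q) (sym st) (Walk.go (isBud-r q' u') (walk-U q' u' u'))) in r ∙ DS.inl-cong refl
            where st : σM (bd q k) ≡ rr q' u'
                  st = σM-U q' k u'

  toBud : ∀ i → ∃ λ q → ∃ λ h → bud q ≡ true × Orb σM i (bd q h)
  toBud = elim (λ i → ∃ λ q → ∃ λ h → bud q ≡ true × Orb σM i (bd q h))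
     (λ d h → let (j , k , e , _) = walk-steps (walk-seg (seg d) h) (F-bud d) in Fm d , k , F-bud d , j , e)
     (λ d h → let (j , k , e , _) = walk-steps (walk-U d h h) (F-bud (c d)) in ρ d , k , F-bud (c d) , suc j , iter-suc σM j (rr d h) ∙ e)

  preM : PreMap
  preM = record { n = NM ; σ = mkPerm σM σM-inj ; α = mkPerm αM αM-inj }

  -- An invariant function on the closed map pulls back along `ext` to an invariant function on the
  -- mobile; at a white vertex this uses the rotation from one matched bud to the next.
  conn-inv : ∀ (h : Fin NM → Bool) → (∀ i → h (σM i) ≡ h i) → (∀ i → h (αM i) ≡ h i) → ∀ i j → h i ≡ h j
  conn-inv h hσ hα i j = at i ∙ invariant-const g gσ gα (und i) (und j) ∙ sym (at j)
    where
    g : X → Bool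
    g u = h (ebd u)
    hφ : ∀ i → h (φM i) ≡ h i
    hφ i = cong h (sym (σαM i)) ∙ hσ (αM i) ∙ hα i
    walk-h : ∀ {q i} → Walk q i → ∃ λ k → h i ≡ h (bd q k)
    walk-h (stop k) = k , refl
    walk-h {i = i} (go _ w) = let (k , e) = walk-h w in k , sym (hσ i) ∙ e
    gα : ∀ u → g (αf u) ≡ g u
    gα u = go' (bud u) refl
      where go' : ∀ v → bud u ≡ v → g (αf u) ≡ g u
            go' true e = cong g (bud-t u e)
            go' false e = cong h (sym (αM-e u e)) ∙ hα (ebd u)
    gσ : ∀ u → g (σf u) ≡ g u
    gσ u = go' (blk u) refl
      where go' : ∀ v → blk u ≡ v → g (σf u) ≡ g u
            go' true e = cong h (DS.inl-cong (ext-b (σf u) (blk-σ u ∙ e)) {h' = blk-σ u ∙ e} ∙ sym (cong φM (DS.inl-cong (ext-b u e) {h' = e}) ∙ φM-b u e (blk-σ u ∙ e))) ∙ hφ (ebd u)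
            go' false e = let (k , r) = walk-h (walk-white u e) in cong h (DS.inl-cong (ext-w (σf u) (blk-σ u ∙ e) ∙ ι-σ u) {h' = k}) ∙ sym r ∙ hσ (ebd u)
    und : Fin NM → X
    und = DS.und
    at : ∀ i → h i ≡ g (und i)
    at = elim (λ i → h i ≡ g (und i)) (λ d k → cong h (DS.inl-cong (sym (ext-b d k))) ∙ cong g (sym (DS.und-l d k)))
       (λ d k → sym (hα (rr d k)) ∙ cong h (αM-r d k ∙ DS.inl-cong (sym (ext-b d (U-blk d k)))) ∙ cong g (sym (DS.und-r d k)))

  connected' : PreMap.Connected preM
  connected' = reach-all preM conn-inv

  xb : ∀ d → Cl d → ℤ
  xb d (inj₁ (u , _)) = wt u
  xb d (inj₂ _) = B

  x : Fin NM → ℤ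
  x = rec (λ d h → xb d (cl d h)) (λ _ _ → -1ℤ)

  x-e : ∀ u → bud u ≡ false → x (ebd u) ≡ wt u
  x-e u nb = (DS.rec-l _ _ (ext u) (ext-blk u)) ∙ go' (cl (ext u) (ext-blk u))
    where go' : ∀ z → xb (ext u) z ≡ wt u
          go' (inj₁ (u' , nb' , p)) = cong wt (ext-inj u' u nb' nb p)
          go' (inj₂ h) = ⊥-elim (ext-U u nb h)
  x-U : ∀ d → isU d ≡ true → ∀ k → x (bd d k) ≡ B
  x-U d h k = (DS.rec-l _ _ d k) ∙ go' (cl d k)
    where go' : ∀ z → xb d z ≡ B
          go' (inj₁ (u , nb , p)) = ⊥-elim (ext-U u nb (cong isU p ∙ h))
          go' (inj₂ _) = refl
  x-r : ∀ d h → x (rr d h) ≡ -1ℤ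
  x-r = DS.rec-r _ _

  wt-white : ∀ u → blk u ≡ false → 1ℤ ≤ wt u
  wt-white u e = <⇒1+≤ (whitePos u (bud-f u (white-nonbud u e)) (isBlack-f e))

  wt-black : ∀ u → blk u ≡ true → bud u ≡ false → (wt u ≡ 0ℤ) ⊎ (wt u ≡ -1ℤ)
  wt-black u e nb = blackHalf u (bud-f u nb) (isBlack-t e)

  np-wt : ∀ u → bud u ≡ false → np (wt u) ≡ blk u
  np-wt u nb = go' (blk u) refl
    where go' : ∀ v → blk u ≡ v → np (wt u) ≡ blk u
          go' true e = ([ (λ p → cong np p) , (λ p → cong np p) ]′ (wt-black u e nb)) ∙ sym e
          go' false e = pos-np-false (wt u) (wt-white u e) ∙ sym e

  npx : ∀ i → np (x i) ≡ not (isBud i)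
  npx = split (λ i → np (x i) ≡ not (isBud i))
     (λ u nb → cong np (x-e u nb) ∙ np-wt u nb ∙ sym (cong not (isBud-b (ext u) (ext-blk u) ∙ ext-bud u nb) ∙ nn' (blk u)))
     (inj₂ (λ d h → cong np (x-U d h (U-blk d h)) ∙ pos-np-false B 1≤B ∙ sym (cong not (isBud-b d (U-blk d h) ∙ U-bud d h))))
     (λ d h → cong np (x-r d h) ∙ sym (cong not (isBud-r d h)))
    where nn' : ∀ u → not (not u) ≡ u
          nn' true = refl
          nn' false = refl

  o1' : ∀ i → x i + x (αM i) ≡ B - 1ℤ
  o1' = split (λ i → x i + x (αM i) ≡ B - 1ℤ)
     (λ u nb → cong₂ _+_ (x-e u nb) (cong x (αM-e u nb) ∙ x-e (αf u) (bud-α u ∙ nb)) ∙ edgeW u (bud-f u nb) ∙ B-1)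
     (inj₂ (λ d h → cong₂ _+_ (x-U d h (U-blk d h)) (cong x (αM-U d h (U-blk d h)) ∙ x-r d h)))
     (λ d h → cong₂ _+_ (x-r d h) (cong x (αM-r d h) ∙ x-U d h (U-blk d h)) ∙ (ℤP.+-comm -1ℤ B))

  nn-b : ∀ d h → nn (x (bd d h)) ≡ - wt d
  nn-b d h = go' (cl d h)
    where
    go' : Cl d → nn (x (bd d h)) ≡ - wt d
    go' (inj₂ u) = cong nn (x-U d u h) ∙ sym (cong -_ (budsZero d (bud-t d (U-bud d u))))
    go' (inj₁ (u , nb , refl)) = cong nn (cong x (DS.inl-cong refl) ∙ x-e u nb) ∙ on (blk u) refl
      where on : ∀ v → blk u ≡ v → nn (wt u) ≡ - wt (ext u)
            on true e = nn-neg (wt u) (np-true-nonpos (wt u) (np-wt u nb ∙ e)) ∙ cong (λ z → - wt z) (sym (ext-b u e))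
            on false e = np-false (wt u) (np-wt u nb ∙ e) ∙ sym (cong -_ (cong wt (ext-w u e) ∙ budsZero (ι u) (bud-t (ι u) (ι-bud u))))

  q0 : X
  q0 = proj₁ root-bud
  u0 : isU q0 ≡ true
  u0 = proj₂ root-bud

  bdT′ : ∀ d v → blk d ≡ v → Fin NM
  bdT′ d true e = bd d e
  bdT′ d false e = rr q0 u0
  bdT : X → Fin NM
  bdT d = bdT′ d (blk d) refl
  bdT-b : ∀ d h → bdT d ≡ bd d h
  bdT-b d h = go' (blk d) refl h
    where go' : ∀ v (e : blk d ≡ v) → v ≡ true → bdT′ d v e ≡ bd d h
          go' true e _ = DS.inl-cong refl

  -- σM-orbits: the buds met around a vertex of the map are those matched with one white vertex,
  -- or a single unmatched bud
  rets-white : ∀ {i e} → RT.Rets i e → ∀ w → i ≡ ebd w → blk w ≡ false → ∃ λ w' → Orb σf w w' × e ≡ ebd w'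
  rets-white (RT.done p) w q e = w , Orb-refl , sym p ∙ q
  rets-white (RT.more h r) w refl e = let (w' , o , p) = rets-white r (σf w) (ret-white w e h) (blk-σ w ∙ e) in w' , Orb-trans Orb-step o , p

  rets-U : ∀ {i e} → RT.Rets i e → ∀ q → isU q ≡ true → ∀ k → i ≡ bd q k → e ≡ bd q k
  rets-U (RT.done p) q u k r = sym p ∙ r
  rets-U (RT.more h r) q u k refl = rets-U r q u k (ret-U q u k h)

  orb-white← : ∀ {w w'} → blk w ≡ false → Orb σf w w' → Orb σM (ebd w) (ebd w')
  orb-white← e (zero , refl) = Orb-refl
  orb-white← {w} e (suc k , refl) = Orb-trans (orb-white← e (k , refl)) (subst (Orb σM (ebd wk)) (ret-white wk ek hk) (RT.ret-orb (ebd wk) hk))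
    where wk = iter σf k w
          ek : blk wk ≡ false
          ek = sym (col-orb (k , refl)) ∙ e
          hk = isBud-e wk ek

  module FV (inj : Inj σM) where
    module Q = Quot σM inj

    white-cls : ∀ w w' → blk w ≡ false → blk w' ≡ false → ind (Q.cls (ebd w)) (Q.cls (ebd w')) ≡ ind (QV.cls w) (QV.cls w')
    white-cls w w' e e' = ind-iff (λ p → let (w'' , o , q) = rets-white (RT.rets (ebd w) (isBud-e w e) (ebd w') (isBud-e w' e') (Q.cls-orb p)) w refl e in
           QV.cls-eq (subst (Orb σf w) (ext-inj w'' w' (white-nonbud w'' (sym (col-orb o) ∙ e)) (white-nonbud w' e') (DS.inl-inj (sym q))) o))
        (λ p → Q.cls-eq (orb-white← e (QV.cls-orb p)))

    U-cls : ∀ q k d k' → isU q ≡ true → bud d ≡ true → Q.cls (bd d k') ≡ Q.cls (bd q k) → d ≡ q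
    U-cls q k d k' u e p = DS.inl-inj (rets-U (RT.rets (bd q k) (isBud-b q k ∙ U-bud q u) (bd d k') (isBud-b d k' ∙ e) (Q.cls-orb (sym p))) q u k refl)

    gl : Fin Q.size → X → ℤ
    gl c0 d = ind (Q.cls (bdT d)) c0 * pp (x (bdT d))

    -- Positive weight sits on buds only, and `∑-buds` splits these into matched ones, indexed by
    -- white half-edges, and unmatched ones of weight `B`.
    expand : ∀ c0 → fib Q.cls c0 (pp ∘ x) ≡ ∑ (λ w → b2z (not (blk w)) * (ind (Q.cls (ebd w)) c0 * wt w)) + ∑ (λ d → b2z (isU d) * (ind (Q.cls (bdT d)) c0 * B))
    expand c0 = DS.∑-two (λ i → ind (Q.cls i) c0 * pp (x i)) (gl c0) (λ _ → 0ℤ) (λ d h → cong (λ i → ind (Q.cls i) c0 * pp (x i)) (sym (bdT-b d h)))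
        (λ d h → cong (λ v → ind (Q.cls (rr d h)) c0 * pp v) (x-r d h) ∙ ℤP.*-zeroʳ (ind (Q.cls (rr d h)) c0)) ∙
      cong₂ _+_ (∑-cong (λ d → pt d (bud d) refl (blk d) refl) ∙ ∑-buds (gl c0)) (∑-zero (λ d → ℤP.*-zeroʳ (b2z (isU d)))) ∙ (ℤP.+-identityʳ _) ∙ cong₂ _+_ (∑-cong (λ w → pw w (blk w) refl)) (∑-cong (λ d → pu d (isU d) refl))
      where
      pt : ∀ d v → bud d ≡ v → ∀ v' → blk d ≡ v' → b2z (blk d) * gl c0 d ≡ b2z (bud d) * gl c0 d
      pt d true e v' e' = cong (λ u → b2z u * gl c0 d) (bud-blk d e ∙ sym e)
      pt d false e false e' = cong (λ u → b2z u * gl c0 d) (e' ∙ sym e)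
      pt d false e true e' = cong (b2z (blk d) *_) g0 ∙ ℤP.*-zeroʳ (b2z (blk d)) ∙ sym (cong (λ u → b2z u * gl c0 d) e)
        where g0 : gl c0 d ≡ 0ℤ
              g0 = cong (ind (Q.cls (bdT d)) c0 *_) (cong (λ i → pp (x i)) (bdT-b d e') ∙ np-true (x (bd d e')) (npx (bd d e') ∙ cong not (isBud-b d e' ∙ e))) ∙ ℤP.*-zeroʳ (ind (Q.cls (bdT d)) c0)
      pw : ∀ w v → blk w ≡ v → b2z (not (blk w)) * gl c0 (ι w) ≡ b2z (not (blk w)) * (ind (Q.cls (ebd w)) c0 * wt w)
      pw w true e = cong (λ u → b2z (not u) * gl c0 (ι w)) e ∙ sym (cong (λ u → b2z (not u) * (ind (Q.cls (ebd w)) c0 * wt w)) e)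
      pw w false e = cong (b2z (not (blk w)) *_) (cong (λ i → ind (Q.cls i) c0 * pp (x i)) (bdT-b (ι w) (bud-blk (ι w) (ι-bud w)) ∙ DS.inl-cong (sym (ext-w w e))) ∙
          cong (ind (Q.cls (ebd w)) c0 *_) (cong pp (x-e w (white-nonbud w e)) ∙ pp-id (wt w) (ℤP.≤-trans (ℤ.+≤+ z≤n) (wt-white w e))))
      pu : ∀ d v → isU d ≡ v → b2z (isU d) * gl c0 d ≡ b2z (isU d) * (ind (Q.cls (bdT d)) c0 * B)
      pu d false e = cong (λ u → b2z u * gl c0 d) e ∙ sym (cong (λ u → b2z u * (ind (Q.cls (bdT d)) c0 * B)) e)
      pu d true e = cong (λ v → b2z (isU d) * (ind (Q.cls (bdT d)) c0 * v)) (cong (λ i → pp (x i)) (bdT-b d (U-blk d e)) ∙ cong pp (x-U d e (U-blk d e)) ∙ refl)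

    fib-white : ∀ w0 → blk w0 ≡ false → fib Q.cls (Q.cls (ebd w0)) (pp ∘ x) ≡ B
    fib-white w0 e0 = expand (Q.cls (ebd w0)) ∙ cong₂ _+_ (∑-cong (λ w → pw w (blk w) refl)) (∑-zero (λ d → pu d (isU d) refl)) ∙ (ℤP.+-identityʳ _) ∙ sym (QV.orbit-sum wt w0) ∙ whiteW w0 (isBlack-f e0)
      where
      pw : ∀ w v → blk w ≡ v → b2z (not (blk w)) * (ind (Q.cls (ebd w)) (Q.cls (ebd w0)) * wt w) ≡ ind (QV.cls w) (QV.cls w0) * wt w
      pw w false e = cong₂ (λ u i → b2z (not u) * (i * wt w)) e (white-cls w w0 e e0) ∙ ℤP.*-identityˡ (ind (QV.cls w) (QV.cls w0) * wt w)
      pw w true e = cong (λ u → b2z (not u) * (ind (Q.cls (ebd w)) (Q.cls (ebd w0)) * wt w)) e ∙ sym (cong (_* wt w) (ind-no (λ p → true≢false (sym e ∙ col-orb (QV.cls-orb p) ∙ e0))))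
      pu : ∀ d v → isU d ≡ v → b2z (isU d) * (ind (Q.cls (bdT d)) (Q.cls (ebd w0)) * B) ≡ 0ℤ
      pu d false e = cong (λ u → b2z u * (ind (Q.cls (bdT d)) (Q.cls (ebd w0)) * B)) e
      pu d true e = cong (λ i → b2z (isU d) * (i * B)) (ind-no (λ p → ext-U w0 (white-nonbud w0 e0) (cong isU (U-cls d (U-blk d e) (ext w0) (ext-blk w0) e (ext-bud w0 (white-nonbud w0 e0) ∙ cong not e0) (sym p ∙ cong Q.cls (bdT-b d (U-blk d e)))) ∙ e))) ∙ ℤP.*-zeroʳ (b2z (isU d))

    fib-U : ∀ q → isU q ≡ true → ∀ k → fib Q.cls (Q.cls (bd q k)) (pp ∘ x) ≡ B
    fib-U q u k = expand (Q.cls (bd q k)) ∙ cong₂ _+_ (∑-zero (λ w → pw w (blk w) refl)) (∑-cong (λ d → pu d (isU d) refl)) ∙ (ℤP.+-identityˡ _) ∙ ∑-ind q (λ _ → B)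
      where
      pw : ∀ w v → blk w ≡ v → b2z (not (blk w)) * (ind (Q.cls (ebd w)) (Q.cls (bd q k)) * wt w) ≡ 0ℤ
      pw w true e = cong (λ u → b2z (not u) * (ind (Q.cls (ebd w)) (Q.cls (bd q k)) * wt w)) e
      pw w false e = cong (λ i → b2z (not (blk w)) * (i * wt w)) (ind-no (λ p → ext-U w (white-nonbud w e) (cong isU (U-cls q k (ext w) (ext-blk w) u (ext-bud w (white-nonbud w e) ∙ cong not e) p) ∙ u))) ∙ ℤP.*-zeroʳ (b2z (not (blk w)))
      pu : ∀ d v → isU d ≡ v → b2z (isU d) * (ind (Q.cls (bdT d)) (Q.cls (bd q k)) * B) ≡ ind q d * B
      pu d false e = cong (λ v → b2z v * (ind (Q.cls (bdT d)) (Q.cls (bd q k)) * B)) e ∙ sym (cong (_* B) (ind-no (λ p → true≢false (sym u ∙ cong isU p ∙ e))))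
      pu d true e = cong₂ (λ v i → b2z v * (i * B)) e (ind-iff (λ p → sym (U-cls q k d (U-blk d e) u (U-bud d e) (cong Q.cls (sym (bdT-b d (U-blk d e))) ∙ p))) (λ p → cong Q.cls (bdT-b d (U-blk d e) ∙ DS.inl-cong (sym p)))) ∙
         ℤP.*-identityˡ (ind q d * B)

    fibV : ∀ v → fib Q.cls v (pp ∘ x) ≡ B
    fibV v = from (toBud (Q.rep v))
      where
      from : (∃ λ q → ∃ λ h → bud q ≡ true × Orb σM (Q.rep v) (bd q h)) → fib Q.cls v (pp ∘ x) ≡ B
      from (q , h , bq , o) = cong (λ c → fib Q.cls c (pp ∘ x)) (sym (Q.cls-rep v) ∙ Q.cls-eq o) ∙ on (cl q h)
        where on : Cl q → fib Q.cls (Q.cls (bd q h)) (pp ∘ x) ≡ B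
              on (inj₂ u) = fib-U q u h
              on (inj₁ (u , nb , refl)) = cong (λ i → fib Q.cls (Q.cls i) (pp ∘ x)) (DS.inl-cong refl) ∙ fib-white u (w (blk u) refl)
                where w : ∀ v → blk u ≡ v → blk u ≡ false
                      w false e = e
                      w true e = ⊥-elim (true≢false (sym bq ∙ ext-bud u nb ∙ cong not e))

  φD : Fin NM → Fin NM
  φD i = σM (αM i)

  φD-b : ∀ d h k → φD (bd d h) ≡ bd (σf d) k
  φD-b d h k = σαM (bd d h) ∙ φM-b d h k

  -- the face of bd d is the black vertex of d; all the rr q lie on the outer face
  lab : Fin NM → Fin QV.size ⊎ ⊤
  lab = rec (λ d _ → inj₁ (QV.cls d)) (λ _ _ → inj₂ tt)
  lab-b : ∀ d h → lab (bd d h) ≡ inj₁ (QV.cls d)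
  lab-b = DS.rec-l _ _
  lab-r : ∀ d h → lab (rr d h) ≡ inj₂ tt
  lab-r = DS.rec-r _ _

  lab-φ : ∀ i → lab (φD i) ≡ lab i
  lab-φ = elim (λ i → lab (φD i) ≡ lab i) (λ d h → cong lab (φD-b d h (blk-σ d ∙ h)) ∙ (lab-b (σf d) _) ∙ cong inj₁ (QV.cls-f d) ∙ sym (lab-b d h))
    (λ d h → let (d' , u' , p) = ρ-sur d h in cong lab (σαM (rr d h) ∙ cong φM (DS.inr-cong (sym p) {h' = ρ-U d' u'}) ∙ φM-r d' u' (ρ-U d' u')) ∙ lab-r d' u' ∙ sym (lab-r d h))

  lab-orb : ∀ {i j} → Orb φD i j → lab i ≡ lab j
  lab-orb = orb-inv lab lab-φ

  orb-b : ∀ {d e} → Orb σf d e → ∀ h k → Orb φD (bd d h) (bd e k)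
  orb-b (zero , refl) h k = 0 , DS.inl-cong refl
  orb-b {d} (suc m , refl) h k = Orb-trans (orb-b {d} (m , refl) h h') (1 , φD-b (iter σf m d) h' k)
    where h' : blk (iter σf m d) ≡ true
          h' = sym (col-orb (m , refl)) ∙ h

  -- Each application of `ρ` away from `q'` shortens the contour distance to `q'`, so iteration from
  -- any unmatched bud arrives there and the outer face is a single orbit.
  orb-r : ∀ q' (u' : isU q' ≡ true) q (u : isU q ≡ true) → Orb φD (rr q' u') (rr q u)
  orb-r q' u' q u = go' (suc (dist q)) q u ℕP.≤-refl
    where
    open Dist q' u'
    go' : ∀ m q u → dist q ℕ.< m → Orb φD (rr q' u') (rr q u)
    go' (suc m) q u l = on (q ≟ q')
      where on : Dec (q ≡ q') → Orb φD (rr q' u') (rr q u)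
            on (yes p) = 0 , DS.inr-cong (sym p)
            on (no ne) = Orb-trans (go' m (ρ q) (ρ-U q u) (ℕP.≤-<-trans (dist-F (c q)) (ℕP.<-≤-trans (subst (dist (c q) ℕ.<_) (sym (dist-suc q ne)) ℕP.≤-refl) (ℕP.≤-pred l))))
                 (1 , σαM (rr (ρ q) (ρ-U q u)) ∙ φM-r q u (ρ-U q u))

  inj₁-inj : ∀ {A C : Set} {a a' : A} → inj₁ {B = C} a ≡ inj₁ a' → a ≡ a'
  inj₁-inj refl = refl
  inj₁≢ : ∀ {A C : Set} {a : A} {c : C} → inj₁ a ≢ inj₂ c
  inj₁≢ ()

  module FF (inj : Inj φD) where
    module Q = Quot φD inj

    fib-inner : ∀ d h → fib Q.cls (Q.cls (bd d h)) (λ i → 1ℤ - pos 2 * nn (x i)) ≡ pos 2 * B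
    fib-inner d h = DS.∑-two (λ i → ind (Q.cls i) (Q.cls (bd d h)) * (1ℤ - pos 2 * nn (x i))) (λ e → ind (QV.cls e) (QV.cls d) * (1ℤ + pos 2 * wt e)) (λ _ → 0ℤ)
         (λ e k → cong₂ _*_ (ind-iff (λ p → inj₁-inj (sym (lab-b e k) ∙ lab-orb (Q.cls-orb p) ∙ lab-b d h)) (λ p → Q.cls-eq (orb-b (QV.cls-orb p) k h))) (cong (λ u → 1ℤ - pos 2 * u) (nn-b e k) ∙ l (wt e)))
         (λ e k → cong (_* (1ℤ - pos 2 * nn (x (rr e k)))) (ind-no (λ p → inj₁≢ (sym (sym (lab-r e k) ∙ lab-orb (Q.cls-orb p) ∙ lab-b d h))))) ∙
      cong₂ _+_ (∑-cong (λ e → pt e)) (∑-zero (λ e → ℤP.*-zeroʳ (b2z (isU e)))) ∙ (ℤP.+-identityʳ _) ∙ class-total (QV.cls d)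
      where
      l : ∀ w → 1ℤ - pos 2 * - w ≡ 1ℤ + pos 2 * w
      l = solve-∀
      pt : ∀ e → b2z (blk e) * (ind (QV.cls e) (QV.cls d) * (1ℤ + pos 2 * wt e)) ≡ ind (QV.cls e) (QV.cls d) * (pos 2 * wt e + b2z (blk e))
      pt e with ind-case (QV.cls e) (QV.cls d)
      ... | inj₂ (ne , i) = cong (λ u → b2z (blk e) * (u * (1ℤ + pos 2 * wt e))) i ∙ ℤP.*-zeroʳ (b2z (blk e)) ∙ sym (cong (_* (pos 2 * wt e + b2z (blk e))) i)
      ... | inj₁ (p , i) = cong (λ u → b2z u * (ind (QV.cls e) (QV.cls d) * (1ℤ + pos 2 * wt e))) be ∙ l2 (ind (QV.cls e) (QV.cls d)) (wt e) ∙ cong (λ u → ind (QV.cls e) (QV.cls d) * (pos 2 * wt e + b2z u)) (sym be)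
        where be : blk e ≡ true
              be = col-orb (QV.cls-orb p) ∙ h
              l2 : ∀ i w → 1ℤ * (i * (1ℤ + pos 2 * w)) ≡ i * (pos 2 * w + 1ℤ)
              l2 = solve-∀

    fib-outer : ∀ q u (g : Fin NM → ℤ) v → (∀ d h → g (rr d h) ≡ v) → fib Q.cls (Q.cls (rr q u)) g ≡ pos 2 * B * v
    fib-outer q u g v gv = DS.∑-two (λ i → ind (Q.cls i) (Q.cls (rr q u)) * g i) (λ _ → 0ℤ) (λ _ → v)
         (λ e k → cong (_* g (bd e k)) (ind-no (λ p → inj₁≢ (sym (lab-b e k) ∙ lab-orb (Q.cls-orb p) ∙ lab-r q u))))
         (λ e k → cong₂ _*_ (cong (λ c → ind c (Q.cls (rr q u))) (Q.cls-eq (orb-r e k q u)) ∙ ind-refl (Q.cls (rr q u))) (gv e k) ∙ ℤP.*-identityˡ v) ∙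
      cong₂ _+_ (∑-zero (λ e → ℤP.*-zeroʳ (b2z (blk e)))) (∑-*ʳ v (λ e → b2z (isU e)) ∙ cong (_* v) U-count) ∙ ℤP.+-identityˡ (pos 2 * B * v)

    not-outer : ∀ d h → Q.cls (bd d h) ≢ Q.cls (rr q0 u0)
    not-outer d h p = inj₁≢ (sym (lab-b d h) ∙ lab-orb (Q.cls-orb p) ∙ lab-r q0 u0)

    fibF : ∀ f → fib Q.cls f (λ i → 1ℤ - pos 2 * nn (x i)) ≡ pos 2 * B - pos 4 * B * ind (Q.cls (rr q0 u0)) f
    fibF f = cong (λ c → fib Q.cls c (λ i → 1ℤ - pos 2 * nn (x i))) (sym (Q.cls-rep f)) ∙ elim (λ i → fib Q.cls (Q.cls i) (λ i → 1ℤ - pos 2 * nn (x i)) ≡ pos 2 * B - pos 4 * B * ind (Q.cls (rr q0 u0)) (Q.cls i)) onB onR (Q.rep f) ∙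
        cong (λ c → pos 2 * B - pos 4 * B * ind (Q.cls (rr q0 u0)) c) (Q.cls-rep f)
      where
      onB : ∀ d h → fib Q.cls (Q.cls (bd d h)) (λ i → 1ℤ - pos 2 * nn (x i)) ≡ pos 2 * B - pos 4 * B * ind (Q.cls (rr q0 u0)) (Q.cls (bd d h))
      onB d h = fib-inner d h ∙ l B ∙ cong (λ i → pos 2 * B - pos 4 * B * i) (sym (ind-no (λ p → not-outer d h (sym p))))
        where l : ∀ b → pos 2 * b ≡ pos 2 * b - pos 4 * b * 0ℤ
              l = solve-∀
      onR : ∀ d h → fib Q.cls (Q.cls (rr d h)) (λ i → 1ℤ - pos 2 * nn (x i)) ≡ pos 2 * B - pos 4 * B * ind (Q.cls (rr q0 u0)) (Q.cls (rr d h))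
      onR d h = (fib-outer d h (λ i → 1ℤ - pos 2 * nn (x i)) -1ℤ (λ e k → cong (λ u → 1ℤ - pos 2 * nn u) (x-r e k))) ∙ l B ∙ cong (λ i → pos 2 * B - pos 4 * B * i) (sym (cong (λ c → ind c (Q.cls (rr d h))) (Q.cls-eq (orb-r q0 u0 d h)) ∙ ind-refl (Q.cls (rr d h))))
        where l : ∀ b → pos 2 * b * -1ℤ ≡ pos 2 * b - pos 4 * b * 1ℤ
              l = solve-∀

  cancelB : ∀ {i j} → B * i ≡ B * j → i ≡ j
  cancelB {i} {j} e = ℤP.*-cancelˡ-≡ B i j ⦃ ℕ.>-nonZero b≥1 ⦄ e

  φD-inj : Inj φD
  φD-inj p = αM-inj (σM-inj p)

  EM : ℕ
  EM = numCycles αM ℕ.∸ numFixed αM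

  -- Euler's formula is a consequence of the three weight conditions.
  planar' : numCycles σM ℕ.+ numCycles φD ≡ EM ℕ.+ 2
  planar' = ℤP.+-injective (ℤP.pos-+ (numCycles σM) (numCycles φD) ∙ cong₂ (λ u v → pos u + pos v) QV'.size-numCycles QF'.size-numCycles ∙ cancelB (cancel2 main) ∙ sym (ℤP.pos-+ EM 2))
    where
    module V' = FV σM-inj
    module F' = FF φD-inj
    module QV' = V'.Q
    module QF' = F'.Q
    V F E : ℤ
    V = pos QV'.size
    F = pos QF'.size
    E = pos EM
    n≡2E : pos NM ≡ pos 2 * E
    n≡2E = involution-count αM αM-inv ∙ cong (pos 2 * E +_) (length-filter-∑ (λ i → ⌊ αM i ≟ i ⌋) ∙ ∑-zero (λ i → cong b2z (nf i))) ∙ ℤP.+-identityʳ (pos 2 * E)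
      where nf : ∀ i → ⌊ αM i ≟ i ⌋ ≡ false
            nf i with αM i ≟ i
            ... | yes p = ⊥-elim (αM-≢ i p)
            ... | no _ = refl
    Σp Σn : ℤ
    Σp = ∑ (pp ∘ x)
    Σn = ∑ (nn ∘ x)
    sp : Σp ≡ V * B
    sp = ∑-cong (λ i → sym (ℤP.*-identityˡ (pp (x i)))) ∙ sym (∑-fib QV'.cls (λ _ → 1ℤ) (pp ∘ x)) ∙ ∑-cong (λ v → (ℤP.*-identityˡ _) ∙ V'.fibV v) ∙ ∑-const QV'.size B
    sn : pos NM - pos 2 * Σn ≡ F * (pos 2 * B) - pos 4 * B
    sn = cong₂ _-_ (sym (∑-const NM 1ℤ ∙ ℤP.*-identityʳ (pos NM))) (sym (∑-*ˡ (pos 2) (nn ∘ x))) ∙ sym (∑-- (λ _ → 1ℤ) (λ i → pos 2 * nn (x i))) ∙ ∑-cong (λ i → sym (ℤP.*-identityˡ (1ℤ - pos 2 * nn (x i)))) ∙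
       sym (∑-fib QF'.cls (λ _ → 1ℤ) (λ i → 1ℤ - pos 2 * nn (x i))) ∙ ∑-cong (λ f → (ℤP.*-identityˡ _) ∙ F'.fibF f) ∙ ∑-- (λ _ → pos 2 * B) (λ f → pos 4 * B * ind f0 f) ∙
         cong₂ _-_ (∑-const QF'.size (pos 2 * B)) (∑-*ˡ (pos 4 * B) (ind f0) ∙ cong (pos 4 * B *_) (∑-cong (λ f → sym (ℤP.*-identityʳ (ind f0 f))) ∙ ∑-ind f0 (λ _ → 1ℤ)) ∙ ℤP.*-identityʳ (pos 4 * B))
      where f0 = QF'.cls (rr q0 u0)
    sx : pos 2 * (Σp - Σn) ≡ pos NM * (B - 1ℤ)
    sx = cong (pos 2 *_) (sym (∑-- (pp ∘ x) (nn ∘ x)) ∙ ∑-cong (λ i → pp-nn (x i))) ∙ l (∑ x) ∙ cong (∑ x +_) (sym (∑-bij αM αM αM-inv αM-inv x)) ∙ sym (∑-+ x (λ i → x (αM i))) ∙ ∑-cong o1' ∙ ∑-const NM (B - 1ℤ)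
      where l : ∀ a → pos 2 * a ≡ a + a
            l = solve-∀
    main : pos 2 * (B * (V + F)) ≡ pos 2 * (B * (E + pos 2))
    main = fin Σp Σn V F E B (pos NM) sp sn sx n≡2E
      where
      fin : ∀ p n V F E b N → p ≡ V * b → N - pos 2 * n ≡ F * (pos 2 * b) - pos 4 * b → pos 2 * (p - n) ≡ N * (b - 1ℤ) → N ≡ pos 2 * E → pos 2 * (b * (V + F)) ≡ pos 2 * (b * (E + pos 2))
      fin p n V F E b N refl e2 e3 refl = l1 b V F ∙ cong₂ (λ u v → u + v) (l3 (V * b) n ∙ cong (_+ pos 2 * n) e3) (l4 (F * (pos 2 * b)) (pos 4 * b) ∙ cong (_+ pos 4 * b) (sym e2)) ∙ l2 E b n
        where l1 : ∀ b V F → pos 2 * (b * (V + F)) ≡ pos 2 * (V * b) + F * (pos 2 * b)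
              l1 = solve-∀
              l3 : ∀ p n → pos 2 * p ≡ pos 2 * (p - n) + pos 2 * n
              l3 = solve-∀
              l4 : ∀ a c → a ≡ (a - c) + c
              l4 = solve-∀
              l2 : ∀ E b n → ((pos 2 * E) * (b - 1ℤ) + pos 2 * n) + ((pos 2 * E - pos 2 * n) + pos 4 * b) ≡ pos 2 * (b * (E + pos 2))
              l2 = solve-∀

  plane : PlaneMap
  plane = record { pre = preM ; root = rr q0 u0 ; involutive = αM-inv ; noFixed = αM-≢ ; connected = connected' ; planar = planar' }

  nextD : Fin NM → Fin NM
  nextD i = if np (x i) then σM i else φD i

  -- From a black dart, `nextD` moves forward along the contour by one step or past a whole matched
  -- segment, and such a segment never contains the unmatched `q0`; the distance to `q0` therefore
  -- decreases.
  goodD : ∀ i → Orb nextD i (bd q0 (U-blk q0 u0))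
  goodD = elim (λ i → Orb nextD i (bd q0 (U-blk q0 u0))) (λ d h → go' (suc (dist d)) d h ℕP.≤-refl)
     (λ d h → Orb-trans (1 , if-t (npx (rr d h) ∙ cong not (isBud-r d h)) ∙ σM-r d h (c-bud-blk d (U-bud d h))) (go' (suc (dist (c d))) (c d) (c-bud-blk d (U-bud d h)) ℕP.≤-refl))
    where
    open Dist q0 u0
    go' : ∀ m d h → dist d ℕ.< m → Orb nextD (bd d h) (bd q0 (U-blk q0 u0))
    go' (suc m) d h l = on (d ≟ q0) (kind d)
      where
      npd : np (x (bd d h)) ≡ not (bud d)
      npd = npx (bd d h) ∙ cong not (isBud-b d h)
      lt : d ≢ q0 → dist (c d) ℕ.< m
      lt ne = ℕP.<-≤-trans (subst (dist (c d) ℕ.<_) (sym (dist-suc d ne)) ℕP.≤-refl) (ℕP.≤-pred l)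
      on : Dec (d ≡ q0) → Kind d → Orb nextD (bd d h) (bd q0 (U-blk q0 u0))
      on (yes p) _ = 0 , DS.inl-cong p
      on (no ne) (kpop e) = Orb-trans (1 , if-f (npd ∙ cong not e) ∙ σαM (bd d h) ∙ φM-bud d h (c-bud-blk d e) e) (go' m (c d) (c-bud-blk d e) (lt ne))
      on (no ne) (kneu nb e) = Orb-trans (1 , if-t (npd ∙ cong not nb) ∙ cong σM (DS.inl-cong (sym (ext-b d h))) ∙ σM-neu d nb e (c-neu-blk d e)) (go' m (c d) (c-neu-blk d e) (lt ne))
      on (no ne) (kpush e) = Orb-trans (1 , if-t (npd ∙ cong not nb) ∙ cong σM (DS.inl-cong (sym (ext-b d h))) ∙ σM-push d e k) (go' m (c (Fm (c d))) k lt2)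
        where nb = push-nonbud d e
              k = c-bud-blk (Fm (c d)) (F-bud (c d))
              lt2 : dist (c (Fm (c d))) ℕ.< m
              lt2 = ℕP.<-trans (subst (dist (c (Fm (c d))) ℕ.<_) (sym (dist-suc (Fm (c d)) (ne-push d e))) ℕP.≤-refl) (ℕP.≤-<-trans (dist-F (c d)) (lt ne))

-- The mobile of the closure is the given mobile.

module Closed (b : ℕ) (b≥1 : 1 ℕ.≤ b) (T : Mobile b) where
  open Mobile T using (σf; αf; col; wt; involutive)
  open Contour b b≥1 T
  open Close b b≥1 T

  module OM = OfMap plane

  S : Surface
  S = OM.surf

  fo : Fin (Surface.Fc S)
  fo = OM.fo

  private
    module FV' = FV OM.σ-inj
    module FF' = FF OM.φ-inj

  faceR : ∀ d h → Surface.face S (rr d h) ≡ fo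
  faceR d h = FF'.Q.cls-eq (orb-r d h q0 u0)

  faceB : ∀ d h → Surface.face S (bd d h) ≢ fo
  faceB = FF'.not-outer

  orient : Weights.Orient S b fo x
  orient = record
    { r0 = rr q0 u0
    ; r0-outer = refl
    ; o1 = o1'
    ; o2 = FV'.fibV
    ; o3 = λ f ne → FF'.fibF f ∙ cong (λ i → pos 2 * B - pos 4 * B * i) (ind-no (λ p → ne (sym p))) ∙ l B
    ; o4 = elim (λ i → Surface.face S i ≡ fo → x i ≡ -1ℤ) (λ d h e → ⊥-elim (faceB d h e)) (λ d h _ → x-r d h)
    ; outer-deg = FF'.fib-outer q0 u0 (λ _ → 1ℤ) 1ℤ (λ _ _ → refl) ∙ ℤP.*-identityʳ (pos 2 * B)
    ; good = λ i → let (k , e) = goodD i in k , same k i ∙ e ∙ sym (αM-r q0 u0) }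
    where
    l : ∀ b → pos 2 * b - pos 4 * b * 0ℤ ≡ pos 2 * b
    l = solve-∀
    one : ∀ i → Surface.nxt S (np ∘ x) i ≡ nextD i
    one i = go' (np (x i))
      where go' : ∀ v → Surface.stp S v i ≡ (if v then σM i else φD i)
            go' true = refl
            go' false = refl
    same : ∀ k i → iter (Surface.nxt S (np ∘ x)) k i ≡ iter nextD k i
    same zero i = refl
    same (suc k) i = one (iter (Surface.nxt S (np ∘ x)) k i) ∙ cong nextD (same k i)

  module A = MobileOf b b≥1 S fo x orient

  isB-b : ∀ d h → A.isB (bd d h) ≡ true
  isB-b d h = A.B-intro (bd d h) (faceB d h)
  isB-r : ∀ d h → A.isB (rr d h) ≡ false
  isB-r d h = cong not (true-does (Surface.face S (rr d h) ≟ fo) (faceR d h))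

  isW-e : ∀ w → blk w ≡ false → A.isW (ebd w) ≡ true
  isW-e w e = ∧-tt (t-not (npx (ebd w) ∙ cong not (isBud-e w e))) (cong A.isB (αM-e w (white-nonbud w e)) ∙ isB-b (ext (αf w)) (ext-blk (αf w)))

  θ′ : ∀ u v → blk u ≡ v → Fin A.NT
  θ′ u true e = A.bd (bd u e) (isB-b u e)
  θ′ u false e = A.wd (ebd u) (isW-e u e)
  θ : X → Fin A.NT
  θ u = θ′ u (blk u) refl
  θ-b : ∀ u e → θ u ≡ A.bd (bd u e) (isB-b u e)
  θ-b u e = go' (blk u) refl e
    where go' : ∀ v (p : blk u ≡ v) → v ≡ true → θ′ u v p ≡ A.bd (bd u e) (isB-b u e)
          go' true p _ = A.TS.inl-cong (DS.inl-cong refl)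
  θ-w : ∀ u e → θ u ≡ A.wd (ebd u) (isW-e u e)
  θ-w u e = go' (blk u) refl e
    where go' : ∀ v (p : blk u ≡ v) → v ≡ false → θ′ u v p ≡ A.wd (ebd u) (isW-e u e)
          go' false p _ = A.TS.inr-cong refl

  byCol : (P : X → Set) → (∀ u → blk u ≡ true → P u) → (∀ u → blk u ≡ false → P u) → ∀ u → P u
  byCol P pb pw u = go' (blk u) refl
    where go' : ∀ v → blk u ≡ v → P u
          go' true e = pb u e
          go' false e = pw u e

  θ-inj : Inj θ
  θ-inj {u} {u'} p = go' (blk u) refl (blk u') refl
    where
    go' : ∀ v → blk u ≡ v → ∀ v' → blk u' ≡ v' → u ≡ u'
    go' true e true e' = DS.inl-inj (A.TS.inl-inj (sym (θ-b u e) ∙ p ∙ θ-b u' e'))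
    go' true e false e' = ⊥-elim (A.TS.l≢r (sym (θ-b u e) ∙ p ∙ θ-w u' e'))
    go' false e true e' = ⊥-elim (A.TS.l≢r (sym (sym (θ-w u e) ∙ p ∙ θ-b u' e')))
    go' false e false e' = ext-inj u u' (white-nonbud u e) (white-nonbud u' e') (DS.inl-inj (A.TS.inr-inj (sym (θ-w u e) ∙ p ∙ θ-w u' e')))

  θ-sur : ∀ j → ∃ λ u → θ u ≡ j
  θ-sur = A.elim (λ j → ∃ λ u → θ u ≡ j) onB onW
    where
    onB : ∀ i h → ∃ λ u → θ u ≡ A.bd i h
    onB = elim (λ i → ∀ h → ∃ λ u → θ u ≡ A.bd i h) (λ d k h → d , θ-b d k ∙ A.TS.inl-cong refl) (λ d k h → ⊥-elim (true≢false (sym h ∙ isB-r d k)))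
    npW : ∀ i → A.isW i ≡ true → isBud i ≡ true
    npW i h = go' (isBud i) refl
      where go' : ∀ v → isBud i ≡ v → isBud i ≡ true
            go' true e = e
            go' false e = ⊥-elim (true≢false (sym (npx i ∙ cong not e) ∙ A.isW-np i h))
    onW : ∀ i h → ∃ λ u → θ u ≡ A.wd i h
    onW = split (λ i → ∀ h → ∃ λ u → θ u ≡ A.wd i h)
      (λ u nb h → u , θ-w u (wh u nb (npW (ebd u) h)) ∙ A.TS.inr-cong refl)
      (inj₂ (λ d k h → ⊥-elim (true≢false (sym (A.isW-α (bd d (U-blk d k)) h) ∙ cong A.isB (αM-U d k (U-blk d k)) ∙ isB-r d k))))
      (λ d k h → ⊥-elim (true≢false (sym (npW (rr d k) h) ∙ isBud-r d k)))
      where wh : ∀ u → bud u ≡ false → isBud (ebd u) ≡ true → blk u ≡ false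
            wh u nb h = not-t (sym (ext-bud u nb) ∙ sym (isBud-b (ext u) (ext-blk u)) ∙ h)

  -- In the closed map the positive darts are exactly the buds, so at a white half-edge the first
  -- return to white darts is the rotation computed by `walk-white`.
  θσ : ∀ u → A.σT (θ u) ≡ θ (σf u)
  θσ = byCol (λ u → A.σT (θ u) ≡ θ (σf u))
    (λ u e → cong A.σT (θ-b u e) ∙ A.σT-b (bd u e) (isB-b u e) ∙ A.TS.inl-cong (φD-b u e (blk-σ u ∙ e)) ∙ sym (θ-b (σf u) (blk-σ u ∙ e)))
    (λ u e → cong A.σT (θ-w u e) ∙ A.σT-w (ebd u) (isW-e u e) ∙ A.TS.inr-cong (ret≡ u e) ∙ sym (θ-w (σf u) (blk-σ u ∙ e)))
    where
    ret≡ : ∀ u e → A.RT.ret (ebd u) (isW-e u e) ≡ ebd (σf u)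
    ret≡ u e = let (j , k , at , t , f) = walk-steps (walk-white u e) (F-bud u) in
        A.RT.ret-unique (ebd u) (isW-e u e) j (cong A.isW (iter-suc σM j (ebd u) ∙ at ∙ eq k) ∙ isW-e (σf u) (blk-σ u ∙ e))
                (λ m l → cong (λ v → not v ∧ A.isB (αM (iter σM (suc m) (ebd u)))) (npx (iter σM (suc m) (ebd u)) ∙ cong not (cong isBud (iter-suc σM m (ebd u)) ∙ f m l))) ∙
              iter-suc σM j (ebd u) ∙ at ∙ eq k
      where eq : ∀ k → bd (Fm u) k ≡ ebd (σf u)
            eq k = DS.inl-cong (sym (ext-w (σf u) (blk-σ u ∙ e) ∙ ι-σ u))

  α-isB : ∀ u → bud u ≡ false → A.isB (αM (ebd u)) ≡ true
  α-isB u nb = cong A.isB (αM-e u nb) ∙ isB-b (ext (αf u)) (ext-blk (αf u))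

  θ-tg : ∀ u (nb : bud u ≡ false) k k' → θ u ≡ A.tg (ebd u) k k'
  θ-tg u nb k k' = go' (blk u) refl
    where go' : ∀ v → blk u ≡ v → θ u ≡ A.tg (ebd u) k k'
          go' true e = θ-b u e ∙ A.TS.inl-cong (DS.inl-cong (sym (ext-b u e))) ∙ sym (A.tg-b (ebd u) k k' (cong np (x-e u nb) ∙ np-wt u nb ∙ e))
          go' false e = θ-w u e ∙ sym (A.tg-w (ebd u) k k' (isW-e u e))

  θα : ∀ u → A.αT (θ u) ≡ θ (αf u)
  θα u = go' (bud u) refl
    where
    go' : ∀ v → bud u ≡ v → A.αT (θ u) ≡ θ (αf u)
    go' true e = cong A.αT (θ-b u h) ∙ A.αT-bud (bd u h) (isB-b u h) (npx (bd u h) ∙ cong not (isBud-b u h ∙ e)) ∙ sym (θ-b u h) ∙ cong θ (sym (bud-t u e))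
      where h = bud-blk u e
    go' false e = cong A.αT (θ-tg u e (isB-b (ext u) (ext-blk u)) (α-isB u e)) ∙ (A.αT-tg (ebd u) _ _) ∙ A.tg-cong (αM-e u e) ∙ sym (θ-tg (αf u) e' (isB-b (ext (αf u)) (ext-blk (αf u))) (α-isB (αf u) e'))
      where e' = bud-α u ∙ e

  θcol : ∀ u → A.colT (θ u) ≡ col u
  θcol = byCol (λ u → A.colT (θ u) ≡ col u) (λ u e → cong A.colT (θ-b u e) ∙ (A.colT-b (bd u e) _) ∙ sym (isBlack-t e)) (λ u e → cong A.colT (θ-w u e) ∙ (A.colT-w (ebd u) _) ∙ sym (isBlack-f e))

  θwt : ∀ u → A.wtT (θ u) ≡ wt u
  θwt = byCol (λ u → A.wtT (θ u) ≡ wt u) (λ u e → cong A.wtT (θ-b u e) ∙ (A.wtT-b (bd u e) _) ∙ (cong -_ (nn-b u e)) ∙ ℤP.neg-involutive (wt u))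
     (λ u e → cong A.wtT (θ-w u e) ∙ (A.wtT-w (ebd u) _) ∙ x-e u (white-nonbud u e))

  θ⁻ : Fin A.NT → X
  θ⁻ j = proj₁ (θ-sur j)

  iso : MobileOf.mobile b b≥1 (OfMap.surf plane) (OfMap.fo plane) x orient ≅ᵀ T
  iso = permutation θ⁻ θ (λ u → θ-inj (proj₂ (θ-sur (θ u)))) (λ j → proj₂ (θ-sur j))
      , (λ j → θ-inj (proj₂ (θ-sur (A.σT j)) ∙ cong A.σT (sym (proj₂ (θ-sur j))) ∙ θσ (θ⁻ j)))
      , (λ j → θ-inj (proj₂ (θ-sur (A.αT j)) ∙ cong A.αT (sym (proj₂ (θ-sur j))) ∙ θα (θ⁻ j)))
      , (λ j → sym (θcol (θ⁻ j)) ∙ cong A.colT (proj₂ (θ-sur j)))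
      , (λ j → sym (θwt (θ⁻ j)) ∙ cong A.wtT (proj₂ (θ-sur j)))

  realised : ∀ {R : Set} → (∀ M x (O : Weights.Orient (OfMap.surf M) b (OfMap.fo M) x) → MobileOf.mobile b b≥1 (OfMap.surf M) (OfMap.fo M) x O ≅ᵀ T → R) → R
  realised k = k plane x orient iso

-- Bipartiteness and girth of an oriented surface

2k≢1 : ∀ k → pos 2 * k ≢ 1ℤ
2k≢1 k e = go ℤ.∣ k ∣ (sym (ℤP.abs-* (pos 2) k) ∙ (cong ℤ.∣_∣ e))
  where go : ∀ m → 2 ℕ.* m ≢ 1
        go (suc m) e with sym (ℕP.+-suc m (m ℕ.+ 0)) ∙ ℕP.suc-injective e
        ... | ()

even : ℤ → Bool
even a = a %ℕ 2 ℕ.≡ᵇ 0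

even-cases : ∀ a → (even a ≡ true × ∃ λ k → a ≡ pos 2 * k) ⊎ (even a ≡ false × ∃ λ k → a ≡ pos 2 * k + 1ℤ)
even-cases a = go (a %ℕ 2) refl (n%ℕd<d a 2)
  where
  l : ∀ r k → r + k * pos 2 ≡ pos 2 * k + r
  l = solve-∀
  eq : a ≡ pos 2 * (a /ℕ 2) + pos (a %ℕ 2)
  eq = a≡a%ℕn+[a/ℕn]*n a 2 ∙ l (pos (a %ℕ 2)) (a /ℕ 2)
  go : ∀ r → a %ℕ 2 ≡ r → r ℕ.< 2 → (even a ≡ true × ∃ λ k → a ≡ pos 2 * k) ⊎ (even a ≡ false × ∃ λ k → a ≡ pos 2 * k + 1ℤ)
  go 0 e _ = inj₁ (cong (ℕ._≡ᵇ 0) e , a /ℕ 2 , eq ∙ cong (λ r → pos 2 * (a /ℕ 2) + pos r) e ∙ ℤP.+-identityʳ (pos 2 * (a /ℕ 2)))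
  go 1 e _ = inj₂ (cong (ℕ._≡ᵇ 0) e , a /ℕ 2 , eq ∙ cong (λ r → pos 2 * (a /ℕ 2) + pos r) e)
  go (suc (suc r)) e (s≤s (s≤s ()))

even-shift : ∀ a b c → a - b ≡ pos 2 * c → even b ≡ even a
even-shift a b c e with even-cases a | even-cases b
... | inj₁ (u , _) | inj₁ (v , _) = v ∙ sym u
... | inj₂ (u , _) | inj₂ (v , _) = v ∙ sym u
... | inj₁ (u , k , p) | inj₂ (v , k' , p') = ⊥-elim (2k≢1 (k - k' - c) (l k k' c ∙ cong (λ w → pos 2 * k - (pos 2 * k' + 1ℤ) - w + 1ℤ) (sym e ∙ cong₂ _-_ p p') ∙ l' (pos 2 * k - (pos 2 * k' + 1ℤ))))
  where l : ∀ k k' c → pos 2 * (k - k' - c) ≡ pos 2 * k - (pos 2 * k' + 1ℤ) - pos 2 * c + 1ℤ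
        l = solve-∀
        l' : ∀ a → a - a + 1ℤ ≡ 1ℤ
        l' = solve-∀
... | inj₂ (u , k , p) | inj₁ (v , k' , p') = ⊥-elim (2k≢1 (c - k + k') (l k k' c ∙ cong (λ w → w - (pos 2 * k + 1ℤ - pos 2 * k') + 1ℤ) (sym e ∙ cong₂ _-_ p p') ∙ l' (pos 2 * k + 1ℤ - pos 2 * k')))
  where l : ∀ k k' c → pos 2 * (c - k + k') ≡ pos 2 * c - (pos 2 * k + 1ℤ - pos 2 * k') + 1ℤ
        l = solve-∀
        l' : ∀ a → a - a + 1ℤ ≡ 1ℤ
        l' = solve-∀

even-flip : ∀ a b c → a - b ≡ pos 2 * c - 1ℤ → even b ≢ even a
even-flip a b c e q with even-cases a | even-cases b
... | inj₁ (u , _) | inj₂ (v , _) = true≢false (sym u ∙ sym q ∙ v)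
... | inj₂ (u , _) | inj₁ (v , _) = true≢false (sym v ∙ q ∙ u)
... | inj₁ (u , k , p) | inj₁ (v , k' , p') = 2k≢1 (c - k + k') (l k k' c ∙ cong (λ w → w - (pos 2 * k - pos 2 * k') + 1ℤ) (sym e ∙ cong₂ _-_ p p') ∙ l' (pos 2 * k - pos 2 * k'))
  where l : ∀ k k' c → pos 2 * (c - k + k') ≡ (pos 2 * c - 1ℤ) - (pos 2 * k - pos 2 * k') + 1ℤ
        l = solve-∀
        l' : ∀ a → a - a + 1ℤ ≡ 1ℤ
        l' = solve-∀
... | inj₂ (u , k , p) | inj₂ (v , k' , p') = 2k≢1 (c - k + k') (l k k' c ∙ cong (λ w → w - (pos 2 * k + 1ℤ - (pos 2 * k' + 1ℤ)) + 1ℤ) (sym e ∙ cong₂ _-_ p p') ∙ l' (pos 2 * k + 1ℤ - (pos 2 * k' + 1ℤ)))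
  where l : ∀ k k' c → pos 2 * (c - k + k') ≡ (pos 2 * c - 1ℤ) - (pos 2 * k + 1ℤ - (pos 2 * k' + 1ℤ)) + 1ℤ
        l = solve-∀
        l' : ∀ a → a - a + 1ℤ ≡ 1ℤ
        l' = solve-∀

tf : ∀ x → (x ≡ true) ⊎ (x ≡ false)
tf true = inj₁ refl
tf false = inj₂ refl

module _ {m : ℕ} where
  cyc : Fin (suc m) → Fin (suc m)
  cyc j = suc (toℕ j) mod suc m

  toℕ-cyc : ∀ j → toℕ j ℕ.< m → toℕ (cyc j) ≡ suc (toℕ j)
  toℕ-cyc j l = toℕ-mod (suc (toℕ j)) m ∙ m<n⇒m%n≡m (s≤s l)

  toℕ-cyc-last : ∀ j → ¬ toℕ j ℕ.< m → toℕ j ≡ m × toℕ (cyc j) ≡ 0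
  toℕ-cyc-last j g = jm , toℕ-mod (suc (toℕ j)) m ∙ cong (λ k → suc k ℕ.% suc m) jm ∙ n%n≡0 (suc m)
    where jm : toℕ j ≡ m
          jm = ℕP.≤-antisym (ℕP.≤-pred (FP.toℕ<n j)) (ℕP.≮⇒≥ g)

  cyc-inj : Inj cyc
  cyc-inj {i} {j} e with toℕ i ℕP.<? m | toℕ j ℕP.<? m
  ... | yes l | yes l' = FP.toℕ-injective (ℕP.suc-injective (sym (toℕ-cyc i l) ∙ cong toℕ e ∙ toℕ-cyc j l'))
  ... | yes l | no g = case sym (toℕ-cyc i l) ∙ cong toℕ e ∙ proj₂ (toℕ-cyc-last j g) of λ ()
  ... | no g | yes l = case sym (toℕ-cyc j l) ∙ cong toℕ (sym e) ∙ proj₂ (toℕ-cyc-last i g) of λ ()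
  ... | no g | no g' = FP.toℕ-injective (proj₁ (toℕ-cyc-last i g) ∙ sym (proj₁ (toℕ-cyc-last j g')))

  ∑-cyc : ∀ (g : Fin (suc m) → ℤ) → ∑ (g ∘ cyc) ≡ ∑ g
  ∑-cyc = ∑-bij cyc (inv cyc cyc-inj) (inv-l cyc cyc-inj) (inv-r cyc cyc-inj)

  cyc-const : ∀ {A : Set} (u : Fin (suc m) → A) → (∀ j → u j ≡ u (cyc j)) → ∀ j → u j ≡ u zero
  cyc-const u e j = go (toℕ j) j refl
    where
    go : ∀ k j → toℕ j ≡ k → u j ≡ u zero
    go zero j p = cong u (FP.toℕ-injective p)
    go (suc k) j p = cong u (FP.toℕ-injective (p ∙ sym (toℕ-cyc i (subst (ℕ._< m) (sym ti) (ℕP.≤-pred km)) ∙ cong suc ti))) ∙ sym (e i) ∙ go k i ti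
      where km : suc k ℕ.< suc m
            km = subst (ℕ._< suc m) p (FP.toℕ<n j)
            i = F.fromℕ< (ℕP.<-trans (ℕP.n<1+n k) km)
            ti : toℕ i ≡ k
            ti = FP.toℕ-fromℕ< (ℕP.<-trans (ℕP.n<1+n k) km)

-- The region enclosed by a cycle.

module Cyclic (S : Surface) {m : ℕ} (C : Cycles.Cycle S m) where
  open Surface S
  open Cycles S
  open Cycle C public

  Off : D → Set
  Off q = ∀ j → q ≢ ds j × q ≢ α (ds j)

  off? : ∀ q → Off q ⊎ ∃ λ j → (q ≡ ds j) ⊎ (q ≡ α (ds j))
  off? q = go (FP.any? (λ j → q ≟ ds j)) (FP.any? (λ j → q ≟ α (ds j)))
    where
    go : Dec (∃ λ j → q ≡ ds j) → Dec (∃ λ j → q ≡ α (ds j)) → Off q ⊎ ∃ λ j → (q ≡ ds j) ⊎ (q ≡ α (ds j))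
    go (yes (j , e)) _ = inj₂ (j , inj₁ e)
    go (no _) (yes (j , e)) = inj₂ (j , inj₂ e)
    go (no a) (no c) = inj₁ λ j → (λ e → a (j , e)) , λ e → c (j , e)

  -- The signed indicator of the cycle. As a flow between vertices and edges alone it has a
  -- potential that is constant on each face and jumps by 1 across the cycle: the winding number.
  flow : D → ℤ
  flow q = ∑ (λ j → ind (ds j) q - ind (α (ds j)) q)

  ∑-flow : ∀ (G : D → ℤ) → ∑ (λ q → flow q * G q) ≡ ∑ (λ j → G (ds j) - G (α (ds j)))
  ∑-flow G = ∑-cong (λ q → sym (∑-*ʳ (G q) (λ j → ind (ds j) q - ind (α (ds j)) q))) ∙ ∑-swap (λ q j → (ind (ds j) q - ind (α (ds j)) q) * G q) ∙
     ∑-cong (λ j → ∑-cong (λ q → l (ind (ds j) q) (ind (α (ds j)) q) (G q)) ∙ ∑-- (λ q → ind (ds j) q * G q) (λ q → ind (α (ds j)) q * G q) ∙ cong₂ _-_ (∑-ind (ds j) G) (∑-ind (α (ds j)) G))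
    where l : ∀ a c g → (a - c) * g ≡ a * g - c * g
          l = solve-∀

  flow-circ : Circ flow (λ _ → 0ℤ)
  flow-circ hv he hf = ∑-cong (λ q → l (flow q) (hv (vert q)) (he (edge q)) (hf (face q))) ∙ ∑-flow (λ q → hv (vert q) - he (edge q)) ∙
     ∑-cong (λ j → cong₂ (λ v e → (hv (vert (ds j)) - he (edge (ds j))) - (hv v - he e)) (closed j) (edge-α (ds j)) ∙ l' (hv (vert (ds j))) (he (edge (ds j))) (hv (vert (ds (cyc j))))) ∙
       ∑-- (λ j → hv (vert (ds j))) (λ j → hv (vert (ds (cyc j)))) ∙ cong (_-_ (∑ (λ j → hv (vert (ds j))))) (∑-cyc (λ j → hv (vert (ds j)))) ∙ ℤP.+-inverseʳ (∑ (λ j → hv (vert (ds j))))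
    where l : ∀ c v e f → c * (v - e) + 0ℤ * (e - f) ≡ c * (v - e)
          l = solve-∀
          l' : ∀ v e w → (v - e) - (w - e) ≡ v - w
          l' = solve-∀

  flow-on : ∀ j → flow (ds j) ≡ 1ℤ
  flow-on j = ∑-cong pt ∙ ∑-ind j (λ _ → 1ℤ)
    where
    pt : ∀ i → ind (ds i) (ds j) - ind (α (ds i)) (ds j) ≡ ind j i * 1ℤ
    pt i with i ≟ j
    ... | yes refl = cong₂ _-_ (ind-refl (ds i)) (ind-no (α≢ (ds i))) ∙ sym (cong (_* 1ℤ) (ind-refl i))
    ... | no ne = cong₂ _-_ (ind-no (proj₁ (edges i j ne))) (ind-no (λ e → proj₂ (edges j i (λ p → ne (sym p))) (sym e))) ∙ sym (cong (_* 1ℤ) (ind-no (λ p → ne (sym p))))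

  flow-off : ∀ q → Off q → flow q ≡ 0ℤ
  flow-off q o = ∑-zero (λ j → cong₂ _-_ (ind-no (λ e → proj₁ (o j) (sym e))) (ind-no (λ e → proj₂ (o j) (sym e))))

  module Region (s : D → Bool) (sφ : ∀ q → s (φ q) ≡ s q) (s-on : ∀ j → s (ds j) ≡ true → s (α (ds j)) ≡ true → ⊥) (s-off : ∀ q → Off q → s (α q) ≡ s q) where

    on? : ∀ v → Dec (∃ λ j → vert (ds j) ≡ v)
    on? v = FP.any? (λ j → vert (ds j) ≟ v)

    hf : Fin Fc → Bool
    hf f = s (frep f)
    -- Edges need the region on both sides and vertices of the cycle are excluded: the region is
    -- open, so the whole cycle lies in its complement.
    he : Fin E → Bool
    he e = s (erep e) ∧ s (α (erep e))
    hv : Fin V → Bool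
    hv v = not (does (on? v)) ∧ s (vrep v)

    hf-face : ∀ q → hf (face q) ≡ s q
    hf-face q = orb-inv s sφ (face-orb (face-frep (face q)))

    he-edge : ∀ q → he (edge q) ≡ s q ∧ s (α q)
    he-edge q = go (edge-eq (edge-erep (edge q)))
      where
      go : ∀ {d} → (d ≡ q) ⊎ (d ≡ α q) → s d ∧ s (α d) ≡ s q ∧ s (α q)
      go (inj₁ refl) = refl
      go (inj₂ refl) = cong (λ d → s (α q) ∧ s d) (αα q) ∙ Data.Bool.Properties.∧-comm (s (α q)) (s q)

    off-vert : ∀ q → (∀ j → vert (ds j) ≢ vert q) → Off q
    off-vert q o j = (λ e → o j (cong vert (sym e))) , λ e → o (cyc j) (sym (closed j) ∙ cong vert (sym e))

    vert-const : ∀ q → (∀ j → vert (ds j) ≢ vert q) → s (vrep (vert q)) ≡ s q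
    vert-const q o = go (vert-orb (sym (vert-vrep (vert q))))
      where
      vi : ∀ k → vert (iter σ k q) ≡ vert q
      vi k = iter-inv vert vert-σ k q
      sσ : ∀ d → s (σ d) ≡ s (α d)
      sσ d = cong (s ∘ σ) (sym (αα d)) ∙ sφ (α d)
      it : ∀ k → s (iter σ k q) ≡ s q
      it zero = refl
      it (suc k) = sσ (iter σ k q) ∙ s-off (iter σ k q) (off-vert (iter σ k q) (λ j e → o j (e ∙ vi k))) ∙ it k
      go : ∀ {d} → Orb σ q d → s d ≡ s q
      go (k , e) = cong s (sym e) ∙ it k

    hv-on : ∀ q j → vert (ds j) ≡ vert q → hv (vert q) ≡ false
    hv-on q j e = cong (λ u → not u ∧ s (vrep (vert q))) (true-does (on? (vert q)) (j , e))

    hv-off : ∀ q → (∀ j → vert (ds j) ≢ vert q) → hv (vert q) ≡ s q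
    hv-off q o = cong (λ u → not u ∧ s (vrep (vert q))) (false-does (on? (vert q)) (λ { (j , e) → o j e })) ∙ vert-const q o

    hv⇒he : ∀ q → hv (vert q) ≡ true → he (edge q) ≡ true
    hv⇒he q t = go (on? (vert q))
      where
      go : Dec (∃ λ j → vert (ds j) ≡ vert q) → he (edge q) ≡ true
      go (yes (j , e)) = ⊥-elim (true≢false (sym t ∙ hv-on q j e))
      go (no o) = he-edge q ∙ cong₂ _∧_ sq (s-off q (off-vert q (λ j e → o (j , e))) ∙ sq)
        where sq : s q ≡ true
              sq = sym (hv-off q (λ j e → o (j , e))) ∙ t

    he⇒s : ∀ q → he (edge q) ≡ true → s q ≡ true
    he⇒s q t = proj₁ (and-true {s q} (sym (he-edge q) ∙ t))

    he-false : ∀ q → he (edge q) ≡ false → hv (vert q) ≡ false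
    he-false q e with tf (hv (vert q))
    ... | inj₂ f = f
    ... | inj₁ t = ⊥-elim (true≢false (sym (hv⇒he q t) ∙ e))

    s-false : ∀ q → s q ≡ false → he (edge q) ≡ false
    s-false q e = he-edge q ∙ cong (_∧ s (α q)) e

    s-falseα : ∀ q → s (α q) ≡ false → he (edge q) ≡ false
    s-falseα q e = cong he (sym (edge-α q)) ∙ s-false (α q) e

    bnd : D → ℤ
    bnd q = b2z (hf (face q)) - b2z (he (edge q))

    bnd-eq : ∀ q → bnd q ≡ b2z (s q ∧ not (s (α q)))
    bnd-eq q = cong₂ (λ u v → b2z u - b2z v) (hf-face q) (he-edge q) ∙ go (s q) (s (α q))
      where go : ∀ u v → b2z u - b2z (u ∧ v) ≡ b2z (u ∧ not v)
            go true true = refl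
            go true false = refl
            go false v = refl

    -- Every boundary edge of the region lies on the cycle, and contributes one dart.
    boundary≤ : ∑ bnd ≤ pos (suc m)
    boundary≤ = ℤP.≤-trans (∑-mono le) (ℤP.≤-trans (ℤP.≤-reflexive sw) (ℤP.≤-trans (∑-mono one) (ℤP.≤-reflexive (∑-const (suc m) 1ℤ ∙ ℤP.*-identityʳ (pos (suc m))))))
      where
      k : D → ℤ
      k q = b2z (s q ∧ not (s (α q)))
      w : D → Fin (suc m) → ℤ
      w q j = (ind (ds j) q + ind (α (ds j)) q) * k q
      0≤w : ∀ q j → 0ℤ ≤ w q j
      0≤w q j = 0≤* {ind (ds j) q + ind (α (ds j)) q} (0≤+ (0≤ind (ds j) q) (0≤ind (α (ds j)) q)) (0≤b2z (s q ∧ not (s (α q))))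
      w1 : ∀ q j → (q ≡ ds j) ⊎ (q ≡ α (ds j)) → k q ≤ w q j
      w1 q j (inj₁ e) = ≤-by (ind (α (ds j)) q * k q) (0≤* {ind (α (ds j)) q} (0≤ind (α (ds j)) q) (0≤b2z (s q ∧ not (s (α q))))) (cong (λ i → (i + ind (α (ds j)) q) * k q - k q) (cong (ind (ds j)) e ∙ ind-refl (ds j)) ∙ l (ind (α (ds j)) q) (k q))
        where l : ∀ i k → (1ℤ + i) * k - k ≡ i * k
              l = solve-∀
      w1 q j (inj₂ e) = ≤-by (ind (ds j) q * k q) (0≤* {ind (ds j) q} (0≤ind (ds j) q) (0≤b2z (s q ∧ not (s (α q))))) (cong (λ i → (ind (ds j) q + i) * k q - k q) (cong (ind (α (ds j))) e ∙ ind-refl (α (ds j))) ∙ l (ind (ds j) q) (k q))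
        where l : ∀ i k → (i + 1ℤ) * k - k ≡ i * k
              l = solve-∀
      le : ∀ q → bnd q ≤ ∑ (w q)
      le q = ℤP.≤-trans (ℤP.≤-reflexive (bnd-eq q)) (go (off? q))
        where
        z : ∀ u → b2z (u ∧ not u) ≡ 0ℤ
        z true = refl
        z false = refl
        go : Off q ⊎ (∃ λ j → (q ≡ ds j) ⊎ (q ≡ α (ds j))) → k q ≤ ∑ (w q)
        go (inj₁ o) = subst (_≤ ∑ (w q)) (sym (cong (λ u → b2z (s q ∧ not u)) (s-off q o) ∙ z (s q))) (∑-nonneg (0≤w q))
        go (inj₂ (j , e)) = ℤP.≤-trans (w1 q j e) (∑-term (w q) (0≤w q) j)
      sw : ∑ (λ q → ∑ (w q)) ≡ ∑ (λ j → k (ds j) + k (α (ds j)))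
      sw = ∑-swap w ∙ ∑-cong (λ j → ∑-cong (λ q → ℤP.*-distribʳ-+ (k q) (ind (ds j) q) (ind (α (ds j)) q)) ∙ ∑-+ (λ q → ind (ds j) q * k q) (λ q → ind (α (ds j)) q * k q) ∙ cong₂ _+_ (∑-ind (ds j) k) (∑-ind (α (ds j)) k))
      one : ∀ j → k (ds j) + k (α (ds j)) ≤ 1ℤ
      one j = subst (λ d → k (ds j) + b2z (s (α (ds j)) ∧ not (s d)) ≤ 1ℤ) (sym (αα (ds j))) (go (s (ds j)) (s (α (ds j))))
        where go : ∀ u v → b2z (u ∧ not v) + b2z (v ∧ not u) ≤ 1ℤ
              go true true = ℤ.+≤+ z≤n
              go true false = ℤP.≤-refl
              go false true = ℤP.≤-refl
              go false false = ℤ.+≤+ z≤n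

    module Complement (π : D → Bool) (ℓ : D → ℕ) (ℓ-dec : ∀ q → s q ≡ false → ℓ (nxt π q) ℕ.< ℓ q) (ℓ<n : ∀ q → ℓ q ℕ.< n) where
      private
        aS aT : D → Fin N
        aS q = nE (edge q)
        -- Interior edges become loops. A dart of the region whose edge is not interior keeps the
        -- arc to its vertex, and the remaining darts keep the uncrossed arc of the policy.
        arc : Bool → Bool → D → Fin N
        arc true _ q = nE (edge q)
        arc false true q = nV (vert q)
        arc false false q = tgt (not (π q)) q
        aT q = arc (he (edge q)) (s q) q

        -- Outside the region the induction on rank of `tree-conn` is repeated, with walks ending in
        -- the region instead of at one corner. The pieces of the complement are then tied together
        -- by the cycle: `H` extends the values at outside vertices by the value on the cycle, and
        -- connectedness of the map makes it constant.
        spans : ∀ h → Cut aS aT h → ∀ x y → not (nodeF hv he hf x) ≡ true → not (nodeF hv he hf y) ≡ true → h x ≡ h y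
        spans h cut x y kx ky = all x (not-true' kx) ∙ sym (all y (not-true' ky))
          where
          open Quad h
          cutS : ∀ q → he (edge q) ≡ false → s q ≡ true → Side q true
          cutS q e t = cut q ∙ cong₂ (λ u v → h (arc u v q)) e t
          cutπ : ∀ q → s q ≡ false → Side q (not (π q))
          cutπ q f = cut q ∙ cong₂ (λ u v → h (arc u v q)) (s-false q f) f
          nn' : ∀ b → not (not b) ≡ b
          nn' true = refl
          nn' false = refl
          sides : ∀ m q → n ℕ.< ℓ q ℕ.+ m → s q ≡ false → ∀ b → Side q b
          sides zero q lt f b = ⊥-elim (ℕP.<-asym (ℓ<n q) (subst (n ℕ.<_) (ℕP.+-identityʳ (ℓ q)) lt))
          sides (suc m) q lt f b = [ (λ e → subst (Side q) (sym e) exit) , (λ e → subst (Side q) (sym e) (cutπ q f)) ]′ (b-cases b (π q))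
            where
            up : ∀ q' → ℓ q ℕ.< ℓ q' → n ℕ.< ℓ q' ℕ.+ m
            up q' l = ℕP.<-≤-trans lt (subst (ℕ._≤ ℓ q' ℕ.+ m) (sym (ℕP.+-suc (ℓ q) m)) (ℕP.+-monoˡ-≤ m l))
            pre : ∀ c q' → stp c q' ≡ q → s q' ≡ false → Side q' c
            pre c q' e f' = [ (λ e' → sides m q' (up q' (subst (λ d → ℓ d ℕ.< ℓ q') (cong (λ c → stp c q') (sym e') ∙ e) (ℓ-dec q' f'))) f' c) , (λ e' → subst (Side q') (sym e') (cutπ q' f')) ]′ (b-cases c (π q'))
            sφ⁻ : s (φ⁻ q) ≡ false
            sφ⁻ = sym (sφ (φ⁻ q)) ∙ cong s (φφ⁻ q) ∙ f
            sa : Side (σ⁻ q) true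
            sa = [ cutS (σ⁻ q) (s-falseα (σ⁻ q) sφ⁻) , pre true (σ⁻ q) (σσ⁻ q) ]′ (tf (s (σ⁻ q)))
            exit : Side q (π q)
            exit = subst (Side q) (nn' (π q)) (other q (not (π q)) (quad q sa (pre false (φ⁻ q) (φφ⁻ q) sφ⁻)) (cutπ q f))
          side : ∀ q → s q ≡ false → ∀ b → Side q b
          side q = sides (suc n) q (ℕP.m≤n+m (suc n) (ℓ q))
          sideV : ∀ q → he (edge q) ≡ false → Side q true
          sideV q e = [ cutS q e , (λ f → side q f true) ]′ (tf (s q))
          link : ∀ q → he (edge q) ≡ false → h (nV (vert q)) ≡ h (nV (vert (α q)))
          link q e = sym (sideV q e) ∙ cong (h ∘ nE) (sym (edge-α q)) ∙ sideV (α q) (cong he (edge-α q) ∙ e)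
          κ : Bool
          κ = h (nV (vert (ds zero)))
          cyc-he : ∀ j → he (edge (ds j)) ≡ false
          cyc-he j = go (tf (s (ds j))) (tf (s (α (ds j))))
            where go : (s (ds j) ≡ true) ⊎ (s (ds j) ≡ false) → (s (α (ds j)) ≡ true) ⊎ (s (α (ds j)) ≡ false) → he (edge (ds j)) ≡ false
                  go (inj₂ f) _ = s-false (ds j) f
                  go _ (inj₂ f) = s-falseα (ds j) f
                  go (inj₁ t) (inj₁ t') = ⊥-elim (s-on j t t')
          onκ : ∀ j → h (nV (vert (ds j))) ≡ κ
          onκ = cyc-const (λ j → h (nV (vert (ds j)))) (λ j → link (ds j) (cyc-he j) ∙ cong (h ∘ nV) (closed j))
          val : Bool → Fin V → Bool
          val true v = κ
          val false v = h (nV v)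
          H : D → Bool
          H q = val (hv (vert q)) (vert q)
          H-in : ∀ q → s q ≡ true → H q ≡ κ
          H-in q t = go (on? (vert q))
            where go : Dec (∃ λ j → vert (ds j) ≡ vert q) → H q ≡ κ
                  go (yes (j , e)) = cong (λ u → val u (vert q)) (hv-on q j e) ∙ cong (h ∘ nV) (sym e) ∙ onκ j
                  go (no o) = cong (λ u → val u (vert q)) (hv-off q (λ j e → o (j , e)) ∙ t)
          H-out : ∀ q → hv (vert q) ≡ false → H q ≡ h (nV (vert q))
          H-out q f = cong (λ u → val u (vert q)) f
          Hα : ∀ q → H (α q) ≡ H q
          Hα q = go (tf (he (edge q)))
            where eα : he (edge (α q)) ≡ he (edge q)
                  eα = cong he (edge-α q)
                  go : (he (edge q) ≡ true) ⊎ (he (edge q) ≡ false) → H (α q) ≡ H q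
                  go (inj₁ t) = H-in (α q) (he⇒s (α q) (eα ∙ t)) ∙ sym (H-in q (he⇒s q t))
                  go (inj₂ f) = H-out (α q) (he-false (α q) (eα ∙ f)) ∙ sym (link q f) ∙ sym (H-out q (he-false q f))
          Hκ : ∀ q → H q ≡ κ
          Hκ q = conn H (λ d → cong (λ v → val (hv v) v) (vert-σ d)) Hα q (ds zero) ∙ H-out (ds zero) (hv-on (ds zero) zero refl)
          outκ : ∀ q → hv (vert q) ≡ false → h (nV (vert q)) ≡ κ
          outκ q f = sym (H-out q f) ∙ Hκ q
          all : ∀ x → nodeF hv he hf x ≡ false → h x ≡ κ
          all = node-elim (λ x → nodeF hv he hf x ≡ false → h x ≡ κ)
            (λ v e → cong (h ∘ nV) (sym (vert-vrep v)) ∙ outκ (vrep v) (cong hv (vert-vrep v) ∙ sym (nodeF-V hv he hf v) ∙ e))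
            (λ e' e → let f = cong he (edge-erep e') ∙ sym (nodeF-E hv he hf e') ∙ e in
               cong (h ∘ nE) (sym (edge-erep e')) ∙ sideV (erep e') f ∙ outκ (erep e') (he-false (erep e') f))
            (λ f e → let g = sym (nodeF-F hv he hf f) ∙ e in
               cong (h ∘ nF) (sym (face-frep f)) ∙ sym (side (frep f) g false) ∙ side (frep f) g true ∙ outκ (frep f) (he-false (frep f) (s-false (frep f) g)))

        not-z : ∀ u → b2z (not u) ≡ 1ℤ - b2z u
        not-z true = refl
        not-z false = refl
        ∑-not : ∀ {k} (g : Fin k → Bool) → ∑ (λ i → b2z (not (g i))) ≡ pos k - ∑ (λ i → b2z (g i))
        ∑-not {k} g = ∑-cong (λ i → not-z (g i)) ∙ ∑-- (λ _ → 1ℤ) (λ i → b2z (g i)) ∙ cong (_- ∑ (λ i → b2z (g i))) (∑-const k 1ℤ ∙ ℤP.*-identityʳ (pos k))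

      -- The complement of the region is connected, being attached to the cycle.
      χ≥1 : 1ℤ ≤ ∑ (b2z ∘ hv) + ∑ (b2z ∘ hf) - ∑ (b2z ∘ he)
      χ≥1 = ≤-by (pos n - pos 2 * e + 1ℤ - (pos N - (v + (e + f)))) (0≤- bd) (l v e f (pos n) ∙ cong (λ u → pos n - pos 2 * e + 1ℤ - (pos u - (v + (e + f)))) (sym nodes-count))
        where
        v = ∑ (b2z ∘ hv)
        e = ∑ (b2z ∘ he)
        f = ∑ (b2z ∘ hf)
        l : ∀ v e f n → v + f - e - 1ℤ ≡ n - pos 2 * e + 1ℤ - ((1ℤ + (1ℤ + n)) - (v + (e + f)))
        l = solve-∀
        ns : ∑ (λ x → b2z (not (nodeF hv he hf x))) ≡ pos N - (v + (e + f))
        ns = ∑-not (nodeF hv he hf) ∙ cong (_-_ (pos N)) (∑-nodes (λ x → b2z (nodeF hv he hf x)) ∙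
           cong₂ _+_ (∑-cong (λ v → cong b2z (nodeF-V hv he hf v))) (cong₂ _+_ (∑-cong (λ v → cong b2z (nodeF-E hv he hf v))) (∑-cong (λ v → cong b2z (nodeF-F hv he hf v)))))
        as : ∑ (λ q → b2z (not (he (edge q)))) ≡ pos n - pos 2 * e
        as = ∑-not (he ∘ edge) ∙ cong (_-_ (pos n)) (∑-cong (λ q → sym (ℤP.*-identityʳ (b2z (he (edge q))))) ∙ ∑-edge (b2z ∘ he) (λ _ → 1ℤ) ∙ ∑-*ʳ (pos 2) (b2z ∘ he) ∙ ℤP.*-comm e (pos 2))
        wl : ∀ q → not (he (edge q)) ≡ false → aS q ≡ aT q
        wl q w = sym (cong (λ u → arc u (s q) q) (sym (Data.Bool.Properties.not-involutive (he (edge q))) ∙ cong not w))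
        bd : pos N - (v + (e + f)) ≤ pos n - pos 2 * e + 1ℤ
        bd = subst (_≤ pos n - pos 2 * e + 1ℤ) ns (subst (λ u → ∑ (λ x → b2z (not (nodeF hv he hf x))) ≤ u + 1ℤ) as (spanned-bound aS aT (λ x → not (nodeF hv he hf x)) (λ q → not (he (edge q))) wl spans))

    module _ (s0 : D) (ss0 : s s0 ≡ true) where
      private
        closed-all : ∀ (X : D → Bool) → X s0 ≡ true → (∀ q → X (σ q) ≡ true → X q ≡ true) → (∀ q → true ≡ true → X (φ q) ≡ true → X q ≡ true) → ∀ q → X q ≡ true
        closed-all X x0 cσ cφ q = conn X iσ (λ d → sym (iσ (α d)) ∙ inv-of φ φ-inj (λ d → cφ d refl) d) q s0 ∙ x0
          where
          inv-of : ∀ (g : D → D) → Inj g → (∀ d → X (g d) ≡ true → X d ≡ true) → ∀ d → X (g d) ≡ X d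
          inv-of g gi c d = bool-ext (c d) λ t → let (k , e) = Orb-sym gi (Orb-step {f = g} {d}) in back k (g d) (cong X e ∙ t)
            where back : ∀ k d → X (iter g k d) ≡ true → X d ≡ true
                  back zero d t = t
                  back (suc k) d t = back k d (c (iter g k d) t)
          iσ = inv-of σ σ-inj cσ
        module Bf = BFS S s0 (λ _ → true) closed-all
        rk = rank Bf.nxt0 s0 Bf.reach
        ℓ : D → ℕ
        ℓ = proj₁ rk
        ℓ-dec : ∀ q → s q ≡ false → ℓ (nxt Bf.π q) ℕ.< ℓ q
        ℓ-dec q f = subst (λ d → ℓ d ℕ.< ℓ q) (Bf.nxt0-ne q ne) (proj₁ (proj₂ rk) q ne)
          where ne : q ≢ s0
                ne e = true≢false (sym ss0 ∙ cong s (sym e) ∙ f)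

      -- The ranks come from walks towards `s0`, a dart of the region, so they decrease at every
      -- dart outside it.
      χ-region : 1ℤ ≤ ∑ (b2z ∘ hv) + ∑ (b2z ∘ hf) - ∑ (b2z ∘ he)
      χ-region = Complement.χ≥1 Bf.π ℓ ℓ-dec (proj₂ (proj₂ rk))

module Oriented (S : Surface) (b : ℕ) (fo : Fin (Surface.Fc S)) (x : Fin (Surface.n S) → ℤ) (O : Weights.Orient S b fo x) where
  open Surface S
  open Weights S b fo
  open Orient O

  private
    rk = rank (nxt (np ∘ x)) (α r0) good
    module P = Policy (np ∘ x) (α r0) (proj₁ rk) (proj₁ (proj₂ rk)) (proj₂ (proj₂ rk))

  potential : ∀ y z → Circ y z → Σ[ p ∈ (D → ℤ) ] (∀ q → y q ≡ p q - p (σ q)) × (∀ q → z q ≡ p q - p (φ q))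
  potential y z c = let (p , e , e' , _) = P.circulation y z c in p , e , e'

  half-degree : ∀ f → ∃ λ h → fib face f (λ _ → 1ℤ) ≡ pos 2 * h
  half-degree f = go (f ≟ fo)
    where
    go : Dec (f ≡ fo) → ∃ λ h → fib face f (λ _ → 1ℤ) ≡ pos 2 * h
    go (yes e) = B , cong (λ g → fib face g (λ _ → 1ℤ)) e ∙ outer-deg
    go (no ne) = B + fib face f (nn ∘ x) , ∑-cong (λ q → l (ind (face q) f) (nn (x q))) ∙ ∑-+ (λ q → ind (face q) f * (1ℤ - pos 2 * nn (x q))) (λ q → pos 2 * (ind (face q) f * nn (x q))) ∙
       cong₂ _+_ (o3 f ne) (∑-*ˡ (pos 2) (λ q → ind (face q) f * nn (x q))) ∙ sym (ℤP.*-distribˡ-+ (pos 2) B (fib face f (nn ∘ x)))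
      where l : ∀ i n → i * 1ℤ ≡ i * (1ℤ - pos 2 * n) + pos 2 * (i * n)
            l = solve-∀

  -- A base solution for b = 0 makes (2y, 2z - 1) a circulation; its potential changes parity exactly along φ.
  bipartite : Σ[ c ∈ (D → Bool) ] (∀ d → c (σ d) ≡ c d) × (∀ d → c (α d) ≢ c d)
  bipartite = even ∘ p , cσ , λ d e → even-flip (p d) (p (φ d)) (z d) (sym (eφ d)) (cσ (α d) ∙ e)
    where
    bs = Base.base S 0 fo (proj₁ ∘ half-degree) (proj₂ ∘ half-degree)
    y z : D → ℤ
    y = proj₁ bs
    z = proj₁ (proj₂ bs)
    circ : Circ (λ q → pos 2 * y q) (λ q → pos 2 * z q - 1ℤ)
    circ hv he hf = ∑-cong (λ q → l (y q) (z q) (hv (vert q)) (he (edge q)) (hf (face q))) ∙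
      ∑-+ (λ q → pos 2 * (y q * (hv (vert q) - he (edge q)) + z q * (he (edge q) - hf (face q)))) (λ q → hf (face q) - he (edge q)) ∙
      cong (_+ Kφ he hf) (∑-*ˡ (pos 2) (λ q → y q * (hv (vert q) - he (edge q)) + z q * (he (edge q) - hf (face q))) ∙ proj₂ (proj₂ bs) hv he hf) ∙
        l' (χ hv he hf) (Kφ he hf) (hf fo)
      where l : ∀ y z v e f → pos 2 * y * (v - e) + (pos 2 * z - 1ℤ) * (e - f) ≡ pos 2 * (y * (v - e) + z * (e - f)) + (f - e)
            l = solve-∀
            l' : ∀ c k o → pos 2 * 0ℤ * c - k - pos 4 * 0ℤ * o + k ≡ 0ℤ
            l' = solve-∀
    pt = potential (λ q → pos 2 * y q) (λ q → pos 2 * z q - 1ℤ) circ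
    p : D → ℤ
    p = proj₁ pt
    eφ : ∀ q → pos 2 * z q - 1ℤ ≡ p q - p (φ q)
    eφ = proj₂ (proj₂ pt)
    cσ : ∀ q → even (p (σ q)) ≡ even (p q)
    cσ q = even-shift (p q) (p (σ q)) (y q) (sym (proj₁ (proj₂ pt) q))

  module _ {m} (C : Cycles.Cycle S m) where
    open Cyclic S C

    module _ (s : D → Bool) (sφ : ∀ q → s (φ q) ≡ s q) (s-on : ∀ j → s (ds j) ≡ true → s (α (ds j)) ≡ true → ⊥) (s-off : ∀ q → Off q → s (α q) ≡ s q)
      (s0 : D) (ss0 : s s0 ≡ true) (sr0 : s r0 ≡ false) where
      private
        open Region s sφ s-on s-off
        X : ℤ
        X = χ (b2z ∘ hv) (b2z ∘ he) (b2z ∘ hf)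
        lower : pos 2 * B ≤ pos 2 * B * X
        lower = ≤-by (pos 2 * B * (X - 1ℤ)) (0≤* {pos 2 * B} (0≤* {pos 2} {B} (ℤ.+≤+ z≤n) (ℤ.+≤+ z≤n)) (0≤- (χ-region s0 ss0))) (l (pos 2 * B) X)
          where l : ∀ k c → k * c - k ≡ k * (c - 1ℤ)
                l = solve-∀
        outer : b2z (hf fo) ≡ 0ℤ
        outer = cong b2z (cong hf (sym r0-outer) ∙ hf-face r0 ∙ sr0)
        mono : ∀ {u v} → (u ≡ true → v ≡ true) → 0ℤ ≤ b2z v - b2z u
        mono {false} {v} _ = subst (0ℤ ≤_) (sym (ℤP.+-identityʳ (b2z v))) (0≤b2z v)
        mono {true} {v} f = subst (λ w → 0ℤ ≤ b2z w - 1ℤ) (sym (f refl)) ℤP.≤-refl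
        W = Wk (pp ∘ x) (nn ∘ x) (b2z ∘ hv) (b2z ∘ he) (b2z ∘ hf)
        W≤0 : 0ℤ ≤ - W
        W≤0 = subst (0ℤ ≤_) (∑-neg (λ q → pp (x q) * (b2z (hv (vert q)) - b2z (he (edge q))) + nn (x q) * (b2z (he (edge q)) - b2z (hf (face q))))) (∑-nonneg λ q →
           subst (0ℤ ≤_) (l (pp (x q)) (nn (x q)) (b2z (hv (vert q))) (b2z (he (edge q))) (b2z (hf (face q))))
             (0≤+ (0≤* {pp (x q)} (0≤pp (x q)) (mono (hv⇒he q))) (0≤* {nn (x q)} (0≤nn (x q)) (mono (λ t → hf-face q ∙ he⇒s q t)))))
          where l : ∀ y z v e f → y * (e - v) + z * (f - e) ≡ - (y * (v - e) + z * (e - f))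
                l = solve-∀
        upper : pos 2 * B * X ≤ ∑ bnd
        upper = ≤-by (pos 2 * - W) (0≤* {pos 2} (ℤ.+≤+ z≤n) W≤0) ((l (pos 2 * B * X) (∑ bnd) (pos 4 * B) ∙ cong (λ u → - (pos 2 * B * X - ∑ bnd - pos 4 * B * u)) (sym outer)) ∙
             (cong -_ (sym (Sol→WS sol (b2z ∘ hv) (b2z ∘ he) (b2z ∘ hf)))) ∙ ℤP.neg-distribʳ-* (pos 2) W)
          where l : ∀ a k c → k - a ≡ - (a - k - c * 0ℤ)
                l = solve-∀

      -- The chain is `2B ≤ 2Bχ ≤ Kφ ≤ m + 1`. The middle inequality tests the weight conditions on
      -- the region: the outer term drops out, and the pairing is nonpositive since indicators grow
      -- from a vertex to its edges and from an edge to its faces.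
      region-bound : 2 ℕ.* b ℕ.≤ suc m
      region-bound = ℤP.drop‿+≤+ (ℤP.≤-trans (ℤP.≤-reflexive (ℤP.pos-* 2 b)) (ℤP.≤-trans lower (ℤP.≤-trans upper boundary≤)))

  -- The inside of the cycle is a level set of the winding number `p`, at a value different from the
  -- one on the outer face; such a value exists since `p` jumps across every edge of the cycle.
  girth-bound : ∀ {m} → Cycles.Cycle S m → 2 ℕ.* b ℕ.≤ suc m
  girth-bound {m} C = go pick
    where
    open Cyclic S C
    pt = potential flow (λ _ → 0ℤ) flow-circ
    p : D → ℤ
    p = proj₁ pt
    sub : ∀ a c → 0ℤ ≡ a - c → c ≡ a
    sub a c e = sym (ℤP.i-j≡0⇒i≡j a c (sym e))
    pφ : ∀ q → p (φ q) ≡ p q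
    pφ q = sub (p q) (p (φ q)) (proj₂ (proj₂ pt) q)
    jump : ∀ q → flow q ≡ p q - p (α q)
    jump q = proj₁ (proj₂ pt) q ∙ cong (_-_ (p q)) (cong (p ∘ σ) (sym (αα q)) ∙ pφ (α q))
    crossing : ∀ j → p (ds j) ≢ p (α (ds j))
    crossing j e = case sym (flow-on j) ∙ jump (ds j) ∙ cong (_- p (α (ds j))) e ∙ ℤP.+-inverseʳ (p (α (ds j))) of λ ()
    pick : ∃ λ s0 → p s0 ≢ p r0
    pick = far (p (ds zero) ℤ.≟ p r0)
      where far : Dec (p (ds zero) ≡ p r0) → ∃ λ s0 → p s0 ≢ p r0
            far (no ne) = ds zero , ne
            far (yes e) = α (ds zero) , λ e' → crossing zero (e ∙ sym e')
    go : (∃ λ s0 → p s0 ≢ p r0) → 2 ℕ.* b ℕ.≤ suc m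
    go (s0 , ne) = region-bound C (λ q → does (p q ℤ.≟ p s0)) (λ q → cong (λ u → does (u ℤ.≟ p s0)) (pφ q))
        (λ j t t' → crossing j (does-true (p (ds j) ℤ.≟ p s0) t ∙ sym (does-true (p (α (ds j)) ℤ.≟ p s0) t')))
        (λ q o → cong (λ u → does (u ℤ.≟ p s0)) (sub (p q) (p (α q)) (sym (flow-off q o) ∙ jump q)))
        s0 (true-does (p s0 ℤ.≟ p s0) refl) (false-does (p r0 ℤ.≟ p s0) (λ e → ne (sym e)))

  -- Outer darts follow one another and none is opposite to another, so a simple cycle can be
  -- extracted from them; the outer degree bounds its length from above, `girth-bound` from below.
  outer-cycle : ∃ λ m → Cycles.Cycle S m × suc m ≡ 2 ℕ.* b
  outer-cycle = let (m , c , le) = Cycles.extract S C r0 (true-does (face r0 ≟ fo) r0-outer) anti (λ q e → φ q , true-does (face (φ q) ≟ fo) (face-φ q ∙ out q e) , vert-σ (α q))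
    in m , c , ℕP.≤-antisym (ℕP.≤-trans le (ℕP.≤-reflexive cnt)) (girth-bound c)
    where
    C : D → Bool
    C q = does (face q ≟ fo)
    out : ∀ q → C q ≡ true → face q ≡ fo
    out q = does-true (face q ≟ fo)
    anti : ∀ q → C q ≡ true → C (α q) ≡ false
    anti q e = false-does (face (α q) ≟ fo) (λ e' → case sym (xα q (out q e)) ∙ o4 (α q) e' of λ ())
    cnt : count C ≡ 2 ℕ.* b
    cnt = ℤP.+-injective (count-∑ C ∙ ∑-cong (λ q → sym (ind-≟ (face q) fo) ∙ sym (ℤP.*-identityʳ (ind (face q) fo))) ∙ outer-deg ∙ sym (ℤP.pos-* 2 b))

-- The bijection up to isomorphism.

≅ᵀ-sym : ∀ {b} {T T' : Mobile b} → T ≅ᵀ T' → T' ≅ᵀ T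
≅ᵀ-sym {T = T} {T'} (ψ , pσ , pα , pc , pw) = permutation (ψ ⟨$⟩ˡ_) (ψ ⟨$⟩ʳ_) (λ d → inverseˡ ψ) (λ d → inverseʳ ψ)
  , back (Mobile.σf T) (Mobile.σf T') pσ , back (Mobile.αf T) (Mobile.αf T') pα , (λ d → sym (pc (ψ ⟨$⟩ˡ d)) ∙ cong (Mobile.col T') (inverseʳ ψ)) , λ d → sym (pw (ψ ⟨$⟩ˡ d)) ∙ cong (Mobile.wt T') (inverseʳ ψ)
  where
  back : ∀ (f : Fin (Mobile.n T) → Fin (Mobile.n T)) (g : Fin (Mobile.n T') → Fin (Mobile.n T')) → (∀ d → ψ ⟨$⟩ʳ f d ≡ g (ψ ⟨$⟩ʳ d)) → ∀ d → ψ ⟨$⟩ˡ g d ≡ f (ψ ⟨$⟩ˡ d)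
  back f g e d = cong (λ u → ψ ⟨$⟩ˡ g u) (sym (inverseʳ ψ)) ∙ cong (ψ ⟨$⟩ˡ_) (sym (e (ψ ⟨$⟩ˡ d))) ∙ inverseˡ ψ

≅ᵀ-trans : ∀ {b} {T T' T'' : Mobile b} → T ≅ᵀ T' → T' ≅ᵀ T'' → T ≅ᵀ T''
≅ᵀ-trans (ψ , pσ , pα , pc , pw) (ψ' , pσ' , pα' , pc' , pw') = permutation (λ d → ψ' ⟨$⟩ʳ (ψ ⟨$⟩ʳ d)) (λ d → ψ ⟨$⟩ˡ (ψ' ⟨$⟩ˡ d)) (λ d → cong (ψ' ⟨$⟩ʳ_) (inverseʳ ψ) ∙ inverseʳ ψ') (λ d → cong (ψ ⟨$⟩ˡ_) (inverseˡ ψ') ∙ inverseˡ ψ)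
  , (λ d → cong (ψ' ⟨$⟩ʳ_) (pσ d) ∙ pσ' (ψ ⟨$⟩ʳ d)) , (λ d → cong (ψ' ⟨$⟩ʳ_) (pα d) ∙ pα' (ψ ⟨$⟩ʳ d)) , (λ d → pc' (ψ ⟨$⟩ʳ d) ∙ pc d) , λ d → pw' (ψ ⟨$⟩ʳ d) ∙ pw d

T-true : ∀ {x} → T x → x ≡ true
T-true {true} _ = refl

true-T : ∀ {x} → x ≡ true → T x
true-T refl = tt

module _ (b : ℕ) (b≥1 : 1 ℕ.≤ b) where

  private
    S : BMap b → Surface
    S M = OfMap.surf (BMap.pmap M)
    fo : ∀ M → Fin (Surface.Fc (S M))
    fo M = OfMap.fo (BMap.pmap M)
    x : ∀ M → Fin (BMap.n M) → ℤ
    x M = OfBMap.x b≥1 M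
    O : ∀ M → Weights.Orient (S M) b (fo M) (x M)
    O M = OfBMap.O b≥1 M

  toMobile : BMap b → Mobile b
  toMobile M = MobileOf.mobile b b≥1 (S M) (fo M) (x M) (O M)

  -- The orientation is obtained separately for each map, so naturality rests on uniqueness: the
  -- orientation of `M'` pulled back along the isomorphism must be that of `M`.
  respects : ∀ M M' → M ≅ᴮ M' → toMobile M ≅ᵀ toMobile M'
  respects M M' (ψ , pσ , pα , r) = Transport.MobIso.iso (S M) (S M') (fo M) (fo M') f g gf fg pσ pα (BMap.root M) refl out b b≥1 (x M) (x M') (O M) (O M')
      (Weights.Unique.x-unique (S M) b (fo M) b≥1 (x M) (x M' ∘ f) (O M) (Transport.transport (S M) (S M') (fo M) (fo M') f g gf fg pσ pα (BMap.root M) refl out b (x M') (O M')))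
    where
    f = ψ ⟨$⟩ʳ_
    g = ψ ⟨$⟩ˡ_
    gf : ∀ d → g (f d) ≡ d
    gf d = inverseˡ ψ
    fg : ∀ d → f (g d) ≡ d
    fg d = inverseʳ ψ
    out : Surface.face (S M') (f (BMap.root M)) ≡ fo M'
    out = sym (OfMap.QF.cls-eq (BMap.pmap M') (inOrbit-sound (BMap.φf M') (BMap.root M') (f (BMap.root M)) (T-true r)))

  underlying : ∀ M M' → toMobile M ≅ᵀ toMobile M' → Σ[ ψ ∈ (Fin (BMap.n M) → Fin (BMap.n M')) ] Inj ψ × (∀ d → ψ (BMap.σf M d) ≡ BMap.σf M' (ψ d)) × (∀ d → ψ (BMap.αf M d) ≡ BMap.αf M' (ψ d))
      × T (inOrbitᵇ (BMap.φf M') (BMap.root M') (ψ (BMap.root M)))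
  underlying M M' (ρ , pσ , pα , pc , pw) = let (ψ , inj , eσ , eα , out) = Recover.recovered b b≥1 (S M) (S M') (fo M) (fo M') (x M) (x M') (O M) (O M') (ρ ⟨$⟩ʳ_) (perm-inj ρ) (λ j → ρ ⟨$⟩ˡ j , inverseʳ ρ) pσ pα pc
    in ψ , inj , eσ , eα , true-T (inOrbit-complete (BMap.φf M') (BMap.root M') (ψ (BMap.root M)) (OfMap.QF.cls-orb (BMap.pmap M') (sym (out (BMap.root M) refl))))

  -- Recovery gives only an injective morphism; applied in both directions it bounds each number of
  -- darts by the other, which makes the morphism bijective.
  reflects : ∀ M M' → toMobile M ≅ᵀ toMobile M' → M ≅ᴮ M'
  reflects M M' i = let (ψ , inj , pσ , pα , r) = underlying M M' i
                        (ψ' , inj' , _) = underlying M' M (≅ᵀ-sym {T = toMobile M} {toMobile M'} i)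
                        (ρ , e) = inj-perm ψ inj (FP.injective⇒≤ {f = ψ'} inj')
    in ρ , (λ d → e (BMap.σf M d) ∙ pσ d ∙ cong (BMap.σf M') (sym (e d))) , (λ d → e (BMap.αf M d) ∙ pα d ∙ cong (BMap.αf M') (sym (e d)))
     , subst (λ d → T (inOrbitᵇ (BMap.φf M') (BMap.root M') d)) (sym (e (BMap.root M))) r

  mobile-unique : ∀ S fo r → Surface.face S r ≡ fo → ∀ x x' (O : Weights.Orient S b fo x) (O' : Weights.Orient S b fo x') → MobileOf.mobile b b≥1 S fo x O ≅ᵀ MobileOf.mobile b b≥1 S fo x' O'
  mobile-unique S fo r e x x' O O' = Transport.MobIso.iso S S fo fo id id (λ _ → refl) (λ _ → refl) (λ _ → refl) (λ _ → refl) r e e b b≥1 x x' O O' (Weights.Unique.x-unique S b fo b≥1 x x' O O')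

  -- The orientation `y` certifies that `M` is bipartite of girth `2b`. The mobile of the resulting
  -- `BMap` is formed with the orientation supplied by the existence argument, and `mobile-unique`
  -- identifies it with the mobile of `y`.
  realise : (M : PlaneMap) → ∀ T x (O : Weights.Orient (OfMap.surf M) b (OfMap.fo M) x) → MobileOf.mobile b b≥1 (OfMap.surf M) (OfMap.fo M) x O ≅ᵀ T → Σ[ M' ∈ BMap b ] (toMobile M' ≅ᵀ T)
  realise M T y Q i = M' , ≅ᵀ-trans {T = toMobile M'} {MobileOf.mobile b b≥1 (OfMap.surf M) (OfMap.fo M) y Q} {T} (mobile-unique (OfMap.surf M) (OfMap.fo M) (PlaneMap.root M) refl (x M') y (O M') Q) i
    where
    open PlaneMap M using (CycleOfLength)
    open OfMap M using (module QV; module QF)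
    toCycle : ∀ {m} → Cycles.Cycle (OfMap.surf M) m → CycleOfLength (suc m)
    toCycle c = ds , (λ j → QV.cls-orb (closed j)) , (λ i j ne o → simple i j ne (QV.cls-eq o)) , edges
      where open Cycles.Cycle c
    fromCycle : ∀ {m} → CycleOfLength (suc m) → Cycles.Cycle (OfMap.surf M) m
    fromCycle (ds , cl , si , ed) = record { ds = ds ; closed = λ j → QV.cls-eq (cl j) ; simple = λ i j ne e → si i j ne (QV.cls-orb e) ; edges = ed }
    short : ∀ k → k ℕ.< 2 ℕ.* b → ¬ CycleOfLength k
    short (suc m) l c = ℕP.<⇒≱ l (Oriented.girth-bound (OfMap.surf M) b (OfMap.fo M) y Q (fromCycle c))
    M' : BMap b
    M' = record
      { pmap = M
      ; bipartite = Oriented.bipartite (OfMap.surf M) b (OfMap.fo M) y Q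
      ; girth = let (m , c , e) = Oriented.outer-cycle (OfMap.surf M) b (OfMap.fo M) y Q in subst CycleOfLength e (toCycle c) , short
      ; outerDeg = ℤP.+-injective (QF.cycleLen-fib (PlaneMap.root M) ∙ Weights.Orient.outer-deg Q ∙ sym (ℤP.pos-* 2 b)) }

  degrees : ∀ M k → PlaneMap.innerFacesOfDegree (BMap.pmap M) k ≡ PreMobile.blackVerticesOfDegree (Mobile.mob (toMobile M)) k
  degrees M k = length-filter p id ∙ count-cong (λ d → cong (λ u → isRep φ d ∧ ((cycleLen φ d ℕ.≡ᵇ k) ∧ not u)) (outer d)) ∙
      Degrees.counts b b≥1 (S M) (fo M) (x M) (O M) k ∙ sym (length-filter q id)
    where
    nT = MobileOf.NT b b≥1 (S M) (fo M) (x M) (O M)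
    σT : Fin nT → Fin nT
    σT = MobileOf.σT b b≥1 (S M) (fo M) (x M) (O M)
    φ = Surface.φ (S M)
    face = Surface.face (S M)
    p : Fin (BMap.n M) → Bool
    p d = isRep φ d ∧ ((cycleLen φ d ℕ.≡ᵇ k) ∧ not (inOrbitᵇ φ (BMap.root M) d))
    q : Fin nT → Bool
    q i = isRep σT i ∧ (isBlack (MobileOf.colT b b≥1 (S M) (fo M) (x M) (O M) i) ∧ (cycleLen σT i ℕ.≡ᵇ k))
    count-cong : ∀ {m} {p q : Fin m → Bool} → (∀ i → p i ≡ q i) → count p ≡ count q
    count-cong {p = p} {q} e = ℤP.+-injective (count-∑ p ∙ ∑-cong (λ i → cong b2z (e i)) ∙ sym (count-∑ q))
    outer : ∀ d → inOrbitᵇ φ (BMap.root M) d ≡ does (face d ≟ fo M)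
    outer d = bool-ext (λ e → true-does (face d ≟ fo M) (sym (OfMap.QF.cls-eq (BMap.pmap M) (inOrbit-sound φ (BMap.root M) d e))))
        (λ e → inOrbit-complete φ (BMap.root M) d (OfMap.QF.cls-orb (BMap.pmap M) (sym (does-true (face d ≟ fo M) e))))

theorem4p5 : (b : ℕ) → 1 ℕ.≤ b →
    Σ[ f ∈ (BMap b → Mobile b) ]
        ((∀ M M' → M ≅ᴮ M' → f M ≅ᵀ f M')
      × (∀ M M' → f M ≅ᵀ f M' → M ≅ᴮ M')
      × (∀ T → Σ[ M ∈ BMap b ] (f M ≅ᵀ T))
      × (∀ M i → PlaneMap.innerFacesOfDegree (BMap.pmap M) (2 ℕ.* i)
                   ≡ PreMobile.blackVerticesOfDegree (Mobile.mob (f M)) (2 ℕ.* i)))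
theorem4p5 b b≥1 = toMobile b b≥1 , respects b b≥1 , reflects b b≥1 , (λ T → Closed.realised b b≥1 T (λ M → realise b b≥1 M T)) , λ M i → degrees b b≥1 M (2 ℕ.* i)
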